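{- Let $\mathcal{H}$ be a family of graphs. Let $G$ be an $n$-vertex graph with $\text{tree- }\pi_{\mathcal{H}}(G)\le k$. There is a set $X\subseteq V(G)$ such that every component of $G-N[X]$ has at most $n/2$ vertices, where \begin{enumerate} \item $|X|=\mathcal{O}(kt)$ if $\mathcal{H}$ contains a path on $t$ vertices, and \item $|X|=\mathcal{O}(k^3\log n)$ if $\mathcal{H}$ contains all cycles. \end{enumerate} The constants hidden in the $\mathcal{O}(\cdot)$-notation are absolute, and the bounds are understood for $k\ge 1$ and $n\ge 2$.
   Context: Graphs are finite, without loops or parallel edges. Logarithms are base 2. $N[X]$ denotes the set consisting of $X$ and all neighbors of vertices of $X$. Disjoint vertex sets are anticomplete if there is no edge between them; subgraphs are pairwise anticomplete if their vertex sets are pairwise disjoint and anticomplete. For a family $\mathcal{H}$ of graphs, an induced $\mathcal{H}$-packing in $G$ is a set of pairwise anticomplete induced subgraphs of $G$, each isomorphic to a member of $\mathcal{H}$. For $B\subseteq V(G)$, it is $B$-rooted if every member of the packing intersects $B$ (members need not be contained in $B$), and $\pi_{\mathcal{H}}(G,B)$ is the largest size of a $B$-rooted induced $\mathcal{H}$-packing. For a tree decomposition $\mathcal{T}=(T,\beta)$ of $G$ let $\pi_{\mathcal{H}}(G,\mathcal{T})=\max_{t\in V(T)}\pi_{\mathcal{H}}(G,\beta(t))$. The induced $\mathcal{H}$-packing treewidth is $\text{tree- }\pi_{\mathcal{H}}(G)=\min_{\mathcal{T}}\pi_{\mathcal{H}}(G,\mathcal{T})$ over all tree decompositions $\mathcal{T}$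 of $G$. -}

module Defs where

open import Data.Nat.Base using (ℕ; suc; _+_; _*_; _≤_)
open import Data.Nat.Properties using (_≟_; 1+n≢n)
open import Data.Fin.Base using (Fin; toℕ)
open import Data.Fin.Subset using (Subset; _∈_; _⊆_; ∣_∣; ⊤)
open import Data.Product.Base using (∃; ∃-syntax; _×_; _,_)
open import Data.Sum.Base using (_⊎_; [_,_]; swap)
open import Function.Bundles using (_⇔_)
open import Function.Definitions using (Injective)
open import Level using (0ℓ) renaming (suc to lsuc)
open import Relation.Binary.Core using (Rel)
open import Relation.Binary.Construct.Closure.ReflexiveTransitive using (Star)
open import Relation.Binary.Definitions using (Decidable; Symmetric; Irreflexive)
open import Relation.Binary.PropositionalEquality using (_≡_; _≢_; refl; sym; trans)
open import Relation.Nullary.Decidable using (_⊎-dec_; _×-dec_)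
open import Relation.Nullary.Negation using (¬_)
open import Relation.Unary using (Pred)

-- Finite graphs without loops or parallel edges, on the vertex set Fin order.

record Graph : Set₁ where
  field
    order     : ℕ
    Adj       : Rel (Fin order) 0ℓ
    adj?      : Decidable Adj
    symmetric : Symmetric Adj
    loopless  : Irreflexive _≡_ Adj

  Vertex : Set
  Vertex = Fin order

  VertexSet : Set
  VertexSet = Subset order

open Graph using (order; Adj; Vertex; VertexSet)

-- The graph whose edges are the pairs i j with R i j or R j i.

symmetrise : ∀ n (R : Rel (Fin n) 0ℓ) → Decidable R → Irreflexive _≡_ R → Graph
symmetrise n R R? irr = record
  { order     = n
  ; Adj       = λ i j → R i j ⊎ R j i
  ; adj?      = λ i j → R? i j ⊎-dec R? j i
  ; symmetric = swap
  ; loopless  = λ i≡j → [ irr i≡j , irr (sym i≡j) ]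
  }

-- The path 0 – 1 – ⋯ – (t - 1) on t vertices.

path : ℕ → Graph
path t = symmetrise t
  (λ i j → suc (toℕ i) ≡ toℕ j)
  (λ i j → suc (toℕ i) ≟ toℕ j)
  (λ { refl → 1+n≢n })

-- The cycle on m + 3 vertices (not on m): the path 0 – 1 – ⋯ – (m + 2)
-- together with the edge from m + 2 to 0.  So cycle ranges over all cycles.

cycle : ℕ → Graph
cycle m = symmetrise (3 + m)
  (λ i j → suc (toℕ i) ≡ toℕ j ⊎ (toℕ i ≡ 2 + m × toℕ j ≡ 0))
  (λ i j → (suc (toℕ i) ≟ toℕ j) ⊎-dec ((toℕ i ≟ 2 + m) ×-dec (toℕ j ≟ 0)))
  (λ { refl → [ 1+n≢n , (λ { (i≡2+m , i≡0) → absurd (trans (sym i≡2+m) i≡0) }) ] })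
  where
  absurd : 2 + m ≢ 0
  absurd ()

-- An isomorphism from F to the induced subgraph G[S]: a bijection from the
-- vertices of F onto S that preserves and reflects adjacency.

record _≅_[_] (F G : Graph) (S : VertexSet G) : Set where
  field
    to        : Vertex F → Vertex G
    injective : Injective _≡_ _≡_ to
    image     : ∀ v → v ∈ S ⇔ (∃[ u ] to u ≡ v)
    adjacency : ∀ u v → Adj F u v ⇔ Adj G (to u) (to v)

_≅_ : Graph → Graph → Set
F ≅ G = F ≅ G [ ⊤ ]

Family : Set₂
Family = Pred Graph (lsuc 0ℓ)

-- Containment is up to isomorphism, as usual for families of graphs.

Contains : Family → Graph → Set₁
Contains 𝓗 F = ∃[ F′ ] (𝓗 F′ × F′ ≅ F)

-- P induces a connected (in particular nonempty) subgraph of G.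

Connected : (G : Graph) → Pred (Vertex G) 0ℓ → Set
Connected G P =
  ∃ P × (∀ {u v} → P u → P v → Star (λ x y → P x × P y × Adj G x y) u v)

-- C is the vertex set of a component of the subgraph of G induced by U, that
-- is, an inclusion-maximal set inducing a connected subgraph of it.

record IsComponent (G : Graph) (U : Pred (Vertex G) 0ℓ) (C : VertexSet G) : Set where
  field
    within    : ∀ {v} → v ∈ C → U v
    connected : Connected G (_∈ C)
    maximal   : ∀ (D : VertexSet G) → (∀ {v} → v ∈ D → U v) →
                Connected G (_∈ D) → C ⊆ D → D ⊆ C

N[_,_] : (G : Graph) → VertexSet G → Pred (Vertex G) 0ℓ
N[ G , X ] v = v ∈ X ⊎ ∃[ u ] (u ∈ X × Adj G u v)

-- Sizes at most n/2 are written without division as 2 * size ≤ n.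

HalvingNeighbourhood : (G : Graph) → VertexSet G → Set
HalvingNeighbourhood G X =
  ∀ C → IsComponent G (λ v → ¬ N[ G , X ] v) C → 2 * ∣ C ∣ ≤ order G

record IsTree (T : Graph) : Set where
  field
    connected : Connected T (_∈ ⊤)
    -- No cycle maps injectively into T, preserving adjacency.
    acyclic   : ∀ m (f : Vertex (cycle m) → Vertex T) → Injective _≡_ _≡_ f →
                ¬ (∀ i j → Adj (cycle m) i j → Adj T (f i) (f j))

record TreeDecomposition (G : Graph) : Set₁ where
  field
    tree       : Graph
    isTree     : IsTree tree
    bag        : Vertex tree → VertexSet G
    vertex-bag : ∀ v → ∃[ t ] v ∈ bag t
    edge-bag   : ∀ {u v} → Adj G u v → ∃[ t ] (u ∈ bag t × v ∈ bag t)
    subtree    : ∀ v → Connected tree (λ t → v ∈ bag t)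

Anticomplete : (G : Graph) → VertexSet G → VertexSet G → Set
Anticomplete G S S′ = ∀ {u v} → u ∈ S → v ∈ S′ → u ≢ v × ¬ Adj G u v

-- An induced 𝓗-packing of p induced subgraphs of G, each given by its vertex
-- set.  Injectivity makes it a set of exactly p subgraphs.

record IsPacking (𝓗 : Family) (G : Graph) {p : ℕ} (S : Fin p → VertexSet G) : Set₁ where
  field
    distinct     : Injective _≡_ _≡_ S
    anticomplete : ∀ {i j} → i ≢ j → Anticomplete G (S i) (S j)
    member       : ∀ i → ∃[ F ] (𝓗 F × F ≅ G [ S i ])

IsRooted : ∀ {G p} → VertexSet G → (Fin p → VertexSet G) → Set
IsRooted B S = ∀ i → ∃[ v ] (v ∈ S i × v ∈ B)

-- Since 𝓗 need not be decidable, π and tree-π are not given as functions but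
-- through their upper bounds: a maximum is at most k when all its entries are,
-- and a minimum is at most k when some entry is.

π[_,_,_]≤_ : Family → (G : Graph) → VertexSet G → ℕ → Set₁
π[ 𝓗 , G , B ]≤ k =
  ∀ p (S : Fin p → VertexSet G) → IsPacking 𝓗 G S → IsRooted {G} B S → p ≤ k

πᵀ[_,_,_]≤_ : Family → (G : Graph) → TreeDecomposition G → ℕ → Set₁
πᵀ[ 𝓗 , G , 𝓣 ]≤ k = ∀ t → π[ 𝓗 , G , bag t ]≤ k
  where open TreeDecomposition 𝓣

tree-π[_,_]≤_ : Family → Graph → ℕ → Set₁
tree-π[ 𝓗 , G ]≤ k = ∃[ 𝓣 ] πᵀ[ 𝓗 , G , 𝓣 ]≤ k

{-# OPTIONS --safe #-}

-- Suppose that no small X works.  Then for every small X some component of G − N[X], the core of X,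
-- has more than n/2 vertices.  The vertices of the core that stay in the giant component when any
-- other vertex is deleted form a nonempty connected set, and any two of these central sets meet;
-- so by the Helly property of subtrees one bag B of the decomposition meets all of them.  For paths,
-- Gyárfás' argument started in B gives an induced path on t vertices.  Dominating it and repeating
-- gives k + 1 anticomplete paths rooted in B.
--
-- For cycles, a set Y and an induced forest are grown such that each core vertex touching the forest
-- does so in consecutive vertices only.  A central s ∈ B has two neighbours in the giant component
-- left by s.  Shortest paths from these back to the forest either close up to a cycle through s away
-- from the forest, or extend the forest such that s, or a core vertex next to it, becomes a connector
-- between two of its vertices.  This costs O(1) new vertices of Y and merges O(1) vertices of the
-- forest into groups.  A cycle is close to at most nine earlier ones, so there are O(k) of them, and
-- only they increase the number of components.  Hence O(k²) steps yield Θ(k²) connectors.  Deleting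
-- O(k) groups splits the forest into O(k) parts with O(k) connector ends each, by pigeonhole two
-- connectors join the same two parts, and this closes a cycle rooted in B.  Repeating without the
-- connectors at these parts gives k + 1 anticomplete cycles.

module Submission where

open import Defs
open import Data.Bool.Base using (true; false)
open import Data.Empty using (⊥; ⊥-elim)
open import Data.Fin.Base using (Fin; zero; suc; toℕ; fromℕ<)
open import Data.Fin.Properties using (any?; all?; toℕ-injective; toℕ<n; toℕ-fromℕ<; pigeonhole) renaming (_≟_ to _≟ᶠ_)
open import Data.Fin.Subset using (Subset; _∈_; _∉_; _⊆_; _∪_; _∩_; ⁅_⁆; ∣_∣; ⊤) renaming (⊥ to ∅)
open import Data.Fin.Subset.Properties using (_∈?_; ∈⊤; ∉⊥; p⊆q⇒∣p∣≤∣q∣; p⊂q⇒∣p∣<∣q∣; ∣∁p∣≡n∸∣p∣; ∣p∣≤n; x∉p⇒x∈∁p; anySubset?; nonempty?; x∈p∩q⁺; x∈p∩q⁻; x∈p∪q⁺; x∈p∪q⁻; x∈⁅x⁆; x∈⁅y⁆⇒x≡y; ∣⊥∣≡0; ∣⁅x⁆∣≡1)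
open import Data.List.Base using (List; []; _∷_; _++_; map; filter; length; concatMap; allFin; cartesianProduct; upTo) renaming (lookup to lookupˡ)
open import Data.List.Membership.Propositional using () renaming (_∈_ to _∈ˡ_; _∉_ to _∉ˡ_)
open import Data.List.Membership.Propositional.Properties using (∈-++⁺ˡ; ∈-++⁺ʳ; ∈-++⁻; ∈-filter⁺; ∈-filter⁻; ∈-map⁺; ∈-map⁻; ∈-allFin; ∈-∃++; ∈-cartesianProduct⁺; ∈-upTo⁺; ∈-upTo⁻)
open import Data.List.Properties using (length-++; length-map; length-filter)
open import Data.List.Relation.Unary.All using (All; []; _∷_)
open import Data.List.Relation.Unary.AllPairs using ([]; _∷_; AllPairs)
open import Data.List.Relation.Unary.Any using (here; there)
open import Data.List.Relation.Unary.Unique.Propositional using (Unique)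
open import Data.Nat.Base using (ℕ; zero; suc; _+_; _*_; _∸_; _^_; _≤_; _<_; z≤n; s≤s; z<s; >-nonZero)
open import Data.Nat.ListAction using (sum)
open import Data.Nat.Logarithm using (⌊log₂_⌋; ⌊log₂⌋-mono-≤)
open import Data.Nat.Properties
open import Data.Nat.Tactic.RingSolver using (solve-∀)
open import Data.Product.Base using (Σ; ∃; ∃-syntax; _×_; _,_; proj₁; proj₂)
open import Data.Product.Properties using (≡-dec)
open import Data.Sum.Base using (_⊎_; inj₁; inj₂; [_,_])
open import Data.Unit.Base using (tt) renaming (⊤ to Unit)
open import Data.Vec.Base using (tabulate; lookup)
open import Data.Vec.Properties using (lookup∘tabulate; lookup⇒[]=; []=⇒lookup)
open import Function.Base using (_∘_; id)
open import Function.Bundles using (_⇔_; mk⇔; Equivalence)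
open import Function.Definitions using (Injective)
open import Level using (0ℓ)
open import Relation.Binary.Construct.Closure.ReflexiveTransitive using (Star; ε; _◅_; _◅◅_; gmap; reverse)
open import Relation.Binary.Core using (Rel)
open import Relation.Binary.Definitions using (Decidable; tri<; tri≈; tri>)
open import Relation.Binary.PropositionalEquality using (_≡_; _≢_; refl; sym; trans; cong; cong₂; subst; subst₂; module ≡-Reasoning)
open import Relation.Nullary.Decidable using (Dec; yes; no; does; _⊎-dec_; _×-dec_; ¬?; map′; dec-true; decidable-stable; _→-dec_)
open import Relation.Nullary.Negation using (¬_; contradiction)
open import Relation.Unary using (Pred)
import Data.List.Relation.Unary.All as All
import Data.List.Relation.Unary.All.Properties as Allₚ
import Data.List.Relation.Unary.Unique.Propositional.Properties as Uniqueₚ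
import Relation.Unary as U
import Data.List.Membership.DecPropositional as DecMembership
import Data.List.Relation.Unary.Any as Any
import Data.List.Relation.Unary.AllPairs.Properties as AllPairsₚ

-- Two obstacles shape the proof. The bag has to be fixed before any set is built up, since only
-- cycles meeting this bag count. For this the core would not do: one of its vertices in `B` may
-- have a single neighbour there and lie on no cycle, whereas a central vertex has two neighbours in
-- the giant component left by its deletion. Moreover, the vertices collected do not induce a forest
-- for long. The first vertex of a new path may see up to three consecutive forest vertices, and
-- linking it to one of them leaves chords to the others. So these vertices enter `Y` and become a
-- group; the forest edges are a selection of edges of `G`, and only the contraction of the groups
-- is faithful to `G`. Later paths run in `clean Y` and never touch a group again. This keeps groups
-- at eight vertices and degrees at four, and connectors keep their contacts for good. Cutting a
-- group thus yields at most 32 new parts and spoils at most eight connectors, which is the origin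
-- of the final constants.

module FinSets where

  -- Decidable finite sets, minima and reachability.

  opaque

    -- Opaque, so that sets are handled through their membership lemmas and do not unfold to
    -- vectors.
    ⟪_⟫ : ∀ {n} {P : Pred (Fin n) 0ℓ} → U.Decidable P → Subset n
    ⟪ P? ⟫ = tabulate (λ v → does (P? v))

    ∈⟪⟫⁺ : ∀ {n} {P : Pred (Fin n) 0ℓ} (P? : U.Decidable P) {v} → P v → v ∈ ⟪ P? ⟫
    ∈⟪⟫⁺ P? {v} p = lookup⇒[]= v _ (trans (lookup∘tabulate _ v) (dec-true (P? v) p))

    ∈⟪⟫⁻ : ∀ {n} {P : Pred (Fin n) 0ℓ} (P? : U.Decidable P) {v} → v ∈ ⟪ P? ⟫ → P v
    ∈⟪⟫⁻ P? {v} v∈ with P? v | trans (sym (lookup∘tabulate (λ v → does (P? v)) v)) ([]=⇒lookup v∈)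
    ... | yes p | _ = p
    ... | no _  | ()

  outside? : ∀ {n} (X : Subset n) s → U.Decidable (λ v → v ∈ X × v ≢ s)
  outside? X s v = (v ∈? X) ×-dec ¬? (v ≟ᶠ s)

  infixl 6 _∖_

  opaque

    _∖_ : ∀ {n} → Subset n → Fin n → Subset n
    X ∖ s = ⟪ outside? X s ⟫

    ∈∖⁺ : ∀ {n} {X : Subset n} {s v} → v ∈ X → v ≢ s → v ∈ X ∖ s
    ∈∖⁺ {X = X} {s} v∈ v≢ = ∈⟪⟫⁺ (outside? X s) (v∈ , v≢)

    ∈∖⁻ : ∀ {n} {X : Subset n} {s v} → v ∈ X ∖ s → v ∈ X × v ≢ s
    ∈∖⁻ {X = X} {s} = ∈⟪⟫⁻ (outside? X s)

  majorities-meet : ∀ {n} {X Y : Subset n} → n < 2 * ∣ X ∣ → n < 2 * ∣ Y ∣ → ∃[ v ] (v ∈ X × v ∈ Y)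
  majorities-meet {n} {X} {Y} x y with nonempty? (X ∩ Y)
  ... | yes (v , v∈) = v , x∈p∩q⁻ X Y v∈
  ... | no none = contradiction bound (<⇒≱ (+-mono-< x y))
    where
    disjoint : ∣ X ∣ ≤ n ∸ ∣ Y ∣
    disjoint = subst (∣ X ∣ ≤_) (∣∁p∣≡n∸∣p∣ Y)
      (p⊆q⇒∣p∣≤∣q∣ (λ {v} v∈X → x∉p⇒x∈∁p (λ v∈Y → none (v , x∈p∩q⁺ (v∈X , v∈Y)))))
    together : ∣ X ∣ + ∣ Y ∣ ≤ n
    together = ≤-trans (+-monoˡ-≤ ∣ Y ∣ disjoint) (≤-reflexive (m∸n+n≡m (∣p∣≤n Y)))
    open ≤-Reasoning
    bound : 2 * ∣ X ∣ + 2 * ∣ Y ∣ ≤ n + n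
    bound = begin
      2 * ∣ X ∣ + 2 * ∣ Y ∣  ≡⟨ *-distribˡ-+ 2 ∣ X ∣ ∣ Y ∣ ⟨
      2 * (∣ X ∣ + ∣ Y ∣)    ≤⟨ *-monoʳ-≤ 2 together ⟩
      2 * n                  ≡⟨ cong (n +_) (+-identityʳ n) ⟩
      n + n                  ∎

  ∣∪∣≤ : ∀ {n} (X Y : Subset n) → ∣ X ∪ Y ∣ ≤ ∣ X ∣ + ∣ Y ∣
  ∣∪∣≤ Data.Vec.Base.[] Data.Vec.Base.[] = z≤n
  ∣∪∣≤ (true Data.Vec.Base.∷ X) (true Data.Vec.Base.∷ Y) =
    s≤s (≤-trans (∣∪∣≤ X Y) (+-monoʳ-≤ ∣ X ∣ (n≤1+n ∣ Y ∣)))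
  ∣∪∣≤ (true Data.Vec.Base.∷ X) (false Data.Vec.Base.∷ Y) = s≤s (∣∪∣≤ X Y)
  ∣∪∣≤ (false Data.Vec.Base.∷ X) (true Data.Vec.Base.∷ Y) =
    ≤-trans (s≤s (∣∪∣≤ X Y)) (≤-reflexive (sym (+-suc ∣ X ∣ ∣ Y ∣)))
  ∣∪∣≤ (false Data.Vec.Base.∷ X) (false Data.Vec.Base.∷ Y) = ∣∪∣≤ X Y

  ⋃ˡ : ∀ {n} → List (Fin n) → Subset n
  ⋃ˡ []       = ∅
  ⋃ˡ (v ∷ vs) = ⁅ v ⁆ ∪ ⋃ˡ vs

  ∈⋃ˡ⁺ : ∀ {n} {v : Fin n} {vs} → v ∈ˡ vs → v ∈ ⋃ˡ vs
  ∈⋃ˡ⁺ (here refl) = x∈p∪q⁺ (inj₁ (x∈⁅x⁆ _))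
  ∈⋃ˡ⁺ (there v∈)  = x∈p∪q⁺ (inj₂ (∈⋃ˡ⁺ v∈))

  ∈⋃ˡ⁻ : ∀ {n} {v : Fin n} vs → v ∈ ⋃ˡ vs → v ∈ˡ vs
  ∈⋃ˡ⁻ []       v∈ = contradiction v∈ ∉⊥
  ∈⋃ˡ⁻ (w ∷ ws) v∈ with x∈p∪q⁻ ⁅ w ⁆ (⋃ˡ ws) v∈
  ... | inj₁ v∈w  = here (x∈⁅y⁆⇒x≡y w v∈w)
  ... | inj₂ v∈ws = there (∈⋃ˡ⁻ ws v∈ws)

  ∣⋃ˡ∣≤ : ∀ {n} (vs : List (Fin n)) → ∣ ⋃ˡ vs ∣ ≤ length vs
  ∣⋃ˡ∣≤ {n} []   = ≤-reflexive (∣⊥∣≡0 n)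
  ∣⋃ˡ∣≤ (v ∷ vs) = ≤-trans (∣∪∣≤ ⁅ v ⁆ (⋃ˡ vs)) (+-mono-≤ (≤-reflexive (∣⁅x⁆∣≡1 v)) (∣⋃ˡ∣≤ vs))

  least : {P : Pred ℕ 0ℓ} → U.Decidable P → ∀ m → P m → ∃[ ℓ ] (P ℓ × (∀ j → P j → ℓ ≤ j))
  least P? zero p = 0 , p , λ _ _ → z≤n
  least {P} P? (suc m) p with P? 0
  ... | yes p₀ = 0 , p₀ , λ _ _ → z≤n
  ... | no ¬p₀ with least (λ j → P? (suc j)) m p
  ... | ℓ , q , min = suc ℓ , q , λ { zero p₀ → contradiction p₀ ¬p₀ ; (suc j) pj → s≤s (min j pj) }

  argmin : ∀ {n} {P : Pred (Fin n) 0ℓ} → U.Decidable P → (f : Fin n → ℕ) → ∃ P →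
           ∃[ v ] (P v × (∀ w → P w → f v ≤ f w))
  argmin P? f (v , p) with least (λ m → any? (λ w → P? w ×-dec (f w ≟ m))) (f v) (v , p , refl)
  ... | _ , (w , q , refl) , min = w , q , λ x px → min (f x) (x , px , refl)

  -- Warshall's algorithm: R* restricted to inner vertices from a list.

  module _ {n} {R : Rel (Fin n) 0ℓ} where

    Via : List (Fin n) → Rel (Fin n) 0ℓ
    Via []       u v = u ≡ v ⊎ R u v
    Via (k ∷ ks) u v = Via ks u v ⊎ (Via ks u k × Via ks k v)

    via? : Decidable R → ∀ ks → Decidable (Via ks)
    via? R? []       u v = (u ≟ᶠ v) ⊎-dec R? u v
    via? R? (k ∷ ks) u v = via? R? ks u v ⊎-dec (via? R? ks u k ×-dec via? R? ks k v)

    via⇒star : ∀ ks {u v} → Via ks u v → Star R u v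
    via⇒star []       (inj₁ refl)    = ε
    via⇒star []       (inj₂ r)       = r ◅ ε
    via⇒star (k ∷ ks) (inj₁ p)       = via⇒star ks p
    via⇒star (k ∷ ks) (inj₂ (p , q)) = via⇒star ks p ◅◅ via⇒star ks q

    via-weaken : ∀ ks {u v} → Via [] u v → Via ks u v
    via-weaken []       p = p
    via-weaken (k ∷ ks) p = inj₁ (via-weaken ks p)

    via-trans : ∀ ks {u v k} → k ∈ˡ ks → Via ks u k → Via ks k v → Via ks u v
    via-trans (k ∷ ks) (here refl) p q = inj₂ ([ id , proj₁ ] p , [ id , proj₂ ] q)
    via-trans (k ∷ ks) (there k∈) (inj₁ p) (inj₁ q) = inj₁ (via-trans ks k∈ p q)
    via-trans (k ∷ ks) (there k∈) (inj₁ p) (inj₂ (q , q′)) = inj₂ (via-trans ks k∈ p q , q′)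
    via-trans (k ∷ ks) (there k∈) (inj₂ (p , p′)) (inj₁ q) = inj₂ (p , via-trans ks k∈ p′ q)
    -- Both walks visit the head pivot; the closed walk between these visits is dropped.
    via-trans (k ∷ ks) (there k∈) (inj₂ (p , _)) (inj₂ (_ , q)) = inj₂ (p , q)

    star⇒via : ∀ {u v} → Star R u v → Via (allFin n) u v
    star⇒via ε        = via-weaken (allFin n) (inj₁ refl)
    star⇒via (r ◅ rs) =
      via-trans (allFin n) (∈-allFin _) (via-weaken (allFin n) (inj₂ r)) (star⇒via rs)

    opaque
      star? : Decidable R → Decidable (Star R)
      star? R? u v = map′ (via⇒star (allFin n)) star⇒via (via? R? (allFin n) u v)

open FinSets

-- Counting in lists.

module Lists where

  unique-length : ∀ {A : Set} {xs ys : List A} → Unique xs → (∀ {x} → x ∈ˡ xs → x ∈ˡ ys) → length xs ≤ length ys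
  unique-length {xs = []} _ _ = z≤n
  unique-length {xs = x ∷ xs} (x∉ ∷ uniq) ⊆ys with ∈-∃++ (⊆ys (here refl))
  ... | pre , post , refl = ≤-trans (s≤s (unique-length uniq sub)) (≤-reflexive count)
    where
    sub : ∀ {y} → y ∈ˡ xs → y ∈ˡ pre ++ post
    sub y∈ with ∈-++⁻ pre (⊆ys (there y∈))
    ... | inj₁ l            = ∈-++⁺ˡ l
    ... | inj₂ (here refl)  = contradiction refl (All.lookup x∉ y∈)
    ... | inj₂ (there r)    = ∈-++⁺ʳ pre r
    count : suc (length (pre ++ post)) ≡ length (pre ++ x ∷ post)
    count = trans (cong suc (length-++ pre)) (trans (sym (+-suc (length pre) (length post))) (sym (length-++ pre)))

  module _ {A : Set} {P Q : Pred A 0ℓ} (P? : U.Decidable P) (Q? : U.Decidable Q) where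

    filter-filter : ∀ xs → length (filter P? (filter Q? xs)) ≤ length (filter P? xs)
    filter-filter [] = z≤n
    filter-filter (x ∷ xs) with Q? x
    ... | no _ with P? x
    ...   | yes _ = m≤n⇒m≤1+n (filter-filter xs)
    ...   | no _  = filter-filter xs
    filter-filter (x ∷ xs) | yes _ with P? x
    ...   | yes _ = s≤s (filter-filter xs)
    ...   | no _  = filter-filter xs

  module _ {A : Set} {P Q : Pred A 0ℓ} (P? : U.Decidable P) (Q? : U.Decidable Q) where

    filter-both : ∀ xs → length (filter P? (filter Q? xs)) ≤ length (filter (λ x → P? x ×-dec Q? x) xs)
    filter-both [] = z≤n
    filter-both (x ∷ xs) with Q? x
    ... | no _ with P? x
    ...   | yes _ = filter-both xs
    ...   | no _  = filter-both xs
    filter-both (x ∷ xs) | yes _ with P? x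
    ...   | yes _ = s≤s (filter-both xs)
    ...   | no _  = filter-both xs

  filter-complement : ∀ {A : Set} {P : Pred A 0ℓ} (P? : U.Decidable P) xs →
                      length xs ≡ length (filter P? xs) + length (filter (λ x → ¬? (P? x)) xs)
  filter-complement P? [] = refl
  filter-complement P? (x ∷ xs) with P? x
  ... | yes _ = cong suc (filter-complement P? xs)
  ... | no _  = trans (cong suc (filter-complement P? xs)) (sym (+-suc (length (filter P? xs)) _))

  sum-member : ∀ {A : Set} (f : A → ℕ) {xs x} → x ∈ˡ xs → f x ≤ sum (map f xs)
  sum-member f (here refl)        = m≤m+n _ _
  sum-member f {y ∷ _} (there x∈) = ≤-trans (sum-member f x∈) (m≤n+m _ (f y))

  sum-≤ : ∀ {A : Set} (f : A → ℕ) b xs → (∀ {x} → x ∈ˡ xs → f x ≤ b) → sum (map f xs) ≤ length xs * b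
  sum-≤ f b []       _  = z≤n
  sum-≤ f b (x ∷ xs) ≤b = +-mono-≤ (≤b (here refl)) (sum-≤ f b xs (λ x∈ → ≤b (there x∈)))

  sum-+ : ∀ {A : Set} (f g : A → ℕ) xs → sum (map (λ x → f x + g x) xs) ≡ sum (map f xs) + sum (map g xs)
  sum-+ f g []       = refl
  sum-+ f g (x ∷ xs) = begin
    f x + g x + sum (map (λ x → f x + g x) xs)           ≡⟨ cong (f x + g x +_) (sum-+ f g xs) ⟩
    f x + g x + (sum (map f xs) + sum (map g xs))        ≡⟨ +-assoc (f x) (g x) _ ⟩
    f x + (g x + (sum (map f xs) + sum (map g xs)))      ≡⟨ cong (f x +_) (+-assoc (g x) (sum (map f xs)) _) ⟨
    f x + (g x + sum (map f xs) + sum (map g xs))        ≡⟨ cong (λ k → f x + (k + sum (map g xs))) (+-comm (g x) (sum (map f xs))) ⟩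
    f x + (sum (map f xs) + g x + sum (map g xs))        ≡⟨ cong (f x +_) (+-assoc (sum (map f xs)) (g x) _) ⟩
    f x + (sum (map f xs) + (g x + sum (map g xs)))      ≡⟨ +-assoc (f x) (sum (map f xs)) _ ⟨
    f x + sum (map f xs) + (g x + sum (map g xs))        ∎
    where open ≡-Reasoning

  pairwise-members : ∀ {A : Set} {R : Rel A 0ℓ} {xs x y} → AllPairs R xs → x ∈ˡ xs → y ∈ˡ xs → x ≡ y ⊎ R x y ⊎ R y x
  pairwise-members (_ ∷ _)  (here refl) (here refl) = inj₁ refl
  pairwise-members (r ∷ _)  (here refl) (there y∈)  = inj₂ (inj₁ (All.lookup r y∈))
  pairwise-members (r ∷ _)  (there x∈)  (here refl) = inj₂ (inj₂ (All.lookup r x∈))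
  pairwise-members (_ ∷ rs) (there x∈)  (there y∈)  = pairwise-members rs x∈ y∈

  length-product : ∀ {A B : Set} (xs : List A) (ys : List B) → length (cartesianProduct xs ys) ≡ length xs * length ys
  length-product []       ys = refl
  length-product (x ∷ xs) ys = trans (length-++ (map (x ,_) ys)) (cong₂ _+_ (length-map (x ,_) ys) (length-product xs ys))

open Lists

-- Walks, giant components and shortest paths.

module Walks (G : Graph) where

  open Graph G renaming (order to n; symmetric to adj-sym; loopless to adj-irrefl)

  Path : VertexSet → Rel Vertex 0ℓ
  Path U = Star (λ x y → x ∈ U × y ∈ U × Adj x y)

  path? : ∀ U → Decidable (Path U)
  path? U = star? (λ x y → (x ∈? U) ×-dec ((y ∈? U) ×-dec adj? x y))

  path-sym : ∀ {U x y} → Path U x y → Path U y x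
  path-sym = reverse (λ (x∈ , y∈ , xy) → y∈ , x∈ , adj-sym xy)

  path-mono : ∀ {U U′ x y} → U ⊆ U′ → Path U x y → Path U′ x y
  path-mono U⊆U′ = gmap id (λ (x∈ , y∈ , xy) → U⊆U′ x∈ , U⊆U′ y∈ , xy)

  path-end : ∀ {U x y} → x ∈ U → Path U x y → y ∈ U
  path-end x∈ ε                  = x∈
  path-end x∈ ((_ , y∈ , _) ◅ p) = path-end y∈ p

  adj-≢ : ∀ {x y} → Adj x y → x ≢ y
  adj-≢ xy x≡y = adj-irrefl x≡y xy

  opaque

    comp : VertexSet → Vertex → VertexSet
    comp U v = ⟪ path? U v ⟫

    comp⁺ : ∀ {U x y} → Path U x y → y ∈ comp U x
    comp⁺ {U} {x} = ∈⟪⟫⁺ (path? U x)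

    comp⁻ : ∀ {U x y} → y ∈ comp U x → Path U x y
    comp⁻ {U} {x} = ∈⟪⟫⁻ (path? U x)

  giant? : ∀ U → U.Decidable (λ v → v ∈ U × n < 2 * ∣ comp U v ∣)
  giant? U v = (v ∈? U) ×-dec (suc n ≤? 2 * ∣ comp U v ∣)

  opaque

    -- At most one component of G[U] has more than n/2 vertices.  If none has, Ω U is empty.
    Ω : VertexSet → VertexSet
    Ω U = ⟪ giant? U ⟫

    Ω⁺ : ∀ {U v} → v ∈ U → n < 2 * ∣ comp U v ∣ → v ∈ Ω U
    Ω⁺ {U} v∈ big = ∈⟪⟫⁺ (giant? U) (v∈ , big)

    Ω⁻ : ∀ {U v} → v ∈ Ω U → v ∈ U × n < 2 * ∣ comp U v ∣
    Ω⁻ {U} = ∈⟪⟫⁻ (giant? U)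

  Ω⊆ : ∀ {U} → Ω U ⊆ U
  Ω⊆ v∈ = proj₁ (Ω⁻ v∈)

  comp⊆ : ∀ {U U′ x y} → (∀ {z} → Path U x z → Path U′ y z) → n < 2 * ∣ comp U x ∣ → n < 2 * ∣ comp U′ y ∣
  comp⊆ f big = ≤-trans big (*-monoʳ-≤ 2 (p⊆q⇒∣p∣≤∣q∣ λ z∈ → comp⁺ (f (comp⁻ z∈))))

  Ω-closed : ∀ {U x y} → x ∈ Ω U → Path U x y → y ∈ Ω U
  Ω-closed x∈ p with Ω⁻ x∈
  ... | x∈U , big = Ω⁺ (path-end x∈U p) (comp⊆ (path-sym p ◅◅_) big)

  Ω-step : ∀ {U x y} → x ∈ Ω U → y ∈ U → Adj x y → y ∈ Ω U
  Ω-step x∈ y∈ xy = Ω-closed x∈ ((Ω⊆ x∈ , y∈ , xy) ◅ ε)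

  Ω-lift : ∀ {U x y} → x ∈ Ω U → Path U x y → Path (Ω U) x y
  Ω-lift x∈ ε                      = ε
  Ω-lift x∈ ((x∈U , y∈U , xy) ◅ p) = (x∈ , y∈ , xy) ◅ Ω-lift y∈ p
    where y∈ = Ω-step x∈ y∈U xy

  Ω-meet : ∀ {U U′ x y} → x ∈ Ω U → y ∈ Ω U′ → ∃[ z ] (z ∈ Ω U × z ∈ Ω U′ × Path U x z × Path U′ y z)
  Ω-meet x∈ y∈ with majorities-meet (proj₂ (Ω⁻ x∈)) (proj₂ (Ω⁻ y∈))
  ... | z , z∈ , z∈′ = z , Ω-closed x∈ (comp⁻ z∈) , Ω-closed y∈ (comp⁻ z∈′) , comp⁻ z∈ , comp⁻ z∈′

  Ω-connected : ∀ {U x y} → x ∈ Ω U → y ∈ Ω U → Path (Ω U) x y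
  Ω-connected x∈ y∈ with Ω-meet x∈ y∈
  ... | z , _ , _ , p , q = Ω-lift x∈ (p ◅◅ path-sym q)

  Ω-mono : ∀ {U U′} → Ω U ⊆ U′ → Ω U ⊆ Ω U′
  Ω-mono sub x∈ = Ω⁺ (sub x∈) (comp⊆ (λ p → path-mono sub (Ω-lift x∈ p)) (proj₂ (Ω⁻ x∈)))

  -- The walk is stopped at its first arrival in `s`; the part before it survives the deletion of
  -- `s`.
  hit : ∀ {U z s} → Path U z s → z ≢ s →
        ∃[ u ] (u ∈ U × Adj u s × u ≢ s × s ∈ U × Path (U ∖ s) z u)
  hit ε z≢s = contradiction refl z≢s
  hit {U} {z} {s} (_◅_ {j = y} (z∈ , y∈ , zy) p) z≢s with y ≟ᶠ s
  ... | yes refl = z , z∈ , zy , z≢s , y∈ , ε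
  ... | no y≢s with hit p y≢s
  ... | u , u∈ , us , u≢s , s∈ , q = u , u∈ , us , u≢s , s∈ , (∈∖⁺ z∈ z≢s , ∈∖⁺ y∈ y≢s , zy) ◅ q

  -- The start v of the walk need not lie in R.
  Reaches : VertexSet → VertexSet → ℕ → Vertex → Set
  Reaches R Z zero    v = v ∈ Z
  Reaches R Z (suc j) v = ∃[ w ] (w ∈ R × Adj v w × Reaches R Z j w)

  reaches? : ∀ R Z j → U.Decidable (Reaches R Z j)
  reaches? R Z zero    v = v ∈? Z
  reaches? R Z (suc j) v = any? (λ w → (w ∈? R) ×-dec (adj? v w ×-dec reaches? R Z j w))

  path⇒reaches : ∀ {R Z a z} → Path R a z → z ∈ Z → ∃[ j ] Reaches R Z j a
  path⇒reaches ε z∈ = 0 , z∈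
  path⇒reaches ((_ , w∈ , aw) ◅ p) z∈ with path⇒reaches p z∈
  ... | j , r = suc j , _ , w∈ , aw , r

  route : ∀ {R Z} j v → Reaches R Z j v → ℕ → Vertex
  route zero    v _             _       = v
  route (suc j) v r             zero    = v
  route (suc j) v (w , _ , _ , r) (suc i) = route j w r i

  route-start : ∀ {R Z} j v (r : Reaches R Z j v) → route j v r 0 ≡ v
  route-start zero    v r = refl
  route-start (suc j) v r = refl

  route-in : ∀ {R Z} j v (r : Reaches R Z j v) → v ∈ R → ∀ i → route j v r i ∈ R
  route-in zero    v r v∈ i       = v∈
  route-in (suc j) v r v∈ zero    = v∈
  route-in (suc j) v (w , w∈ , _ , r) v∈ (suc i) = route-in j w r w∈ i

  route-adj : ∀ {R Z} j v (r : Reaches R Z j v) i → i < j → Adj (route j v r i) (route j v r (suc i))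
  route-adj (suc j) v (w , _ , vw , r) zero    _       = subst (Adj v) (sym (route-start j w r)) vw
  route-adj (suc j) v (w , _ , vw , r) (suc i) (s≤s i<) = route-adj j w r i i<

  route-reaches : ∀ {R Z} j v (r : Reaches R Z j v) i → i ≤ j → Reaches R Z (j ∸ i) (route j v r i)
  route-reaches zero    v r zero    _ = r
  route-reaches (suc j) v r zero    _ = r
  route-reaches (suc j) v (w , _ , _ , r) (suc i) (s≤s i≤) = route-reaches j w r i i≤

  route-prefix : ∀ {R Z} j v (r : Reaches R Z j v) i → i ≤ j → ∀ k →
                 Reaches R Z k (route j v r i) → Reaches R Z (i + k) v
  route-prefix zero    v r zero    _ k q = q
  route-prefix (suc j) v r zero    _ k q = q
  route-prefix (suc j) v (w , w∈ , vw , r) (suc i) (s≤s i≤) k q = w , w∈ , vw , route-prefix j w r i i≤ k q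

  route-beyond : ∀ {R Z} j v (r : Reaches R Z j v) i → j ≤ i → route j v r i ≡ route j v r j
  route-beyond zero    v r               i       _        = refl
  route-beyond (suc j) v (w , _ , _ , r) (suc i) (s≤s j≤) = route-beyond j w r i j≤

  -- The path is a total function that stays at its end from `ℓ` on, so that `p 1` makes sense even
  -- if `ℓ` is 0. Minimality is stored for all continuations (`tight`) and all starts (`minimal`);
  -- the estimates on chords and outside neighbours below compare lengths by means of these two
  -- fields.
  record Shortest (R A Z : VertexSet) : Set where
    field
      p       : ℕ → Vertex
      ℓ       : ℕ
      inside  : ∀ i → p i ∈ R
      start   : p 0 ∈ A
      step    : ∀ {i} → i < ℓ → Adj (p i) (p (suc i))
      onward  : ∀ {i} → i ≤ ℓ → Reaches R Z (ℓ ∸ i) (p i)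
      tight   : ∀ {i} j → i ≤ ℓ → Reaches R Z j (p i) → ℓ ≤ i + j
      beyond  : ∀ {i} → ℓ ≤ i → p i ≡ p ℓ
      minimal : ∀ {a} j → a ∈ A → a ∈ R → Reaches R Z j a → ℓ ≤ j

    finish : p ℓ ∈ Z
    finish = subst (λ k → Reaches R Z k (p ℓ)) (n∸n≡0 ℓ) (onward ≤-refl)

    private
      -- Cancels the common tail after `p j`: a detour of `k` steps from `p i` to `p j` cannot beat
      -- the path itself.
      shift : ∀ {i j} → j ≤ ℓ → ∀ k → ℓ ≤ i + (k + (ℓ ∸ j)) → j ≤ i + k
      shift {i} {j} j≤ k le = +-cancelʳ-≤ (ℓ ∸ j) j (i + k) (begin
        j + (ℓ ∸ j)        ≡⟨ m+[n∸m]≡n j≤ ⟩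
        ℓ                  ≤⟨ le ⟩
        i + (k + (ℓ ∸ j))  ≡⟨ +-assoc i k (ℓ ∸ j) ⟨
        i + k + (ℓ ∸ j)    ∎)
        where open ≤-Reasoning

    shortcut₀ : ∀ {i j} → i ≤ ℓ → j ≤ ℓ → p i ≡ p j → j ≤ i
    shortcut₀ {i} {j} i≤ j≤ eq = subst (j ≤_) (+-identityʳ i)
      (shift j≤ 0 (tight (ℓ ∸ j) i≤ (subst (Reaches R Z (ℓ ∸ j)) (sym eq) (onward j≤))))

    shortcut₁ : ∀ {i j} → i ≤ ℓ → j ≤ ℓ → Adj (p i) (p j) → j ≤ i + 1
    shortcut₁ {i} {j} i≤ j≤ e = shift j≤ 1 (tight _ i≤ (p j , inside j , e , onward j≤))

    shortcut₂ : ∀ {i j v} → i ≤ ℓ → j ≤ ℓ → v ∈ R → Adj v (p i) → Adj v (p j) → j ≤ i + 2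
    shortcut₂ {i} {j} i≤ j≤ v∈ e e′ =
      shift j≤ 2 (tight _ i≤ (_ , v∈ , adj-sym e , p j , inside j , e′ , onward j≤))

    p-injective : ∀ {i j} → i ≤ ℓ → j ≤ ℓ → p i ≡ p j → i ≡ j
    p-injective i≤ j≤ eq = ≤-antisym (shortcut₀ j≤ i≤ (sym eq)) (shortcut₀ i≤ j≤ eq)

    induced : ∀ {i j} → i ≤ ℓ → j ≤ ℓ → Adj (p i) (p j) → i ≡ suc j ⊎ j ≡ suc i
    induced {i} {j} i≤ j≤ e with <-cmp i j
    ... | tri< i<j _ _ = inj₂ (≤-antisym (subst (j ≤_) (+-comm i 1) (shortcut₁ i≤ j≤ e)) i<j)
    ... | tri≈ _ refl _ = contradiction refl (adj-≢ e)
    ... | tri> _ _ j<i = inj₁ (≤-antisym (subst (i ≤_) (+-comm j 1) (shortcut₁ j≤ i≤ (adj-sym e))) j<i)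

    segment : ∀ {U} i d → i + d ≤ ℓ → (∀ {j} → i ≤ j → j ≤ i + d → p j ∈ U) → Path U (p i) (p (i + d))
    segment {U} i zero _ _ = subst (λ k → Path U (p i) (p k)) (sym (+-identityʳ i)) ε
    segment {U} i (suc d) le in-U = subst (λ k → Path U (p i) (p k)) (sym eq)
      (segment i d (≤-trans (n≤1+n _) le′) (λ i≤ j≤ → in-U i≤ (≤-trans j≤ (+-monoʳ-≤ i (n≤1+n d))))
        ◅◅ (in-U (m≤m+n i d) (+-monoʳ-≤ i (n≤1+n d)) , in-U (m≤n⇒m≤1+n (m≤m+n i d)) (≤-reflexive (sym eq)) , step le′) ◅ ε)
      where
      eq = +-suc i d
      le′ = subst (_≤ ℓ) eq le

    segment′ : ∀ {U i k} → i ≤ k → k ≤ ℓ → (∀ {j} → i ≤ j → j ≤ k → p j ∈ U) → Path U (p i) (p k)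
    segment′ {U} {i} {k} i≤k k≤ in-U = subst (λ m → Path U (p i) (p m)) eq
      (segment i (k ∸ i) (subst (_≤ ℓ) (sym eq) k≤) (λ i≤ j≤ → in-U i≤ (subst (_ ≤_) eq j≤)))
      where eq = m+[n∸m]≡n i≤k

    only-finish : ∀ {i} → i ≤ ℓ → p i ∈ Z → i ≡ ℓ
    only-finish {i} i≤ z = ≤-antisym i≤ (subst (ℓ ≤_) (+-identityʳ i) (tight 0 i≤ z))

    near-finish : ∀ {i v} → i ≤ ℓ → v ∈ R → v ∈ Z → Adj v (p i) → ℓ ≤ i + 1
    near-finish i≤ v∈ z e = tight 1 i≤ (_ , v∈ , adj-sym e , z)

    only-start : ∀ {i} → i ≤ ℓ → p i ∈ A → i ≡ 0
    only-start {i} i≤ a = n≤0⇒n≡0 (shift {i = 0} i≤ 0 (minimal _ a (inside i) (onward i≤)))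

    near-start : ∀ {i v} → i ≤ ℓ → v ∈ R → v ∈ A → Adj v (p i) → i ≤ 1
    near-start {i} i≤ v∈ a e = shift {i = 0} i≤ 1 (minimal _ a v∈ (p i , inside i , e , onward i≤))

  shortest : ∀ {R A Z a} j → a ∈ A → a ∈ R → Reaches R Z j a → Shortest R A Z
  shortest {R} {A} {Z} {a} j a∈A a∈R r
    with least (λ j → any? (λ a → (a ∈? A) ×-dec ((a ∈? R) ×-dec reaches? R Z j a))) j (a , a∈A , a∈R , r)
  ... | ℓ , (b , b∈A , b∈R , q) , min = record
    { p       = route ℓ b q
    ; ℓ       = ℓ
    ; inside  = route-in ℓ b q b∈R
    ; start   = subst (_∈ A) (sym (route-start ℓ b q)) b∈A
    ; step    = route-adj ℓ b q _
    ; onward  = λ i≤ → route-reaches ℓ b q _ i≤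
    ; tight   = λ k i≤ r → min _ (b , b∈A , b∈R , route-prefix ℓ b q _ i≤ k r)
    ; beyond  = λ ℓ≤ → route-beyond ℓ b q _ ℓ≤
    ; minimal = λ k c∈A c∈R r → min k (_ , c∈A , c∈R , r)
    }

-- Induced copies and induced cycles through a vertex.

module Cycles (G : Graph) where

  open Graph G renaming (order to n; symmetric to adj-sym; loopless to adj-irrefl)
  open Walks G

  record InducedCopy (F : Graph) : Set where
    field
      f         : Graph.Vertex F → Vertex
      injective : Injective _≡_ _≡_ f
      adjacency : ∀ u v → Graph.Adj F u v ⇔ Adj (f u) (f v)

    copy? : U.Decidable (λ v → ∃[ u ] (f u ≡ v))
    copy? v = any? (λ u → f u ≟ᶠ v)

    carrier : VertexSet
    carrier = ⟪ copy? ⟫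

    f∈carrier : ∀ u → f u ∈ carrier
    f∈carrier u = ∈⟪⟫⁺ copy? (u , refl)

    carrier⁻ : ∀ {v} → v ∈ carrier → ∃[ u ] (f u ≡ v)
    carrier⁻ = ∈⟪⟫⁻ copy?

    copy-≅ : ∀ {F′} → F′ ≅ F → F′ ≅ G [ carrier ]
    copy-≅ {F′} iso = record
      { to        = f ∘ I.to
      ; injective = I.injective ∘ injective
      ; image     = λ v → mk⇔ (onto v) (λ { (u , refl) → f∈carrier _ })
      ; adjacency = λ u v → mk⇔
          (Equivalence.to (adjacency _ _) ∘ Equivalence.to (I.adjacency u v))
          (Equivalence.from (I.adjacency u v) ∘ Equivalence.from (adjacency _ _))
      }
      where
      module I = _≅_[_] iso
      onto : ∀ v → v ∈ carrier → ∃[ u ] (f (I.to u) ≡ v)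
      onto v v∈ with carrier⁻ v∈
      ... | u , refl with Equivalence.to (I.image u) ∈⊤
      ... | u′ , refl = u′ , refl

  record CycleThrough (s : Vertex) (K : Pred Vertex 0ℓ) : Set where
    field
      m      : ℕ
      copy   : InducedCopy (cycle m)
      apex   : InducedCopy.f copy zero ≡ s
      within : ∀ i → K (InducedCopy.f copy i)

  neighbours? : ∀ s D t → U.Decidable (λ v → v ∈ D × Adj s v × v ≢ t)
  neighbours? s D t v = (v ∈? D) ×-dec (adj? s v ×-dec ¬? (v ≟ᶠ t))

  -- A shortest path in D between two neighbours of s, closed up through s.
  cycle-through : ∀ {s D u t} → s ∉ D → u ∈ D → t ∈ D → u ≢ t → Adj s u → Adj s t → Path D u t →
                  CycleThrough s (λ v → v ≡ s ⊎ v ∈ D)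
  cycle-through {s} {D} {u} {t} s∉ u∈ t∈ u≢t su st walk with path⇒reaches walk (x∈⁅x⁆ t)
  ... | j , r = go ℓ refl
    where
    A? = neighbours? s D t
    -- Every neighbour of `s` in `D` other than `t` may start the path. Minimality then leaves no
    -- neighbour of `s` inside it, so the closed cycle has no chord.
    sp : Shortest D ⟪ A? ⟫ ⁅ t ⁆
    sp = shortest j (∈⟪⟫⁺ A? (u∈ , su , u≢t)) u∈ r
    open Shortest sp

    end : p ℓ ≡ t
    end = x∈⁅y⁆⇒x≡y t finish

    p≢s : ∀ i → p i ≢ s
    p≢s i eq = s∉ (subst (_∈ D) eq (inside i))

    ends : ∀ {i} → i ≤ ℓ → Adj s (p i) → i ≡ 0 ⊎ i ≡ ℓ
    ends {i} i≤ e with p i ≟ᶠ t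
    ... | yes eq = inj₂ (p-injective i≤ ≤-refl (trans eq (sym end)))
    ... | no ¬eq = inj₁ (only-start i≤ (∈⟪⟫⁺ A? (inside i , e , ¬eq)))

    go : ∀ k → ℓ ≡ k → CycleThrough s (λ v → v ≡ s ⊎ v ∈ D)
    go zero eq = contradiction (trans (cong p (sym eq)) end) (proj₂ (proj₂ (∈⟪⟫⁻ A? start)))
    go (suc m) ℓ≡ = record
      { m = m
      ; copy = record { f = f ; injective = λ {i} {j} → f-injective i j ; adjacency = λ i j → mk⇔ (to i j) (from i j) }
      ; apex = refl
      ; within = λ { zero → inj₁ refl ; (suc i) → inj₂ (inside _) }
      }
      where
      f : Fin (3 + m) → Vertex
      f zero    = s
      f (suc i) = p (toℕ i)

      ≤ℓ : (i : Fin (2 + m)) → toℕ i ≤ ℓ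
      ≤ℓ i = subst (toℕ i ≤_) (sym ℓ≡) (≤-pred (toℕ<n i))

      f-injective : ∀ i j → f i ≡ f j → i ≡ j
      f-injective zero    zero    _  = refl
      f-injective zero    (suc j) eq = contradiction (sym eq) (p≢s _)
      f-injective (suc i) zero    eq = contradiction eq (p≢s _)
      f-injective (suc i) (suc j) eq = cong suc (toℕ-injective (p-injective (≤ℓ i) (≤ℓ j) eq))

      Next : Fin (3 + m) → Fin (3 + m) → Set
      Next i j = suc (toℕ i) ≡ toℕ j ⊎ (toℕ i ≡ 2 + m × toℕ j ≡ 0)

      next : ∀ i j → Next i j → Adj (f i) (f j)
      next zero zero (inj₁ ())
      next zero zero (inj₂ (() , _))
      next zero (suc j) (inj₁ eq) = subst (λ k → Adj s (p k)) (suc-injective eq) (proj₁ (proj₂ (∈⟪⟫⁻ A? start)))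
      next zero (suc j) (inj₂ (() , _))
      next (suc i) zero (inj₁ ())
      next (suc i) zero (inj₂ (eq , _)) =
        subst (λ k → Adj (p k) s) (trans ℓ≡ (sym (suc-injective eq))) (adj-sym (subst (Adj s) (sym end) st))
      next (suc i) (suc j) (inj₁ eq) =
        subst (λ k → Adj (p (toℕ i)) (p k)) (suc-injective eq) (step (subst (_≤ ℓ) (sym (suc-injective eq)) (≤ℓ j)))
      next (suc i) (suc j) (inj₂ (_ , ()))

      to : ∀ i j → Graph.Adj (cycle m) i j → Adj (f i) (f j)
      to i j (inj₁ ij) = next i j ij
      to i j (inj₂ ji) = adj-sym (next j i ji)

      at-apex : ∀ (j : Fin (2 + m)) → Adj s (p (toℕ j)) → Graph.Adj (cycle m) zero (suc j)
      at-apex j e with ends (≤ℓ j) e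
      ... | inj₁ eq = inj₁ (inj₁ (cong suc (sym eq)))
      ... | inj₂ eq = inj₂ (inj₂ (cong suc (trans eq ℓ≡) , refl))

      from : ∀ i j → Adj (f i) (f j) → Graph.Adj (cycle m) i j
      from zero    zero    e = contradiction refl (adj-≢ e)
      from zero    (suc j) e = at-apex j e
      from (suc i) zero    e = Graph.symmetric (cycle m) (at-apex i (adj-sym e))
      from (suc i) (suc j) e with induced (≤ℓ i) (≤ℓ j) e
      ... | inj₁ eq = inj₂ (inj₁ (cong suc (sym eq)))
      ... | inj₂ eq = inj₁ (inj₁ (cong suc (sym eq)))

-- The Helly property of subtrees.

module Helly (T : Graph) (tree : IsTree T) where

  open Graph T renaming (order to n; symmetric to adj-sym; loopless to adj-irrefl)
  open Walks T
  open Cycles T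
  open IsTree tree

  iter : (Vertex → Vertex) → ℕ → Vertex → Vertex
  iter f zero    t = t
  iter f (suc k) t = f (iter f k t)

  iter-+ : ∀ f a b t → iter f (a + b) t ≡ iter f a (iter f b t)
  iter-+ f zero    b t = refl
  iter-+ f (suc a) b t = cong f (iter-+ f a b t)

  iter-∸ : ∀ f {i j} t → i ≤ j → iter f i t ≡ iter f j t → iter f (j ∸ i) (iter f i t) ≡ iter f i t
  iter-∸ f {i} {j} t i≤j eq = begin
    iter f (j ∸ i) (iter f i t)  ≡⟨ iter-+ f (j ∸ i) i t ⟨
    iter f (j ∸ i + i) t         ≡⟨ cong (λ k → iter f k t) (m∸n+n≡m i≤j) ⟩
    iter f j t                   ≡⟨ eq ⟨
    iter f i t                   ∎
    where open ≡-Reasoning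

  -- A map moving every vertex of a tree to a neighbour swaps the ends of some edge, as its
  -- shortest orbit would be a cycle otherwise.
  swapped-edge : (f : Vertex → Vertex) → (∀ t → Adj t (f t)) → Vertex → ∃[ t ] (f (f t) ≡ t)
  swapped-edge f edge t₀ with pigeonhole ≤-refl (λ (i : Fin (suc n)) → iter f (toℕ i) t₀)
  -- The minimum is taken over all starting vertices at once, so no vertex of the orbit found has a
  -- shorter period.
  ... | i , j , i<j , eq with least (λ d → any? (λ t → iter f (suc d) t ≟ᶠ t)) (toℕ j ∸ suc (toℕ i))
                              (iter f (toℕ i) t₀ , trans (cong (λ k → iter f k (iter f (toℕ i) t₀)) (sym (+-∸-assoc 1 i<j)))
                                 (iter-∸ f t₀ (<⇒≤ i<j) eq))
  ... | zero , (t , fix) , _ = contradiction (edge t) (λ e → adj-≢ e (sym fix))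
  ... | suc zero , (t , fix) , _ = t , fix
  ... | suc (suc m) , (t , fix) , min = contradiction hom (acyclic m g (λ {i} {j} → g-injective i j))
    where
    g : Fin (3 + m) → Vertex
    g i = iter f (toℕ i) t

    distinct : ∀ {i j : Fin (3 + m)} → toℕ i < toℕ j → g i ≢ g j
    distinct {i} {j} i<j eq = <-irrefl refl (≤-trans (s≤s (min (toℕ j ∸ suc (toℕ i)) (g i , fixed))) le)
      where
      fixed : iter f (suc (toℕ j ∸ suc (toℕ i))) (g i) ≡ g i
      fixed = trans (cong (λ k → iter f k (g i)) (sym (+-∸-assoc 1 i<j))) (iter-∸ f t (<⇒≤ i<j) eq)
      le : suc (toℕ j ∸ suc (toℕ i)) ≤ suc (suc m)
      le = ≤-trans (≤-reflexive (sym (+-∸-assoc 1 i<j))) (≤-trans (m∸n≤m (toℕ j) (toℕ i)) (≤-pred (toℕ<n j)))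

    g-injective : ∀ i j → g i ≡ g j → i ≡ j
    g-injective i j eq with <-cmp (toℕ i) (toℕ j)
    ... | tri< i<j _ _ = contradiction eq (distinct {i} {j} i<j)
    ... | tri≈ _ i≡j _ = toℕ-injective i≡j
    ... | tri> _ _ j<i = contradiction (sym eq) (distinct {j} {i} j<i)

    next : ∀ i j → suc (toℕ i) ≡ toℕ j ⊎ (toℕ i ≡ 2 + m × toℕ j ≡ 0) → Adj (g i) (g j)
    next i j (inj₁ eq) = subst (λ k → Adj (g i) (iter f k t)) eq (edge (g i))
    next i j (inj₂ (eq , eq′)) = subst₂ Adj (cong (λ k → iter f k t) (sym eq))
      (trans fix (cong (λ k → iter f k t) (sym eq′))) (edge (iter f (2 + m) t))

    hom : ∀ i j → Graph.Adj (cycle m) i j → Adj (g i) (g j)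
    hom i j (inj₁ ij) = next i j ij
    hom i j (inj₂ ji) = adj-sym (next j i ji)

  no-cycle-through : ∀ {s K} → ¬ CycleThrough s K
  no-cycle-through c = acyclic m f injective (λ i j → Equivalence.to (adjacency i j))
    where open CycleThrough c
          open InducedCopy copy

  -- If no node lies in all sets, each node `t` is missed by a connected set, which lies in one
  -- component of the tree minus `t`; `f t` is the neighbour of `t` towards it. At an edge swapped
  -- by `f` the two missed sets lie on opposite sides. They meet nevertheless, and the walks to a
  -- common node connect two neighbours of `t` around `t`, which gives a cycle.
  helly : {I : Set} (τ : I → VertexSet) → (∀ t → Dec (∃[ i ] (t ∉ τ i))) →
          (∀ i {x y} → x ∈ τ i → y ∈ τ i → Path (τ i) x y) →
          (∀ i j → ∃[ z ] (z ∈ τ i × z ∈ τ j)) → Vertex → ∃[ t ] (∀ i → t ∈ τ i)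
  helly {I} τ avoid? τ-connected meet t₀ with any? (λ t → ¬? (avoid? t))
  ... | yes (t , all) = t , λ i → decidable-stable (t ∈? τ i) (λ t∉ → all (i , t∉))
  ... | no none = ⊥-elim (contra (swapped-edge f f-edge t₀))
    where
    avoids : ∀ t → ∃[ i ] (t ∉ τ i)
    avoids t with avoid? t
    ... | yes a = a
    ... | no ¬a = contradiction (t , ¬a) none

    towards : ∀ t → ∃[ u ] (Adj t u × (∀ {z} → z ∈ τ (proj₁ (avoids t)) → Path (⊤ ∖ t) u z))
    towards t with avoids t
    -- Meeting itself makes `τ i` nonempty.
    ... | i , t∉ with meet i i
    ... | z , z∈ , _ with hit (path-sym (proj₂ connected ∈⊤ ∈⊤)) (λ { refl → t∉ z∈ })
    ... | u , _ , ut , _ , _ , p = u , adj-sym ut , λ z′∈ →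
          path-sym p ◅◅ path-mono (λ x∈ → ∈∖⁺ ∈⊤ (λ { refl → t∉ x∈ })) (τ-connected i z∈ z′∈)

    f : Vertex → Vertex
    f t = proj₁ (towards t)

    f-edge : ∀ t → Adj t (f t)
    f-edge t = proj₁ (proj₂ (towards t))

    contra : ∃[ t ] (f (f t) ≡ t) → ⊥
    contra (t , fft≡t) with meet (proj₁ (avoids t)) (proj₁ (avoids (f t)))
    ... | r , r∈ , r∈′ with hit (path-sym (subst (λ x → Path (⊤ ∖ f t) x r) fft≡t (proj₂ (proj₂ (towards (f t))) r∈′)))
                                (λ { refl → proj₂ (avoids t) r∈ })
    ... | w , w∈ , wt , w≢t , _ , q =
      no-cycle-through (cycle-through (λ t∈ → proj₂ (∈∖⁻ t∈) refl) (∈∖⁺ ∈⊤ (λ eq → adj-≢ (f-edge t) (sym eq)))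
        (∈∖⁺ ∈⊤ w≢t) (λ eq → proj₂ (∈∖⁻ w∈) (sym eq)) (f-edge t) (adj-sym wt)
        (proj₂ (proj₂ (towards t)) r∈ ◅◅ path-mono (λ x∈ → ∈∖⁺ ∈⊤ (proj₂ (∈∖⁻ x∈))) q))

-- Cores, central sets and a bag meeting all of them.

module Tangle (G : Graph) where

  open Graph G renaming (order to n; symmetric to adj-sym; loopless to adj-irrefl)
  open Walks G

  dominated? : ∀ X → U.Decidable (N[ G , X ])
  dominated? X v = (v ∈? X) ⊎-dec any? (λ u → (u ∈? X) ×-dec adj? u v)

  clean? : ∀ X → U.Decidable (λ v → ¬ N[ G , X ] v)
  clean? X v = ¬? (dominated? X v)

  opaque

    clean : VertexSet → VertexSet
    clean X = ⟪ clean? X ⟫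

    clean⁺ : ∀ {X v} → ¬ N[ G , X ] v → v ∈ clean X
    clean⁺ {X} = ∈⟪⟫⁺ (clean? X)

    clean⁻ : ∀ {X v} → v ∈ clean X → ¬ N[ G , X ] v
    clean⁻ {X} = ∈⟪⟫⁻ (clean? X)

  clean∉ : ∀ {X v} → v ∈ clean X → v ∉ X
  clean∉ v∈ v∈X = clean⁻ v∈ (inj₁ v∈X)

  clean-¬adj : ∀ {X v x} → v ∈ clean X → x ∈ X → ¬ Adj v x
  clean-¬adj v∈ x∈ e = clean⁻ v∈ (inj₂ (_ , x∈ , adj-sym e))

  clean-anti : ∀ {X Y} → X ⊆ Y → clean Y ⊆ clean X
  clean-anti X⊆Y v∈ = clean⁺
    λ { (inj₁ v∈X) → clean∉ v∈ (X⊆Y v∈X) ; (inj₂ (u , u∈ , uv)) → clean-¬adj v∈ (X⊆Y u∈) (adj-sym uv) }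

  core : VertexSet → VertexSet
  core X = Ω (clean X)

  core-anti : ∀ {X Y} → X ⊆ Y → core Y ⊆ core X
  core-anti X⊆Y = Ω-mono (clean-anti X⊆Y ∘ Ω⊆)

  -- Dominating `s` removes at least what deleting `s` removes.
  core-minus : ∀ {X Y s} → X ⊆ Y → s ∈ Y → core Y ⊆ Ω (clean X ∖ s)
  core-minus X⊆Y s∈ = Ω-mono (λ v∈ → ∈∖⁺ (clean-anti X⊆Y (Ω⊆ v∈)) (λ { refl → clean∉ (Ω⊆ v∈) s∈ }))

  central? : ∀ X → U.Decidable (λ w → w ∈ core X × (∀ v → v ≢ w → w ∈ Ω (clean X ∖ v)))
  central? X w = (w ∈? core X) ×-dec all? (λ v → ¬? (v ≟ᶠ w) →-dec (w ∈? Ω (clean X ∖ v)))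

  opaque

    central : VertexSet → VertexSet
    central X = ⟪ central? X ⟫

    central⁺ : ∀ {X w} → w ∈ core X → (∀ v → v ≢ w → w ∈ Ω (clean X ∖ v)) → w ∈ central X
    central⁺ {X} w∈ stays = ∈⟪⟫⁺ (central? X) (w∈ , stays)

    central⁻ : ∀ {X w} → w ∈ central X → w ∈ core X × (∀ v → v ≢ w → w ∈ Ω (clean X ∖ v))
    central⁻ {X} = ∈⟪⟫⁻ (central? X)

  central-anti : ∀ {X Y} → X ⊆ Y → central Y ⊆ central X
  central-anti {X} {Y} X⊆Y w∈ with central⁻ w∈
  ... | w∈core , stays = central⁺ (core-anti X⊆Y w∈core)
    λ v v≢w → Ω-mono (λ x∈ → ∈∖⁺ (clean-anti X⊆Y (proj₁ (∈∖⁻ (Ω⊆ x∈)))) (proj₂ (∈∖⁻ (Ω⊆ x∈)))) (stays v v≢w)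

  -- All vertices of a shortest path in `clean X` between central vertices are central: a deleted
  -- vertex `v` occurs at most once on it, so `p i` stays joined to `x` or to `y`, and this end
  -- stays in the giant component.
  central-connected : ∀ {X x y} → x ∈ central X → y ∈ central X → Path (central X) x y
  central-connected {X} {x} {y} x∈ y∈ with central⁻ x∈ | central⁻ y∈
  ... | x∈core , x-stays | y∈core , y-stays
    with path⇒reaches (path-mono Ω⊆ (Ω-connected x∈core y∈core)) (x∈⁅x⁆ y)
  ... | j , r = subst₂ (Path (central X)) first last (segment′ z≤n ≤-refl (λ _ j≤ → on-route j≤))
    where
    sp : Shortest (clean X) ⁅ x ⁆ ⁅ y ⁆
    sp = shortest j (x∈⁅x⁆ x) (Ω⊆ x∈core) r
    open Shortest sp

    first : p 0 ≡ x
    first = x∈⁅y⁆⇒x≡y x start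
    last : p ℓ ≡ y
    last = x∈⁅y⁆⇒x≡y y finish

    on-route : ∀ {i} → i ≤ ℓ → p i ∈ central X
    on-route {i} i≤ = central⁺
      (Ω-closed (subst (_∈ core X) (sym first) x∈core) (segment′ z≤n i≤ (λ _ _ → inside _))) stays
      where
      stays : ∀ v → v ≢ p i → p i ∈ Ω (clean X ∖ v)
      stays v v≢ with any? {n = i} (λ j → p (toℕ j) ≟ᶠ v)
      ... | no before = Ω-closed (subst (_∈ Ω (clean X ∖ v)) (sym first) (x-stays v (λ { refl → p≢v z≤n first })))
                          (segment′ z≤n i≤ (λ _ j≤ → ∈∖⁺ (inside _) (p≢v j≤)))
        where
        p≢v : ∀ {j} → j ≤ i → p j ≢ v
        p≢v {j} j≤i eq with m≤n⇒m<n∨m≡n j≤i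
        ... | inj₁ j<i  = before (fromℕ< j<i , trans (cong p (toℕ-fromℕ< j<i)) eq)
        ... | inj₂ refl = v≢ (sym eq)
      ... | yes (j , pj≡v) = Ω-closed (subst (_∈ Ω (clean X ∖ v)) (sym last) (y-stays v (λ { refl → p≢v i≤ ≤-refl last })))
                               (path-sym (segment′ i≤ ≤-refl (λ i≤j j≤ → ∈∖⁺ (inside _) (p≢v i≤j j≤))))
        where
        p≢v : ∀ {k} → i ≤ k → k ≤ ℓ → p k ≢ v
        p≢v {k} i≤k k≤ eq = <⇒≢ (≤-trans (toℕ<n j) i≤k)
          (p-injective (≤-trans (<⇒≤ (toℕ<n j)) i≤) k≤ (trans pj≡v (sym eq)))

  -- The bound `2s + 1` leaves room for the union of two sets of size `s` and one deleted vertex.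
  module Persistent (s : ℕ) (persistent : ∀ X → ∣ X ∣ ≤ suc (s + s) → ∃[ v ] (v ∈ core X)) where

    punctured : ∀ X v → ∣ X ∣ ≤ s + s → ∃[ w ] (w ∈ Ω (clean X ∖ v))
    punctured X v ≤2s with persistent (⁅ v ⁆ ∪ X)
        (≤-trans (∣∪∣≤ ⁅ v ⁆ X) (+-mono-≤ (≤-reflexive (∣⁅x⁆∣≡1 v)) ≤2s))
    ... | w , w∈ = w , core-minus (λ x∈ → x∈p∪q⁺ (inj₂ x∈)) (x∈p∪q⁺ (inj₁ (x∈⁅x⁆ v))) w∈

    -- A vertex whose deletion leaves the smallest giant component is central: a deletion that
    -- cut it off would leave a smaller one.
    central-nonempty : ∀ X → ∣ X ∣ ≤ s + s → ∃[ w ] (w ∈ central X)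
    central-nonempty X ≤2s with argmin (_∈? core X) (λ v → ∣ Ω (clean X ∖ v) ∣) (persistent X (m≤n⇒m≤1+n ≤2s))
    ... | w , w∈ , min = w , central⁺ w∈ stays
      where
      stays : ∀ v → v ≢ w → w ∈ Ω (clean X ∖ v)
      stays v v≢w with v ∈? core X
      ... | no v∉ = Ω-mono (λ x∈ → ∈∖⁺ (Ω⊆ x∈) (λ { refl → v∉ x∈ })) w∈
      ... | yes v∈ with w ∈? Ω (clean X ∖ v)
      ... | yes w∈′ = w∈′
      ... | no w∉ = contradiction (min v v∈) (<⇒≱ (p⊂q⇒∣p∣<∣q∣ (sub , v , v∈K , λ v∈′ → proj₂ (∈∖⁻ (Ω⊆ v∈′)) refl)))
        where
        z = proj₁ (punctured X v ≤2s)
        z∈ = proj₂ (punctured X v ≤2s)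
        z∈core : z ∈ core X
        z∈core = Ω-mono (λ x∈ → proj₁ (∈∖⁻ (Ω⊆ x∈))) z∈
        sub : Ω (clean X ∖ v) ⊆ Ω (clean X ∖ w)
        sub = Ω-mono (λ x∈ → ∈∖⁺ (proj₁ (∈∖⁻ (Ω⊆ x∈))) (λ { refl → w∉ x∈ }))
        v∈K : v ∈ Ω (clean X ∖ w)
        v∈K with hit (path-mono Ω⊆ (Ω-connected z∈core v∈)) (proj₂ (∈∖⁻ (Ω⊆ z∈)))
        ... | u , _ , uv , _ , v∈clean , q = Ω-step (sub (Ω-closed z∈ q)) (∈∖⁺ v∈clean v≢w) uv

    -- The first neighbour `u` lies just before `w` on a walk from the giant component left by `w`.
    -- If `u` is deleted instead, the central vertex `w` stays in the giant component. The two giant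
    -- components meet, and a walk from a common vertex to `w` avoiding `u` arrives through a second
    -- neighbour.
    central-neighbours : ∀ {X w} → ∣ X ∣ ≤ s + s → w ∈ central X →
      ∃[ u ] ∃[ u′ ] (u ≢ u′ × Adj w u × Adj w u′ × u ∈ Ω (clean X ∖ w) × u′ ∈ Ω (clean X ∖ w))
    central-neighbours {X} {w} ≤2s w∈ with central⁻ w∈ | punctured X w ≤2s
    ... | w∈core , stays | z , z∈
      with hit (path-mono Ω⊆ (Ω-connected (Ω-mono (λ x∈ → proj₁ (∈∖⁻ (Ω⊆ x∈))) z∈) w∈core)) (proj₂ (∈∖⁻ (Ω⊆ z∈)))
    ... | u , _ , uw , u≢w , _ , q with Ω-meet z∈ (stays u u≢w)
    ... | z′ , z′∈ , z′∈′ , _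
      with hit (path-mono Ω⊆ (Ω-connected z′∈′ (stays u u≢w))) (proj₂ (∈∖⁻ (Ω⊆ z′∈)))
    ... | u′ , u′∈ , u′w , _ , _ , q′ =
      u , u′ , (λ { refl → proj₂ (∈∖⁻ u′∈) refl }) , adj-sym uw , adj-sym u′w , Ω-closed z∈ q ,
      Ω-closed z′∈ (path-mono (λ x∈ → ∈∖⁺ (proj₁ (∈∖⁻ (proj₁ (∈∖⁻ x∈)))) (proj₂ (∈∖⁻ x∈))) q′)

    module _ (𝓣 : TreeDecomposition G) where
      open TreeDecomposition 𝓣
      module WT = Walks tree

      meets? : ∀ X → U.Decidable (λ t → ∃[ w ] (w ∈ central X × w ∈ bag t))
      meets? X t = any? (λ w → (w ∈? central X) ×-dec (w ∈? bag t))

      opaque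

        traces : VertexSet → Graph.VertexSet tree
        traces X = ⟪ meets? X ⟫

        traces⁺ : ∀ {X w t} → w ∈ central X → w ∈ bag t → t ∈ traces X
        traces⁺ {X} w∈ w∋ = ∈⟪⟫⁺ (meets? X) (_ , w∈ , w∋)

        traces⁻ : ∀ {X t} → t ∈ traces X → ∃[ w ] (w ∈ central X × w ∈ bag t)
        traces⁻ {X} = ∈⟪⟫⁻ (meets? X)

      in-bags : ∀ {X w t t′} → w ∈ central X → w ∈ bag t → w ∈ bag t′ → WT.Path (traces X) t t′
      in-bags {X} {w} w∈ t∋ t′∋ =
        gmap id (λ (x∋ , y∋ , xy) → traces⁺ w∈ x∋ , traces⁺ w∈ y∋ , xy) (proj₂ (subtree w) t∋ t′∋)

      along : ∀ {X x y t t′} → Path (central X) x y → x ∈ central X → x ∈ bag t → y ∈ bag t′ → WT.Path (traces X) t t′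
      along ε x∈ x∋ y∋ = in-bags x∈ x∋ y∋
      along ((_ , z∈ , xz) ◅ p) x∈ x∋ y∋ with edge-bag xz
      ... | b , x∋b , z∋b = in-bags x∈ x∋ x∋b ◅◅ along p z∈ z∋b y∋

      traces-connected : ∀ {X t t′} → t ∈ traces X → t′ ∈ traces X → WT.Path (traces X) t t′
      traces-connected t∈ t′∈ with traces⁻ t∈ | traces⁻ t′∈
      ... | w , w∈ , w∋ | w′ , w′∈ , w′∋ = along (central-connected w∈ w′∈) w∈ w∋ w′∋

      -- A vertex central for `X ∪ Y` is central for both sets, so any bag holding it is common to
      -- both traces.
      traces-meet : ∀ X Y → ∣ X ∣ ≤ s → ∣ Y ∣ ≤ s → ∃[ t ] (t ∈ traces X × t ∈ traces Y)
      traces-meet X Y X≤ Y≤ with central-nonempty (X ∪ Y) (≤-trans (∣∪∣≤ X Y) (+-mono-≤ X≤ Y≤))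
      ... | w , w∈ with vertex-bag w
      ... | t , w∋ = t , traces⁺ (central-anti (λ x∈ → x∈p∪q⁺ (inj₁ x∈)) w∈) w∋
                       , traces⁺ (central-anti (λ x∈ → x∈p∪q⁺ (inj₂ x∈)) w∈) w∋

      avoided? : ∀ t → Dec (∃[ X ] (∣ X ∣ ≤ s × t ∉ traces X))
      avoided? t = anySubset? (λ X → (∣ X ∣ ≤? s) ×-dec ¬? (t ∈? traces X))

      -- One bag serves all sets of size at most `s`, so it can be fixed before any of them is
      -- built.
      central-bag : Vertex → ∃[ t ] (∀ X → ∣ X ∣ ≤ s → ∃[ w ] (w ∈ central X × w ∈ bag t))
      central-bag v₀ = proj₁ found , λ X ≤s → traces⁻ (proj₂ found (X , ≤s))
        where
        found : ∃[ t ] (∀ (i : ∃[ X ] (∣ X ∣ ≤ s)) → t ∈ traces (proj₁ i))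
        found = Helly.helly tree isTree (λ i → traces (proj₁ i))
          (λ t → map′ (λ (X , ≤s , t∉) → (X , ≤s) , t∉) (λ ((X , ≤s) , t∉) → X , ≤s , t∉) (avoided? t))
          (λ i → traces-connected) (λ i j → traces-meet (proj₁ i) (proj₁ j) (proj₂ i) (proj₂ j))
          (proj₁ (vertex-bag v₀))

-- Packings, and the path argument for the first bound.

module Packing (G : Graph) where

  open Graph G renaming (order to n; symmetric to adj-sym; loopless to adj-irrefl)
  open Walks G
  open Cycles G
  open Tangle G

  anticomplete-sym : ∀ {S S′} → Anticomplete G S S′ → Anticomplete G S′ S
  anticomplete-sym a u∈ v∈ with a v∈ u∈
  ... | v≢u , ¬e = (λ eq → v≢u (sym eq)) , λ e → ¬e (adj-sym e)

  pairwise : ∀ {A : Set} {R : Rel A 0ℓ} → (∀ {x y} → R x y → R y x) → ∀ {xs} → AllPairs R xs →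
             ∀ {i j} → i ≢ j → R (lookupˡ xs i) (lookupˡ xs j)
  pairwise {R = R} R-sym {xs} = go xs
    where
    head : ∀ {x} xs → All (R x) xs → ∀ i → R x (lookupˡ xs i)
    head (y ∷ ys) (r ∷ rs) zero    = r
    head (y ∷ ys) (r ∷ rs) (suc i) = head ys rs i
    go : ∀ xs → AllPairs R xs → ∀ {i j} → i ≢ j → R (lookupˡ xs i) (lookupˡ xs j)
    go (x ∷ xs) (rs ∷ _)  {zero}  {zero}  i≢j = contradiction refl i≢j
    go (x ∷ xs) (rs ∷ _)  {zero}  {suc j} _   = head xs rs j
    go (x ∷ xs) (rs ∷ _)  {suc i} {zero}  _   = R-sym (head xs rs i)
    go (x ∷ xs) (_  ∷ ps) {suc i} {suc j} i≢j = go xs ps (λ eq → i≢j (cong suc eq))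

  module _ (𝓗 : Family) (B : VertexSet) where

    Member : VertexSet → Set₁
    Member S = (∃[ F ] (𝓗 F × F ≅ G [ S ])) × (∃[ v ] (v ∈ S × v ∈ B))

    -- Distinctness follows from rootedness: each set has a vertex and so is not anticomplete to
    -- itself.
    packing-bound : ∀ {k} → π[ 𝓗 , G , B ]≤ k → (Ss : List VertexSet) → AllPairs (Anticomplete G) Ss →
                    (∀ i → Member (lookupˡ Ss i)) → length Ss ≤ k
    packing-bound bound Ss anti member = bound (length Ss) (lookupˡ Ss)
      record { distinct = λ {i} {j} → distinct i j
             ; anticomplete = apart
             ; member = λ i → proj₁ (member i) }
      (λ i → proj₂ (member i))
      where
      apart : ∀ {i j} → i ≢ j → Anticomplete G (lookupˡ Ss i) (lookupˡ Ss j)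
      apart = pairwise {R = Anticomplete G} (λ {S} {S′} → anticomplete-sym {S} {S′}) anti
      distinct : ∀ i j → lookupˡ Ss i ≡ lookupˡ Ss j → i ≡ j
      distinct i j eq with i ≟ᶠ j | proj₂ (member i)
      ... | yes i≡j | _ = i≡j
      ... | no i≢j | v , v∈ , _ = contradiction refl (proj₁ (apart i≢j v∈ (subst (v ∈_) eq v∈)))

  no-core⇒halving : ∀ X → ¬ (∃[ v ] (v ∈ core X)) → HalvingNeighbourhood G X
  no-core⇒halving X none C isC with 2 * ∣ C ∣ ≤? n
  ... | yes le = le
  ... | no ¬le with IsComponent.connected isC
  ... | (v , v∈) , conn = contradiction
    (v , Ω⁺ (C⊆ v∈)
      (≤-trans (≰⇒> ¬le) (*-monoʳ-≤ 2 (p⊆q⇒∣p∣≤∣q∣ λ x∈ → comp⁺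
        (gmap id (λ (a∈ , b∈ , ab) → C⊆ a∈ , C⊆ b∈ , ab) (conn v∈ x∈)))))) none
    where
    C⊆ : ∀ {x} → x ∈ C → x ∈ clean X
    C⊆ x∈ = clean⁺ (IsComponent.within isC x∈)

  halving-or-persistent : ∀ M → (∃[ X ] (HalvingNeighbourhood G X × ∣ X ∣ ≤ M)) ⊎ (∀ X → ∣ X ∣ ≤ M → ∃[ v ] (v ∈ core X))
  halving-or-persistent M with anySubset? (λ X → (∣ X ∣ ≤? M) ×-dec ¬? (any? (_∈? core X)))
  ... | yes (X , le , none) = inj₁ (X , no-core⇒halving X none , le)
  ... | no never = inj₂ λ X le → decidable-stable (any? (_∈? core X)) (λ none → never (X , le , none))

  path-copy : Vertex → InducedCopy (path 1)
  path-copy v = record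
    { f = λ _ → v
    ; injective = λ { {zero} {zero} _ → refl }
    ; adjacency = λ { zero zero → mk⇔ (λ { (inj₁ ()) ; (inj₂ ()) }) (λ e → contradiction refl (adj-≢ e)) } }

  -- The path is extended at index 0, which therefore always is its newest vertex.
  extend-copy : ∀ {i} (c : InducedCopy (path (suc i))) w → (∀ j → w ≢ InducedCopy.f c j) →
                Adj w (InducedCopy.f c zero) → (∀ j → ¬ Adj w (InducedCopy.f c (suc j))) → InducedCopy (path (suc (suc i)))
  extend-copy {i} c w w≢ w~ w≁ = record { f = g ; injective = λ {a} {b} → inj a b ; adjacency = λ a b → mk⇔ (to a b) (from a b) }
    where
    open InducedCopy c
    g : Fin (suc (suc i)) → Vertex
    g zero    = w
    g (suc j) = f j
    inj : ∀ a b → g a ≡ g b → a ≡ b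
    inj zero    zero    _  = refl
    inj zero    (suc b) eq = contradiction eq (w≢ b)
    inj (suc a) zero    eq = contradiction (sym eq) (w≢ a)
    inj (suc a) (suc b) eq = cong suc (injective eq)
    to₁ : ∀ a b → suc (toℕ a) ≡ toℕ b → Adj (g a) (g b)
    to₁ zero    zero          ()
    to₁ zero    (suc zero)    _  = w~
    to₁ zero    (suc (suc b)) ()
    to₁ (suc a) zero          ()
    to₁ (suc a) (suc b)       eq = Equivalence.to (adjacency a b) (inj₁ (suc-injective eq))
    to : ∀ a b → Graph.Adj (path (suc (suc i))) a b → Adj (g a) (g b)
    to a b (inj₁ ab) = to₁ a b ab
    to a b (inj₂ ba) = adj-sym (to₁ b a ba)
    up : ∀ {a b : Fin (suc i)} → Graph.Adj (path (suc i)) a b → Graph.Adj (path (suc (suc i))) (suc a) (suc b)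
    up (inj₁ eq) = inj₁ (cong suc eq)
    up (inj₂ eq) = inj₂ (cong suc eq)
    from : ∀ a b → Adj (g a) (g b) → Graph.Adj (path (suc (suc i))) a b
    from zero          zero          e = contradiction refl (adj-≢ e)
    from zero          (suc zero)    e = inj₁ refl
    from zero          (suc (suc b)) e = contradiction e (w≁ b)
    from (suc zero)    zero          e = inj₂ refl
    from (suc (suc a)) zero          e = contradiction (adj-sym e) (w≁ a)
    from (suc a)       (suc b)       e = up (Equivalence.from (adjacency a b) e)

  -- Gyárfás' path argument, rooted in B: the path is extended into the core left by its
  -- domination, so its last vertex always touches that core.
  module Gyarfas (s : ℕ) (persistent : ∀ X → ∣ X ∣ ≤ s → ∃[ v ] (v ∈ core X))
                 (B : VertexSet) (rooted : ∀ X → ∣ X ∣ ≤ s → ∃[ v ] (v ∈ core X × v ∈ B)) where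

    -- `X` collects the paths of earlier rounds. `Z` holds in addition all vertices of the current
    -- path but the newest, so only this one can have neighbours in `clean Z`.
    record Front (X : VertexSet) (i : ℕ) : Set where
      field
        copy    : InducedCopy (path (suc i))
        Z       : VertexSet
        X⊆Z     : X ⊆ Z
        size    : ∣ Z ∣ ≤ ∣ X ∣ + i
        older   : ∀ j → InducedCopy.f copy (suc j) ∈ Z
        fresh   : ∀ j → InducedCopy.f copy j ∈ clean X
        root    : ∃[ j ] (InducedCopy.f copy j ∈ B)
        touches : ∃[ y ] (y ∈ core Z × (y ≡ InducedCopy.f copy zero ⊎ Adj (InducedCopy.f copy zero) y))

    -- A walk in `clean Z` from the new core to a vertex near `v` has to leave the set that remains
    -- after dominating `v`. Its first vertex `w` outside is a neighbour of `v` and of no vertex of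
    -- `Z`, and the vertex before it is still in the new core. So `w` extends the path and touches
    -- this core.
    first-outside : ∀ {Z v a y} → a ∈ core (⁅ v ⁆ ∪ Z) → Path (clean Z) a y → y ≡ v ⊎ Adj v y →
                    ∃[ w ] ∃[ b ] (w ∈ clean Z × Adj v w × b ∈ core (⁅ v ⁆ ∪ Z) × Adj b w)
    first-outside a∈ ε (inj₁ refl) = contradiction (x∈p∪q⁺ (inj₁ (x∈⁅x⁆ _))) (clean∉ (Ω⊆ a∈))
    first-outside a∈ ε (inj₂ vy)   = contradiction (adj-sym vy) (clean-¬adj (Ω⊆ a∈) (x∈p∪q⁺ (inj₁ (x∈⁅x⁆ _))))
    first-outside {Z} {v} {a} a∈ (_◅_ {j = b} (_ , b∈ , ab) p) near with dominated? (⁅ v ⁆ ∪ Z) b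
    ... | no ¬dom = first-outside (Ω-step a∈ (clean⁺ ¬dom) ab) p near
    ... | yes (inj₁ b∈∪) with x∈p∪q⁻ ⁅ v ⁆ Z b∈∪
    ...   | inj₁ b∈v rewrite x∈⁅y⁆⇒x≡y v b∈v = contradiction ab (clean-¬adj (Ω⊆ a∈) (x∈p∪q⁺ (inj₁ (x∈⁅x⁆ v))))
    ...   | inj₂ b∈Z = contradiction b∈Z (clean∉ b∈)
    first-outside {Z} {v} {a} a∈ (_◅_ {j = b} (_ , b∈ , ab) p) near | yes (inj₂ (u , u∈∪ , ub)) with x∈p∪q⁻ ⁅ v ⁆ Z u∈∪
    ...   | inj₁ u∈v = b , a , b∈ , subst (λ u → Adj u b) (x∈⁅y⁆⇒x≡y v u∈v) ub , a∈ , ab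
    ...   | inj₂ u∈Z = contradiction (adj-sym ub) (clean-¬adj b∈ u∈Z)

    grow : ∀ X i → ∣ X ∣ + i ≤ s → Front X i
    grow X zero ≤s with rooted X (≤-trans (m≤m+n ∣ X ∣ 0) ≤s)
    ... | b , b∈ , b∈B = record
      { copy = path-copy b ; Z = X ; X⊆Z = id ; size = m≤m+n ∣ X ∣ 0 ; older = λ () ; fresh = λ _ → Ω⊆ b∈
      ; root = zero , b∈B ; touches = b , b∈ , inj₁ refl }
    grow X (suc i) ≤s with grow X i (≤-trans (+-monoʳ-≤ ∣ X ∣ (n≤1+n i)) ≤s)
    ... | fr = step (persistent Z′ (≤-trans size′ ≤s))
      where
      open Front fr
      open InducedCopy copy
      v = f zero
      Z′ = ⁅ v ⁆ ∪ Z
      size′ : ∣ Z′ ∣ ≤ ∣ X ∣ + suc i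
      size′ = ≤-trans (∣∪∣≤ ⁅ v ⁆ Z) (≤-trans (+-mono-≤ (≤-reflexive (∣⁅x⁆∣≡1 v)) size) (≤-reflexive (sym (+-suc ∣ X ∣ i))))
      step : ∃[ a ] (a ∈ core Z′) → Front X (suc i)
      step (a , a∈) with touches
      ... | y , y∈ , near with first-outside a∈ (path-mono Ω⊆ (Ω-connected (core-anti {Z} {Z′} (λ z∈ → x∈p∪q⁺ (inj₂ z∈)) a∈) y∈)) near
      ... | w , b , w∈ , vw , b∈ , bw = record
        { copy = extend-copy copy w (λ { zero refl → adj-≢ vw refl ; (suc j) refl → clean∉ w∈ (older j) })
                   (adj-sym vw) (λ j → clean-¬adj w∈ (older j))
        ; Z = Z′ ; X⊆Z = λ x∈ → x∈p∪q⁺ (inj₂ (X⊆Z x∈)) ; size = size′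
        ; older = λ { zero → x∈p∪q⁺ (inj₁ (x∈⁅x⁆ v)) ; (suc j) → x∈p∪q⁺ (inj₂ (older j)) }
        ; fresh = λ { zero → clean-anti X⊆Z w∈ ; (suc j) → fresh j }
        ; root = suc (proj₁ root) , proj₂ root
        ; touches = b , b∈ , inj₂ (adj-sym bw) }

    module _ (𝓗 : Family) {i} (has-path : Contains 𝓗 (path (suc i))) where

      record Rounds (r : ℕ) : Set₁ where
        field
          X      : VertexSet
          size   : ∣ X ∣ ≤ r * suc i
          Ss     : List VertexSet
          count  : length Ss ≡ r
          inside : All (_⊆ X) Ss
          anti   : AllPairs (Anticomplete G) Ss
          member : ∀ j → Member 𝓗 B (lookupˡ Ss j)

      rounds : ∀ r → r * suc i ≤ s → Rounds r
      rounds zero _ = record { X = ∅ ; size = ≤-reflexive (∣⊥∣≡0 n) ; Ss = [] ; count = refl ; inside = [] ; anti = [] ; member = λ () }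
      rounds (suc r) ≤s with rounds r (≤-trans (m≤n+m (r * suc i) (suc i)) ≤s)
      ... | R = add (grow (Rounds.X R) i (≤-trans (+-monoˡ-≤ i (Rounds.size R)) (≤-trans (≤-trans (≤-reflexive (+-comm (r * suc i) i)) (n≤1+n _)) ≤s)))
        where
        open Rounds R using (size; Ss; count; inside; anti; member)
        X₀ = Rounds.X R
        add : Front X₀ i → Rounds (suc r)
        add fr = record
          { X = ⁅ f zero ⁆ ∪ Z
          ; size = ≤-trans (∣∪∣≤ ⁅ f zero ⁆ Z) (+-mono-≤ (≤-reflexive (∣⁅x⁆∣≡1 (f zero)))
              (≤-trans (Front.size fr) (≤-trans (+-monoˡ-≤ i size) (≤-reflexive (+-comm (r * suc i) i)))))
          ; Ss = carrier ∷ Ss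
          ; count = cong suc count
          ; inside = (λ v∈ → carrier⊆ (carrier⁻ v∈)) ∷ All.map (λ S⊆ {v} v∈ → x∈p∪q⁺ (inj₂ (X⊆Z (S⊆ v∈)))) inside
          ; anti = All.map (λ {S} S⊆ {u} {v} u∈ v∈ → apart (carrier⁻ u∈) (S⊆ v∈)) inside ∷ anti
          ; member = λ { zero → (proj₁ has-path , proj₁ (proj₂ has-path) , copy-≅ (proj₂ (proj₂ has-path)))
                              , f (proj₁ root) , f∈carrier _ , proj₂ root
                       ; (suc j) → member j }
          }
          where
          open Front fr using (copy; Z; X⊆Z; older; fresh; root)
          open InducedCopy copy
          carrier⊆ : ∀ {v} → ∃[ u ] (f u ≡ v) → v ∈ ⁅ f zero ⁆ ∪ Z
          carrier⊆ (zero , refl)  = x∈p∪q⁺ (inj₁ (x∈⁅x⁆ _))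
          carrier⊆ (suc u , refl) = x∈p∪q⁺ (inj₂ (older u))
          apart : ∀ {u v} → ∃[ w ] (f w ≡ u) → v ∈ X₀ → u ≢ v × ¬ Adj u v
          apart (w , refl) v∈ = (λ { refl → clean∉ (fresh w) v∈ }) , clean-¬adj (fresh w) v∈

-- Forests as edge lists: connectivity, degrees, deletion.

module Forest (n : ℕ) where

  V : Set
  V = Fin n

  open DecMembership (_≟ᶠ_ {n = n}) using () renaming (_∈?_ to _∈ˡ?_) public

  Edges : Set
  Edges = List (V × V)

  TE : Edges → Rel V 0ℓ
  TE E x y = (x , y) ∈ˡ E ⊎ (y , x) ∈ˡ E

  Conn : Edges → Rel V 0ℓ
  Conn E = Star (TE E)

  te-sym : ∀ {E x y} → TE E x y → TE E y x
  te-sym (inj₁ e) = inj₂ e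
  te-sym (inj₂ e) = inj₁ e

  conn-sym : ∀ {E x y} → Conn E x y → Conn E y x
  conn-sym = reverse te-sym

  te-there : ∀ {e E x y} → TE E x y → TE (e ∷ E) x y
  te-there (inj₁ e) = inj₁ (there e)
  te-there (inj₂ e) = inj₂ (there e)

  conn-mono : ∀ {E E′ x y} → (∀ {a b} → TE E a b → TE E′ a b) → Conn E x y → Conn E′ x y
  conn-mono f = gmap id f

  from : V → V → V → List V
  from x a b with x ≟ᶠ a
  ... | yes _ = b ∷ []
  ... | no _  = []

  nbrs : Edges → V → List V
  nbrs []            x = []
  nbrs ((a , b) ∷ E) x = from x a b ++ from x b a ++ nbrs E x

  deg : Edges → V → ℕ
  deg E x = length (nbrs E x)

  from-hit : ∀ x b → b ∈ˡ from x x b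
  from-hit x b with x ≟ᶠ x
  ... | yes _ = here refl
  ... | no ¬p = contradiction refl ¬p

  from⁻ : ∀ {y} x a b → y ∈ˡ from x a b → x ≡ a × y ≡ b
  from⁻ x a b y∈ with x ≟ᶠ a | y∈
  ... | yes eq | here refl = eq , refl

  from-miss : ∀ {x a} b → x ≢ a → from x a b ≡ []
  from-miss {x} {a} b x≢a with x ≟ᶠ a
  ... | yes eq = contradiction eq x≢a
  ... | no _   = refl

  from-self : ∀ x b → length (from x x b) ≡ 1
  from-self x b with x ≟ᶠ x
  ... | yes _ = refl
  ... | no ¬p = contradiction refl ¬p

  te⇒nbr : ∀ {E x y} → TE E x y → y ∈ˡ nbrs E x
  te⇒nbr {_ ∷ E} {x} {y} (inj₁ (here refl)) = ∈-++⁺ˡ (from-hit x y)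
  te⇒nbr {_ ∷ E} {x} {y} (inj₂ (here refl)) = ∈-++⁺ʳ (from x y x) (∈-++⁺ˡ (from-hit x y))
  te⇒nbr {(a , b) ∷ E} {x} (inj₁ (there e)) = ∈-++⁺ʳ (from x a b) (∈-++⁺ʳ (from x b a) (te⇒nbr (inj₁ e)))
  te⇒nbr {(a , b) ∷ E} {x} (inj₂ (there e)) = ∈-++⁺ʳ (from x a b) (∈-++⁺ʳ (from x b a) (te⇒nbr (inj₂ e)))

  nbr⇒te : ∀ {E x y} → y ∈ˡ nbrs E x → TE E x y
  nbr⇒te {(a , b) ∷ E} {x} y∈ with ∈-++⁻ (from x a b) y∈
  ... | inj₁ y∈₁ with from⁻ x a b y∈₁
  ...   | refl , refl = inj₁ (here refl)
  nbr⇒te {(a , b) ∷ E} {x} y∈ | inj₂ y∈′ with ∈-++⁻ (from x b a) y∈′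
  ...   | inj₂ y∈E = te-there (nbr⇒te y∈E)
  ...   | inj₁ y∈₂ with from⁻ x b a y∈₂
  ...     | refl , refl = inj₂ (here refl)

  te? : ∀ E → Decidable (TE E)
  te? E x y = map′ nbr⇒te te⇒nbr (y ∈ˡ? nbrs E x)

  conn? : ∀ E → Decidable (Conn E)
  conn? E = star? (te? E)

  deg-miss : ∀ {a b x} E → x ≢ a → x ≢ b → deg ((a , b) ∷ E) x ≡ deg E x
  deg-miss {a} {b} E x≢a x≢b rewrite from-miss b x≢a | from-miss a x≢b = refl

  deg-left : ∀ {a b} E → a ≢ b → deg ((a , b) ∷ E) a ≡ suc (deg E a)
  deg-left {a} {b} E a≢b rewrite from-miss a a≢b = trans (length-++ (from a a b)) (cong (_+ deg E a) (from-self a b))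

  deg-right : ∀ {a b} E → a ≢ b → deg ((a , b) ∷ E) b ≡ suc (deg E b)
  deg-right {a} {b} E a≢b rewrite from-miss b (λ eq → a≢b (sym eq)) = trans (length-++ (from b b a)) (cong (_+ deg E b) (from-self b a))

  two-at-most : ∀ {A : Set} {xs : List A} {a b c} → length xs ≤ 2 → a ∈ˡ xs → b ∈ˡ xs → c ∈ˡ xs → a ≢ b → a ≢ c → b ≡ c
  two-at-most _ (here refl) (here refl) _ a≢b _ = contradiction refl a≢b
  two-at-most _ (here refl) _ (here refl) _ a≢c = contradiction refl a≢c
  two-at-most _ (here refl) (there (here refl)) (there (here refl)) _ _ = refl
  two-at-most _ (there (here refl)) (here refl) (here refl) _ _ = refl
  two-at-most _ (there (here refl)) (there (here refl)) _ a≢b _ = contradiction refl a≢b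
  two-at-most _ (there (here refl)) _ (there (here refl)) _ a≢c = contradiction refl a≢c
  two-at-most {xs = _ ∷ _ ∷ _ ∷ _} (s≤s (s≤s ()))
  two-at-most {xs = _ ∷ _ ∷ []} _ (there (there ()))

  -- Edges are listed so that each joins two components of the later ones.
  Acyclic : Edges → Set
  Acyclic []            = Unit
  Acyclic ((a , b) ∷ E) = ¬ Conn E a b × Acyclic E

  -- A walk can be shortened until it uses the new edge at most once, in one of two directions.
  conn-cons : ∀ {a b E x y} → Conn ((a , b) ∷ E) x y →
              Conn E x y ⊎ (Conn E x a × Conn E b y) ⊎ (Conn E x b × Conn E a y)
  conn-cons ε = inj₁ ε
  conn-cons {a} {b} {E} (e ◅ p) with conn-cons p
  conn-cons (inj₁ (here refl) ◅ p) | inj₁ q              = inj₂ (inj₁ (ε , q))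
  conn-cons (inj₁ (here refl) ◅ p) | inj₂ (inj₁ (_ , q)) = inj₂ (inj₁ (ε , q))
  conn-cons (inj₁ (here refl) ◅ p) | inj₂ (inj₂ (_ , q)) = inj₁ q
  conn-cons (inj₂ (here refl) ◅ p) | inj₁ q              = inj₂ (inj₂ (ε , q))
  conn-cons (inj₂ (here refl) ◅ p) | inj₂ (inj₁ (_ , q)) = inj₁ q
  conn-cons (inj₂ (here refl) ◅ p) | inj₂ (inj₂ (_ , q)) = inj₂ (inj₂ (ε , q))
  conn-cons (inj₁ (there e) ◅ p) | inj₁ q              = inj₁ (inj₁ e ◅ q)
  conn-cons (inj₁ (there e) ◅ p) | inj₂ (inj₁ (r , q)) = inj₂ (inj₁ (inj₁ e ◅ r , q))
  conn-cons (inj₁ (there e) ◅ p) | inj₂ (inj₂ (r , q)) = inj₂ (inj₂ (inj₁ e ◅ r , q))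
  conn-cons (inj₂ (there e) ◅ p) | inj₁ q              = inj₁ (inj₂ e ◅ q)
  conn-cons (inj₂ (there e) ◅ p) | inj₂ (inj₁ (r , q)) = inj₂ (inj₁ (inj₂ e ◅ r , q))
  conn-cons (inj₂ (there e) ◅ p) | inj₂ (inj₂ (r , q)) = inj₂ (inj₂ (inj₂ e ◅ r , q))

  Isolated : Edges → V → Set
  Isolated E v = ∀ {y} → ¬ TE E v y

  isolated : ∀ {E v y} → Isolated E v → Conn E v y → v ≡ y
  isolated iso ε       = refl
  isolated iso (e ◅ _) = contradiction e iso

  acyclic-pendant : ∀ {E v a} → Acyclic E → Isolated E v → v ≢ a → Acyclic ((v , a) ∷ E)
  acyclic-pendant ac iso v≢a = (λ p → v≢a (isolated iso p)) , ac

  acyclic-bridge : ∀ {E v a b} → Acyclic E → Isolated E v → v ≢ a → v ≢ b → ¬ Conn E a b → Acyclic ((v , a) ∷ (v , b) ∷ E)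
  acyclic-bridge {E} {v} {a} {b} ac iso v≢a v≢b a≁b = new , acyclic-pendant ac iso v≢b
    where
    new : ¬ Conn ((v , b) ∷ E) v a
    new p with conn-cons p
    ... | inj₁ q              = v≢a (isolated iso q)
    ... | inj₂ (inj₁ (_ , q)) = a≁b (conn-sym q)
    ... | inj₂ (inj₂ (q , _)) = v≢b (isolated iso q)

  conn-pendant : ∀ {E v a x} → Isolated E v → x ≢ v → Conn ((v , a) ∷ E) v x → Conn E a x
  conn-pendant iso x≢v p with conn-cons p
  ... | inj₁ q              = contradiction (sym (isolated iso q)) x≢v
  ... | inj₂ (inj₁ (_ , q)) = q
  ... | inj₂ (inj₂ (_ , q)) = contradiction (sym (isolated iso q)) x≢v

  conn-old : ∀ {E v a x y} → Isolated E v → x ≢ v → y ≢ v → Conn ((v , a) ∷ E) x y → Conn E x y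
  conn-old iso x≢v y≢v p with conn-cons p
  ... | inj₁ q              = q
  ... | inj₂ (inj₁ (q , _)) = contradiction (sym (isolated iso (conn-sym q))) x≢v
  ... | inj₂ (inj₂ (_ , q)) = contradiction (sym (isolated iso q)) y≢v

  conn-insert : ∀ pre {e post x y} → Conn (pre ++ post) x y → Conn (pre ++ e ∷ post) x y
  conn-insert pre {e} {post} = conn-mono λ { (inj₁ xy) → inj₁ (into xy) ; (inj₂ yx) → inj₂ (into yx) }
    where
    into : ∀ {d} → d ∈ˡ pre ++ post → d ∈ˡ pre ++ e ∷ post
    into d∈ with ∈-++⁻ pre d∈
    ... | inj₁ l = ∈-++⁺ˡ l
    ... | inj₂ r = ∈-++⁺ʳ pre (there r)

  -- `Acyclic` tests an edge against the later ones only; this lemma frees it from the order of the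
  -- list. If a walk around the edge between `a` and `b` used an edge listed before it, that edge
  -- would itself be bypassed through `a` and `b`.
  acyclic-cut : ∀ pre {a b post} → Acyclic (pre ++ (a , b) ∷ post) → ¬ Conn (pre ++ post) a b
  acyclic-cut []              (new , _)  p = new p
  acyclic-cut ((c , d) ∷ pre) (new , ac) p with conn-cons p
  ... | inj₁ q              = acyclic-cut pre ac q
  ... | inj₂ (inj₁ (q , r)) =
    new (conn-sym (conn-insert pre q) ◅◅ inj₁ (∈-++⁺ʳ pre (here refl)) ◅ conn-sym (conn-insert pre r))
  ... | inj₂ (inj₂ (q , r)) =
    new (conn-insert pre r ◅◅ inj₂ (∈-++⁺ʳ pre (here refl)) ◅ conn-insert pre q)

  avoids? : ∀ s → U.Decidable (λ (e : V × V) → proj₁ e ≢ s × proj₂ e ≢ s)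
  avoids? s (a , b) = ¬? (a ≟ᶠ s) ×-dec ¬? (b ≟ᶠ s)

  remove : V → Edges → Edges
  remove s = filter (avoids? s)

  te-remove⁺ : ∀ {s E x y} → TE E x y → x ≢ s → y ≢ s → TE (remove s E) x y
  te-remove⁺ {s} (inj₁ e) x≢ y≢ = inj₁ (∈-filter⁺ (avoids? s) e (x≢ , y≢))
  te-remove⁺ {s} (inj₂ e) x≢ y≢ = inj₂ (∈-filter⁺ (avoids? s) e (y≢ , x≢))

  te-remove⁻ : ∀ {s E x y} → TE (remove s E) x y → TE E x y × x ≢ s × y ≢ s
  te-remove⁻ {s} (inj₁ e) with ∈-filter⁻ (avoids? s) e
  ... | e∈ , x≢ , y≢ = inj₁ e∈ , x≢ , y≢
  te-remove⁻ {s} (inj₂ e) with ∈-filter⁻ (avoids? s) e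
  ... | e∈ , y≢ , x≢ = inj₂ e∈ , x≢ , y≢

  acyclic-filter : ∀ {P : Pred (V × V) 0ℓ} (P? : U.Decidable P) E → Acyclic E → Acyclic (filter P? E)
  acyclic-filter P? []      _          = tt
  acyclic-filter P? (e ∷ E) (new , ac) with P? e
  ... | no _  = acyclic-filter P? E ac
  ... | yes _ = (λ p → new (conn-mono (Data.Sum.Base.map kept kept) p)) , acyclic-filter P? E ac
    where
    kept : ∀ {d} → d ∈ˡ filter P? E → d ∈ˡ E
    kept d∈ = proj₁ (∈-filter⁻ P? d∈)

  acyclic-remove : ∀ s E → Acyclic E → Acyclic (remove s E)
  acyclic-remove s = acyclic-filter (avoids? s)

  deg-cons : ∀ a b E x → deg ((a , b) ∷ E) x ≡ length (from x a b) + (length (from x b a) + deg E x)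
  deg-cons a b E x = trans (length-++ (from x a b)) (cong (length (from x a b) +_) (length-++ (from x b a)))

  deg-grows : ∀ a b E x → deg E x ≤ deg ((a , b) ∷ E) x
  deg-grows a b E x = ≤-trans (≤-trans (m≤n+m (deg E x) (length (from x b a))) (m≤n+m _ (length (from x a b))))
    (≤-reflexive (sym (deg-cons a b E x)))

  deg-remove : ∀ s E x → deg (remove s E) x ≤ deg E x
  deg-remove s []            x = z≤n
  deg-remove s ((a , b) ∷ E) x with a ≟ᶠ s | b ≟ᶠ s
  ... | yes _ | _     = ≤-trans (deg-remove s E x) (deg-grows a b E x)
  ... | no _  | yes _ = ≤-trans (deg-remove s E x) (deg-grows a b E x)
  ... | no _  | no _  = subst₂ _≤_ (sym (deg-cons a b (remove s E) x)) (sym (deg-cons a b E x))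
    (+-monoʳ-≤ (length (from x a b)) (+-monoʳ-≤ (length (from x b a)) (deg-remove s E x)))

  count-remove : ∀ s E → length E ≤ length (remove s E) + deg E s
  count-remove s []            = z≤n
  count-remove s ((a , b) ∷ E) with a ≟ᶠ s | b ≟ᶠ s
  ... | no a≢ | no b≢ = s≤s (≤-trans (count-remove s E) (+-monoʳ-≤ (length (remove s E)) (deg-grows a b E s)))
  ... | yes refl | _ = ≤-trans (s≤s (count-remove s E)) (≤-trans (≤-reflexive (sym (+-suc (length (remove s E)) (deg E s))))
      (+-monoʳ-≤ (length (remove s E)) (≤-trans (+-mono-≤ (≤-reflexive (sym (from-self s b))) (m≤n+m (deg E s) (length (from s b s))))
        (≤-reflexive (sym (deg-cons s b E s))))))
  ... | no a≢ | yes refl = ≤-trans (s≤s (count-remove s E)) (≤-trans (≤-reflexive (sym (+-suc (length (remove s E)) (deg E s))))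
      (+-monoʳ-≤ (length (remove s E)) (≤-trans (≤-trans (+-monoˡ-≤ (deg E s) (≤-reflexive (sym (from-self s a)))) (m≤n+m _ (length (from s a s))))
        (≤-reflexive (sym (deg-cons a s E s))))))

  ∈-drop : ∀ {A : Set} pre {e : A} {post d} → d ∈ˡ pre ++ e ∷ post → d ≢ e → d ∈ˡ pre ++ post
  ∈-drop pre d∈ d≢e with ∈-++⁻ pre d∈
  ... | inj₁ l         = ∈-++⁺ˡ l
  ... | inj₂ (here eq) = contradiction eq d≢e
  ... | inj₂ (there r) = ∈-++⁺ʳ pre r

  te-drop : ∀ pre {a b post x y} → TE (pre ++ (a , b) ∷ post) x y → (x , y) ≢ (a , b) → (y , x) ≢ (a , b) → TE (pre ++ post) x y
  te-drop pre (inj₁ e) n _ = inj₁ (∈-drop pre e n)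
  te-drop pre (inj₂ e) _ n = inj₂ (∈-drop pre e n)

  -- A walk between `p` and `q` avoiding `s`, together with the edge from `s` to `q`, would bypass
  -- the edge from `s` to `p`.
  remove-separates : ∀ {s E p q} → Acyclic E → TE E s p → TE E s q → p ≢ q → ¬ Conn (remove s E) p q
  remove-separates {s} {E} {p} {q} ac sp sq p≢q pq = [ cut , cut′ ] sp
    where
    cut : (s , p) ∈ˡ E → ⊥
    cut e with ∈-∃++ e
    ... | pre , post , refl = acyclic-cut pre ac (te-drop pre sq (λ { refl → p≢q refl }) (λ { refl → p≢q refl }) ◅
      conn-sym (conn-mono (λ e → let e′ , x≢ , y≢ = te-remove⁻ {s} e in te-drop pre e′ (λ { refl → x≢ refl }) (λ { refl → y≢ refl })) pq))
    cut′ : (p , s) ∈ˡ E → ⊥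
    cut′ e with ∈-∃++ e
    ... | pre , post , refl = acyclic-cut pre ac (conn-sym (te-drop pre sq (λ { refl → p≢q refl }) (λ { refl → p≢q refl }) ◅
      conn-sym (conn-mono (λ e → let e′ , x≢ , y≢ = te-remove⁻ {s} e in te-drop pre e′ (λ { refl → y≢ refl }) (λ { refl → x≢ refl })) pq)))

-- Cutting a weighted forest into light parts.

module Elimination (n : ℕ) where

  open Forest n

  -- The last clause drives the induction: the leaf found beyond the first edge keeps its degree
  -- only if it is not the end of this edge. If that end had no other edge, it is a leaf itself.
  leaf : ∀ E → Acyclic E → ∀ x → ∃[ v ] (Conn E x v × deg E v ≤ 1 × (1 ≤ deg E x → v ≢ x))
  leaf [] _ x = x , ε , z≤n , λ ()
  leaf ((a , b) ∷ E) (a≁b , ac) x = split (conn? E x a) (conn? E x b)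
    where
    a≢b : a ≢ b
    a≢b refl = a≁b ε
    Leaf : Set
    Leaf = ∃[ v ] (Conn ((a , b) ∷ E) x v × deg ((a , b) ∷ E) v ≤ 1 × (1 ≤ deg ((a , b) ∷ E) x → v ≢ x))

    up : ∀ {y z} → Conn E y z → Conn ((a , b) ∷ E) y z
    up = conn-mono te-there

    across : ∀ {d e} → Conn E x d → TE ((a , b) ∷ E) d e → ¬ Conn E d e → (d ≡ a × e ≡ b) ⊎ (d ≡ b × e ≡ a) → Leaf
    across {d} {e} xd de d≁e ends = go (1 ≤? deg E e) (leaf E ac e)
      where
      far : ∀ {v} → Conn E e v → v ≢ x
      far ev refl = d≁e (conn-sym xd ◅◅ conn-sym ev)
      route : ∀ {v} → Conn E e v → Conn ((a , b) ∷ E) x v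
      route ev = up xd ◅◅ de ◅ up ev
      deg-end : ∀ {d e} → (d ≡ a × e ≡ b) ⊎ (d ≡ b × e ≡ a) → deg ((a , b) ∷ E) e ≡ suc (deg E e)
      deg-end (inj₁ (refl , refl)) = deg-right E a≢b
      deg-end (inj₂ (refl , refl)) = deg-left E a≢b
      deg-else : ∀ {v} → (d ≡ a × e ≡ b) ⊎ (d ≡ b × e ≡ a) → v ≢ d → v ≢ e → deg ((a , b) ∷ E) v ≡ deg E v
      deg-else (inj₁ (refl , refl)) v≢d v≢e = deg-miss E v≢d v≢e
      deg-else (inj₂ (refl , refl)) v≢d v≢e = deg-miss E v≢e v≢d
      go : Dec (1 ≤ deg E e) → ∃[ v ] (Conn E e v × deg E v ≤ 1 × (1 ≤ deg E e → v ≢ e)) → Leaf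
      go (no deg0) _ = e , route ε , ≤-trans (≤-reflexive (deg-end ends)) (≰⇒> deg0) , λ _ → far ε
      go (yes 1≤) (v , ev , thin , other) = v , route ev ,
        ≤-trans (≤-reflexive (deg-else ends (λ { refl → d≁e (conn-sym ev) }) (other 1≤))) thin , λ _ → far ev

    split : Dec (Conn E x a) → Dec (Conn E x b) → Leaf
    split (yes xa) _ = across xa (inj₁ (here refl)) a≁b (inj₁ (refl , refl))
    split (no _) (yes xb) = across xb (inj₂ (here refl)) (λ p → a≁b (conn-sym p)) (inj₂ (refl , refl))
    split (no x≁a) (no x≁b) = old (leaf E ac x)
      where
      same : ∀ {v} → Conn E x v → deg ((a , b) ∷ E) v ≡ deg E v
      same xv = deg-miss E (λ { refl → x≁a xv }) (λ { refl → x≁b xv })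
      old : ∃[ v ] (Conn E x v × deg E v ≤ 1 × (1 ≤ deg E x → v ≢ x)) → Leaf
      old (v , xv , thin , other) = v , up xv , ≤-trans (≤-reflexive (same xv)) thin , λ 1≤ → other (subst (1 ≤_) (same ε) 1≤)

  deg-remove< : ∀ {s x} E → TE E s x → x ≢ s → deg (remove s E) x < deg E x
  deg-remove< [] (inj₁ ()) _
  deg-remove< [] (inj₂ ()) _
  deg-remove< {s} {x} ((a , b) ∷ E) e x≢s = split e (a ≟ᶠ s) (b ≟ᶠ s)
    where
    le : deg E x ≤ deg ((a , b) ∷ E) x
    le = deg-grows a b E x
    drop : a ≡ s ⊎ b ≡ s → remove s ((a , b) ∷ E) ≡ remove s E
    drop c with a ≟ᶠ s | b ≟ᶠ s
    ... | yes _ | _ = refl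
    ... | no _ | yes _ = refl
    ... | no a≢ | no b≢ = contradiction c [ a≢ , b≢ ]
    keep : a ≢ s → b ≢ s → remove s ((a , b) ∷ E) ≡ (a , b) ∷ remove s E
    keep a≢s b≢s with a ≟ᶠ s | b ≟ᶠ s
    ... | yes eq | _ = contradiction eq a≢s
    ... | no _ | yes eq = contradiction eq b≢s
    ... | no _ | no _ = refl
    hit : a ≡ s ⊎ b ≡ s → deg E x < deg ((a , b) ∷ E) x → deg (remove s ((a , b) ∷ E)) x < deg ((a , b) ∷ E) x
    hit c lt = subst (λ F → deg F x < deg ((a , b) ∷ E) x) (sym (drop c)) (≤-trans (s≤s (deg-remove s E x)) lt)
    rest : TE E s x → Dec (a ≡ s) → Dec (b ≡ s) → deg (remove s ((a , b) ∷ E)) x < deg ((a , b) ∷ E) x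
    rest e′ (yes eq) _ = subst (λ F → deg F x < deg ((a , b) ∷ E) x) (sym (drop (inj₁ eq))) (≤-trans (deg-remove< E e′ x≢s) le)
    rest e′ (no _) (yes eq) = subst (λ F → deg F x < deg ((a , b) ∷ E) x) (sym (drop (inj₂ eq))) (≤-trans (deg-remove< E e′ x≢s) le)
    rest e′ (no a≢) (no b≢) = subst (λ F → deg F x < deg ((a , b) ∷ E) x) (sym (keep a≢ b≢)) (subst₂ _<_ (sym (deg-cons a b (remove s E) x)) (sym (deg-cons a b E x))
        (+-monoʳ-< (length (from x a b)) (+-monoʳ-< (length (from x b a)) (deg-remove< E e′ x≢s))))
    split : TE ((a , b) ∷ E) s x → Dec (a ≡ s) → Dec (b ≡ s) → deg (remove s ((a , b) ∷ E)) x < deg ((a , b) ∷ E) x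
    split (inj₁ (here refl)) _ _ = hit (inj₁ refl) (≤-reflexive (sym (deg-right E (λ eq → x≢s (sym eq)))))
    split (inj₂ (here refl)) _ _ = hit (inj₂ refl) (≤-reflexive (sym (deg-left E x≢s)))
    split (inj₁ (there e′)) da db = rest (inj₁ e′) da db
    split (inj₂ (there e′)) da db = rest (inj₂ e′) da db

  without : V → List V → List V
  without v = filter (λ x → ¬? (x ≟ᶠ v))

  ∈-without⁺ : ∀ {v xs x} → x ∈ˡ xs → x ≢ v → x ∈ˡ without v xs
  ∈-without⁺ {v} = ∈-filter⁺ (λ x → ¬? (x ≟ᶠ v))

  ∈-without⁻ : ∀ {v xs x} → x ∈ˡ without v xs → x ∈ˡ xs × x ≢ v
  ∈-without⁻ {v} = ∈-filter⁻ (λ x → ¬? (x ≟ᶠ v))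

  without-absent : ∀ {v xs} → All (v ≢_) xs → without v xs ≡ xs
  without-absent {xs = []} [] = refl
  without-absent {v} {x ∷ xs} (v≢ ∷ vs) with x ≟ᶠ v
  ... | yes eq = contradiction (sym eq) v≢
  ... | no _   = cong (x ∷_) (without-absent vs)

  bump : V → ℕ → (V → ℕ) → V → ℕ
  bump p k w x with x ≟ᶠ p
  ... | yes _ = k + w x
  ... | no _  = w x

  bump-at : ∀ p k w → bump p k w p ≡ k + w p
  bump-at p k w with p ≟ᶠ p
  ... | yes _  = refl
  ... | no p≢p = contradiction refl p≢p

  bump-else : ∀ {p x} k w → x ≢ p → bump p k w x ≡ w x
  bump-else {p} {x} k w x≢ with x ≟ᶠ p
  ... | yes eq = contradiction eq x≢
  ... | no _   = refl

  module _ {Sel : Pred V 0ℓ} (sel? : U.Decidable Sel) where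

    gate : V → ℕ → ℕ
    gate x k with sel? x
    ... | yes _ = k
    ... | no _  = 0

    gate-yes : ∀ {x} k → Sel x → gate x k ≡ k
    gate-yes {x} k s with sel? x
    ... | yes _ = refl
    ... | no ¬s = contradiction s ¬s

    gate-no : ∀ {x} k → ¬ Sel x → gate x k ≡ 0
    gate-no {x} k ¬s with sel? x
    ... | yes s = contradiction s ¬s
    ... | no _  = refl

    load : (V → ℕ) → List V → ℕ
    load w []       = 0
    load w (x ∷ xs) = gate x (w x) + load w xs

    load-cong : ∀ {w w′} xs → (∀ {x} → x ∈ˡ xs → Sel x → w x ≡ w′ x) → load w xs ≡ load w′ xs
    load-cong [] _ = refl
    load-cong {w} {w′} (x ∷ xs) eq = cong₂ _+_ (head (sel? x)) (load-cong xs (λ x∈ → eq (there x∈)))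
      where
      head : Dec (Sel x) → gate x (w x) ≡ gate x (w′ x)
      head (yes s) = cong (gate x) (eq (here refl) s)
      head (no ¬s) = trans (gate-no (w x) ¬s) (sym (gate-no (w′ x) ¬s))

    load-bump-out : ∀ {p} k w xs → ¬ Sel p → load (bump p k w) xs ≡ load w xs
    load-bump-out k w xs ¬p = load-cong xs λ _ s → bump-else k w (λ { refl → ¬p s })

    load-bump-absent : ∀ {p} k w {xs} → All (p ≢_) xs → load (bump p k w) xs ≡ load w xs
    load-bump-absent k w {xs} absent = load-cong xs λ x∈ _ → bump-else k w (λ eq → All.lookup absent x∈ (sym eq))

    load-bump : ∀ {p} k w {xs} → Unique xs → p ∈ˡ xs → Sel p → load (bump p k w) xs ≡ k + load w xs
    load-bump {p} k w {p ∷ xs} (absent ∷ _) (here refl) s = begin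
      gate p (bump p k w p) + load (bump p k w) xs  ≡⟨ cong₂ _+_ (trans (gate-yes _ s) (bump-at p k w)) (load-bump-absent k w absent) ⟩
      k + w p + load w xs                           ≡⟨ +-assoc k (w p) (load w xs) ⟩
      k + (w p + load w xs)                         ≡⟨ cong (λ g → k + (g + load w xs)) (gate-yes (w p) s) ⟨
      k + (gate p (w p) + load w xs)                ∎
      where open ≡-Reasoning
    load-bump {p} k w {x ∷ xs} (x∉ ∷ uniq) (there p∈) s = begin
      gate x (bump p k w x) + load (bump p k w) xs  ≡⟨ cong₂ _+_ (cong (gate x) (bump-else k w (All.lookup x∉ p∈))) (load-bump k w uniq p∈ s) ⟩
      gate x (w x) + (k + load w xs)                ≡⟨ +-assoc (gate x (w x)) k (load w xs) ⟨
      gate x (w x) + k + load w xs                  ≡⟨ cong (_+ load w xs) (+-comm (gate x (w x)) k) ⟩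
      k + gate x (w x) + load w xs                  ≡⟨ +-assoc k (gate x (w x)) (load w xs) ⟩
      k + (gate x (w x) + load w xs)                ∎
      where open ≡-Reasoning

    load-without : ∀ {v} w {xs} → Unique xs → v ∈ˡ xs → load w xs ≡ gate v (w v) + load w (without v xs)
    load-without {v} w {v ∷ xs} (absent ∷ _) (here refl) with v ≟ᶠ v
    ... | no v≢v = contradiction refl v≢v
    ... | yes _  = cong (λ ys → gate v (w v) + load w ys) (sym (without-absent absent))
    load-without {v} w {x ∷ xs} (x∉ ∷ uniq) (there v∈) with x ≟ᶠ v
    ... | yes eq = contradiction eq (All.lookup x∉ v∈)
    ... | no _   = begin
      gate x (w x) + load w xs                                ≡⟨ cong (gate x (w x) +_) (load-without w uniq v∈) ⟩
      gate x (w x) + (gate v (w v) + load w (without v xs))   ≡⟨ +-assoc (gate x (w x)) (gate v (w v)) _ ⟨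
      gate x (w x) + gate v (w v) + load w (without v xs)     ≡⟨ cong (_+ load w (without v xs)) (+-comm (gate x (w x)) (gate v (w v))) ⟩
      gate v (w v) + gate x (w x) + load w (without v xs)     ≡⟨ +-assoc (gate v (w v)) (gate x (w x)) _ ⟩
      gate v (w v) + (gate x (w x) + load w (without v xs))   ∎
      where open ≡-Reasoning

  total : (V → ℕ) → List V → ℕ
  total = load {Sel = λ _ → Unit} (λ _ → yes tt)

  without-length : ∀ {v xs} → v ∈ˡ xs → length (without v xs) < length xs
  without-length {v} {xs} v∈ = Data.List.Properties.filter-notAll (λ x → ¬? (x ≟ᶠ v)) xs (Any.map (λ { refl ≢v → ≢v refl }) v∈)

  Kept : Edges → List V → Rel V 0ℓ
  Kept E P a b = TE E a b × a ∉ˡ P × b ∉ˡ P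

  InPart : List V → (V → V) → V → Pred V 0ℓ
  InPart P rep r x = x ∉ˡ P × rep x ≡ r

  in-part? : ∀ P rep r → U.Decidable (InPart P rep r)
  in-part? P rep r x = ¬? (x ∈ˡ? P) ×-dec (rep x ≟ᶠ r)

  -- Deleting `P` leaves parts with representatives in `Rs`, while each cut accounts for weight `θ`.
  -- The field `few` counts the parts: the forest has `length N` minus `length E` components, and a
  -- cut vertex of degree `d` adds at most `d` parts.
  record Parts (N : List V) (E : Edges) (w : V → ℕ) (θ : ℕ) : Set where
    field
      P       : List V
      rep     : V → V
      Rs      : List V
      P⊆N     : ∀ {p} → p ∈ˡ P → p ∈ˡ N
      rep∈    : ∀ {x} → x ∈ˡ N → x ∉ˡ P → rep x ∈ˡ N
      to-rep  : ∀ {x} → x ∈ˡ N → x ∉ˡ P → Star (Kept E P) x (rep x)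
      same    : ∀ {x y} → TE E x y → x ∉ˡ P → y ∉ˡ P → rep x ≡ rep y
      light   : ∀ r → load (in-part? P rep r) w N < θ
      charged : θ * length P ≤ total w N
      listed  : ∀ {x} → x ∈ˡ N → x ∉ˡ P → rep x ∈ˡ Rs
      few     : length Rs + length E ≤ length N + sum (map (deg E) P)

  sum-degrees-remove : ∀ s E P → sum (map (deg (remove s E)) P) ≤ sum (map (deg E) P)
  sum-degrees-remove s E []      = z≤n
  sum-degrees-remove s E (p ∷ P) = +-mono-≤ (deg-remove s E p) (sum-degrees-remove s E P)

  sum-degrees-remove< : ∀ {s p} E P → p ∈ˡ P → TE E s p → p ≢ s → suc (sum (map (deg (remove s E)) P)) ≤ sum (map (deg E) P)
  sum-degrees-remove< {s} E (p ∷ P) (here refl) e p≢ = +-mono-≤ (deg-remove< E e p≢) (sum-degrees-remove s E P)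
  sum-degrees-remove< {s} E (x ∷ P) (there p∈) e p≢ = ≤-trans (≤-reflexive (sym (+-suc (deg (remove s E) x) _)))
    (+-mono-≤ (deg-remove s E x) (sum-degrees-remove< E P p∈ e p≢))

  -- Leaves are removed one by one.  A leaf of weight at least θ is cut; any other passes its weight on
  -- to its neighbour and later joins the part of this neighbour, or is a part itself if that is cut.
  module Eliminate {N : List V} {E : Edges} {w : V → ℕ} {θ : ℕ} {v : V} (uniq : Unique N) (ends : ∀ {x y} → TE E x y → x ∈ˡ N) (v∈ : v ∈ˡ N) (thin : deg E v ≤ 1) where

    N′ : List V
    N′ = without v N

    E′ : Edges
    E′ = remove v E

    count : suc (length N′) ≤ length N
    count = without-length v∈

    edges : length E ≤ length E′ + deg E v
    edges = count-remove v E

    te-split : ∀ {x y} → TE E x y → x ≢ v → y ≢ v → TE E′ x y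
    te-split = te-remove⁺

    lift : ∀ {P P⁺ x y} → (∀ {z} → z ≢ v → z ∉ˡ P → z ∉ˡ P⁺) → Star (Kept E′ P) x y → Star (Kept E P⁺) x y
    lift keep = gmap id λ (e , x∉ , y∉) → let e′ , x≢ , y≢ = te-remove⁻ e in e′ , keep x≢ x∉ , keep y≢ y∉

    cut : θ ≤ w v → Parts N′ E′ w θ → Parts N E w θ
    cut heavy parts = record
      { P = v ∷ P ; rep = rep ; Rs = Rs
      ; P⊆N = λ { (here refl) → v∈ ; (there p∈) → proj₁ (∈-without⁻ (P⊆N p∈)) }
      ; rep∈ = λ x∈ x∉ → proj₁ (∈-without⁻ (rep∈ (∈-without⁺ x∈ (≢v x∉)) (λ x∈P → x∉ (there x∈P))))
      ; to-rep = λ x∈ x∉ → lift (λ z≢ z∉ → λ { (here eq) → z≢ eq ; (there z∈) → z∉ z∈ }) (to-rep (∈-without⁺ x∈ (≢v x∉)) (λ x∈P → x∉ (there x∈P)))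
      ; same = λ e x∉ y∉ → same (te-split e (≢v x∉) (≢v y∉)) (λ x∈ → x∉ (there x∈)) (λ y∈ → y∉ (there y∈))
      ; light = λ r → ≤-trans (s≤s (≤-reflexive (trans (load-without (sel? r) w uniq v∈)
          (trans (cong (_+ load (sel? r) w N′) (gate-no (sel? r) {v} (w v) (λ s → proj₁ s (here refl)))) (swap-sel r N))))) (light r)
      ; charged = begin
          θ * suc (length P)  ≡⟨ *-suc θ (length P) ⟩
          θ + θ * length P    ≤⟨ +-mono-≤ heavy charged ⟩
          w v + total w N′    ≡⟨ load-without (λ _ → yes tt) w uniq v∈ ⟨
          total w N           ∎
      ; listed = λ x∈ x∉ → listed (∈-without⁺ x∈ (≢v x∉)) (λ x∈P → x∉ (there x∈P))
      -- The edge lost with `v` is covered by the degree that `v` contributes as a cut vertex.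
      ; few = begin
          length Rs + length E                                      ≤⟨ +-monoʳ-≤ (length Rs) edges ⟩
          length Rs + (length E′ + deg E v)                         ≡⟨ +-assoc (length Rs) (length E′) (deg E v) ⟨
          length Rs + length E′ + deg E v                           ≤⟨ +-monoˡ-≤ (deg E v) (≤-trans few (+-mono-≤ (≤-trans (n≤1+n _) count) (sum-degrees-remove v E P))) ⟩
          length N + sum (map (deg E) P) + deg E v                  ≡⟨ +-assoc (length N) (sum (map (deg E) P)) (deg E v) ⟩
          length N + (sum (map (deg E) P) + deg E v)                ≡⟨ cong (length N +_) (+-comm (sum (map (deg E) P)) (deg E v)) ⟩
          length N + (deg E v + sum (map (deg E) P))                ∎
      }
      where
      open Parts parts
      open ≤-Reasoning
      ≢v : ∀ {x} → x ∉ˡ v ∷ P → x ≢ v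
      ≢v x∉ refl = x∉ (here refl)
      sel? : ∀ r → U.Decidable (InPart (v ∷ P) rep r)
      sel? = in-part? (v ∷ P) rep
      swap-sel : ∀ r xs → load (sel? r) w (without v xs) ≡ load (in-part? P rep r) w (without v xs)
      swap-sel r xs = go (without v xs) (λ x∈ → proj₂ (∈-without⁻ {xs = xs} x∈))
        where
        go : ∀ ys → (∀ {x} → x ∈ˡ ys → x ≢ v) → load (sel? r) w ys ≡ load (in-part? P rep r) w ys
        go [] _ = refl
        go (y ∷ ys) ≢v′ = cong₂ _+_ (one (in-part? P rep r y)) (go ys (λ x∈ → ≢v′ (there x∈)))
          where
          one : Dec (InPart P rep r y) → gate (sel? r) y (w y) ≡ gate (in-part? P rep r) y (w y)
          one (yes (y∉ , eq)) = trans (gate-yes (sel? r) (w y) ((λ { (here y≡) → ≢v′ (here refl) y≡ ; (there y∈) → y∉ y∈ }) , eq))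
                                  (sym (gate-yes (in-part? P rep r) (w y) (y∉ , eq)))
          one (no ¬s) = trans (gate-no (sel? r) (w y) (λ (y∉ , eq) → ¬s ((λ y∈ → y∉ (there y∈)) , eq))) (sym (gate-no (in-part? P rep r) (w y) ¬s))

    module Place {w′} (parts : Parts N′ E′ w′ θ) (r₀ : V) where
      open Parts parts

      v∉P : v ∉ˡ P
      v∉P v∈P = proj₂ (∈-without⁻ {xs = N} (P⊆N v∈P)) refl

      rep⁺ : V → V
      rep⁺ x with x ≟ᶠ v
      ... | yes _ = r₀
      ... | no _  = rep x

      rep⁺-v : rep⁺ v ≡ r₀
      rep⁺-v with v ≟ᶠ v
      ... | yes _  = refl
      ... | no v≢v = contradiction refl v≢v

      rep⁺-else : ∀ {x} → x ≢ v → rep⁺ x ≡ rep x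
      rep⁺-else {x} x≢ with x ≟ᶠ v
      ... | yes eq = contradiction eq x≢
      ... | no _   = refl

      load-else : ∀ r → load (in-part? P rep⁺ r) w N′ ≡ load (in-part? P rep r) w N′
      load-else r = go N′ (λ x∈ → proj₂ (∈-without⁻ {xs = N} x∈))
        where
        go : ∀ ys → (∀ {x} → x ∈ˡ ys → x ≢ v) → load (in-part? P rep⁺ r) w ys ≡ load (in-part? P rep r) w ys
        go [] _ = refl
        go (y ∷ ys) ≢v = cong₂ _+_ (one (in-part? P rep r y)) (go ys (λ x∈ → ≢v (there x∈)))
          where
          one : Dec (InPart P rep r y) → gate (in-part? P rep⁺ r) y (w y) ≡ gate (in-part? P rep r) y (w y)
          one (yes (y∉ , eq)) = trans (gate-yes (in-part? P rep⁺ r) (w y) (y∉ , trans (rep⁺-else (≢v (here refl))) eq))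
                                  (sym (gate-yes (in-part? P rep r) (w y) (y∉ , eq)))
          one (no ¬s) = trans (gate-no (in-part? P rep⁺ r) (w y) (λ (y∉ , eq) → ¬s (y∉ , trans (sym (rep⁺-else (≢v (here refl)))) eq)))
                                  (sym (gate-no (in-part? P rep r) (w y) ¬s))

      load-v : ∀ r → load (in-part? P rep⁺ r) w N ≡ gate (in-part? P rep⁺ r) v (w v) + load (in-part? P rep r) w N′
      load-v r = trans (load-without (in-part? P rep⁺ r) w uniq v∈) (cong (gate (in-part? P rep⁺ r) v (w v) +_) (load-else r))

      finish : ∀ {Rs⁺} → r₀ ∈ˡ N → Star (Kept E P) v r₀ → (∀ {y} → TE E v y → y ≢ v → y ∉ˡ P → r₀ ≡ rep y) →
               (∀ r → load (in-part? P rep⁺ r) w N < θ) → θ * length P ≤ total w N →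
               r₀ ∈ˡ Rs⁺ → (∀ {x} → x ∈ˡ Rs → x ∈ˡ Rs⁺) → length Rs⁺ + length E ≤ length N + sum (map (deg E) P) → Parts N E w θ
      finish {Rs⁺} r₀∈ v⇝r₀ agree light⁺ charged⁺ r₀∈Rs Rs⊆ few⁺ = record
        { P = P ; rep = rep⁺ ; Rs = Rs⁺ ; P⊆N = λ p∈ → proj₁ (∈-without⁻ (P⊆N p∈))
        ; rep∈ = λ {x} x∈ x∉ → at x (λ y → y ∈ˡ N) (λ _ → r₀∈) (λ x≢ → proj₁ (∈-without⁻ (rep∈ (∈-without⁺ x∈ x≢) x∉)))
        ; to-rep = λ {x} x∈ x∉ → at x (Star (Kept E P) x) (λ { refl → v⇝r₀ }) (λ x≢ → lift (λ _ z∉ → z∉) (to-rep (∈-without⁺ x∈ x≢) x∉))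
        ; same = same⁺ ; light = light⁺ ; charged = charged⁺
        ; listed = λ {x} x∈ x∉ → at x (λ y → y ∈ˡ Rs⁺) (λ _ → r₀∈Rs) (λ x≢ → Rs⊆ (listed (∈-without⁺ x∈ x≢) x∉))
        ; few = few⁺ }
        where
        at : ∀ x (Q : V → Set) → (x ≡ v → Q r₀) → (x ≢ v → Q (rep x)) → Q (rep⁺ x)
        at x Q f g with x ≟ᶠ v
        ... | yes eq = f eq
        ... | no ¬eq = g ¬eq
        same⁺ : ∀ {x y} → TE E x y → x ∉ˡ P → y ∉ˡ P → rep⁺ x ≡ rep⁺ y
        same⁺ {x} {y} e x∉ y∉ = go (x ≟ᶠ v) (y ≟ᶠ v)
          where
          go : Dec (x ≡ v) → Dec (y ≡ v) → rep⁺ x ≡ rep⁺ y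
          go (yes refl) (yes refl) = refl
          go (yes refl) (no y≢)    = trans rep⁺-v (trans (agree e y≢ y∉) (sym (rep⁺-else y≢)))
          go (no x≢)    (yes refl) = trans (rep⁺-else x≢) (trans (sym (agree (te-sym e) x≢ x∉)) (sym rep⁺-v))
          go (no x≢)    (no y≢)    = trans (rep⁺-else x≢) (trans (same (te-split e x≢ y≢) x∉ y∉) (sym (rep⁺-else y≢)))

      alone : w v < θ → (∀ r → load (in-part? P rep r) w N′ ≤ load (in-part? P rep r) w′ N′) →
              r₀ ≡ v → (∀ {y} → TE E v y → y ∈ˡ P) → θ * length P ≤ total w N →
              suc (length Rs) + length E ≤ length N + sum (map (deg E) P) → Parts N E w θ
      alone small below refl cut-off charged⁺ few⁺ = finish {Rs⁺ = v ∷ Rs} v∈ ε (λ e _ y∉ → contradiction (cut-off e) y∉)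
          (λ r → subst (_< θ) (sym (load-v r)) (own r (v ≟ᶠ r))) charged⁺ (here refl) there few⁺
        where
        -- Representatives of the smaller forest lie in `N′`, so the label `v` is new and its part
        -- is `v` alone.
        empty : ∀ ys → (∀ {x} → x ∈ˡ ys → x ∈ˡ N′) → load (in-part? P rep v) w ys ≡ 0
        empty [] _ = refl
        empty (y ∷ ys) ⊆N′ = cong₂ _+_ (gate-no (in-part? P rep v) (w y) λ (y∉ , eq) →
          proj₂ (∈-without⁻ {xs = N} (subst (_∈ˡ N′) eq (rep∈ (⊆N′ (here refl)) y∉))) refl) (empty ys (λ x∈ → ⊆N′ (there x∈)))
        own : ∀ r → Dec (v ≡ r) → gate (in-part? P rep⁺ r) v (w v) + load (in-part? P rep r) w N′ < θ
        own r (yes refl) = ≤-trans (s≤s (≤-reflexive (trans (cong₂ _+_ (gate-yes (in-part? P rep⁺ v) (w v) (v∉P , rep⁺-v)) (empty N′ id)) (+-identityʳ (w v))))) small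
        own r (no v≢r) = ≤-trans (s≤s (≤-trans (≤-reflexive (cong (_+ load (in-part? P rep r) w N′) (gate-no (in-part? P rep⁺ r) (w v) (λ (_ , eq) → v≢r (trans (sym rep⁺-v) eq))))) (below r))) (light r)

    weigh-less : w v < θ → (∀ {y} → ¬ TE E v y) → Parts N′ E′ w θ → Parts N E w θ
    weigh-less small free parts = Place.alone parts v small (λ _ → ≤-refl) refl (λ e → contradiction e free)
        (≤-trans charged (≤-trans (m≤n+m _ (w v)) (≤-reflexive (sym (load-without (λ _ → yes tt) w uniq v∈)))))
        (≤-trans (s≤s (+-monoʳ-≤ (length Rs) same-edges)) (≤-trans (s≤s few) (+-mono-≤ count (sum-degrees-remove v E P))))
      where
      open Parts parts
      same-edges : length E ≤ length E′
      same-edges = ≤-trans edges (≤-reflexive (trans (cong (length E′ +_) (none (nbrs E v) (λ y∈ → free (nbr⇒te y∈)))) (+-identityʳ (length E′))))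
        where
        none : ∀ ys → (∀ {y : V} → y ∉ˡ ys) → length ys ≡ 0
        none [] _ = refl
        none (y ∷ ys) no-y = contradiction (here refl) no-y

    hang : w v < θ → (∀ {x} → ¬ TE E x x) → ∀ {p} → TE E v p → Parts N′ E′ (bump p (w v) w) θ → Parts N E w θ
    hang small loopfree {p} vp parts = split (p ∈ˡ? P)
      where
      open Parts parts
      p≢v : p ≢ v
      p≢v refl = loopfree vp
      p∈N′ : p ∈ˡ N′
      p∈N′ = ∈-without⁺ (ends (te-sym vp)) p≢v
      uniq′ : Unique N′
      uniq′ = Uniqueₚ.filter⁺ (λ x → ¬? (x ≟ᶠ v)) uniq
      only-p : ∀ {y} → TE E v y → y ≡ p
      only-p e = single thin (te⇒nbr {E} e) (te⇒nbr {E} vp)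
        where
        single : ∀ {xs : List V} {a b} → length xs ≤ 1 → a ∈ˡ xs → b ∈ˡ xs → a ≡ b
        single _ (here refl) (here refl) = refl
        single {_ ∷ _ ∷ _} (s≤s ())
        single {_ ∷ []} _ (here _) (there ())
        single {_ ∷ []} _ (there ()) _
      charged⁺ : θ * length P ≤ total w N
      charged⁺ = ≤-trans charged (≤-reflexive (trans (load-bump (λ _ → yes tt) (w v) w uniq′ p∈N′ tt) (sym (load-without (λ _ → yes tt) w uniq v∈))))
      one-edge : length E ≤ suc (length E′)
      one-edge = ≤-trans edges (≤-trans (+-monoʳ-≤ (length E′) thin) (≤-reflexive (+-comm (length E′) 1)))
      split : Dec (p ∈ˡ P) → Parts N E w θ
      -- The cut vertex `p` pays for the new part: in the smaller forest it lacks the edge to `v`,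
      -- so its degree in `E` is larger by one.
      split (yes p∈P) = Place.alone parts v small (λ r → more r N′) refl (λ e → subst (_∈ˡ P) (sym (only-p e)) p∈P) charged⁺
          (≤-trans (s≤s (+-monoʳ-≤ (length Rs) one-edge)) (≤-trans (≤-reflexive (cong suc (+-suc (length Rs) (length E′))))
            (≤-trans (s≤s (s≤s few)) (≤-trans (≤-reflexive (cong suc (sym (+-suc (length N′) _)))) (+-mono-≤ count (sum-degrees-remove< E P p∈P vp p≢v))))))
        where
        raise : ∀ x → w x ≤ bump p (w v) w x
        raise x with x ≟ᶠ p
        ... | yes _ = m≤n+m (w x) (w v)
        ... | no _  = ≤-refl
        more : ∀ r xs → load (in-part? P rep r) w xs ≤ load (in-part? P rep r) (bump p (w v) w) xs
        more r [] = z≤n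
        more r (x ∷ xs) = +-mono-≤ (one (in-part? P rep r x)) (more r xs)
          where
          one : Dec (InPart P rep r x) → gate (in-part? P rep r) x (w x) ≤ gate (in-part? P rep r) x (bump p (w v) w x)
          one (yes s) = subst₂ _≤_ (sym (gate-yes (in-part? P rep r) _ s)) (sym (gate-yes (in-part? P rep r) _ s)) (raise x)
          one (no ¬s) = ≤-reflexive (trans (gate-no (in-part? P rep r) _ ¬s) (sym (gate-no (in-part? P rep r) _ ¬s)))
      split (no p∉P) = Pl.finish {Rs⁺ = Rs} (proj₁ (∈-without⁻ (rep∈ p∈N′ p∉P)))
          ((vp , Pl.v∉P , p∉P) ◅ lift (λ _ z∉ → z∉) (to-rep p∈N′ p∉P)) (λ e _ _ → cong rep (sym (only-p e)))
          (λ r → subst (_< θ) (sym (Pl.load-v r)) (passed r (rep p ≟ᶠ r))) charged⁺ (listed p∈N′ p∉P) id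
          (≤-trans (+-monoʳ-≤ (length Rs) one-edge) (≤-trans (≤-reflexive (+-suc (length Rs) (length E′)))
            (≤-trans (s≤s few) (+-mono-≤ count (sum-degrees-remove v E P)))))
        where
        module Pl = Place parts (rep p)
        -- The bumped weight of `p` already contains the weight of `v`, so the bound for this part
        -- carries over.
        passed : ∀ r → Dec (rep p ≡ r) → gate (in-part? P Pl.rep⁺ r) v (w v) + load (in-part? P rep r) w N′ < θ
        passed r (yes refl) = ≤-trans (s≤s (≤-reflexive (trans (cong (_+ load (in-part? P rep r) w N′) (gate-yes (in-part? P Pl.rep⁺ r) (w v) (Pl.v∉P , Pl.rep⁺-v)))
          (sym (load-bump (in-part? P rep r) (w v) w uniq′ p∈N′ (p∉P , refl)))))) (light r)
        passed r (no p≢r) = ≤-trans (s≤s (≤-reflexive (trans (cong (_+ load (in-part? P rep r) w N′) (gate-no (in-part? P Pl.rep⁺ r) (w v) (λ (_ , eq) → p≢r (trans (sym Pl.rep⁺-v) eq))))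
          (sym (load-bump-out (in-part? P rep r) (w v) w N′ (λ (_ , eq) → p≢r eq)))))) (light r)

  eliminate : ∀ k {N E w θ} → length N ≤ k → 1 ≤ θ → Unique N → (∀ {x y} → TE E x y → x ∈ˡ N) → Acyclic E → (∀ {x} → ¬ TE E x x) → Parts N E w θ
  eliminate k {[]} {[]} {w} {θ} _ 1≤θ _ _ _ _ = record
    { P = [] ; rep = id ; Rs = [] ; P⊆N = λ () ; rep∈ = λ () ; to-rep = λ () ; same = λ { (inj₁ ()) ; (inj₂ ()) } ; light = λ _ → 1≤θ
    ; charged = ≤-reflexive (*-zeroʳ θ) ; listed = λ () ; few = z≤n }
  eliminate k {[]} {(a , b) ∷ E} _ _ _ ends _ _ = contradiction (ends (inj₁ (here refl))) λ ()
  eliminate (suc k) {x ∷ N} {E} {w} {θ} len 1≤θ uniq ends ac loopfree = at (leaf E ac x)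
    where
    inside : ∀ {v} → Conn E x v → v ∈ˡ x ∷ N
    inside = go (here refl)
      where
      go : ∀ {y v} → y ∈ˡ x ∷ N → Conn E y v → v ∈ˡ x ∷ N
      go y∈ ε       = y∈
      go y∈ (e ◅ p) = go (ends (te-sym e)) p

    at : ∃[ v ] (Conn E x v × deg E v ≤ 1 × (1 ≤ deg E x → v ≢ x)) → Parts (x ∷ N) E w θ
    at (v , xv , thin , _) = weigh (θ ≤? w v) (nbrs E v) refl
      where
      v∈ : v ∈ˡ x ∷ N
      v∈ = inside xv
      module El = Eliminate {x ∷ N} {E} {w} {θ} {v} uniq ends v∈ thin

      rest : ∀ w → Parts El.N′ El.E′ w θ
      rest w = eliminate k (≤-pred (≤-trans El.count len)) 1≤θ (Uniqueₚ.filter⁺ (λ y → ¬? (y ≟ᶠ v)) uniq)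
        (λ e → let e′ , y≢ , _ = te-remove⁻ e in ∈-without⁺ (ends e′) y≢) (acyclic-remove v E ac) (λ e → loopfree (proj₁ (te-remove⁻ e)))

      weigh : Dec (θ ≤ w v) → ∀ ys → nbrs E v ≡ ys → Parts (x ∷ N) E w θ
      weigh (yes heavy) _ _ = El.cut heavy (rest w)
      weigh (no small) [] eq = El.weigh-less (≰⇒> small) (λ e → contradiction (subst (_ ∈ˡ_) eq (te⇒nbr {E} e)) λ ()) (rest w)
      weigh (no small) (p ∷ _) eq = El.hang (≰⇒> small) loopfree (nbr⇒te (subst (p ∈ˡ_) (sym eq) (here refl))) (rest (bump p (w v) w))

-- Forests with grouped vertices, and windows.

module Structure (G : Graph) where

  open Graph G renaming (order to n; symmetric to adj-sym; loopless to adj-irrefl)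
  open Forest n

  Within : Edges → (V → V) → Rel V 0ℓ
  Within E gid x y = TE E x y × gid x ≡ gid y

  within-sym : ∀ {E gid x y} → Star (Within E gid) x y → Star (Within E gid) y x
  within-sym = reverse (λ (xy , eq) → te-sym xy , sym eq)

  -- N induces a forest with edges E and at most c components, up to further edges inside
  -- the groups gid x = const.  Outside Y groups are single vertices of degree at most two.
  -- A larger group consists of up to two windows of three vertices and two vertices hooked onto them.
  record Forested (Y : VertexSet) (N : List V) (E : Edges) (gid : V → V) (c : ℕ) : Set where
    field
      uniq    : Unique N
      ends    : ∀ {x y} → TE E x y → x ∈ˡ N
      acyclic : Acyclic E
      count   : length N ≤ c + length E
      label   : ∀ {x} → x ∈ˡ N → gid x ∈ˡ N
      idem    : ∀ {x} → x ∈ˡ N → gid (gid x) ≡ gid x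
      adj     : ∀ {x y} → x ∈ˡ N → y ∈ˡ N → Adj x y → TE E x y ⊎ gid x ≡ gid y
      edge    : ∀ {x y} → TE E x y → Adj x y
      -- Groups are connected by forest edges, so contracting them leaves a forest.
      joined  : ∀ {x y} → x ∈ˡ N → y ∈ˡ N → gid x ≡ gid y → Star (Within E gid) x y
      class   : ∀ {x} → x ∈ˡ N → ∃[ C ] (length C ≤ 8 × (∀ {y} → y ∈ˡ N → gid y ≡ gid x → y ∈ˡ C))
      alone   : ∀ {x y} → x ∈ˡ N → x ∉ Y → y ∈ˡ N → gid y ≡ gid x → y ≡ x
      thin    : ∀ {x} → x ∈ˡ N → x ∉ Y → deg E x ≤ 2
      -- Two edges by `thin`, and room for two hooks once the vertex is in `Y`.
      bounded : ∀ x → deg E x ≤ 4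

    ends′ : ∀ {x y} → TE E x y → y ∈ˡ N
    ends′ xy = ends (te-sym xy)

  enlarge : ∀ {Y Y′ N E gid c} → Y ⊆ Y′ → Forested Y N E gid c → Forested Y′ N E gid c
  enlarge Y⊆ F = record
    { uniq = uniq ; ends = ends ; acyclic = acyclic ; count = count ; label = label ; idem = idem ; adj = adj ; edge = edge
    ; joined = joined ; class = class ; alone = λ x∈ x∉ → alone x∈ (λ x∈Y → x∉ (Y⊆ x∈Y))
    ; thin = λ x∈ x∉ → thin x∈ (λ x∈Y → x∉ (Y⊆ x∈Y)) ; bounded = bounded }
    where open Forested F

  regroup : List V → V → (V → V) → V → V
  regroup S g gid x with x ∈ˡ? S
  ... | yes _ = g
  ... | no _  = gid x

  regroup-in : ∀ {S} g gid {x} → x ∈ˡ S → regroup S g gid x ≡ g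
  regroup-in {S} g gid {x} x∈ with x ∈ˡ? S
  ... | yes _ = refl
  ... | no x∉ = contradiction x∈ x∉

  regroup-out : ∀ {S} g gid {x} → x ∉ˡ S → regroup S g gid x ≡ gid x
  regroup-out {S} g gid {x} x∉ with x ∈ˡ? S
  ... | yes x∈ = contradiction x∈ x∉
  ... | no _   = refl

  Inside : Edges → List V → Rel V 0ℓ
  Inside E S x y = TE E x y × x ∈ˡ S × y ∈ˡ S

  -- By `closed` no old group is torn apart, and by `reach` the new one is connected by forest edges
  -- within itself.
  module Group {Y N E gid c} (F : Forested Y N E gid c) (S : List V) (g : V) (g∈ : g ∈ˡ S)
               (S⊆N : ∀ {x} → x ∈ˡ S → x ∈ˡ N) (reach : ∀ {x} → x ∈ˡ S → Star (Inside E S) g x)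
               (closed : ∀ {x y} → x ∈ˡ S → y ∈ˡ N → gid y ≡ gid x → y ∈ˡ S)
               (small : length S ≤ 8) (S⊆Y : ∀ {x} → x ∈ˡ S → x ∈ Y) where
    open Forested F

    gid′ : V → V
    gid′ = regroup S g gid

    coarser : ∀ {x y} → x ∈ˡ N → y ∈ˡ N → gid x ≡ gid y → gid′ x ≡ gid′ y
    coarser {x} {y} x∈N y∈N eq with x ∈ˡ? S | y ∈ˡ? S
    ... | yes _  | yes _  = refl
    ... | yes x∈ | no y∉  = contradiction (closed x∈ y∈N (sym eq)) y∉
    ... | no x∉  | yes y∈ = contradiction (closed y∈ x∈N eq) x∉
    ... | no _   | no _   = eq

    inside⇒within : ∀ {x y} → Star (Inside E S) x y → Star (Within E gid′) x y
    inside⇒within = gmap id (λ (e , x∈ , y∈) → e , trans (regroup-in g gid x∈) (sym (regroup-in g gid y∈)))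

    mixed : ∀ {y} → y ∈ˡ N → y ∉ˡ S → g ≢ gid y
    mixed y∈N y∉ g≡ = y∉ (closed g∈ y∈N (trans (sym (idem y∈N)) (cong gid (sym g≡))))

    joined′ : ∀ {x y} → x ∈ˡ N → y ∈ˡ N → gid′ x ≡ gid′ y → Star (Within E gid′) x y
    joined′ {x} {y} x∈N y∈N eq with x ∈ˡ? S | y ∈ˡ? S
    ... | yes x∈ | yes y∈ = within-sym (inside⇒within (reach x∈)) ◅◅ inside⇒within (reach y∈)
    ... | yes x∈ | no y∉  = contradiction eq (mixed y∈N y∉)
    ... | no x∉  | yes y∈ = contradiction (sym eq) (mixed x∈N x∉)
    ... | no x∉  | no y∉  = gmap id (λ (e , eq) → e , coarser (ends e) (ends′ e) eq) (joined x∈N y∈N eq)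

    label′ : ∀ {x} → x ∈ˡ N → gid′ x ∈ˡ N
    label′ {x} x∈N with x ∈ˡ? S
    ... | yes _ = S⊆N g∈
    ... | no _  = label x∈N

    idem′ : ∀ {x} → x ∈ˡ N → gid′ (gid′ x) ≡ gid′ x
    idem′ {x} x∈N with x ∈ˡ? S
    ... | yes _ = regroup-in g gid g∈
    ... | no x∉ = trans (regroup-out g gid (λ l∈ → x∉ (closed l∈ x∈N (sym (idem x∈N))))) (idem x∈N)

    class′ : ∀ {x} → x ∈ˡ N → ∃[ C ] (length C ≤ 8 × (∀ {y} → y ∈ˡ N → gid′ y ≡ gid′ x → y ∈ˡ C))
    class′ {x} x∈N with x ∈ˡ? S
    ... | yes x∈ = S , small , in-S
      where
      in-S : ∀ {y} → y ∈ˡ N → gid′ y ≡ g → y ∈ˡ S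
      in-S {y} y∈N eq with y ∈ˡ? S
      ... | yes y∈ = y∈
      ... | no y∉  = contradiction (sym eq) (mixed y∈N y∉)
    ... | no x∉ with class x∈N
    ... | C , len , all = C , len , in-C
      where
      in-C : ∀ {y} → y ∈ˡ N → gid′ y ≡ gid x → y ∈ˡ C
      in-C {y} y∈N eq with y ∈ˡ? S
      ... | yes y∈ = contradiction eq (mixed x∈N x∉)
      ... | no _   = all y∈N eq

    alone′ : ∀ {x y} → x ∈ˡ N → x ∉ Y → y ∈ˡ N → gid′ y ≡ gid′ x → y ≡ x
    alone′ {x} {y} x∈N x∉Y y∈N eq with x ∈ˡ? S | y ∈ˡ? S
    ... | yes x∈ | _      = contradiction (S⊆Y x∈) x∉Y
    ... | no x∉  | yes y∈ = contradiction eq (mixed x∈N x∉)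
    ... | no _   | no _   = alone x∈N x∉Y y∈N eq

    adj′ : ∀ {x y} → x ∈ˡ N → y ∈ˡ N → Adj x y → TE E x y ⊎ gid′ x ≡ gid′ y
    adj′ x∈ y∈ xy with adj x∈ y∈ xy
    ... | inj₁ e  = inj₁ e
    ... | inj₂ eq = inj₂ (coarser x∈ y∈ eq)

    grouped : Forested Y N E gid′ c
    grouped = record
      { uniq = uniq ; ends = ends ; acyclic = acyclic ; count = count ; label = label′ ; idem = idem′ ; adj = adj′ ; edge = edge
      ; joined = joined′ ; class = class′ ; alone = alone′ ; thin = thin ; bounded = bounded }

  meeting : (xs ys : List V) → (∃[ z ] (z ∈ˡ xs × z ∈ˡ ys)) ⊎ (∀ {z} → z ∈ˡ xs → z ∉ˡ ys)
  meeting []       ys = inj₂ λ ()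
  meeting (x ∷ xs) ys with x ∈ˡ? ys | meeting xs ys
  ... | yes x∈ | _ = inj₁ (x , here refl , x∈)
  ... | no _   | inj₁ (z , z∈ , z∈′) = inj₁ (z , there z∈ , z∈′)
  ... | no x∉  | inj₂ none = inj₂ λ { (here refl) → x∉ ; (there z∈) → none z∈ }

  window : VertexSet → Edges → V → List V
  window Y E c = c ∷ filter (λ x → ¬? (x ∈? Y)) (nbrs E c)

  window⁺ : ∀ {Y E c x} → c ∉ Y → x ∉ Y → x ≡ c ⊎ TE E c x → x ∈ˡ window Y E c
  window⁺ _ _ (inj₁ refl) = here refl
  window⁺ {Y} _ x∉ (inj₂ e) = there (∈-filter⁺ (λ x → ¬? (x ∈? Y)) (te⇒nbr e) x∉)

  window⁻ : ∀ {Y E c x} → c ∉ Y → x ∈ˡ window Y E c → (x ≡ c ⊎ TE E c x) × x ∉ Y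
  window⁻ c∉ (here refl) = inj₁ refl , c∉
  window⁻ {Y} {E} {c} c∉ (there x∈) with ∈-filter⁻ (λ x → ¬? (x ∈? Y)) {xs = nbrs E c} x∈
  ... | x∈′ , x∉ = inj₂ (nbr⇒te x∈′) , x∉

  record Grouping (Y : VertexSet) (N : List V) (E : Edges) (gid : V → V) (c : ℕ) (S₁ S₂ : List V) : Set where
    field
      gid′    : V → V
      g₁ g₂   : V
      forest  : Forested Y N E gid′ c
      in₁     : ∀ {x} → x ∈ˡ S₁ → gid′ x ≡ g₁
      in₂     : ∀ {x} → x ∈ˡ S₂ → gid′ x ≡ g₂
      cls₁    : ∀ {x} → x ∈ˡ N → gid′ x ≡ g₁ → x ∈ˡ S₁ ++ S₂
      cls₂    : ∀ {x} → x ∈ˡ N → gid′ x ≡ g₂ → x ∈ˡ S₁ ++ S₂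
      coarser : ∀ {x y} → x ∈ˡ N → y ∈ˡ N → gid x ≡ gid y → gid′ x ≡ gid′ y

  -- Windows sharing a vertex become one group, disjoint ones become two; `g₁` and `g₂` hide the
  -- difference. As vertices outside `Y` were groups of their own, no older group is cut. At most
  -- six vertices leave room for two hooks.
  group-windows : ∀ {Y Y′ N E gid c c₁ c₂} → Forested Y N E gid c → Y ⊆ Y′ →
                  c₁ ∈ˡ N → c₁ ∉ Y → c₂ ∈ˡ N → c₂ ∉ Y →
                  (∀ {x} → x ∈ˡ window Y E c₁ → x ∈ Y′) → (∀ {x} → x ∈ˡ window Y E c₂ → x ∈ Y′) →
                  Grouping Y′ N E gid c (window Y E c₁) (window Y E c₂)
  group-windows {Y} {Y′} {N} {E} {gid} {c} {c₁} {c₂} F Y⊆ c₁∈ c₁∉ c₂∈ c₂∉ W₁⊆ W₂⊆ = go (meeting W₁ W₂)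
    where
    open Forested F
    F′ = enlarge Y⊆ F
    W₁ = window Y E c₁
    W₂ = window Y E c₂

    W⊆N : ∀ {c x} → c ∈ˡ N → c ∉ Y → x ∈ˡ window Y E c → x ∈ˡ N
    W⊆N c∈ c∉ x∈ with window⁻ {E = E} c∉ x∈
    ... | inj₁ refl , _ = c∈
    ... | inj₂ e , _    = ends′ e

    short : ∀ {c} → c ∈ˡ N → c ∉ Y → length (window Y E c) ≤ 3
    short {c} c∈ c∉ = s≤s (≤-trans (length-filter (λ x → ¬? (x ∈? Y)) (nbrs E c)) (thin c∈ c∉))

    alone-in : ∀ {c x y} → c ∈ˡ N → c ∉ Y → x ∈ˡ window Y E c → y ∈ˡ N → gid y ≡ gid x → y ≡ x
    alone-in c∈ c∉ x∈ = alone (W⊆N c∈ c∉ x∈) (proj₂ (window⁻ {E = E} c∉ x∈))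

    spoke : ∀ {c x} S → c ∉ Y → (∀ {z} → z ∈ˡ window Y E c → z ∈ˡ S) → x ∈ˡ window Y E c → Star (Inside E S) c x
    spoke S c∉ ⊆S x∈ with window⁻ {E = E} c∉ x∈
    ... | inj₁ refl , _ = ε
    ... | inj₂ e , _    = (e , ⊆S (here refl) , ⊆S x∈) ◅ ε

    inside-sym : ∀ {S x y} → Star (Inside E S) x y → Star (Inside E S) y x
    inside-sym = reverse (λ (e , x∈ , y∈) → te-sym e , y∈ , x∈)

    go : (∃[ z ] (z ∈ˡ W₁ × z ∈ˡ W₂)) ⊎ (∀ {z} → z ∈ˡ W₁ → z ∉ˡ W₂) → Grouping Y′ N E gid c W₁ W₂
    go (inj₁ (z , z∈₁ , z∈₂)) = record
      { gid′ = gid′ ; g₁ = c₁ ; g₂ = c₁ ; forest = grouped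
      ; in₁ = λ x∈ → regroup-in c₁ gid (∈-++⁺ˡ x∈) ; in₂ = λ x∈ → regroup-in c₁ gid (∈-++⁺ʳ W₁ x∈)
      ; cls₁ = cls ; cls₂ = cls ; coarser = coarser }
      where
      S = W₁ ++ W₂
      reach : ∀ {x} → x ∈ˡ S → Star (Inside E S) c₁ x
      reach x∈ with ∈-++⁻ W₁ x∈
      ... | inj₁ x∈₁ = spoke S c₁∉ ∈-++⁺ˡ x∈₁
      ... | inj₂ x∈₂ = spoke S c₁∉ ∈-++⁺ˡ z∈₁ ◅◅ inside-sym (spoke S c₂∉ (∈-++⁺ʳ W₁) z∈₂) ◅◅ spoke S c₂∉ (∈-++⁺ʳ W₁) x∈₂
      closed : ∀ {x y} → x ∈ˡ S → y ∈ˡ N → gid y ≡ gid x → y ∈ˡ S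
      closed x∈ y∈N eq with ∈-++⁻ W₁ x∈
      ... | inj₁ x∈₁ = subst (_∈ˡ S) (sym (alone-in c₁∈ c₁∉ x∈₁ y∈N eq)) x∈
      ... | inj₂ x∈₂ = subst (_∈ˡ S) (sym (alone-in c₂∈ c₂∉ x∈₂ y∈N eq)) x∈
      open Group F′ S c₁ (here refl) (λ x∈ → [ W⊆N c₁∈ c₁∉ , W⊆N c₂∈ c₂∉ ] (∈-++⁻ W₁ x∈)) reach closed
        (≤-trans (≤-reflexive (length-++ W₁)) (≤-trans (+-mono-≤ (short c₁∈ c₁∉) (short c₂∈ c₂∉)) (m≤m+n 6 2)))
        (λ x∈ → [ W₁⊆ , W₂⊆ ] (∈-++⁻ W₁ x∈))
      cls : ∀ {x} → x ∈ˡ N → gid′ x ≡ c₁ → x ∈ˡ S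
      cls {x} x∈N eq with x ∈ˡ? S
      ... | yes x∈ = x∈
      ... | no x∉  = contradiction (sym eq) (mixed x∈N x∉)
    go (inj₂ disjoint) = record
      { gid′ = Second.gid′ ; g₁ = c₁ ; g₂ = c₂ ; forest = Second.grouped
      ; in₁ = λ x∈ → trans (regroup-out c₂ First.gid′ (disjoint x∈)) (regroup-in c₁ gid x∈)
      ; in₂ = regroup-in c₂ First.gid′
      ; cls₁ = cls₁ ; cls₂ = cls₂
      ; coarser = λ x∈ y∈ eq → Second.coarser x∈ y∈ (First.coarser x∈ y∈ eq) }
      where
      module First = Group F′ W₁ c₁ (here refl) (W⊆N c₁∈ c₁∉) (spoke W₁ c₁∉ id)
        (λ x∈ y∈N eq → subst (_∈ˡ W₁) (sym (alone-in c₁∈ c₁∉ x∈ y∈N eq)) x∈)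
        (≤-trans (short c₁∈ c₁∉) (m≤m+n 3 5)) W₁⊆
      closed : ∀ {x y} → x ∈ˡ W₂ → y ∈ˡ N → First.gid′ y ≡ First.gid′ x → y ∈ˡ W₂
      closed {x} {y} x∈ y∈N eq with x ∈ˡ? W₁ | y ∈ˡ? W₁
      ... | yes x∈₁ | _       = contradiction x∈ (disjoint x∈₁)
      ... | no x∉   | yes y∈₁ = contradiction eq (First.mixed (W⊆N c₂∈ c₂∉ x∈) x∉)
      ... | no _    | no _    = subst (_∈ˡ W₂) (sym (alone-in c₂∈ c₂∉ x∈ y∈N eq)) x∈
      module Second = Group First.grouped W₂ c₂ (here refl) (W⊆N c₂∈ c₂∉) (spoke W₂ c₂∉ id) closed
        (≤-trans (short c₂∈ c₂∉) (m≤m+n 3 5)) W₂⊆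
      cls₁ : ∀ {x} → x ∈ˡ N → Second.gid′ x ≡ c₁ → x ∈ˡ W₁ ++ W₂
      cls₁ {x} x∈N eq = split (x ∈ˡ? W₂) (x ∈ˡ? W₁)
        where
        split : Dec (x ∈ˡ W₂) → Dec (x ∈ˡ W₁) → x ∈ˡ W₁ ++ W₂
        split (yes x∈) _       = ∈-++⁺ʳ W₁ x∈
        split (no _) (yes x∈)  = ∈-++⁺ˡ x∈
        split (no x∉₂) (no x∉) = contradiction
          (trans (sym eq) (trans (regroup-out c₂ First.gid′ x∉₂) (regroup-out c₁ gid x∉))) (First.mixed x∈N x∉)
      cls₂ : ∀ {x} → x ∈ˡ N → Second.gid′ x ≡ c₂ → x ∈ˡ W₁ ++ W₂
      cls₂ {x} x∈N eq = split (x ∈ˡ? W₂)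
        where
        split : Dec (x ∈ˡ W₂) → x ∈ˡ W₁ ++ W₂
        split (yes x∈) = ∈-++⁺ʳ W₁ x∈
        split (no x∉)  = contradiction (trans (sym eq) (regroup-out c₂ First.gid′ x∉)) (Second.mixed x∈N x∉)

-- Adding and removing a single vertex.

module Skeletons (G : Graph) where

  open Graph G renaming (order to n; symmetric to adj-sym; loopless to adj-irrefl)
  open Forest n
  open Structure G

  attach : V → List V → Edges → Edges
  attach v as E = map (v ,_) as ++ E

  te-attach⁺ : ∀ {v as E a} → a ∈ˡ as → TE (attach v as E) v a
  te-attach⁺ {v} a∈ = inj₁ (∈-++⁺ˡ (∈-map⁺ (v ,_) a∈))

  te-attach : ∀ {v} as {E x y} → TE E x y → TE (attach v as E) x y
  te-attach as (inj₁ e) = inj₁ (∈-++⁺ʳ (map _ as) e)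
  te-attach as (inj₂ e) = inj₂ (∈-++⁺ʳ (map _ as) e)

  te-attach⁻ : ∀ {v} as {E x y} → TE (attach v as E) x y → TE E x y ⊎ (x ≡ v × y ∈ˡ as) ⊎ (y ≡ v × x ∈ˡ as)
  te-attach⁻ {v} as (inj₁ e) with ∈-++⁻ (map (v ,_) as) e
  ... | inj₂ e′ = inj₁ (inj₁ e′)
  ... | inj₁ e′ with ∈-map⁻ (v ,_) e′
  ... | _ , a∈ , refl = inj₂ (inj₁ (refl , a∈))
  te-attach⁻ {v} as (inj₂ e) with ∈-++⁻ (map (v ,_) as) e
  ... | inj₂ e′ = inj₁ (inj₂ e′)
  ... | inj₁ e′ with ∈-map⁻ (v ,_) e′
  ... | _ , a∈ , refl = inj₂ (inj₂ (refl , a∈))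

  deg-attached : ∀ {v} as {E} → v ∉ˡ as → deg (attach v as E) v ≡ length as + deg E v
  deg-attached []           _  = refl
  deg-attached {v} (a ∷ as) v∉ = trans (deg-left (attach v as _) (λ { refl → v∉ (here refl) }))
    (cong suc (deg-attached as (λ v∈ → v∉ (there v∈))))

  deg-aside : ∀ {v x} as {E} → x ≢ v → x ∉ˡ as → deg (attach v as E) x ≡ deg E x
  deg-aside []           _  _  = refl
  deg-aside {v} (a ∷ as) x≢ x∉ = trans (deg-miss (attach v as _) x≢ (λ { refl → x∉ (here refl) }))
    (deg-aside as x≢ (λ x∈ → x∉ (there x∈)))

  deg-attach : ∀ {v x} as {E} → Unique as → x ≢ v → deg (attach v as E) x ≤ suc (deg E x)
  deg-attach [] _ _ = n≤1+n _
  deg-attach {v} {x} (a ∷ as) {E} (a∉ ∷ uniq) x≢v = split (x ≟ᶠ a)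
    where
    split : Dec (x ≡ a) → deg (attach v (a ∷ as) E) x ≤ suc (deg E x)
    split (no x≢a)   = ≤-trans (≤-reflexive (deg-miss (attach v as E) x≢v x≢a)) (deg-attach as uniq x≢v)
    split (yes refl) = ≤-reflexive (trans (deg-right (attach v as E) (λ eq → x≢v (sym eq)))
                         (cong suc (deg-aside as x≢v (λ a∈ → All.lookup a∉ a∈ refl))))

  no-degree : ∀ {E v} → Isolated E v → deg E v ≡ 0
  no-degree {E} {v} iso = empty (nbrs E v) (λ y∈ → iso (nbr⇒te y∈))
    where
    empty : ∀ ys → (∀ {y : V} → y ∉ˡ ys) → length ys ≡ 0
    empty []       _ = refl
    empty (y ∷ ys) none = contradiction (here refl) none

  record Skeleton (Y : VertexSet) (c : ℕ) : Set where
    field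
      N      : List V
      E      : Edges
      gid    : V → V
      forest : Forested Y N E gid c
    open Forested forest public

    isolated-outside : ∀ {v} → v ∉ˡ N → Isolated E v
    isolated-outside v∉ e = v∉ (ends e)

  record _≼_ {Y Y′ c c′} (S : Skeleton Y c) (S′ : Skeleton Y′ c′) : Set where
    private
      module S  = Skeleton S
      module S′ = Skeleton S′
    field
      members  : ∀ {x} → x ∈ˡ S.N → x ∈ˡ S′.N
      edges    : ∀ {x y} → TE S.E x y → TE S′.E x y
      coarsens : ∀ {x y} → x ∈ˡ S.N → y ∈ˡ S.N → S.gid x ≡ S.gid y → S′.gid x ≡ S′.gid y

  ≼-refl : ∀ {Y c} {S : Skeleton Y c} → S ≼ S
  ≼-refl = record { members = id ; edges = id ; coarsens = λ _ _ → id }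

  ≼-trans : ∀ {Y Y′ Y″ c c′ c″} {S : Skeleton Y c} {S′ : Skeleton Y′ c′} {S″ : Skeleton Y″ c″} → S ≼ S′ → S′ ≼ S″ → S ≼ S″
  ≼-trans p q = record
    { members  = λ x∈ → Q.members (P.members x∈)
    ; edges    = λ e → Q.edges (P.edges e)
    ; coarsens = λ x∈ y∈ eq → Q.coarsens (P.members x∈) (P.members y∈) (P.coarsens x∈ y∈ eq) }
    where
    module P = _≼_ p
    module Q = _≼_ q

  opaque

    relabel : V → V → (V → V) → V → V
    relabel v l gid = regroup (v ∷ []) l gid

    relabel-self : ∀ v l gid → relabel v l gid v ≡ l
    relabel-self v l gid = regroup-in {v ∷ []} l gid (here refl)

    relabel-other : ∀ {v} l gid {x} → x ≢ v → relabel v l gid x ≡ gid x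
    relabel-other {v} l gid x≢ = regroup-out {v ∷ []} l gid λ { (here eq) → x≢ eq }

  -- C lists the group that v joins.
  data Label {Y c} (S : Skeleton Y c) (v : V) (as : List V) : V → Set where
    own    : Label S v as v
    joins  : ∀ {a} → a ∈ˡ as → a ∈ Y → v ∈ Y → (C : List V) → length C ≤ 8 → v ∈ˡ C →
             (∀ {y} → y ∈ˡ Skeleton.N S → Skeleton.gid S y ≡ Skeleton.gid S a → y ∈ˡ C) →
             Label S v as (Skeleton.gid S a)

  -- `as` are the vertices that `v` is linked to by forest edges; by `touch` all further contacts
  -- lie in the group with label `l`, which `v` receives. The new vertex counts as one more
  -- component and each of its edges saves one, hence `components`.
  module Add {Y c} (S : Skeleton Y c) {v : V} (v∉ : v ∉ˡ Skeleton.N S) (as : List V) {l : V} (c′ : ℕ)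
    (few : length as ≤ 2) (distinct : Unique as) (as⊆N : ∀ {a} → a ∈ˡ as → a ∈ˡ Skeleton.N S)
    (as-adj : ∀ {a} → a ∈ˡ as → Adj v a) (touch : ∀ {x} → x ∈ˡ Skeleton.N S → Adj v x → x ∈ˡ as ⊎ Skeleton.gid S x ≡ l)
    (lab : Label S v as l) (room : ∀ {a} → a ∈ˡ as → deg (Skeleton.E S) a ≤ 1 ⊎ (a ∈ Y × deg (Skeleton.E S) a ≤ 3))
    (still-acyclic : Acyclic (attach v as (Skeleton.E S))) (components : suc c ≤ c′ + length as) where
    open Skeleton S

    private
      N′ : List V
      N′ = v ∷ N
      E′ : Edges
      E′ = attach v as E
      gid′ : V → V
      gid′ = relabel v l gid

      old≢ : ∀ {x} → x ∈ˡ N → x ≢ v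
      old≢ x∈ refl = v∉ x∈

      v∉as : v ∉ˡ as
      v∉as v∈ = v∉ (as⊆N v∈)

      kept : ∀ {x} → x ∈ˡ N → gid′ x ≡ gid x
      kept x∈ = relabel-other l gid (old≢ x∈)

      self : gid′ v ≡ l
      self = relabel-self v l gid

      ends″ : ∀ {x y} → TE E′ x y → x ∈ˡ N′
      ends″ e with te-attach⁻ as e
      ... | inj₁ e′ = there (ends e′)
      ... | inj₂ (inj₁ (refl , _)) = here refl
      ... | inj₂ (inj₂ (_ , x∈)) = there (as⊆N x∈)

      count″ : suc (length N) ≤ c′ + length E′
      count″ = begin
        suc (length N)                     ≤⟨ s≤s count ⟩
        suc c + length E                   ≤⟨ +-monoˡ-≤ (length E) components ⟩
        c′ + length as + length E          ≡⟨ +-assoc c′ (length as) (length E) ⟩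
        c′ + (length as + length E)        ≡⟨ cong (λ k → c′ + (k + length E)) (length-map (v ,_) as) ⟨
        c′ + (length (map (v ,_) as) + length E) ≡⟨ cong (c′ +_) (length-++ (map (v ,_) as)) ⟨
        c′ + length E′                     ∎
        where open ≤-Reasoning

      label″ : ∀ {x} → x ∈ˡ N′ → gid′ x ∈ˡ N′
      label″ (here refl) = subst (_∈ˡ N′) (sym self) (l∈ lab)
        where
        l∈ : ∀ {l} → Label S v as l → l ∈ˡ N′
        l∈ own                     = here refl
        l∈ (joins a∈ _ _ _ _ _ _) = there (label (as⊆N a∈))
      label″ (there x∈) = subst (_∈ˡ N′) (sym (kept x∈)) (there (label x∈))

      idem″ : ∀ {x} → x ∈ˡ N′ → gid′ (gid′ x) ≡ gid′ x
      idem″ (here refl) = trans (cong gid′ self) (trans (fixed lab) (sym self))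
        where
        fixed : ∀ {l} → Label S v as l → relabel v l gid l ≡ l
        fixed own                             = relabel-self v _ gid
        fixed (joins a∈ _ _ _ _ _ _) =
          trans (relabel-other _ gid (old≢ (label (as⊆N a∈)))) (idem (as⊆N a∈))
      idem″ {x} (there x∈) = trans (cong gid′ (kept x∈)) (trans (kept (label x∈)) (trans (idem x∈) (sym (kept x∈))))

      adj-new : ∀ {x} → x ∈ˡ N → Adj v x → TE E′ v x ⊎ gid′ v ≡ gid′ x
      adj-new x∈ e with touch x∈ e
      ... | inj₁ x∈as = inj₁ (te-attach⁺ x∈as)
      ... | inj₂ eq   = inj₂ (trans self (trans (sym eq) (sym (kept x∈))))

      adj″ : ∀ {x y} → x ∈ˡ N′ → y ∈ˡ N′ → Adj x y → TE E′ x y ⊎ gid′ x ≡ gid′ y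
      adj″ (here refl) (here refl) e = contradiction e (adj-irrefl refl)
      adj″ (here refl) (there y∈)  e = adj-new y∈ e
      adj″ (there x∈)  (here refl) e with adj-new x∈ (adj-sym e)
      ... | inj₁ e′ = inj₁ (te-sym e′)
      ... | inj₂ eq = inj₂ (sym eq)
      adj″ (there x∈) (there y∈) e with adj x∈ y∈ e
      ... | inj₁ e′ = inj₁ (te-attach as e′)
      ... | inj₂ eq = inj₂ (trans (kept x∈) (trans eq (sym (kept y∈))))

      edge″ : ∀ {x y} → TE E′ x y → Adj x y
      edge″ e with te-attach⁻ as e
      ... | inj₁ e′ = edge e′
      ... | inj₂ (inj₁ (refl , y∈)) = as-adj y∈
      ... | inj₂ (inj₂ (refl , x∈)) = adj-sym (as-adj x∈)

      lift : ∀ {x y} → Star (Within E gid) x y → Star (Within E′ gid′) x y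
      lift = gmap id (λ (e , eq) → te-attach as e , trans (kept (ends e)) (trans eq (sym (kept (ends′ e)))))

      joined-new : ∀ {x} → x ∈ˡ N → l ≡ gid x → Star (Within E′ gid′) v x
      joined-new {x} x∈ = go lab self
        where
        go : ∀ {l} → Label S v as l → gid′ v ≡ l → l ≡ gid x → Star (Within E′ gid′) v x
        go own _ eq = contradiction (subst (_∈ˡ N) (sym eq) (label x∈)) v∉
        go (joins a∈ _ _ _ _ _ _) s eq = (te-attach⁺ a∈ , trans s (sym (kept (as⊆N a∈)))) ◅ lift (joined (as⊆N a∈) x∈ eq)

      joined″ : ∀ {x y} → x ∈ˡ N′ → y ∈ˡ N′ → gid′ x ≡ gid′ y → Star (Within E′ gid′) x y
      joined″ (here refl) (here refl) _  = ε
      joined″ (here refl) (there y∈)  eq = joined-new y∈ (trans (sym self) (trans eq (kept y∈)))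
      joined″ (there x∈)  (here refl) eq = within-sym (joined-new x∈ (trans (sym self) (trans (sym eq) (kept x∈))))
      joined″ (there x∈)  (there y∈)  eq = lift (joined x∈ y∈ (trans (sym (kept x∈)) (trans eq (kept y∈))))

      class-new : ∀ {l} → Label S v as l → ∃[ C ] (length C ≤ 8 × v ∈ˡ C × (∀ {y} → y ∈ˡ N → gid y ≡ l → y ∈ˡ C))
      class-new own = v ∷ [] , s≤s z≤n , here refl , λ y∈ eq → contradiction (subst (_∈ˡ N) eq (label y∈)) v∉
      class-new (joins _ _ _ C len v∈ all) = C , len , v∈ , all

      class-of-v : ∀ {x} → gid′ x ≡ l → ∃[ C ] (length C ≤ 8 × (∀ {y} → y ∈ˡ N′ → gid′ y ≡ gid′ x → y ∈ˡ C))
      class-of-v x≡l with class-new lab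
      ... | C , len , v∈ , all = C , len , λ { (here refl) _ → v∈ ; (there y∈) eq → all y∈ (trans (sym (kept y∈)) (trans eq x≡l)) }

      class″ : ∀ {x} → x ∈ˡ N′ → ∃[ C ] (length C ≤ 8 × (∀ {y} → y ∈ˡ N′ → gid′ y ≡ gid′ x → y ∈ˡ C))
      class″ (here refl) = class-of-v self
      class″ {x} (there x∈) = split (gid x ≟ᶠ l)
        where
        split : Dec (gid x ≡ l) → ∃[ C ] (length C ≤ 8 × (∀ {y} → y ∈ˡ N′ → gid′ y ≡ gid′ x → y ∈ˡ C))
        split (yes eq) = class-of-v (trans (kept x∈) eq)
        split (no ¬eq) with class x∈
        ... | C , len , all = C , len , λ { (here refl) eq → contradiction (trans (sym (kept x∈)) (trans (sym eq) self)) ¬eq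
                                          ; (there y∈) eq → all y∈ (trans (sym (kept y∈)) (trans eq (kept x∈))) }

      not-new : ∀ {x l} → Label S v as l → x ∈ˡ N → x ∉ Y → l ≢ gid x
      not-new own x∈ _ eq = v∉ (subst (_∈ˡ N) (sym eq) (label x∈))
      not-new (joins a∈ a∈Y _ _ _ _ _) x∈ x∉ eq = x∉ (subst (_∈ Y) (alone x∈ x∉ (as⊆N a∈) eq) a∈Y)

      alone-new : ∀ {y l} → Label S v as l → v ∉ Y → y ∈ˡ N → gid y ≢ l
      alone-new own _ y∈ eq = v∉ (subst (_∈ˡ N) eq (label y∈))
      alone-new (joins _ _ v∈ _ _ _ _) v∉Y _ _ = v∉Y v∈

      alone″ : ∀ {x y} → x ∈ˡ N′ → x ∉ Y → y ∈ˡ N′ → gid′ y ≡ gid′ x → y ≡ x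
      alone″ (here refl) _  (here refl) _  = refl
      alone″ (here refl) x∉ (there y∈)  eq = contradiction (trans (sym (kept y∈)) (trans eq self)) (alone-new lab x∉ y∈)
      alone″ (there x∈)  x∉ (here refl) eq = contradiction (trans (sym self) (trans eq (kept x∈))) (not-new lab x∈ x∉)
      alone″ (there x∈)  x∉ (there y∈)  eq = alone x∈ x∉ y∈ (trans (sym (kept y∈)) (trans eq (kept x∈)))

      deg-v : deg E′ v ≤ 2
      deg-v = ≤-trans (≤-reflexive (trans (deg-attached as v∉as)
        (trans (cong (length as +_) (no-degree (isolated-outside v∉))) (+-identityʳ (length as))))) few

      thin″ : ∀ {x} → x ∈ˡ N′ → x ∉ Y → deg E′ x ≤ 2
      thin″ (here refl) _ = deg-v
      thin″ {x} (there x∈) x∉ with x ∈ˡ? as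
      ... | no x∉as = ≤-trans (≤-reflexive (deg-aside as (old≢ x∈) x∉as)) (thin x∈ x∉)
      ... | yes x∈as with room x∈as
      ...   | inj₁ ≤1 = ≤-trans (deg-attach as distinct (old≢ x∈)) (s≤s ≤1)
      ...   | inj₂ (x∈Y , _) = contradiction x∈Y x∉

      bounded″ : ∀ x → deg E′ x ≤ 4
      bounded″ x with x ≟ᶠ v
      ... | yes refl = ≤-trans deg-v (m≤m+n 2 2)
      ... | no x≢v with x ∈ˡ? as
      ... | no x∉as = ≤-trans (≤-reflexive (deg-aside as x≢v x∉as)) (bounded x)
      ... | yes x∈as with room x∈as
      ...   | inj₁ ≤1 = ≤-trans (deg-attach as distinct x≢v) (≤-trans (s≤s ≤1) (m≤m+n 2 2))
      ...   | inj₂ (_ , ≤3) = ≤-trans (deg-attach as distinct x≢v) (s≤s ≤3)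

    added : Skeleton Y c′
    added = record { N = N′ ; E = E′ ; gid = gid′ ; forest = record
      { uniq = All.tabulate (λ x∈ eq → v∉ (subst (_∈ˡ N) (sym eq) x∈)) ∷ uniq ; ends = ends″ ; acyclic = still-acyclic ; count = count″
      ; label = label″ ; idem = idem″ ; adj = adj″ ; edge = edge″ ; joined = joined″ ; class = class″ ; alone = alone″
      ; thin = thin″ ; bounded = bounded″ } }

    above : S ≼ added
    above = record { members = there ; edges = te-attach as ; coarsens = λ x∈ y∈ eq → trans (kept x∈) (trans eq (sym (kept y∈))) }

    label-new : gid′ v ≡ l
    label-new = self

    label-old : ∀ {x} → x ∈ˡ N → gid′ x ≡ gid x
    label-old = kept

  -- A vertex outside `Y` has degree at most two and is its own group. So its removal creates at
  -- most one more component and leaves the other groups connected.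
  module Remove {Y c} (S : Skeleton Y c) {s : V} (s∈ : s ∈ˡ Skeleton.N S) (s∉ : s ∉ Y) where
    open Skeleton S

    private
      other? : U.Decidable (λ x → x ≢ s)
      other? x = ¬? (x ≟ᶠ s)

    N′ : List V
    N′ = filter other? N

    ∈N′⁺ : ∀ {x} → x ∈ˡ N → x ≢ s → x ∈ˡ N′
    ∈N′⁺ = ∈-filter⁺ other?

    ∈N′⁻ : ∀ {x} → x ∈ˡ N′ → x ∈ˡ N × x ≢ s
    ∈N′⁻ = ∈-filter⁻ other?

    private
      E′ : Edges
      E′ = remove s E

      in-group : ∀ {x y} → x ≢ s → x ∈ˡ N → Star (Within E gid) x y → Star (Within E′ gid) x y
      in-group x≢ x∈ ε = ε
      in-group x≢ x∈ ((e , eq) ◅ p) = (te-remove⁺ e x≢ z≢ , eq) ◅ in-group z≢ (ends′ e) p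
        where z≢ = λ { refl → x≢ (alone s∈ s∉ x∈ eq) }

      count′ : length N′ ≤ suc c + length E′
      count′ = ≤-pred (begin
        suc (length N′)            ≤⟨ Data.List.Properties.filter-notAll other? N (Any.map (λ { refl ≢s → ≢s refl }) s∈) ⟩
        length N                   ≤⟨ count ⟩
        c + length E               ≤⟨ +-monoʳ-≤ c (≤-trans (count-remove s E) (+-monoʳ-≤ (length E′) (thin s∈ s∉))) ⟩
        c + (length E′ + 2)        ≡⟨ cong (c +_) (+-comm (length E′) 2) ⟩
        c + (2 + length E′)        ≡⟨ +-assoc c 2 (length E′) ⟨
        c + 2 + length E′          ≡⟨ cong (_+ length E′) (+-comm c 2) ⟩
        2 + c + length E′          ∎)
        where open ≤-Reasoning

      label′ : ∀ {x} → x ∈ˡ N′ → gid x ∈ˡ N′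
      label′ x∈ with ∈N′⁻ x∈
      ... | x∈N , x≢ = ∈N′⁺ (label x∈N) λ eq → x≢ (alone s∈ s∉ x∈N (trans (sym (idem x∈N)) (cong gid eq)))

      adj′ : ∀ {x y} → x ∈ˡ N′ → y ∈ˡ N′ → Adj x y → TE E′ x y ⊎ gid x ≡ gid y
      adj′ x∈ y∈ e with adj (proj₁ (∈N′⁻ x∈)) (proj₁ (∈N′⁻ y∈)) e
      ... | inj₁ e′ = inj₁ (te-remove⁺ e′ (proj₂ (∈N′⁻ x∈)) (proj₂ (∈N′⁻ y∈)))
      ... | inj₂ eq = inj₂ eq

      class′ : ∀ {x} → x ∈ˡ N′ → ∃[ C ] (length C ≤ 8 × (∀ {y} → y ∈ˡ N′ → gid y ≡ gid x → y ∈ˡ C))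
      class′ x∈ with class (proj₁ (∈N′⁻ x∈))
      ... | C , len , all = C , len , λ y∈ → all (proj₁ (∈N′⁻ y∈))

    removed : Skeleton Y (suc c)
    removed = record { N = N′ ; E = E′ ; gid = gid ; forest = record
      { uniq = Uniqueₚ.filter⁺ other? uniq
      ; ends = λ e → let e′ , x≢ , _ = te-remove⁻ e in ∈N′⁺ (ends e′) x≢
      ; acyclic = acyclic-remove s E acyclic ; count = count′ ; label = label′ ; idem = λ x∈ → idem (proj₁ (∈N′⁻ x∈))
      ; adj = adj′ ; edge = λ e → edge (proj₁ (te-remove⁻ e))
      ; joined = λ x∈ y∈ eq → in-group (proj₂ (∈N′⁻ x∈)) (proj₁ (∈N′⁻ x∈)) (joined (proj₁ (∈N′⁻ x∈)) (proj₁ (∈N′⁻ y∈)) eq)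
      ; class = class′ ; alone = λ x∈ x∉ y∈ → alone (proj₁ (∈N′⁻ x∈)) x∉ (proj₁ (∈N′⁻ y∈))
      ; thin = λ {x} x∈ x∉ → ≤-trans (deg-remove s E x) (thin (proj₁ (∈N′⁻ x∈)) x∉)
      ; bounded = λ x → ≤-trans (deg-remove s E x) (bounded x) } }

-- New components, pendant vertices, bridges and growing paths.

module Growth (G : Graph) where

  open Graph G renaming (order to n; symmetric to adj-sym; loopless to adj-irrefl)
  open Forest n
  open Structure G
  open Skeletons G
  open Walks G using (adj-≢)

  record Placed {Y c c′} (S : Skeleton Y c) (v : V) (as : List V) (l : V) (S′ : Skeleton Y c′) : Set where
    private
      module S  = Skeleton S
      module S′ = Skeleton S′
    field
      above     : S ≼ S′
      new       : v ∈ˡ S′.N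
      new⁻      : ∀ {x} → x ∈ˡ S′.N → x ≡ v ⊎ x ∈ˡ S.N
      linked    : ∀ {a} → a ∈ˡ as → TE S′.E v a
      label-new : S′.gid v ≡ l
      label-old : ∀ {x} → x ∈ˡ S.N → S′.gid x ≡ S.gid x
      deg-new   : deg S′.E v ≤ length as
      deg-old   : ∀ {x} → x ∈ˡ S.N → deg S′.E x ≤ suc (deg S.E x)
      deg-same  : ∀ {x} → x ∈ˡ S.N → x ∉ˡ as → deg S′.E x ≡ deg S.E x

  sprout : ∀ {Y c} (S : Skeleton Y c) → let open Skeleton S in ∀ {v} → v ∉ˡ N → (∀ {x} → x ∈ˡ N → ¬ Adj v x) →
           ∃[ S′ ] Placed {c′ = suc c} S v [] v S′
  sprout {c = c} S {v} v∉ free = added , record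
    { above = above ; new = here refl ; new⁻ = λ { (here eq) → inj₁ eq ; (there x∈) → inj₂ x∈ } ; linked = λ ()
    ; label-new = label-new ; label-old = label-old ; deg-new = ≤-reflexive (no-degree {E} {v} (isolated-outside v∉))
    ; deg-old = λ _ → n≤1+n _ ; deg-same = λ _ _ → refl }
    where
    open Skeleton S
    open Add S v∉ [] (suc c) z≤n [] (λ ()) (λ ()) (λ x∈ e → contradiction e (free x∈)) own (λ ()) acyclic (m≤m+n (suc c) 0)

  pendant : ∀ {Y c} (S : Skeleton Y c) → let open Skeleton S in ∀ {v a l} → v ∉ˡ N → a ∈ˡ N → Adj v a →
            (∀ {x} → x ∈ˡ N → Adj v x → x ≡ a ⊎ gid x ≡ l) → Label S v (a ∷ []) l → deg E a ≤ 1 ⊎ (a ∈ Y × deg E a ≤ 3) →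
            Σ (Skeleton Y c) λ S′ → Placed S v (a ∷ []) l S′ ×
              (∀ {x} → x ∈ˡ N → Conn (Skeleton.E S′) v x → Conn E a x) ×
              (∀ {x y} → x ∈ˡ N → y ∈ˡ N → Conn (Skeleton.E S′) x y → Conn E x y)
  pendant {c = c} S {v} {a} v∉ a∈ va touch lab room = added , record
    { above = above ; new = here refl ; new⁻ = λ { (here eq) → inj₁ eq ; (there x∈) → inj₂ x∈ } ; linked = te-attach⁺
    ; label-new = label-new ; label-old = label-old
    ; deg-new = ≤-reflexive (trans (deg-attached {v} (a ∷ []) {E} (λ { (here refl) → v∉ a∈ })) (cong suc (no-degree {E} {v} (isolated-outside v∉))))
    ; deg-old = λ x∈ → deg-attach {v} (a ∷ []) {E} ([] ∷ []) (≢v x∈) ; deg-same = λ x∈ → deg-aside {v} (a ∷ []) {E} (≢v x∈) } ,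
    (λ x∈ → conn-pendant (isolated-outside v∉) (≢v x∈)) ,
    (λ x∈ y∈ → conn-old (isolated-outside v∉) (≢v x∈) (≢v y∈))
    where
    open Skeleton S
    ≢v : ∀ {x} → x ∈ˡ N → x ≢ v
    ≢v x∈ refl = v∉ x∈
    only : ∀ {P : Pred V 0ℓ} → P a → ∀ {x} → x ∈ˡ a ∷ [] → P x
    only p (here refl) = p
    open Add S v∉ (a ∷ []) c (s≤s z≤n) ([] ∷ []) (only a∈) (only va) (λ x∈ e → Data.Sum.Base.map here id (touch x∈ e)) lab (only room)
      (acyclic-pendant acyclic (isolated-outside v∉) (adj-≢ va)) (≤-reflexive (+-comm 1 c))

  bridge : ∀ {Y c} (S : Skeleton Y (suc c)) → let open Skeleton S in ∀ {v a b l} → v ∉ˡ N → a ∈ˡ N → b ∈ˡ N → Adj v a → Adj v b →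
           (∀ {x} → x ∈ˡ N → Adj v x → x ≡ a ⊎ x ≡ b ⊎ gid x ≡ l) → Label S v (a ∷ b ∷ []) l →
           deg E a ≤ 1 ⊎ (a ∈ Y × deg E a ≤ 3) → deg E b ≤ 1 ⊎ (b ∈ Y × deg E b ≤ 3) → ¬ Conn E a b →
           ∃[ S′ ] Placed {c′ = c} S v (a ∷ b ∷ []) l S′
  bridge {c = c} S {v} {a} {b} {l} v∉ a∈ b∈ va vb touch lab room-a room-b apart = added , record
    { above = above ; new = here refl ; new⁻ = λ { (here eq) → inj₁ eq ; (there x∈) → inj₂ x∈ } ; linked = te-attach⁺
    ; label-new = label-new ; label-old = label-old
    ; deg-new = ≤-reflexive (trans (deg-attached {v} (a ∷ b ∷ []) {E} (λ { (here refl) → v∉ a∈ ; (there (here refl)) → v∉ b∈ }))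
        (cong (2 +_) (no-degree {E} {v} (isolated-outside v∉))))
    ; deg-old = λ x∈ → deg-attach {v} (a ∷ b ∷ []) {E} distinct (≢v x∈) ; deg-same = λ x∈ → deg-aside {v} (a ∷ b ∷ []) {E} (≢v x∈) }
    where
    open Skeleton S
    ≢v : ∀ {x} → x ∈ˡ N → x ≢ v
    ≢v x∈ refl = v∉ x∈
    distinct : Unique (a ∷ b ∷ [])
    distinct = ((λ { refl → apart ε }) ∷ []) ∷ [] ∷ []
    touch′ : ∀ {x} → x ∈ˡ N → Adj v x → x ∈ˡ a ∷ b ∷ [] ⊎ gid x ≡ l
    touch′ x∈ e with touch x∈ e
    ... | inj₁ eq        = inj₁ (here eq)
    ... | inj₂ (inj₁ eq) = inj₁ (there (here eq))
    ... | inj₂ (inj₂ eq) = inj₂ eq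
    components : suc (suc c) ≤ c + 2
    components = ≤-reflexive (+-comm 2 c)
    either : ∀ {P : Pred V 0ℓ} → P a → P b → ∀ {x} → x ∈ˡ a ∷ b ∷ [] → P x
    either p q (here refl)         = p
    either p q (there (here refl)) = q
    open Add S v∉ (a ∷ b ∷ []) c ≤-refl distinct (either a∈ b∈) (either va vb)
      touch′ lab
      (either room-a room-b)
      (acyclic-bridge acyclic (isolated-outside v∉) (adj-≢ va) (adj-≢ vb) apart) components

  record InducedPath (r : ℕ → V) (m : ℕ) : Set where
    field
      inj     : ∀ {i j} → i ≤ m → j ≤ m → r i ≡ r j → i ≡ j
      step    : ∀ {i} → i < m → Adj (r i) (r (suc i))
      induced : ∀ {i j} → i ≤ m → j ≤ m → Adj (r i) (r j) → i ≡ suc j ⊎ j ≡ suc i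

  -- The path continues the forest from the old vertex `r 0`, and its new vertices are groups of
  -- their own. The last two fields say that no old vertices become connected, which a later bridge
  -- relies on.
  record Grown {Y c} (S : Skeleton Y c) (r : ℕ → V) (m : ℕ) (S′ : Skeleton Y c) : Set where
    private
      module S  = Skeleton S
      module S′ = Skeleton S′
    field
      above     : S ≼ S′
      new       : ∀ {i} → i ≤ m → r i ∈ˡ S′.N
      new⁻      : ∀ {x} → x ∈ˡ S′.N → x ∈ˡ S.N ⊎ ∃[ i ] (1 ≤ i × i ≤ m × x ≡ r i)
      links     : ∀ {i} → i < m → TE S′.E (r i) (r (suc i))
      label-old : ∀ {x} → x ∈ˡ S.N → S′.gid x ≡ S.gid x
      class-old : ∀ {x y} → x ∈ˡ S.N → y ∈ˡ S′.N → S′.gid y ≡ S.gid x → y ∈ˡ S.N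
      deg-top   : deg S′.E (r m) ≤ 1
      deg-old   : ∀ {x} → x ∈ˡ S.N → x ≢ r 0 → deg S′.E x ≡ deg S.E x
      conn-top  : ∀ {x} → x ∈ˡ S.N → Conn S′.E (r m) x → Conn S.E (r 0) x
      conn-old′ : ∀ {x y} → x ∈ˡ S.N → y ∈ˡ S.N → Conn S′.E x y → Conn S.E x y

  grow : ∀ {Y c} (S : Skeleton Y c) → let open Skeleton S in ∀ {r} m → InducedPath r m → r 0 ∈ˡ N → deg E (r 0) ≤ 1 →
         (∀ {i} → 1 ≤ i → i ≤ m → r i ∉ˡ N) → (∀ {i x} → 1 ≤ i → i ≤ m → x ∈ˡ N → Adj (r i) x → x ≡ r 0) → ∃ (Grown S r m)
  grow S zero path r₀∈ thin₀ fresh untouched = S , record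
    { above = ≼-refl ; new = λ { z≤n → r₀∈ } ; new⁻ = inj₁ ; links = λ () ; label-old = λ _ → refl ; class-old = λ _ y∈ _ → y∈
    ; deg-top = thin₀ ; deg-old = λ _ _ → refl ; conn-top = λ _ → id ; conn-old′ = λ _ _ → id }
  grow {Y} {c} S {r} (suc m) path r₀∈ thin₀ fresh untouched = extend (grow S m
      (record { inj = λ i≤ j≤ → inj (m≤n⇒m≤1+n i≤) (m≤n⇒m≤1+n j≤) ; step = λ i< → step (m≤n⇒m≤1+n i<)
              ; induced = λ i≤ j≤ → induced (m≤n⇒m≤1+n i≤) (m≤n⇒m≤1+n j≤) })
      r₀∈ thin₀ (λ 1≤ i≤ → fresh 1≤ (m≤n⇒m≤1+n i≤)) (λ 1≤ i≤ → untouched 1≤ (m≤n⇒m≤1+n i≤)))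
    where
    open Skeleton S
    open InducedPath path
    v = r (suc m)

    extend : ∃ (Grown S r m) → ∃ (Grown S r (suc m))
    extend (S₁ , g) = finish (pendant S₁ v∉ (g.new ≤-refl) (adj-sym (step ≤-refl)) (λ x∈ e → inj₁ (touch (g.new⁻ x∈) e)) own (inj₁ g.deg-top))
      where
      module g = Grown g
      module S₁ = Skeleton S₁

      v∉ : v ∉ˡ S₁.N
      v∉ v∈ with g.new⁻ v∈
      ... | inj₁ v∈N = fresh (s≤s z≤n) ≤-refl v∈N
      ... | inj₂ (i , _ , i≤ , eq) = <⇒≢ (s≤s i≤) (sym (inj ≤-refl (m≤n⇒m≤1+n i≤) eq))

      below-top : ∀ {i} → i ≤ m → Adj v (r i) → i ≡ m
      below-top i≤ e with induced ≤-refl (m≤n⇒m≤1+n i≤) e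
      ... | inj₁ eq = sym (suc-injective eq)
      ... | inj₂ refl = contradiction i≤ (<⇒≱ (n≤1+n (suc m)))

      touch : ∀ {x} → x ∈ˡ N ⊎ (∃[ i ] (1 ≤ i × i ≤ m × x ≡ r i)) → Adj v x → x ≡ r m
      touch (inj₁ x∈) e with untouched (s≤s z≤n) ≤-refl x∈ e
      ... | refl = cong r (below-top z≤n e)
      touch (inj₂ (i , _ , i≤ , refl)) e = cong r (below-top i≤ e)

      finish : (Σ (Skeleton Y c) λ S′ → Placed S₁ v (r m ∷ []) v S′ ×
                  (∀ {x} → x ∈ˡ S₁.N → Conn (Skeleton.E S′) v x → Conn S₁.E (r m) x) ×
                  (∀ {x y} → x ∈ˡ S₁.N → y ∈ˡ S₁.N → Conn (Skeleton.E S′) x y → Conn S₁.E x y)) → ∃ (Grown S r (suc m))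
      finish (S₂ , pl , conn-new , conn-keep) = S₂ , record
        { above = ≼-trans g.above P.above
        ; new = λ {i} i≤ → [ (λ i< → A.members (g.new (≤-pred i<))) , (λ { refl → P.new }) ] (m≤n⇒m<n∨m≡n i≤)
        ; new⁻ = λ x∈ → sort (P.new⁻ x∈)
        ; links = λ {i} i< → [ (λ i<m → A.edges (g.links (≤-pred i<m))) , (λ { refl → te-sym (P.linked (here refl)) }) ] (m≤n⇒m<n∨m≡n i<)
        ; label-old = λ x∈ → trans (P.label-old (G₁.members x∈)) (g.label-old x∈)
        ; class-old = λ x∈ y∈ eq → mates x∈ (P.new⁻ y∈) eq
        ; deg-top = P.deg-new
        ; deg-old = λ {x} x∈ x≢ → trans (P.deg-same (G₁.members x∈) (λ { (here eq) → not-top x∈ x≢ eq })) (g.deg-old x∈ x≢)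
        ; conn-top = λ x∈ p → g.conn-top x∈ (conn-new (G₁.members x∈) p)
        ; conn-old′ = λ x∈ y∈ p → g.conn-old′ x∈ y∈ (conn-keep (G₁.members x∈) (G₁.members y∈) p) }
        where
        module P = Placed pl
        module S₂ = Skeleton S₂
        module A = _≼_ P.above
        module G₁ = _≼_ g.above
        not-top : ∀ {x} → x ∈ˡ N → x ≢ r 0 → x ≢ r m
        not-top {x} x∈ x≢ eq = x≢ (trans eq (at m refl))
          where
          at : ∀ k → k ≡ m → r m ≡ r 0
          at zero    refl = refl
          at (suc k) refl = contradiction (subst (_∈ˡ N) eq x∈) (fresh (s≤s z≤n) (n≤1+n m))
        sort : ∀ {x} → x ≡ v ⊎ x ∈ˡ S₁.N → x ∈ˡ N ⊎ ∃[ i ] (1 ≤ i × i ≤ suc m × x ≡ r i)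
        sort (inj₁ eq) = inj₂ (suc m , s≤s z≤n , ≤-refl , eq)
        sort (inj₂ x∈) with g.new⁻ x∈
        ... | inj₁ x∈N = inj₁ x∈N
        ... | inj₂ (i , 1≤ , i≤ , eq) = inj₂ (i , 1≤ , m≤n⇒m≤1+n i≤ , eq)
        mates : ∀ {x y} → x ∈ˡ N → y ≡ v ⊎ y ∈ˡ S₁.N → S₂.gid y ≡ gid x → y ∈ˡ N
        mates x∈ (inj₁ refl) eq = contradiction
          (subst (_∈ˡ N) (trans (sym eq) P.label-new) (label x∈)) (fresh (s≤s z≤n) ≤-refl)
        mates x∈ (inj₂ y∈) eq = g.class-old x∈ y∈ (trans (sym (P.label-old y∈)) eq)

-- Paths hooked onto a group, and floating paths.

module Limbs (G : Graph) where

  open Graph G renaming (order to n; symmetric to adj-sym; loopless to adj-irrefl)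
  open Forest n
  open Structure G
  open Skeletons G
  open Growth G
  open Walks G using (adj-≢)

  record Limbed {Y c} (S : Skeleton Y c) (r : ℕ → V) (m : ℕ) (a : V) (S′ : Skeleton Y c) : Set where
    private
      module S  = Skeleton S
      module S′ = Skeleton S′
    field
      above     : S ≼ S′
      new       : ∀ {i} → i ≤ m → r i ∈ˡ S′.N
      new⁻      : ∀ {x} → x ∈ˡ S′.N → x ∈ˡ S.N ⊎ ∃[ i ] (i ≤ m × x ≡ r i)
      links     : ∀ {i} → i < m → TE S′.E (r i) (r (suc i))
      label-old : ∀ {x} → x ∈ˡ S.N → S′.gid x ≡ S.gid x
      mates     : ∀ {x y} → x ∈ˡ S.N → y ∈ˡ S′.N → S′.gid y ≡ S.gid x → y ∈ˡ S.N ⊎ y ≡ r 0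
      deg-top   : deg S′.E (r m) ≤ 1
      deg-old   : ∀ {x} → x ∈ˡ S.N → deg S′.E x ≤ suc (deg S.E x)
      conn-top  : ∀ {x} → x ∈ˡ S.N → Conn S′.E (r m) x → Conn S.E a x

  -- The vertex `r 0` may see several vertices of one group. It is linked to `a` alone and joins the
  -- group of `a`, so its further edges disappear in the contraction.
  limb : ∀ {Y c} (S : Skeleton Y c) → let open Skeleton S in ∀ {r m a} → InducedPath r m → a ∈ˡ N → Adj (r 0) a →
         (∀ {i} → i ≤ m → r i ∉ˡ N) → (∀ {x} → x ∈ˡ N → Adj (r 0) x → gid x ≡ gid a) →
         (∀ {i x} → 1 ≤ i → i ≤ m → x ∈ˡ N → ¬ Adj (r i) x) →
         Label S (r 0) (a ∷ []) (gid a) → a ∈ Y → deg E a ≤ 3 → ∃ (Limbed S r m a)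
  limb {Y} {c} S {r} {m} {a} path a∈ r₀a fresh touch₀ untouched lab a∈Y ≤3 =
    extend (pendant S (fresh z≤n) a∈ r₀a (λ x∈ e → inj₂ (touch₀ x∈ e)) lab (inj₂ (a∈Y , ≤3)))
    where
    open Skeleton S
    open InducedPath path

    extend : (Σ (Skeleton Y c) λ S₁ → Placed S (r 0) (a ∷ []) (gid a) S₁ ×
               (∀ {x} → x ∈ˡ N → Conn (Skeleton.E S₁) (r 0) x → Conn E a x) ×
               (∀ {x y} → x ∈ˡ N → y ∈ˡ N → Conn (Skeleton.E S₁) x y → Conn E x y)) → ∃ (Limbed S r m a)
    extend (S₁ , pl , conn-new , _) = finish (grow S₁ m path P.new P.deg-new
        (λ 1≤ i≤ r∈ → fresh₁ 1≤ i≤ (P.new⁻ r∈)) (λ 1≤ i≤ x∈ e → at-root 1≤ i≤ (P.new⁻ x∈) e))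
      where
      module S₁ = Skeleton S₁
      module P = Placed pl
      module A = _≼_ P.above

      fresh₁ : ∀ {i} → 1 ≤ i → i ≤ m → r i ≡ r 0 ⊎ r i ∈ˡ N → ⊥
      fresh₁ 1≤ i≤ (inj₁ eq) = contradiction (inj z≤n i≤ (sym eq)) (<⇒≢ 1≤)
      fresh₁ 1≤ i≤ (inj₂ r∈) = fresh i≤ r∈

      at-root : ∀ {i x} → 1 ≤ i → i ≤ m → x ≡ r 0 ⊎ x ∈ˡ N → Adj (r i) x → x ≡ r 0
      at-root _  _  (inj₁ eq) _ = eq
      at-root 1≤ i≤ (inj₂ x∈) e = contradiction e (untouched 1≤ i≤ x∈)

      finish : ∃ (Grown S₁ r m) → ∃ (Limbed S r m a)
      finish (S₂ , g) = S₂ , record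
        { above = ≼-trans P.above g.above
        ; new = g.new
        ; new⁻ = λ x∈ → sort (g.new⁻ x∈)
        ; links = g.links
        ; label-old = λ x∈ → trans (g.label-old (A.members x∈)) (P.label-old x∈)
        ; mates = λ x∈ y∈ eq → back (P.new⁻ (g.class-old (A.members x∈) y∈ (trans eq (sym (P.label-old x∈)))))
        ; deg-top = g.deg-top
        ; deg-old = λ x∈ → ≤-trans (≤-reflexive (g.deg-old (A.members x∈) (λ { refl → fresh z≤n x∈ }))) (P.deg-old x∈)
        ; conn-top = λ x∈ p → conn-new x∈ (g.conn-top (A.members x∈) p) }
        where
        module g = Grown g
        sort : ∀ {x} → x ∈ˡ S₁.N ⊎ ∃[ i ] (1 ≤ i × i ≤ m × x ≡ r i) → x ∈ˡ N ⊎ ∃[ i ] (i ≤ m × x ≡ r i)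
        sort (inj₂ (i , _ , i≤ , eq)) = inj₂ (i , i≤ , eq)
        sort (inj₁ x∈) with P.new⁻ x∈
        ... | inj₁ eq  = inj₂ (0 , z≤n , eq)
        ... | inj₂ x∈N = inj₁ x∈N
        back : ∀ {y} → y ≡ r 0 ⊎ y ∈ˡ N → y ∈ˡ N ⊎ y ≡ r 0
        back (inj₁ eq) = inj₂ eq
        back (inj₂ y∈) = inj₁ y∈

  record Floated {Y c} (S : Skeleton Y c) (r : ℕ → V) (m : ℕ) (S′ : Skeleton Y (suc c)) : Set where
    private
      module S  = Skeleton S
      module S′ = Skeleton S′
    field
      above : S ≼ S′
      new   : ∀ {i} → 1 ≤ i → i ≤ m → r i ∈ˡ S′.N
      new⁻  : ∀ {x} → x ∈ˡ S′.N → x ∈ˡ S.N ⊎ ∃[ i ] (1 ≤ i × i ≤ m × x ≡ r i)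
      links : ∀ {i} → 1 ≤ i → i < m → TE S′.E (r i) (r (suc i))

  more-components : ∀ {Y c} → Skeleton Y c → Skeleton Y (suc c)
  more-components S = record { N = N ; E = E ; gid = gid ; forest = record
    { uniq = uniq ; ends = ends ; acyclic = acyclic ; count = m≤n⇒m≤1+n count ; label = label ; idem = idem ; adj = adj ; edge = edge
    ; joined = joined ; class = class ; alone = alone ; thin = thin ; bounded = bounded } }
    where open Skeleton S

  -- The vertex `r 0`, which may see the old forest, is left out; the rest of the path becomes a
  -- component.
  float : ∀ {Y c} (S : Skeleton Y c) → let open Skeleton S in ∀ {r} m → InducedPath r m → (∀ {i} → 1 ≤ i → i ≤ m → r i ∉ˡ N) →
          (∀ {i x} → 1 ≤ i → i ≤ m → x ∈ˡ N → ¬ Adj (r i) x) → ∃ (Floated S r m)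
  -- Nothing is added, but the component count is raised to fit the general case.
  float S zero path fresh untouched = more-components S , record
    { above = record { members = id ; edges = id ; coarsens = λ _ _ → id } ; new = λ { (s≤s _) () } ; new⁻ = inj₁ ; links = λ _ () }
  float {Y} {c} S {r} (suc m) path fresh untouched = extend (sprout S (fresh ≤-refl (s≤s z≤n)) (untouched ≤-refl (s≤s z≤n)))
    where
    open Skeleton S
    open InducedPath path

    path′ : InducedPath (r ∘ suc) m
    path′ = record { inj = λ i≤ j≤ eq → suc-injective (inj (s≤s i≤) (s≤s j≤) eq) ; step = λ i< → step (s≤s i<)
                   ; induced = λ i≤ j≤ e → Data.Sum.Base.map suc-injective suc-injective (induced (s≤s i≤) (s≤s j≤) e) }

    extend : (∃[ S′ ] Placed {c′ = suc c} S (r 1) [] (r 1) S′) → ∃ (Floated S r (suc m))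
    extend (S₁ , pl) = finish (grow S₁ m path′ P.new (≤-trans P.deg-new z≤n)
        (λ 1≤ i≤ r∈ → fresh₁ 1≤ i≤ (P.new⁻ r∈)) (λ 1≤ i≤ x∈ e → at-root 1≤ i≤ (P.new⁻ x∈) e))
      where
      module S₁ = Skeleton S₁
      module P = Placed pl

      fresh₁ : ∀ {i} → 1 ≤ i → i ≤ m → r (suc i) ≡ r 1 ⊎ r (suc i) ∈ˡ N → ⊥
      fresh₁ 1≤ i≤ (inj₁ eq) = contradiction (suc-injective (inj (s≤s z≤n) (s≤s i≤) (sym eq))) (<⇒≢ 1≤)
      fresh₁ 1≤ i≤ (inj₂ r∈) = fresh (s≤s z≤n) (s≤s i≤) r∈

      at-root : ∀ {i x} → 1 ≤ i → i ≤ m → x ≡ r 1 ⊎ x ∈ˡ N → Adj (r (suc i)) x → x ≡ r 1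
      at-root _  _  (inj₁ eq) _ = eq
      at-root 1≤ i≤ (inj₂ x∈) e = contradiction e (untouched (s≤s z≤n) (s≤s i≤) x∈)

      finish : ∃ (Grown S₁ (r ∘ suc) m) → ∃ (Floated S r (suc m))
      finish (S₂ , g) = S₂ , record
        { above = ≼-trans P.above g.above
        ; new = λ { {suc i} _ (s≤s i≤) → g.new i≤ }
        ; new⁻ = λ x∈ → sort (g.new⁻ x∈)
        ; links = λ { {suc i} _ (s≤s i<) → g.links i< } }
        where
        module g = Grown g
        sort : ∀ {x} → x ∈ˡ S₁.N ⊎ ∃[ i ] (1 ≤ i × i ≤ m × x ≡ r (suc i)) → x ∈ˡ N ⊎ ∃[ i ] (1 ≤ i × i ≤ suc m × x ≡ r i)
        sort (inj₂ (i , _ , i≤ , eq)) = inj₂ (suc i , s≤s z≤n , s≤s i≤ , eq)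
        sort (inj₁ x∈) with P.new⁻ x∈
        ... | inj₁ eq  = inj₂ (1 , s≤s z≤n , s≤s z≤n , eq)
        ... | inj₂ x∈N = inj₁ x∈N

-- How core vertices touch the forest.

module Location (G : Graph) where

  open Graph G renaming (order to n; symmetric to adj-sym; loopless to adj-irrefl)
  open Forest n
  open Structure G
  open Skeletons G
  open Growth G
  open Walks G

  Touches : List V → V → Set
  Touches N v = ∃[ x ] (x ∈ˡ N × Adj v x)

  touches? : ∀ N → U.Decidable (Touches N)
  touches? N v = any? (λ x → (x ∈ˡ? N) ×-dec adj? v x)

  Avoids : V → VertexSet → Set
  Avoids v Y = ∀ {y} → y ∈ Y → ¬ Adj v y

  -- The neighbours of v in the forest are consecutive around some c outside Y.
  Centred : ∀ {Y c} → Skeleton Y c → V → Set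
  Centred {Y} S v = ∃[ c₀ ] (c₀ ∈ˡ N × c₀ ∉ Y × (∀ {y} → y ∈ˡ N → Adj v y → y ≡ c₀ ⊎ TE E c₀ y))
    where open Skeleton S

  Located : ∀ {Y c} → VertexSet → Skeleton Y c → Set
  Located K S = ∀ {v} → v ∈ K → v ∉ˡ Skeleton.N S → Touches (Skeleton.N S) v → Centred S v

  touched-list : ∀ {Y c} (S : Skeleton Y c) → let open Skeleton S in ∀ {K v} → Located K S → v ∈ K → v ∉ˡ N →
                 ∃[ W ] (length W ≤ 3 × (∀ {x} → x ∈ˡ N → Adj v x → x ∈ˡ W))
  touched-list S {K} {v} located v∈ v∉ with touches? (Skeleton.N S) v
  ... | no ¬t = [] , z≤n , λ x∈ e → contradiction (_ , x∈ , e) ¬t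
  ... | yes t with located v∈ v∉ t
  ... | c₀ , c₀∈ , c₀∉ , near = c₀ ∷ nbrs E c₀ , s≤s (thin c₀∈ c₀∉) , λ x∈ e → place (near x∈ e)
    where
    open Skeleton S
    place : ∀ {x} → x ≡ c₀ ⊎ TE E c₀ x → x ∈ˡ c₀ ∷ nbrs E c₀
    place (inj₁ eq) = here eq
    place (inj₂ e)  = there (te⇒nbr e)

  away? : ∀ K N → U.Decidable (λ v → v ∈ K × v ∉ˡ N)
  away? K N v = (v ∈? K) ×-dec ¬? (v ∈ˡ? N)

  -- The walk is stopped at its first vertex touching `N`, before it can enter `N`.
  approach : ∀ {K N z y} → z ∈ K → z ∉ˡ N → Path K z y → y ∈ˡ N ⊎ Touches N y →
             ∃[ a ] (a ∈ K × a ∉ˡ N × Touches N a × Path ⟪ away? K N ⟫ z a)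
  approach {K} {N} {z} z∈ z∉ p near with touches? N z
  ... | yes t = z , z∈ , z∉ , t , ε
  approach z∈ z∉ ε (inj₁ y∈) | no ¬t = contradiction y∈ z∉
  approach z∈ z∉ ε (inj₂ t)  | no ¬t = contradiction t ¬t
  approach {K} {N} {z} z∈ z∉ (_◅_ {j = w} (_ , w∈ , zw) p) near | no ¬t with approach w∈ (λ w∈N → ¬t (w , w∈N , zw)) p near
  ... | a , a∈ , a∉ , t , q = a , a∈ , a∉ , t ,
    (∈⟪⟫⁺ (away? K N) (z∈ , z∉) , ∈⟪⟫⁺ (away? K N) (w∈ , (λ w∈N → ¬t (w , w∈N , zw))) , zw) ◅ q

  -- If the old centre `c₀` has entered `Y′`, it did so with the window of some `w`. For `c₀ ≡ w`
  -- all possible contacts of `v` would be in `Y′`. Otherwise `w` is a neighbour of `c₀`, which has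
  -- degree at most two; so `v` has just one contact, and this is the new centre.
  recentre : ∀ {Y Y′ c} (S : Skeleton Y c) → let open Skeleton S in ∀ {v} → Y ⊆ Y′ → Avoids v Y′ →
    (∀ {x} → x ∈ˡ N → x ∈ Y′ → x ∉ Y → ∃[ w ] (w ∉ Y × x ∈ˡ window Y E w × (∀ {z} → z ∈ˡ window Y E w → z ∈ Y′))) →
    Touches N v → Centred S v → ∃[ c₁ ] (c₁ ∈ˡ N × c₁ ∉ Y′ × (∀ {y} → y ∈ˡ N → Adj v y → y ≡ c₁ ⊎ TE E c₁ y))
  recentre {Y} {Y′} S {v} Y⊆ av windows (x , x∈ , vx) (c₀ , c₀∈ , c₀∉Y , only) with c₀ ∈? Y′
  ... | no c₀∉ = c₀ , c₀∈ , c₀∉ , only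
  ... | yes c₀∈Y′ with windows c₀∈ c₀∈Y′ c₀∉Y
  ... | w , w∉ , c₀∈W , W⊆ = at (proj₁ (window⁻ {E = Skeleton.E S} w∉ c₀∈W))
    where
    open Skeleton S
    Goal = ∃[ c₁ ] (c₁ ∈ˡ N × c₁ ∉ Y′ × (∀ {y} → y ∈ˡ N → Adj v y → y ≡ c₁ ⊎ TE E c₁ y))

    spoke : ∀ {y} → y ∈ˡ N → Adj v y → TE E c₀ y
    spoke y∈ vy with only y∈ vy
    ... | inj₁ refl = contradiction vy (av c₀∈Y′)
    ... | inj₂ e    = e

    at : c₀ ≡ w ⊎ TE E w c₀ → Goal
    at (inj₁ refl) = contradiction vx (av (W⊆ (window⁺ {E = E} w∉ (λ x∈Y → av (Y⊆ x∈Y) vx) (inj₂ (spoke x∈ vx)))))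
    at (inj₂ wc₀)  = x , x∈ , (λ x∈Y′ → av x∈Y′ vx) , λ y∈ vy →
      inj₁ (sym (two-at-most (thin c₀∈ c₀∉Y) (te⇒nbr {E} (te-sym wc₀)) (te⇒nbr {E} (spoke x∈ vx)) (te⇒nbr {E} (spoke y∈ vy)) (w≢ vx) (w≢ vy)))
      where
      w≢ : ∀ {y} → Adj v y → w ≢ y
      w≢ vy refl = av (W⊆ (here refl)) vy

  module _ {R A Z : VertexSet} (Q : Shortest R A Z) where
    open Shortest Q

    initial-path : ∀ {m} → m ≤ ℓ → InducedPath p m
    initial-path m≤ = record
      { inj = λ i≤ j≤ → p-injective (≤-trans i≤ m≤) (≤-trans j≤ m≤) ; step = λ i< → step (≤-trans i< m≤)
      ; induced = λ i≤ j≤ → induced (≤-trans i≤ m≤) (≤-trans j≤ m≤) }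

    shortest-path : InducedPath p ℓ
    shortest-path = initial-path ≤-refl

    -- As the path is shortest, v touches at most three consecutive vertices of it.
    centre-on : ∀ {Y c} (S : Skeleton Y c) → let open Skeleton S in ∀ {v m} → m ≤ ℓ → v ∈ R → Avoids v Y → p 0 ∈ Y → p 1 ∈ Y →
      (∀ {i} → 2 ≤ i → i ≤ m → p i ∈ˡ N) → (∀ {i} → 2 ≤ i → i < m → TE E (p i) (p (suc i))) →
      (∀ {i} → 2 ≤ i → i < m → p i ∈ Y → p (suc i) ∈ Y) →
      (∀ {y} → y ∈ˡ N → Adj v y → ∃[ j ] (j ≤ m × y ≡ p j)) → Touches N v → Centred S v
    centre-on {Y} S {v} {m} m≤ v∈ av p₀∈ p₁∈ on links marked only (x , x∈ , vx) = split (only x∈ vx)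
      where
      open Skeleton S

      split : ∃[ j ] (j ≤ m × x ≡ p j) → Centred S v
      split (j , j≤ , refl) with least (λ i → (i ≤? m) ×-dec adj? v (p i)) j (j≤ , vx)
      ... | i , (i≤ , vi) , min = choose (suc (suc i) ≤? m)
        where
        2≤i : 2 ≤ i
        2≤i = late i vi
          where
          late : ∀ i → Adj v (p i) → 2 ≤ i
          late zero          e = contradiction e (av p₀∈)
          late (suc zero)    e = contradiction e (av p₁∈)
          late (suc (suc i)) _ = s≤s (s≤s z≤n)

        within : ∀ {y} → y ∈ˡ N → Adj v y → ∃[ k ] (i ≤ k × k ≤ i + 2 × k ≤ m × y ≡ p k)
        within y∈ vy with only y∈ vy
        ... | k , k≤ , refl = k , min k (k≤ , vy) , shortcut₂ (≤-trans i≤ m≤) (≤-trans k≤ m≤) v∈ vi vy , k≤ , refl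

        here-if : (∀ {k} → k ≤ m → k ≡ suc (suc i) → ¬ Adj v (p k)) → Centred S v
        here-if no-far = p i , on 2≤i i≤ , (λ pi∈ → av pi∈ vi) , λ y∈ vy → place (within y∈ vy) vy
          where
          place : ∀ {y} → ∃[ k ] (i ≤ k × k ≤ i + 2 × k ≤ m × y ≡ p k) → Adj v y → y ≡ p i ⊎ TE E (p i) y
          place (k , i≤k , k≤i+2 , k≤ , refl) vy with m≤n⇒m<n∨m≡n i≤k
          ... | inj₂ refl = inj₁ refl
          ... | inj₁ i<k with m≤n⇒m<n∨m≡n i<k
          ...   | inj₂ refl = inj₂ (links 2≤i k≤)
          ...   | inj₁ si<k = contradiction vy (no-far k≤ (≤-antisym (subst (k ≤_) (+-comm i 2) k≤i+2) si<k))

        choose : Dec (suc (suc i) ≤ m) → Centred S v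
        choose (no far) = here-if λ { k≤ refl → contradiction k≤ far }
        choose (yes i+2≤) with adj? v (p (suc (suc i)))
        ... | no ¬e = here-if λ { _ refl → ¬e }
        -- The middle vertex is outside `Y`: otherwise `marked` would put the third one into `Y`,
        -- but `v` sees it and avoids `Y`.
        ... | yes e = p (suc i) , on (m≤n⇒m≤1+n 2≤i) (<⇒≤ i+2≤) ,
          (λ m∈ → av (marked (m≤n⇒m≤1+n 2≤i) i+2≤ m∈) e) , λ y∈ vy → place (within y∈ vy)
          where
          place : ∀ {y} → ∃[ k ] (i ≤ k × k ≤ i + 2 × k ≤ m × y ≡ p k) → y ≡ p (suc i) ⊎ TE E (p (suc i)) y
          place (k , i≤k , k≤i+2 , k≤ , refl) with m≤n⇒m<n∨m≡n i≤k
          ... | inj₂ refl = inj₂ (te-sym (links 2≤i (<⇒≤ i+2≤)))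
          ... | inj₁ i<k with m≤n⇒m<n∨m≡n i<k
          ...   | inj₂ refl = inj₁ refl
          ...   | inj₁ si<k with ≤-antisym (subst (k ≤_) (+-comm i 2) k≤i+2) si<k
          ...     | refl = inj₂ (links (m≤n⇒m≤1+n 2≤i) i+2≤)

-- Contracting the groups.

module Quotient (G : Graph) where

  open Graph G renaming (order to n; symmetric to adj-sym; loopless to adj-irrefl)
  open Forest n
  open Elimination n
  open Structure G
  open Skeletons G
  open Walks G using (adj-≢)

  module Contract {Y c} (S : Skeleton Y c) where
    open Skeleton S

    label? : U.Decidable (λ x → gid x ≡ x)
    label? x = gid x ≟ᶠ x

    -- A group is represented by its label, the vertex of it that `gid` fixes.
    Nq : List V
    Nq = filter label? N

    outer? : U.Decidable (λ (e : V × V) → gid (proj₁ e) ≢ gid (proj₂ e))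
    outer? (a , b) = ¬? (gid a ≟ᶠ gid b)

    inner? : U.Decidable (λ (e : V × V) → gid (proj₁ e) ≡ gid (proj₂ e))
    inner? (a , b) = gid a ≟ᶠ gid b

    contract : Edges → Edges
    contract F = map (λ (a , b) → gid a , gid b) (filter outer? F)

    Eq : Edges
    Eq = contract E

    label∈Nq : ∀ {x} → x ∈ˡ N → gid x ∈ˡ Nq
    label∈Nq x∈ = ∈-filter⁺ label? (label x∈) (idem x∈)

    Nq⁻ : ∀ {l} → l ∈ˡ Nq → l ∈ˡ N × gid l ≡ l
    Nq⁻ = ∈-filter⁻ label?

    contract⁻ : ∀ {F l l′} → (l , l′) ∈ˡ contract F → ∃[ x ] ∃[ y ] ((x , y) ∈ˡ F × l ≡ gid x × l′ ≡ gid y × gid x ≢ gid y)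
    contract⁻ e with ∈-map⁻ _ e
    ... | (x , y) , xy∈ , refl = let xy∈F , x≢y = ∈-filter⁻ outer? xy∈ in x , y , xy∈F , refl , refl , x≢y

    contract-te⁻ : ∀ {F l l′} → TE (contract F) l l′ → ∃[ x ] ∃[ y ] (TE F x y × l ≡ gid x × l′ ≡ gid y × gid x ≢ gid y)
    contract-te⁻ (inj₁ e) = let x , y , xy , l≡ , l′≡ , x≢y = contract⁻ e in x , y , inj₁ xy , l≡ , l′≡ , x≢y
    contract-te⁻ (inj₂ e) = let y , x , yx , l′≡ , l≡ , y≢x = contract⁻ e in x , y , inj₂ yx , l≡ , l′≡ , λ eq → y≢x (sym eq)

    contract-te⁺ : ∀ {x y} → TE E x y → gid x ≢ gid y → TE Eq (gid x) (gid y)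
    contract-te⁺ (inj₁ e) x≢y = inj₁ (∈-map⁺ _ (∈-filter⁺ outer? e x≢y))
    contract-te⁺ (inj₂ e) x≢y = inj₂ (∈-map⁺ _ (∈-filter⁺ outer? e (λ eq → x≢y (sym eq))))

    ends-q : ∀ {l l′} → TE Eq l l′ → l ∈ˡ Nq
    ends-q e with contract-te⁻ {E} e
    ... | x , y , xy , refl , _ = label∈Nq (ends xy)

    loopfree-q : ∀ {l} → ¬ TE Eq l l
    loopfree-q e with contract-te⁻ {E} e
    ... | x , y , _ , l≡ , l≡′ , x≢y = x≢y (trans (sym l≡) l≡′)

    unique-q : Unique Nq
    unique-q = Uniqueₚ.filter⁺ label? uniq

    -- A walk in the contraction lifts to the forest through the connected groups. A cycle there
    -- would bypass the forest edge behind one of its edges.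
    acyclic-q : Acyclic Eq
    acyclic-q = go [] E refl
      where
      go : ∀ pre F → E ≡ pre ++ F → Acyclic (contract F)
      go pre [] _ = tt
      go pre ((a , b) ∷ F) eq = split (outer? (a , b))
        where
        rest : Acyclic (contract F)
        rest = go (pre ++ (a , b) ∷ []) F (trans eq (sym (Data.List.Properties.++-assoc pre ((a , b) ∷ []) F)))

        of-F : ∀ {x y} → TE F x y → TE E x y
        of-F (inj₁ e) = inj₁ (subst (_ ∈ˡ_) (sym eq) (∈-++⁺ʳ pre (there e)))
        of-F (inj₂ e) = inj₂ (subst (_ ∈ˡ_) (sym eq) (∈-++⁺ʳ pre (there e)))

        split : Dec (gid a ≢ gid b) → Acyclic (contract ((a , b) ∷ F))
        split (no same) = subst Acyclic (sym skip) rest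
          where
          skip : contract ((a , b) ∷ F) ≡ contract F
          skip = cong (map _) (Data.List.Properties.filter-reject outer? same)
        split (yes a≢b) = subst Acyclic (sym keep) ((λ p → acyclic-cut pre (subst Acyclic eq acyclic) (lift p a∈ refl b∈ refl)) , rest)
          where
          keep : contract ((a , b) ∷ F) ≡ (gid a , gid b) ∷ contract F
          keep = cong (map _) (Data.List.Properties.filter-accept outer? a≢b)
          ab : TE E a b
          ab = inj₁ (subst (_ ∈ˡ_) (sym eq) (∈-++⁺ʳ pre (here refl)))
          a∈ = ends ab
          b∈ = ends′ ab
          -- Paths within groups do not use the edge between a and b.
          within : ∀ {x y} → x ∈ˡ N → y ∈ˡ N → gid x ≡ gid y → Conn (pre ++ F) x y
          within x∈ y∈ same = gmap id (λ (e , eq′) → te-drop pre (subst (λ F → TE F _ _) eq e) (λ { refl → a≢b eq′ }) (λ { refl → a≢b (sym eq′) })) (joined x∈ y∈ same)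
          old : ∀ {x y} → TE F x y → TE (pre ++ F) x y
          old (inj₁ e) = inj₁ (∈-++⁺ʳ pre e)
          old (inj₂ e) = inj₂ (∈-++⁺ʳ pre e)
          lift : ∀ {l l′ x y} → Conn (contract F) l l′ → x ∈ˡ N → gid x ≡ l → y ∈ˡ N → gid y ≡ l′ → Conn (pre ++ F) x y
          lift ε x∈ x≡ y∈ y≡ = within x∈ y∈ (trans x≡ (sym y≡))
          lift (e ◅ p) x∈ x≡ y∈ y≡ with contract-te⁻ {F} e
          ... | u , v , uv , refl , refl , _ = within x∈ (ends (of-F uv)) x≡ ◅◅ old uv ◅ lift p (ends′ (of-F uv)) refl y∈ y≡

    -- The edges inside groups form a forest with at least one component for each group.
    count-q : length Nq ≤ c + length Eq
    count-q = +-cancelˡ-≤ (length Ein) (length Nq) (c + length Eq) (begin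
      length Ein + length Nq            ≡⟨ +-comm (length Ein) (length Nq) ⟩
      length Nq + length Ein            ≤⟨ +-monoˡ-≤ (length Ein) labels ⟩
      length Rs + length Ein            ≤⟨ few ⟩
      length N + sum (map (deg Ein) P)  ≡⟨ cong (length N +_) (no-cuts P (≤-trans (≤-reflexive (sym (*-identityˡ (length P)))) (≤-trans charged (≤-reflexive (weightless N))))) ⟩
      length N + 0                      ≡⟨ +-identityʳ (length N) ⟩
      length N                          ≤⟨ count ⟩
      c + length E                      ≡⟨ cong (c +_) (trans (filter-complement inner? E) (cong (length Ein +_) (sym (length-map _ (filter outer? E))))) ⟩
      c + (length Ein + length Eq)      ≡⟨ +-assoc c (length Ein) (length Eq) ⟨
      c + length Ein + length Eq        ≡⟨ cong (_+ length Eq) (+-comm c (length Ein)) ⟩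
      length Ein + c + length Eq        ≡⟨ +-assoc (length Ein) c (length Eq) ⟩
      length Ein + (c + length Eq)      ∎)
      where
      open ≤-Reasoning
      Ein : Edges
      Ein = filter inner? E
      inner : ∀ {x y} → TE Ein x y → TE E x y × gid x ≡ gid y
      inner (inj₁ e) = let e∈ , eq = ∈-filter⁻ inner? e in inj₁ e∈ , eq
      inner (inj₂ e) = let e∈ , eq = ∈-filter⁻ inner? e in inj₂ e∈ , sym eq
      -- With weight zero and threshold one nothing is cut, and `few` counts the components formed
      -- by the inner edges.
      parts : Parts N Ein (λ _ → 0) 1
      parts = eliminate (length N) ≤-refl ≤-refl uniq (λ e → ends (proj₁ (inner e))) (acyclic-filter inner? E acyclic)
        (λ e → adj-≢ (edge (proj₁ (inner e))) refl)
      open Parts parts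
      weightless : ∀ xs → total (λ _ → 0) xs ≡ 0
      weightless []       = refl
      weightless (x ∷ xs) = weightless xs
      no-cuts : ∀ P → length P ≤ 0 → sum (map (deg Ein) P) ≡ 0
      no-cuts [] _ = refl
      no-cut : ∀ P → length P ≤ 0 → ∀ {x} → x ∉ˡ P
      no-cut [] _ ()
      uncut : ∀ {x} → x ∉ˡ P
      uncut = no-cut P (≤-trans (≤-reflexive (sym (*-identityˡ (length P)))) (≤-trans charged (≤-reflexive (weightless N))))
      constant : ∀ {x y} → Star (Kept Ein P) x y → gid x ≡ gid y
      constant ε = refl
      constant ((e , _) ◅ p) = trans (proj₂ (inner e)) (constant p)
      labels : length Nq ≤ length Rs
      labels = ≤-trans (unique-length unique-q λ l∈ → subst (_∈ˡ map gid Rs)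
          (trans (sym (constant (to-rep (proj₁ (Nq⁻ l∈)) uncut))) (proj₂ (Nq⁻ l∈))) (∈-map⁺ gid (listed (proj₁ (Nq⁻ l∈)) uncut)))
        (≤-reflexive (length-map gid Rs))

    deg-contract : ∀ {l} C → (∀ {x} → x ∈ˡ N → gid x ≡ l → x ∈ˡ C) → ∀ F → (∀ {x y} → TE F x y → x ∈ˡ N) →
                   deg (contract F) l ≤ sum (map (deg F) C)
    deg-contract C all [] _ = z≤n
    deg-contract {l} C all ((a , b) ∷ F) ends-F = ≤-trans (split (outer? (a , b))) (≤-reflexive (sym expand))
      where
      fa fb : V → ℕ
      fa x = length (from x a b)
      fb x = length (from x b a)
      expand : sum (map (deg ((a , b) ∷ F)) C) ≡ sum (map fa C) + (sum (map fb C) + sum (map (deg F) C))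
      expand = trans (cong sum (Data.List.Properties.map-cong (deg-cons a b F) C))
        (trans (sum-+ fa (λ x → fb x + deg F x) C) (cong (sum (map fa C) +_) (sum-+ fb (deg F) C)))
      ih : deg (contract F) l ≤ sum (map (deg F) C)
      ih = deg-contract C all F (λ e → ends-F (te-there e))
      one : ∀ x y → x ∈ˡ N → length (from l (gid x) (gid y)) ≤ sum (map (λ z → length (from z x y)) C)
      one x y x∈ with l ≟ᶠ gid x
      ... | no _   = z≤n
      ... | yes eq = ≤-trans (≤-reflexive (sym (from-self x y))) (sum-member (λ z → length (from z x y)) (all x∈ (sym eq)))
      split : Dec (gid a ≢ gid b) → deg (contract ((a , b) ∷ F)) l ≤ sum (map fa C) + (sum (map fb C) + sum (map (deg F) C))
      split (no same) = subst (λ D → deg D l ≤ sum (map fa C) + (sum (map fb C) + sum (map (deg F) C))) (sym skip)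
          (≤-trans ih (≤-trans (m≤n+m _ (sum (map fb C))) (m≤n+m _ (sum (map fa C)))))
        where
        skip : contract ((a , b) ∷ F) ≡ contract F
        skip = cong (map _) (Data.List.Properties.filter-reject outer? same)
      split (yes a≢b) = subst (λ D → deg D l ≤ sum (map fa C) + (sum (map fb C) + sum (map (deg F) C))) (sym keep)
          (≤-trans (≤-reflexive (deg-cons (gid a) (gid b) (contract F) l))
            (+-mono-≤ (one a b (ends-F (inj₁ (here refl)))) (+-mono-≤ (one b a (ends-F (inj₂ (here refl)))) ih)))
        where
        keep : contract ((a , b) ∷ F) ≡ (gid a , gid b) ∷ contract F
        keep = cong (map _) (Data.List.Properties.filter-accept outer? a≢b)

    -- A group has at most eight vertices of degree at most four.
    deg-q : ∀ {l} → l ∈ˡ Nq → deg Eq l ≤ 32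
    deg-q {l} l∈ = bound (class (proj₁ (Nq⁻ l∈)))
      where
      bound : ∃[ C ] (length C ≤ 8 × (∀ {y} → y ∈ˡ N → gid y ≡ gid l → y ∈ˡ C)) → deg Eq l ≤ 32
      bound (C , len , all) = ≤-trans (deg-contract C (λ x∈ eq → all x∈ (trans eq (sym (proj₂ (Nq⁻ l∈))))) E ends)
        (≤-trans (sum-≤ (deg E) 4 C (λ {x} _ → bounded x)) (*-monoˡ-≤ 4 len))

-- Connectors, and the possible outcomes of a step.

module States (G : Graph) (B : Graph.VertexSet G) where

  open Graph G renaming (order to n; symmetric to adj-sym; loopless to adj-irrefl)
  open Forest n
  open Structure G
  open Skeletons G
  open Growth G
  open Location G
  open Walks G
  open Tangle G
  open Cycles G

  -- Both σ and a will lie on the cycles closed through the connector, so either of them may be in B.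
  record IsConnector {Y c} (S : Skeleton Y c) (σ a b : V) : Set where
    open Skeleton S
    field
      σ∈    : σ ∈ Y
      σ∉    : σ ∉ˡ N
      a∈    : a ∈ˡ N
      a∈Y   : a ∈ Y
      b∈    : b ∈ˡ N
      b∈Y   : b ∈ Y
      σa    : Adj σ a
      σb    : Adj σ b
      root  : σ ∈ B ⊎ a ∈ B
      only  : ∀ {y} → y ∈ˡ N → Adj σ y → gid y ≡ gid a ⊎ gid y ≡ gid b

  -- New forest vertices come from `clean Y` and `σ` is in `Y`, so a connector never gains contacts.
  connector-kept : ∀ {Y Y′ c c′} {S : Skeleton Y c} {S′ : Skeleton Y′ c′} → Y ⊆ Y′ → S ≼ S′ →
                   (∀ {x} → x ∈ˡ Skeleton.N S′ → x ∈ˡ Skeleton.N S ⊎ x ∈ clean Y) →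
                   ∀ {σ a b} → IsConnector S σ a b → IsConnector S′ σ a b
  connector-kept {S = S} {S′} Y⊆ S≼ fresh {σ} κ = record
    { σ∈ = Y⊆ σ∈ ; σ∉ = λ σ∈N → [ σ∉ , (λ σ∈c → clean∉ σ∈c σ∈) ] (fresh σ∈N) ; a∈ = members a∈ ; a∈Y = Y⊆ a∈Y
    ; b∈ = members b∈ ; b∈Y = Y⊆ b∈Y ; σa = σa ; σb = σb ; root = root ; only = λ y∈ e → only′ (fresh y∈) e }
    where
    open IsConnector κ
    open _≼_ S≼
    only′ : ∀ {y} → y ∈ˡ Skeleton.N S ⊎ y ∈ clean _ → Adj σ y → Skeleton.gid S′ y ≡ Skeleton.gid S′ _ ⊎ Skeleton.gid S′ y ≡ Skeleton.gid S′ _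
    only′ (inj₂ y∈) e = contradiction (adj-sym e) (clean-¬adj y∈ σ∈)
    only′ (inj₁ y∈) e with only y∈ e
    ... | inj₁ eq = inj₁ (coarsens y∈ a∈ eq)
    ... | inj₂ eq = inj₂ (coarsens y∈ b∈ eq)

  opaque

    infixl 6 _⊕_

    _⊕_ : VertexSet → List V → VertexSet
    Y ⊕ ys = Y ∪ ⋃ˡ ys

    ∈⊕⁺ˡ : ∀ {Y ys v} → v ∈ Y → v ∈ Y ⊕ ys
    ∈⊕⁺ˡ v∈ = x∈p∪q⁺ (inj₁ v∈)

    ∈⊕⁺ʳ : ∀ {Y ys v} → v ∈ˡ ys → v ∈ Y ⊕ ys
    ∈⊕⁺ʳ v∈ = x∈p∪q⁺ (inj₂ (∈⋃ˡ⁺ v∈))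

    ∈⊕⁻ : ∀ {Y ys v} → v ∈ Y ⊕ ys → v ∈ Y ⊎ v ∈ˡ ys
    ∈⊕⁻ {Y} {ys} v∈ = Data.Sum.Base.map₂ (∈⋃ˡ⁻ ys) (x∈p∪q⁻ Y (⋃ˡ ys) v∈)

    ∣⊕∣≤ : ∀ Y ys → ∣ Y ⊕ ys ∣ ≤ ∣ Y ∣ + length ys
    ∣⊕∣≤ Y ys = ≤-trans (∣∪∣≤ Y (⋃ˡ ys)) (+-monoʳ-≤ ∣ Y ∣ (∣⋃ˡ∣≤ ys))

  record Advance {Y Y′ c c′} (S : Skeleton Y c) (S′ : Skeleton Y′ c′) : Set where
    field
      located : Located (core Y′) S′
      housed  : ∀ {x} → x ∈ˡ Skeleton.N S → x ∈ Y′ ⊎ x ∈ˡ Skeleton.N S′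
      kept    : ∀ {σ a b} → IsConnector S σ a b → IsConnector S′ σ a b

  -- A connector leaves the bound on the components unchanged, a cycle raises it by two. The steps
  -- below add at most 13 vertices to `Y`, so 32 is generous. `W` holds the forest vertices next to
  -- the cycle: three each for the vertex `s` and the first vertices of its two paths.
  data Outcome {Y c} (S : Skeleton Y c) : Set where
    connect : ∀ {ys} → length ys ≤ 32 → {S′ : Skeleton (Y ⊕ ys) c} → Advance S S′ →
              ∀ {σ a b} → IsConnector S′ σ a b → σ ∈ clean Y → a ∉ Y → b ∉ Y → a ≢ b → Outcome S
    enclose : ∀ {ys} → length ys ≤ 32 → {S′ : Skeleton (Y ⊕ ys) (2 + c)} → Advance S S′ →
              ∀ {Γ apex} → (∀ {v} → v ∈ Γ → v ∈ clean Y × v ∉ˡ Skeleton.N S × (v ∈ Y ⊕ ys ⊎ v ∈ˡ Skeleton.N S′)) →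
              apex ∈ B → CycleThrough apex (_∈ Γ) →
              ∀ {W} → length W ≤ 9 → (∀ {v x} → v ∈ Γ → x ∈ˡ Skeleton.N S → Adj v x → x ∈ˡ W) → Outcome S

  InWindow : ∀ {Y c} → Skeleton Y c → List V → V → Set
  InWindow {Y} S ys x = ∃[ w ] (w ∉ Y × x ∈ˡ window Y E w × (∀ {z} → z ∈ˡ window Y E w → z ∈ˡ ys))
    where open Skeleton S

  -- Forest vertices have to enter `Y` in whole windows, or core vertices centred at one of them
  -- could lose their centre.
  Windowed : ∀ {Y c} → Skeleton Y c → List V → Set
  Windowed S ys = ∀ {x} → x ∈ˡ Skeleton.N S → x ∈ˡ ys → InWindow S ys x

  recentre-⊕ : ∀ {Y c ys} (S : Skeleton Y c) → let open Skeleton S in ∀ {v} → Avoids v (Y ⊕ ys) → Windowed S ys → Touches N v → Centred S v →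
               ∃[ c₁ ] (c₁ ∈ˡ N × c₁ ∉ Y ⊕ ys × (∀ {y} → y ∈ˡ N → Adj v y → y ≡ c₁ ⊎ TE E c₁ y))
  recentre-⊕ {Y} {c} {ys} S av windows = recentre S ∈⊕⁺ˡ av λ x∈ x∈Y′ x∉ → go x∈ x∉ (∈⊕⁻ x∈Y′)
    where
    open Skeleton S
    go : ∀ {x} → x ∈ˡ N → x ∉ Y → x ∈ Y ⊎ x ∈ˡ ys → ∃[ w ] (w ∉ Y × x ∈ˡ window Y E w × (∀ {z} → z ∈ˡ window Y E w → z ∈ Y ⊕ ys))
    go x∈ x∉ (inj₁ x∈Y) = contradiction x∈Y x∉
    go x∈ x∉ (inj₂ x∈ys) with windows x∈ x∈ys
    ... | w , w∉ , x∈W , W⊆ = w , w∉ , x∈W , λ z∈ → ∈⊕⁺ʳ (W⊆ z∈)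

  transfer : ∀ {Y Y′ c c′} {S : Skeleton Y c} {S′ : Skeleton Y′ c′} → S ≼ S′ → ∀ {v} →
             (∀ {y} → y ∈ˡ Skeleton.N S′ → Adj v y → y ∈ˡ Skeleton.N S) →
             ∃[ c₁ ] (c₁ ∈ˡ Skeleton.N S × c₁ ∉ Y′ × (∀ {y} → y ∈ˡ Skeleton.N S → Adj v y → y ≡ c₁ ⊎ TE (Skeleton.E S) c₁ y)) →
             Centred S′ v
  transfer S≼ only (c₁ , c₁∈ , c₁∉ , near) = c₁ , members c₁∈ , c₁∉ , λ y∈ e → Data.Sum.Base.map₂ edges (near (only y∈ e) e)
    where open _≼_ S≼

  regrouped : ∀ {Y c ys c₁ c₂} (S : Skeleton Y c) → let open Skeleton S in c₁ ∈ˡ N → c₁ ∉ Y → c₂ ∈ˡ N → c₂ ∉ Y →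
              (∀ {x} → x ∈ˡ window Y E c₁ → x ∈ˡ ys) → (∀ {x} → x ∈ˡ window Y E c₂ → x ∈ˡ ys) →
              Grouping (Y ⊕ ys) N E gid c (window Y E c₁) (window Y E c₂)
  regrouped S c₁∈ c₁∉ c₂∈ c₂∉ W₁⊆ W₂⊆ = group-windows (Skeleton.forest S) ∈⊕⁺ˡ c₁∈ c₁∉ c₂∈ c₂∉ (λ x∈ → ∈⊕⁺ʳ (W₁⊆ x∈)) (λ x∈ → ∈⊕⁺ʳ (W₂⊆ x∈))

  window-short : ∀ {Y c} (S : Skeleton Y c) → let open Skeleton S in ∀ {w} → w ∈ˡ N → w ∉ Y → length (window Y E w) ≤ 3
  window-short {Y} S {w} w∈ w∉ = s≤s (≤-trans (length-filter (λ x → ¬? (x ∈? Y)) (nbrs (Skeleton.E S) w)) (Skeleton.thin S w∈ w∉))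

  window⊆N : ∀ {Y c} (S : Skeleton Y c) → let open Skeleton S in ∀ {w x} → w ∈ˡ N → w ∉ Y → x ∈ˡ window Y E w → x ∈ˡ N
  window⊆N S w∈ w∉ x∈ with window⁻ {E = Skeleton.E S} w∉ x∈
  ... | inj₁ refl , _ = w∈
  ... | inj₂ e , _    = Skeleton.ends′ S e

  -- Two windows are added to Y and become groups, along with some special vertices.
  module Patch {Y c} (S : Skeleton Y c) {c₁ c₂} (c₁∈ : c₁ ∈ˡ Skeleton.N S) (c₁∉ : c₁ ∉ Y) (c₂∈ : c₂ ∈ˡ Skeleton.N S) (c₂∉ : c₂ ∉ Y)
               (specials : List V) where
    open Skeleton S

    W₁ W₂ ys : List V
    W₁ = window Y E c₁
    W₂ = window Y E c₂
    ys = specials ++ W₁ ++ W₂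

    W≤ : length (W₁ ++ W₂) ≤ 6
    W≤ = ≤-trans (≤-reflexive (length-++ W₁)) (+-mono-≤ (window-short S c₁∈ c₁∉) (window-short S c₂∈ c₂∉))

    ys≤ : length ys ≤ length specials + 6
    ys≤ = ≤-trans (≤-reflexive (length-++ specials)) (+-monoʳ-≤ (length specials) W≤)

    special : ∀ {x} → x ∈ˡ specials → x ∈ Y ⊕ ys
    special x∈ = ∈⊕⁺ʳ (∈-++⁺ˡ x∈)

    W₁⊆ys : ∀ {x} → x ∈ˡ W₁ → x ∈ˡ ys
    W₁⊆ys x∈ = ∈-++⁺ʳ specials (∈-++⁺ˡ x∈)

    W₂⊆ys : ∀ {x} → x ∈ˡ W₂ → x ∈ˡ ys
    W₂⊆ys x∈ = ∈-++⁺ʳ specials (∈-++⁺ʳ W₁ x∈)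

    W₁⊆ : ∀ {x} → x ∈ˡ W₁ → x ∈ Y ⊕ ys
    W₁⊆ x∈ = ∈⊕⁺ʳ (W₁⊆ys x∈)

    W₂⊆ : ∀ {x} → x ∈ˡ W₂ → x ∈ Y ⊕ ys
    W₂⊆ x∈ = ∈⊕⁺ʳ (W₂⊆ys x∈)

    gr : Grouping (Y ⊕ ys) N E gid c W₁ W₂
    gr = regrouped S c₁∈ c₁∉ c₂∈ c₂∉ W₁⊆ys W₂⊆ys
    module Gr = Grouping gr

    S₀ : Skeleton (Y ⊕ ys) c
    S₀ = record { N = N ; E = E ; gid = Gr.gid′ ; forest = Gr.forest }

    S≼S₀ : S ≼ S₀
    S≼S₀ = record { members = id ; edges = id ; coarsens = Gr.coarser }

    by-window : ∀ {Q : Pred V 0ℓ} → (∀ {x} → x ∈ˡ W₁ → Q x) → (∀ {x} → x ∈ˡ W₂ → Q x) → ∀ {x} → x ∈ˡ W₁ ++ W₂ → Q x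
    by-window f g x∈ with ∈-++⁻ W₁ x∈
    ... | inj₁ x∈₁ = f x∈₁
    ... | inj₂ x∈₂ = g x∈₂

    windows⊆N : ∀ {x} → x ∈ˡ W₁ ++ W₂ → x ∈ˡ N
    windows⊆N = by-window {_∈ˡ N} (window⊆N S c₁∈ c₁∉) (window⊆N S c₂∈ c₂∉)

    in-window : ∀ {x} → x ∈ˡ W₁ ++ W₂ → InWindow S ys x
    in-window = by-window {InWindow S ys} (λ x∈₁ → c₁ , c₁∉ , x∈₁ , W₁⊆ys) (λ x∈₂ → c₂ , c₂∉ , x∈₂ , W₂⊆ys)

    windowed : All (λ x → x ∈ˡ N → InWindow S ys x) specials → Windowed S ys
    windowed specials-in {x} x∈ x∈ys with ∈-++⁻ specials x∈ys
    ... | inj₁ x∈s = All.lookup specials-in x∈s x∈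
    ... | inj₂ x∈W = in-window x∈W

    unmarked : ∀ {x} → x ∉ˡ N → All (x ≢_) specials → x ∉ˡ ys
    unmarked x∉ others x∈ys with ∈-++⁻ specials x∈ys
    ... | inj₁ x∈s = All.lookup others x∈s refl
    ... | inj₂ x∈W = x∉ (windows⊆N x∈W)

    touched₁ : ∀ {v x} → v ∈ clean Y → (∀ {y} → y ∈ˡ N → Adj v y → y ≡ c₁ ⊎ TE E c₁ y) → x ∈ˡ N → Adj v x → x ∈ˡ W₁
    touched₁ v∈ near x∈ e = window⁺ {E = E} c₁∉ (λ x∈Y → clean-¬adj v∈ x∈Y e) (near x∈ e)

    touched₂ : ∀ {v x} → v ∈ clean Y → (∀ {y} → y ∈ˡ N → Adj v y → y ≡ c₂ ⊎ TE E c₂ y) → x ∈ˡ N → Adj v x → x ∈ˡ W₂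
    touched₂ v∈ near x∈ e = window⁺ {E = E} c₂∉ (λ x∈Y → clean-¬adj v∈ x∈Y e) (near x∈ e)

-- Two paths from a vertex outside the forest.

module Pairs (G : Graph) (B : Graph.VertexSet G) where

  open Graph G renaming (order to n; symmetric to adj-sym; loopless to adj-irrefl)
  open Forest n
  open Structure G
  open Skeletons G
  open Growth G
  open Limbs G
  open Location G
  open Walks G
  open Tangle G
  open Cycles G
  open States G B

  other-neighbours? : ∀ s t → U.Decidable (λ v → Adj s v × v ≢ t)
  other-neighbours? s t v = adj? s v ×-dec ¬? (v ≟ᶠ t)

  vertices-of : (ℕ → V) → ℕ → List V
  vertices-of p m = map p (upTo (suc m))

  ∈-vertices⁺ : ∀ {p m i} → i ≤ m → p i ∈ˡ vertices-of p m
  ∈-vertices⁺ {p} i≤ = ∈-map⁺ p (∈-upTo⁺ (s≤s i≤))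

  ∈-vertices⁻ : ∀ {p m x} → x ∈ˡ vertices-of p m → ∃[ i ] (i ≤ m × x ≡ p i)
  ∈-vertices⁻ {p} x∈ with ∈-map⁻ p x∈
  ... | i , i∈ , eq = i , ≤-pred (∈-upTo⁻ i∈) , eq

  -- L joins s to a vertex near the forest N, or floats; Q joins s to N or L.
  record Pairing {Y c} (S : Skeleton Y c) (s : V) : Set where
    open Skeleton S
    field
      located : Located (core Y) S
      s∈      : s ∈ core Y
      s∉N     : s ∉ˡ N
      s∈B     : s ∈ B
      {A Z}   : VertexSet
      L       : Shortest ⟪ away? (Ω (clean Y ∖ s)) N ⟫ A Z
      near-L  : ∀ {v i} → v ∈ Ω (clean Y ∖ s) → v ∉ˡ N → Touches N v → i ≤ Shortest.ℓ L → Adj v (Shortest.p L i) → i ≤ 1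
      only-L  : ∀ {i} → i ≤ Shortest.ℓ L → Touches N (Shortest.p L i) → i ≡ 0
      top-L   : Adj s (Shortest.p L (Shortest.ℓ L))
      end-L   : ∀ {i} → i ≤ Shortest.ℓ L → Adj s (Shortest.p L i) → i ≡ Shortest.ℓ L
      Q       : Shortest ⟪ away? (Ω (clean Y ∖ s)) (N ++ vertices-of (Shortest.p L) (Shortest.ℓ L)) ⟫
                  ⟪ touches? (N ++ vertices-of (Shortest.p L) (Shortest.ℓ L)) ⟫ ⟪ other-neighbours? s (Shortest.p L (Shortest.ℓ L)) ⟫

  module Pair {Y c} {S : Skeleton Y c} {s : V} (pairing : Pairing S s) where

    open Skeleton S
    open Pairing pairing
    module L = Shortest L
    module Q = Shortest Q
    open L using (p; ℓ)
    open Q using () renaming (p to q; ℓ to m)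

    K : VertexSet
    K = Ω (clean Y ∖ s)

    K⊆core : K ⊆ core Y
    K⊆core = Ω-mono (λ v∈ → proj₁ (∈∖⁻ (Ω⊆ v∈)))

    K⊆clean : K ⊆ clean Y
    K⊆clean v∈ = Ω⊆ (K⊆core v∈)

    s∉K : s ∉ K
    s∉K s∈K = proj₂ (∈∖⁻ (Ω⊆ s∈K)) refl

    p∈K : ∀ i → p i ∈ K
    p∈K i = proj₁ (∈⟪⟫⁻ (away? _ _) (L.inside i))

    p∉N : ∀ i → p i ∉ˡ N
    p∉N i = proj₂ (∈⟪⟫⁻ (away? _ _) (L.inside i))

    q∈K : ∀ i → q i ∈ K
    q∈K i = proj₁ (∈⟪⟫⁻ (away? _ _) (Q.inside i))

    q∉NL : ∀ i → q i ∉ˡ N ++ vertices-of p ℓ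
    q∉NL i = proj₂ (∈⟪⟫⁻ (away? _ _) (Q.inside i))

    q∉N : ∀ i → q i ∉ˡ N
    q∉N i q∈ = q∉NL i (∈-++⁺ˡ q∈)

    q≢p : ∀ {i j} → j ≤ ℓ → q i ≢ p j
    q≢p {i} j≤ eq = q∉NL i (∈-++⁺ʳ N (subst (_∈ˡ vertices-of p ℓ) (sym eq) (∈-vertices⁺ j≤)))

    q≢p* : ∀ {i j} → q i ≢ p j
    q≢p* {i} {j} with ≤-total j ℓ
    ... | inj₁ j≤ = q≢p j≤
    ... | inj₂ ℓ≤ = λ eq → q≢p ≤-refl (trans eq (L.beyond ℓ≤))

    touch-N : ∀ {v} → Touches N v → v ∈ ⟪ touches? (N ++ vertices-of p ℓ) ⟫
    touch-N (x , x∈ , e) = ∈⟪⟫⁺ (touches? _) (x , ∈-++⁺ˡ x∈ , e)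

    touch-L : ∀ {v i} → i ≤ ℓ → Adj v (p i) → v ∈ ⟪ touches? (N ++ vertices-of p ℓ) ⟫
    touch-L i≤ e = ∈⟪⟫⁺ (touches? _) (_ , ∈-++⁺ʳ N (∈-vertices⁺ i≤) , e)

    end-Q : ∀ {i} → i ≤ m → Adj s (q i) → i ≡ m
    end-Q i≤ e = Q.only-finish i≤ (∈⟪⟫⁺ (other-neighbours? _ _) (e , q≢p ≤-refl))

    top-Q : Adj s (q m)
    top-Q = proj₁ (∈⟪⟫⁻ (other-neighbours? _ _) Q.finish)

    specials-outside : All (_∉ˡ N) (s ∷ p 0 ∷ p 1 ∷ q 0 ∷ q 1 ∷ [])
    specials-outside = s∉N ∷ p∉N 0 ∷ p∉N 1 ∷ q∉N 0 ∷ q∉N 1 ∷ []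

    p-fresh : ∀ {i} → 2 ≤ i → i < ℓ → All (p i ≢_) (s ∷ p 0 ∷ p 1 ∷ q 0 ∷ q 1 ∷ [])
    p-fresh {i} 2≤ i< = (λ eq → s∉K (subst (_∈ K) eq (p∈K i))) ∷ (λ eq → <⇒≢ (<-trans z<s 2≤) (L.p-injective z≤n (<⇒≤ i<) (sym eq))) ∷
      (λ eq → <⇒≢ 2≤ (L.p-injective (≤-trans (<⇒≤ 2≤) (<⇒≤ i<)) (<⇒≤ i<) (sym eq))) ∷ (λ eq → q≢p* (sym eq)) ∷ (λ eq → q≢p* (sym eq)) ∷ []

    q-fresh : ∀ {i} → 2 ≤ i → i < m → All (q i ≢_) (s ∷ p 0 ∷ p 1 ∷ q 0 ∷ q 1 ∷ [])
    q-fresh {i} 2≤ i< = (λ eq → s∉K (subst (_∈ K) eq (q∈K i))) ∷ q≢p* ∷ q≢p* ∷ (λ eq → <⇒≢ (<-trans z<s 2≤) (Q.p-injective z≤n (<⇒≤ i<) (sym eq))) ∷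
      (λ eq → <⇒≢ 2≤ (Q.p-injective (≤-trans (<⇒≤ 2≤) (<⇒≤ i<)) (<⇒≤ i<) (sym eq))) ∷ []

    -- The new forest consists of N and of final parts of both paths.
    module _ {ys c′} (S′ : Skeleton (Y ⊕ ys) c′) (S≼ : S ≼ S′) (windows : Windowed S ys)
      (specials : ∀ {x} → x ∈ˡ s ∷ p 0 ∷ p 1 ∷ q 0 ∷ q 1 ∷ [] → x ∈ˡ ys)
      (inside-p : ∀ {i} → 2 ≤ i → i < ℓ → p i ∉ˡ ys) (inside-q : ∀ {i} → 2 ≤ i → i < m → q i ∉ˡ ys)
      (new-p : ∀ {i} → 1 ≤ i → i ≤ ℓ → p i ∈ˡ Skeleton.N S′) (new-q : ∀ {i} → 1 ≤ i → i ≤ m → q i ∈ˡ Skeleton.N S′)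
      (new⁻ : ∀ {x} → x ∈ˡ Skeleton.N S′ → x ∈ˡ N ⊎ (∃[ i ] (i ≤ ℓ × x ≡ p i)) ⊎ (∃[ i ] (i ≤ m × x ≡ q i)))
      (links-p : ∀ {i} → 1 ≤ i → i < ℓ → TE (Skeleton.E S′) (p i) (p (suc i)))
      (links-q : ∀ {i} → 1 ≤ i → i < m → TE (Skeleton.E S′) (q i) (q (suc i))) where

      private
        module S′ = Skeleton S′
        Y′ = Y ⊕ ys

        -- If `v` touched two of the forest, `L` and `Q`, it could itself start one of the paths it
        -- touches. So it would see only the first two vertices of this path, and these are in `Y`.
        -- Hence `v` touches just one of the three, and its centre is found there.
        module Spot {v} (v∈core : v ∈ core Y′) (v∉ : v ∉ˡ S′.N) where

          av : Avoids v Y′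
          av y∈ = clean-¬adj (Ω⊆ v∈core) y∈

          ∉ys : v ∉ˡ ys
          ∉ys v∈ = clean∉ (Ω⊆ v∈core) (∈⊕⁺ʳ v∈)

          av-ys : ∀ {y} → y ∈ˡ s ∷ p 0 ∷ p 1 ∷ q 0 ∷ q 1 ∷ [] → ¬ Adj v y
          av-ys y∈ = av (∈⊕⁺ʳ (specials y∈))

          v∈K : v ∈ K
          v∈K = core-minus ∈⊕⁺ˡ (∈⊕⁺ʳ (specials (here refl))) v∈core

          v∉N : v ∉ˡ N
          v∉N v∈ = v∉ (_≼_.members S≼ v∈)

          v≢p : ∀ i → i ≤ ℓ → v ≢ p i
          v≢p zero    _  refl = ∉ys (specials (there (here refl)))
          v≢p (suc i) i≤ refl = v∉ (new-p (s≤s z≤n) i≤)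

          v∈R : v ∈ ⟪ away? K N ⟫
          v∈R = ∈⟪⟫⁺ (away? K N) (v∈K , v∉N)

          v∈R′ : v ∈ ⟪ away? K (N ++ vertices-of p ℓ) ⟫
          v∈R′ = ∈⟪⟫⁺ (away? K (N ++ vertices-of p ℓ)) (v∈K , λ v∈ → [ v∉N , on-L ] (∈-++⁻ N v∈))
            where
            on-L : v ∉ˡ vertices-of p ℓ
            on-L v∈L with ∈-vertices⁻ {p = p} v∈L
            ... | i , i≤ , eq = v≢p i i≤ eq

          low-p : ∀ {i} → i ≤ 1 → ¬ Adj v (p i)
          low-p z≤n       = av-ys (there (here refl))
          low-p (s≤s z≤n) = av-ys (there (there (here refl)))

          low-q : ∀ {i} → i ≤ 1 → ¬ Adj v (q i)
          low-q z≤n       = av-ys (there (there (there (here refl))))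
          low-q (s≤s z≤n) = av-ys (there (there (there (there (here refl)))))

          N-not-p : ∀ {i} → Touches N v → i ≤ ℓ → ¬ Adj v (p i)
          N-not-p t i≤ e = low-p (near-L v∈K v∉N t i≤ e) e

          N-not-q : ∀ {i} → Touches N v → i ≤ m → ¬ Adj v (q i)
          N-not-q t i≤ e = low-q (Q.near-start i≤ v∈R′ (touch-N t) e) e

          p-not-q : ∀ {i j} → i ≤ ℓ → Adj v (p i) → j ≤ m → ¬ Adj v (q j)
          p-not-q i≤ e j≤ e′ = low-q (Q.near-start j≤ v∈R′ (touch-L i≤ e) e′) e′

          centred : Touches S′.N v → Centred S′ v
          centred (x , x∈ , vx) with new⁻ x∈
          ... | inj₁ x∈N = transfer S≼ only (recentre-⊕ S av windows t (located (K⊆core v∈K) v∉N t))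
            where
            t : Touches N v
            t = x , x∈N , vx
            only : ∀ {y} → y ∈ˡ S′.N → Adj v y → y ∈ˡ N
            only y∈ e with new⁻ y∈
            ... | inj₁ y∈N = y∈N
            ... | inj₂ (inj₁ (i , i≤ , refl)) = contradiction e (N-not-p t i≤)
            ... | inj₂ (inj₂ (i , i≤ , refl)) = contradiction e (N-not-q t i≤)
          ... | inj₂ (inj₁ (i , i≤ , refl)) = centre-on L S′ ≤-refl v∈R av (∈⊕⁺ʳ (specials (there (here refl)))) (∈⊕⁺ʳ (specials (there (there (here refl)))))
                (λ 2≤ → new-p (<⇒≤ 2≤)) (λ 2≤ → links-p (<⇒≤ 2≤)) marked only (x , x∈ , vx)
            where
            marked : ∀ {j} → 2 ≤ j → j < ℓ → p j ∈ Y′ → p (suc j) ∈ Y′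
            marked 2≤ j< pj∈ with ∈⊕⁻ pj∈
            ... | inj₁ pj∈Y  = contradiction pj∈Y (clean∉ (K⊆clean (p∈K _)))
            ... | inj₂ pj∈ys = contradiction pj∈ys (inside-p 2≤ j<)
            only : ∀ {y} → y ∈ˡ S′.N → Adj v y → ∃[ j ] (j ≤ ℓ × y ≡ p j)
            only y∈ e with new⁻ y∈
            ... | inj₁ y∈N = contradiction vx (N-not-p (_ , y∈N , e) i≤)
            ... | inj₂ (inj₁ on-p) = on-p
            ... | inj₂ (inj₂ (j , j≤ , refl)) = contradiction e (p-not-q i≤ vx j≤)
          ... | inj₂ (inj₂ (i , i≤ , refl)) = centre-on Q S′ ≤-refl v∈R′ av (∈⊕⁺ʳ (specials (there (there (there (here refl))))))
                (∈⊕⁺ʳ (specials (there (there (there (there (here refl)))))))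
                (λ 2≤ → new-q (<⇒≤ 2≤)) (λ 2≤ → links-q (<⇒≤ 2≤)) marked only (x , x∈ , vx)
            where
            marked : ∀ {j} → 2 ≤ j → j < m → q j ∈ Y′ → q (suc j) ∈ Y′
            marked 2≤ j< qj∈ with ∈⊕⁻ qj∈
            ... | inj₁ qj∈Y  = contradiction qj∈Y (clean∉ (K⊆clean (q∈K _)))
            ... | inj₂ qj∈ys = contradiction qj∈ys (inside-q 2≤ j<)
            only : ∀ {y} → y ∈ˡ S′.N → Adj v y → ∃[ j ] (j ≤ m × y ≡ q j)
            only y∈ e with new⁻ y∈
            ... | inj₁ y∈N = contradiction vx (N-not-q (_ , y∈N , e) i≤)
            ... | inj₂ (inj₁ (j , j≤ , refl)) = contradiction vx (p-not-q j≤ e i≤)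
            ... | inj₂ (inj₂ on-q) = on-q

      advance : Advance S S′
      advance = record
        { located = λ v∈ v∉ → Spot.centred v∈ v∉
        ; housed = λ x∈ → inj₂ (_≼_.members S≼ x∈)
        ; kept = connector-kept ∈⊕⁺ˡ S≼ λ x∈ → fresh (new⁻ x∈) }
        where
        fresh : ∀ {x} → x ∈ˡ N ⊎ (∃[ i ] (i ≤ ℓ × x ≡ p i)) ⊎ (∃[ i ] (i ≤ m × x ≡ q i)) → x ∈ˡ N ⊎ x ∈ clean Y
        fresh (inj₁ x∈) = inj₁ x∈
        fresh (inj₂ (inj₁ (i , _ , refl))) = inj₂ (K⊆clean (p∈K i))
        fresh (inj₂ (inj₂ (i , _ , refl))) = inj₂ (K⊆clean (q∈K i))

    -- Q returns to L: together with s they contain a cycle, apart from the forest.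
    enclosing : ∀ {i} → i ≤ ℓ → Adj (q 0) (p i) → Outcome S
    enclosing {i₀} i₀≤ touch = floated (float S₀ ℓ (shortest-path L) (λ _ _ → p∉N _) (λ 1≤ i≤ x∈ e → <⇒≢ 1≤ (sym (only-L i≤ (_ , x∈ , e)))))
      where
      ys : List V
      ys = s ∷ p 0 ∷ p 1 ∷ q 0 ∷ q 1 ∷ []

      S₀ : Skeleton (Y ⊕ ys) c
      S₀ = record { N = N ; E = E ; gid = gid ; forest = enlarge ∈⊕⁺ˡ forest }

      floated : ∃ (Floated S₀ p ℓ) → Outcome S
      floated (S₁ , f₁) = finish (float S₁ m (shortest-path Q) (λ _ _ q∈ → q∉S₁ (F₁.new⁻ q∈)) λ 1≤ i≤ x∈ e → <⇒≢ 1≤ (sym (untouched i≤ (F₁.new⁻ x∈) e)))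
        where
        module F₁ = Floated f₁
        q∉S₁ : ∀ {i} → q i ∈ˡ N ⊎ ∃[ j ] (1 ≤ j × j ≤ ℓ × q i ≡ p j) → ⊥
        q∉S₁ (inj₁ q∈)                = q∉N _ q∈
        q∉S₁ (inj₂ (j , _ , j≤ , eq)) = q≢p j≤ eq
        untouched : ∀ {i x} → i ≤ m → x ∈ˡ N ⊎ ∃[ j ] (1 ≤ j × j ≤ ℓ × x ≡ p j) → Adj (q i) x → i ≡ 0
        untouched i≤ (inj₁ x∈) e = Q.only-start i≤ (touch-N (_ , x∈ , e))
        untouched i≤ (inj₂ (j , _ , j≤ , refl)) e = Q.only-start i≤ (touch-L j≤ e)

        finish : ∃ (Floated S₁ q m) → Outcome S
        finish (S₂ , f₂) = enclose {ys = ys} (m≤m+n 5 27) adv {Γ} {s} member s∈B cyc {W} W≤ W-all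
          where
          module F₂ = Floated f₂
          module A₂ = _≼_ F₂.above

          S≼ : S ≼ S₂
          S≼ = ≼-trans (record { members = id ; edges = id ; coarsens = λ _ _ → id }) (≼-trans F₁.above F₂.above)

          new⁻ : ∀ {x} → x ∈ˡ Skeleton.N S₂ → x ∈ˡ N ⊎ (∃[ i ] (i ≤ ℓ × x ≡ p i)) ⊎ (∃[ i ] (i ≤ m × x ≡ q i))
          new⁻ x∈ with F₂.new⁻ x∈
          ... | inj₂ (i , _ , i≤ , eq) = inj₂ (inj₂ (i , i≤ , eq))
          ... | inj₁ x∈₁ with F₁.new⁻ x∈₁
          ...   | inj₁ x∈N = inj₁ x∈N
          ...   | inj₂ (i , _ , i≤ , eq) = inj₂ (inj₁ (i , i≤ , eq))

          inside-p : ∀ {i} → 2 ≤ i → i < ℓ → p i ∉ˡ ys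
          inside-p 2≤ i< p∈ = All.lookup (p-fresh 2≤ i<) p∈ refl

          inside-q : ∀ {i} → 2 ≤ i → i < m → q i ∉ˡ ys
          inside-q 2≤ i< q∈ = All.lookup (q-fresh 2≤ i<) q∈ refl

          windows : Windowed S ys
          windows x∈ x∈ys = contradiction x∈ (All.lookup specials-outside x∈ys)

          adv : Advance S S₂
          adv = advance S₂ S≼ windows id inside-p inside-q (λ 1≤ i≤ → A₂.members (F₁.new 1≤ i≤)) F₂.new new⁻
            (λ 1≤ i< → A₂.edges (F₁.links 1≤ i<)) F₂.links

          ds : List V
          ds = vertices-of p ℓ ++ vertices-of q m

          D Γ : VertexSet
          D = ⋃ˡ ds
          Γ = ⋃ˡ (s ∷ ds)

          p∈D : ∀ {i} → i ≤ ℓ → p i ∈ D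
          p∈D i≤ = ∈⋃ˡ⁺ (∈-++⁺ˡ (∈-vertices⁺ i≤))

          q∈D : ∀ {i} → i ≤ m → q i ∈ D
          q∈D i≤ = ∈⋃ˡ⁺ (∈-++⁺ʳ (vertices-of p ℓ) (∈-vertices⁺ i≤))

          data Spot′ (v : V) : Set where
            at-s : v ≡ s → Spot′ v
            at-p : ∀ i → i ≤ ℓ → v ≡ p i → Spot′ v
            at-q : ∀ i → i ≤ m → v ≡ q i → Spot′ v

          spot : ∀ {v} → v ∈ˡ s ∷ ds → Spot′ v
          spot (here eq) = at-s eq
          spot (there v∈) with ∈-++⁻ (vertices-of p ℓ) v∈
          ... | inj₁ v∈p = let i , i≤ , eq = ∈-vertices⁻ {p = p} v∈p in at-p i i≤ eq
          ... | inj₂ v∈q = let i , i≤ , eq = ∈-vertices⁻ {p = q} v∈q in at-q i i≤ eq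

          s∉D : s ∉ D
          s∉D s∈D with ∈-++⁻ (vertices-of p ℓ) (∈⋃ˡ⁻ ds s∈D)
          ... | inj₁ v∈p = let i , i≤ , eq = ∈-vertices⁻ {p = p} v∈p in s∉K (subst (_∈ K) (sym eq) (p∈K i))
          ... | inj₂ v∈q = let i , i≤ , eq = ∈-vertices⁻ {p = q} v∈q in s∉K (subst (_∈ K) (sym eq) (q∈K i))

          round : Path D (p ℓ) (q m)
          round = path-sym (L.segment′ i₀≤ ≤-refl (λ _ j≤ → p∈D j≤)) ◅◅ (p∈D i₀≤ , q∈D z≤n , adj-sym touch) ◅
                  Q.segment′ z≤n ≤-refl (λ _ j≤ → q∈D j≤)

          cyc : CycleThrough s (_∈ Γ)
          cyc = record { m = C.m ; copy = C.copy ; apex = C.apex ; within = λ i → into (C.within i) }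
            where
            module C = CycleThrough (cycle-through s∉D (p∈D ≤-refl) (q∈D ≤-refl) (λ eq → q≢p ≤-refl (sym eq)) top-L top-Q round)
            into : ∀ {v} → v ≡ s ⊎ v ∈ D → v ∈ Γ
            into (inj₁ refl) = ∈⋃ˡ⁺ {vs = s ∷ ds} (here refl)
            into (inj₂ v∈)   = ∈⋃ˡ⁺ {vs = s ∷ ds} (there (∈⋃ˡ⁻ ds v∈))

          member : ∀ {v} → v ∈ Γ → v ∈ clean Y × v ∉ˡ N × (v ∈ Y ⊕ ys ⊎ v ∈ˡ Skeleton.N S₂)
          member v∈ = go (spot (∈⋃ˡ⁻ (s ∷ ds) v∈))
            where
            go : ∀ {v} → Spot′ v → v ∈ clean Y × v ∉ˡ N × (v ∈ Y ⊕ ys ⊎ v ∈ˡ Skeleton.N S₂)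
            go (at-s refl)           = Ω⊆ s∈ , s∉N , inj₁ (∈⊕⁺ʳ (here refl))
            go (at-p zero    _  refl) = K⊆clean (p∈K 0) , p∉N 0 , inj₁ (∈⊕⁺ʳ (there (here refl)))
            go (at-p (suc i) i≤ refl) = K⊆clean (p∈K _) , p∉N _ , inj₂ (A₂.members (F₁.new (s≤s z≤n) i≤))
            go (at-q zero    _  refl) = K⊆clean (q∈K 0) , q∉N 0 , inj₁ (∈⊕⁺ʳ (there (there (there (here refl)))))
            go (at-q (suc i) i≤ refl) = K⊆clean (q∈K _) , q∉N _ , inj₂ (F₂.new (s≤s z≤n) i≤)

          -- Apart from `s`, only the first vertices of both paths can touch the forest.
          T-s = touched-list S located s∈ s∉N
          T-p = touched-list S located (K⊆core (p∈K 0)) (p∉N 0)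
          T-q = touched-list S located (K⊆core (q∈K 0)) (q∉N 0)
          W : List V
          W = proj₁ T-s ++ proj₁ T-p ++ proj₁ T-q

          W≤ : length W ≤ 9
          W≤ = ≤-trans (≤-reflexive (trans (length-++ (proj₁ T-s)) (cong (length (proj₁ T-s) +_) (length-++ (proj₁ T-p)))))
            (+-mono-≤ (proj₁ (proj₂ T-s)) (+-mono-≤ (proj₁ (proj₂ T-p)) (proj₁ (proj₂ T-q))))

          W-all : ∀ {v x} → v ∈ Γ → x ∈ˡ N → Adj v x → x ∈ˡ W
          W-all v∈ x∈ e = go (spot (∈⋃ˡ⁻ (s ∷ ds) v∈)) x∈ e
            where
            go : ∀ {v x} → Spot′ v → x ∈ˡ N → Adj v x → x ∈ˡ W
            go (at-s refl) x∈ e = ∈-++⁺ˡ (proj₂ (proj₂ T-s) x∈ e)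
            go (at-p i i≤ refl) x∈ e with only-L i≤ (_ , x∈ , e)
            ... | refl = ∈-++⁺ʳ (proj₁ T-s) (∈-++⁺ˡ (proj₂ (proj₂ T-p) x∈ e))
            go (at-q i i≤ refl) x∈ e with Q.only-start i≤ (touch-N (_ , x∈ , e))
            ... | refl = ∈-++⁺ʳ (proj₁ T-s) (∈-++⁺ʳ (proj₁ T-p) (proj₂ (proj₂ T-q) x∈ e))

    -- Both paths start at the forest: s joins their tops.
    joining : Touches N (p 0) → Touches N (q 0) → (∀ {i} → i ≤ ℓ → ¬ Adj (q 0) (p i)) → (∀ {x} → x ∈ˡ N → ¬ Adj s x) → Outcome S
    joining (x₁ , x₁∈ , px₁) (x₂ , x₂∈ , qx₂) apart s-free =
      centred (located (K⊆core (p∈K 0)) (p∉N 0) (x₁ , x₁∈ , px₁)) (located (K⊆core (q∈K 0)) (q∉N 0) (x₂ , x₂∈ , qx₂))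
      where
      q-apart : ∀ {i j} → i ≤ m → j ≤ ℓ → ¬ Adj (q i) (p j)
      q-apart i≤ j≤ e with Q.only-start i≤ (touch-L j≤ e)
      ... | refl = apart j≤ e

      centred : Centred S (p 0) → Centred S (q 0) → Outcome S
      centred (c₁ , c₁∈ , c₁∉ , near₁) (c₂ , c₂∈ , c₂∉ , near₂) = limbed (limb S₀ (shortest-path L) x₁∈ px₁ (λ _ → p∉N _)
          (λ x∈ e → trans (Gr.in₁ (touch₁ x∈ e)) (sym (Gr.in₁ (touch₁ x₁∈ px₁))))
          (λ 1≤ i≤ x∈ e → <⇒≢ 1≤ (sym (only-L i≤ (_ , x∈ , e))))
          (joins (here refl) (W₁⊆ (touch₁ x₁∈ px₁)) (special (there (here refl))) C (s≤s (s≤s W≤)) (here refl)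
            (λ y∈ eq → there (there (Gr.cls₁ y∈ (trans eq (Gr.in₁ (touch₁ x₁∈ px₁)))))))
          (W₁⊆ (touch₁ x₁∈ px₁)) (≤-trans (thin x₁∈ (clear (p∈K 0) px₁)) (m≤m+n 2 1)))
        where
        -- The first two vertices of each path keep later core vertices from touching both this path
        -- and the old forest; the tops are the feet of the new connector.
        specials : List V
        specials = s ∷ p 0 ∷ p 1 ∷ q 0 ∷ q 1 ∷ p ℓ ∷ q m ∷ []

        open Patch S c₁∈ c₁∉ c₂∈ c₂∉ specials

        -- Two windows of three vertices and both hooks make eight, even if the windows merge into
        -- one group.
        C : List V
        C = p 0 ∷ q 0 ∷ W₁ ++ W₂

        touch₁ : ∀ {x} → x ∈ˡ N → Adj (p 0) x → x ∈ˡ W₁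
        touch₁ = touched₁ (K⊆clean (p∈K 0)) near₁

        touch₂ : ∀ {x} → x ∈ˡ N → Adj (q 0) x → x ∈ˡ W₂
        touch₂ = touched₂ (K⊆clean (q∈K 0)) near₂

        clear : ∀ {v x} → v ∈ K → Adj v x → x ∉ Y
        clear v∈ e x∈ = clean-¬adj (K⊆clean v∈) x∈ e

        limbed : ∃ (Limbed S₀ p ℓ x₁) → Outcome S
        limbed (S₁ , l₁) = finish (limb S₁ (shortest-path Q) (A₁.members x₂∈) qx₂ (λ i≤ q∈ → q∉S₁ (L₁.new⁻ q∈))
            (λ x∈ e → first (L₁.new⁻ x∈) e) (λ 1≤ i≤ x∈ e → <⇒≢ 1≤ (sym (later i≤ (L₁.new⁻ x∈) e)))
            (joins (here refl) (W₂⊆ (touch₂ x₂∈ qx₂)) (special (there (there (there (here refl))))) C (s≤s (s≤s W≤)) (there (here refl))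
              (λ y∈ eq → group₂ (L₁.mates x₂∈ y∈ (trans eq (L₁.label-old x₂∈))) eq))
            -- The first limb may hang on `x₂` too, so its degree may already be three.
            (W₂⊆ (touch₂ x₂∈ qx₂)) (≤-trans (L₁.deg-old x₂∈) (s≤s (thin x₂∈ (clear (q∈K 0) qx₂)))))
          where
          module L₁ = Limbed l₁
          module S₁ = Skeleton S₁
          module A₁ = _≼_ L₁.above

          q∉S₁ : ∀ {i} → q i ∈ˡ N ⊎ ∃[ j ] (j ≤ ℓ × q i ≡ p j) → ⊥
          q∉S₁ (inj₁ q∈)            = q∉N _ q∈
          q∉S₁ (inj₂ (j , j≤ , eq)) = q≢p j≤ eq

          first : ∀ {x} → x ∈ˡ N ⊎ ∃[ j ] (j ≤ ℓ × x ≡ p j) → Adj (q 0) x → S₁.gid x ≡ S₁.gid x₂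
          first (inj₁ x∈) e = trans (L₁.label-old x∈) (trans (Gr.in₂ (touch₂ x∈ e))
            (trans (sym (Gr.in₂ (touch₂ x₂∈ qx₂))) (sym (L₁.label-old x₂∈))))
          first (inj₂ (j , j≤ , refl)) e = contradiction e (apart j≤)

          later : ∀ {i x} → i ≤ m → x ∈ˡ N ⊎ ∃[ j ] (j ≤ ℓ × x ≡ p j) → Adj (q i) x → i ≡ 0
          later i≤ (inj₁ x∈) e = Q.only-start i≤ (touch-N (_ , x∈ , e))
          later i≤ (inj₂ (j , j≤ , refl)) e = contradiction e (q-apart i≤ j≤)

          group₂ : ∀ {y} → y ∈ˡ N ⊎ y ≡ p 0 → S₁.gid y ≡ S₁.gid x₂ → y ∈ˡ C
          group₂ (inj₂ eq) _ = here eq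
          group₂ (inj₁ y∈) eq = there (there (Gr.cls₂ y∈ (trans (sym (L₁.label-old y∈))
            (trans eq (trans (L₁.label-old x₂∈) (Gr.in₂ (touch₂ x₂∈ qx₂)))))))

          finish : ∃ (Limbed S₁ q m x₂) → Outcome S
          finish (S₂ , l₂) = connect {ys = ys} (≤-trans ys≤ (m≤m+n 13 19)) adv {s} {p ℓ} {q m} connector (Ω⊆ s∈) (outside (p∈K ℓ)) (outside (q∈K m)) (λ eq → q≢p ≤-refl (sym eq))
            where
            module L₂ = Limbed l₂
            module S₂ = Skeleton S₂
            module A₂ = _≼_ L₂.above

            outside : ∀ {v} → v ∈ K → v ∉ Y
            outside v∈ = clean∉ (K⊆clean v∈)

            S≼ : S ≼ S₂
            S≼ = ≼-trans S≼S₀ (≼-trans L₁.above L₂.above)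

            new⁻ : ∀ {x} → x ∈ˡ S₂.N → x ∈ˡ N ⊎ (∃[ i ] (i ≤ ℓ × x ≡ p i)) ⊎ (∃[ i ] (i ≤ m × x ≡ q i))
            new⁻ x∈ with L₂.new⁻ x∈
            ... | inj₂ on-q = inj₂ (inj₂ on-q)
            ... | inj₁ x∈₁ with L₁.new⁻ x∈₁
            ...   | inj₁ x∈N  = inj₁ x∈N
            ...   | inj₂ on-p = inj₂ (inj₁ on-p)

            off-forest : All (_∉ˡ N) specials
            off-forest = Allₚ.++⁺ specials-outside (p∉N ℓ ∷ q∉N m ∷ [])

            sp₅ : ∀ {x} → x ∈ˡ s ∷ p 0 ∷ p 1 ∷ q 0 ∷ q 1 ∷ [] → x ∈ˡ ys
            sp₅ x∈ = ∈-++⁺ˡ {ys = W₁ ++ W₂} (∈-++⁺ˡ {ys = p ℓ ∷ q m ∷ []} x∈)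

            adv : Advance S S₂
            adv = advance S₂ S≼ (windowed (All.map (λ x∉ x∈ → contradiction x∈ x∉) off-forest)) sp₅
              (λ 2≤ i< → unmarked (p∉N _) (Allₚ.++⁺ (p-fresh 2≤ i<) ((λ eq → <⇒≢ i< (L.p-injective (<⇒≤ i<) ≤-refl eq)) ∷ (λ eq → q≢p* (sym eq)) ∷ [])))
              (λ 2≤ i< → unmarked (q∉N _) (Allₚ.++⁺ (q-fresh 2≤ i<) (q≢p* ∷ (λ eq → <⇒≢ i< (Q.p-injective (<⇒≤ i<) ≤-refl eq)) ∷ [])))
              (λ _ i≤ → A₂.members (L₁.new i≤)) (λ _ → L₂.new) new⁻ (λ _ i< → A₂.edges (L₁.links i<)) (λ _ → L₂.links)

            connector : IsConnector S₂ s (p ℓ) (q m)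
            connector = record
              { σ∈ = special (here refl) ; σ∉ = λ s∈N → absurd (new⁻ s∈N)
              ; a∈ = A₂.members (L₁.new ≤-refl) ; a∈Y = special (there (there (there (there (there (here refl))))))
              ; b∈ = L₂.new ≤-refl ; b∈Y = special (there (there (there (there (there (there (here refl)))))))
              ; σa = top-L ; σb = top-Q ; root = inj₁ s∈B ; only = λ y∈ e → only (new⁻ y∈) e }
              where
              absurd : s ∈ˡ N ⊎ (∃[ i ] (i ≤ ℓ × s ≡ p i)) ⊎ (∃[ i ] (i ≤ m × s ≡ q i)) → ⊥
              absurd (inj₁ s∈N) = s∉N s∈N
              absurd (inj₂ (inj₁ (i , _ , eq))) = s∉K (subst (_∈ K) (sym eq) (p∈K i))
              absurd (inj₂ (inj₂ (i , _ , eq))) = s∉K (subst (_∈ K) (sym eq) (q∈K i))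
              only : ∀ {y} → y ∈ˡ N ⊎ (∃[ i ] (i ≤ ℓ × y ≡ p i)) ⊎ (∃[ i ] (i ≤ m × y ≡ q i)) → Adj s y →
                     S₂.gid y ≡ S₂.gid (p ℓ) ⊎ S₂.gid y ≡ S₂.gid (q m)
              only (inj₁ y∈) e = contradiction e (s-free y∈)
              only (inj₂ (inj₁ (i , i≤ , refl))) e = inj₁ (cong (λ k → S₂.gid (p k)) (end-L i≤ e))
              only (inj₂ (inj₂ (i , i≤ , refl))) e = inj₂ (cong (λ k → S₂.gid (q k)) (end-Q i≤ e))

-- Connectors with a foot in the old forest.

module Lasso (G : Graph) (B : Graph.VertexSet G) where

  open Graph G renaming (order to n; symmetric to adj-sym; loopless to adj-irrefl)
  open Forest n
  open Structure G
  open Skeletons G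
  open Growth G
  open Limbs G
  open Location G
  open Walks G
  open Tangle G
  open States G B

  module _ {Y c} (S : Skeleton Y c) (located : Located (core Y) S) {σ a} (σ∈ : σ ∈ core Y) (σ∉N : σ ∉ˡ Skeleton.N S)
           (a∈ : a ∈ˡ Skeleton.N S) (σa : Adj σ a) (root : σ ∈ B ⊎ a ∈ B) where

    open Skeleton S

    private
      clear : ∀ {x} → Adj σ x → x ∉ Y
      clear e x∈ = clean-¬adj (Ω⊆ σ∈) x∈ e

    -- σ touches the forest twice.
    pinning : ∀ {b} → b ∈ˡ N → Adj σ b → a ≢ b → Outcome S
    pinning {b} b∈ σb a≢b = centred (located σ∈ σ∉N (a , a∈ , σa))
      where
      centred : Centred S σ → Outcome S
      centred (c₁ , c₁∈ , c₁∉ , near) = connect {ys = ys} (≤-trans (s≤s (window-short S c₁∈ c₁∉)) (m≤m+n 4 28)) adv connector (Ω⊆ σ∈) (clear σa) (clear σb) a≢b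
        where
        W ys : List V
        W = window Y E c₁
        ys = σ ∷ W

        -- A single window, used twice: both feet of the connector lie in one group.
        gr : Grouping (Y ⊕ ys) N E gid c W W
        gr = regrouped S c₁∈ c₁∉ c₁∈ c₁∉ there there
        module Gr = Grouping gr

        S₀ : Skeleton (Y ⊕ ys) c
        S₀ = record { N = N ; E = E ; gid = Gr.gid′ ; forest = Gr.forest }

        touched : ∀ {x} → x ∈ˡ N → Adj σ x → x ∈ˡ W
        touched x∈ e = window⁺ {E = E} c₁∉ (clear e) (near x∈ e)

        windows : Windowed S ys
        windows x∈ (here refl)  = contradiction x∈ σ∉N
        windows x∈ (there x∈W) = c₁ , c₁∉ , x∈W , there

        S≼ : S ≼ S₀
        S≼ = record { members = id ; edges = id ; coarsens = Gr.coarser }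

        adv : Advance S S₀
        adv = record
          { located = λ v∈ v∉ t → recentre-⊕ S (λ y∈ → clean-¬adj (Ω⊆ v∈) y∈) windows t (located (core-anti ∈⊕⁺ˡ v∈) v∉ t)
          ; housed = inj₂ ; kept = connector-kept ∈⊕⁺ˡ S≼ inj₁ }

        connector : IsConnector S₀ σ a b
        connector = record
          { σ∈ = ∈⊕⁺ʳ (here refl) ; σ∉ = σ∉N ; a∈ = a∈ ; a∈Y = ∈⊕⁺ʳ (there (touched a∈ σa)) ; b∈ = b∈ ; b∈Y = ∈⊕⁺ʳ (there (touched b∈ σb))
          ; σa = σa ; σb = σb ; root = root ; only = λ y∈ e → inj₁ (trans (Gr.in₁ (touched y∈ e)) (sym (Gr.in₁ (touched a∈ σa)))) }

    -- σ touches the forest and the end of a path leaving it.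
    lassoing : ∀ {s A Z} (Q : Shortest ⟪ away? (Ω (clean Y ∖ s)) N ⟫ A Z) (let module Q = Shortest Q) {m} → m ≤ Q.ℓ →
      (∀ {v i} → v ∈ Ω (clean Y ∖ s) → v ∉ˡ N → ¬ Adj v s → Touches N v → i ≤ m → Adj v (Q.p i) → i ≤ 1) →
      (∀ {i} → i ≤ m → Touches N (Q.p i) → i ≡ 0) → Touches N (Q.p 0) →
      (∀ {i} → i ≤ m → σ ≢ Q.p i) → Adj σ (Q.p m) → (∀ {i} → i ≤ m → Adj σ (Q.p i) → i ≡ m) → (s ∈ˡ N → Adj σ s) → Outcome S
    lassoing {s} Q {m} m≤ near-Q only-Q (x₀ , x₀∈ , qx₀) σ≢q top end s-near =
      centred (located σ∈ σ∉N (a , a∈ , σa)) (located (K⊆core (q∈K 0)) (q∉N 0) (x₀ , x₀∈ , qx₀))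
      where
      module Q = Shortest Q
      open Q using () renaming (p to q; ℓ to ℓ)

      K : VertexSet
      K = Ω (clean Y ∖ s)

      K⊆core : K ⊆ core Y
      K⊆core = Ω-mono (λ v∈ → proj₁ (∈∖⁻ (Ω⊆ v∈)))

      K⊆clean : K ⊆ clean Y
      K⊆clean v∈ = Ω⊆ (K⊆core v∈)

      s∉K : s ∉ K
      s∉K s∈K = proj₂ (∈∖⁻ (Ω⊆ s∈K)) refl

      q∈K : ∀ i → q i ∈ K
      q∈K i = proj₁ (∈⟪⟫⁻ (away? _ _) (Q.inside i))

      q∉N : ∀ i → q i ∉ˡ N
      q∉N i = proj₂ (∈⟪⟫⁻ (away? _ _) (Q.inside i))

      centred : Centred S σ → Centred S (q 0) → Outcome S
      centred (c₁ , c₁∈ , c₁∉ , near₁) (c₂ , c₂∈ , c₂∉ , near₂) = limbed (limb S₀ (initial-path Q m≤) x₀∈ qx₀ (λ _ → q∉N _)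
          (λ x∈ e → trans (Gr.in₂ (touch₂ x∈ e)) (sym (Gr.in₂ (touch₂ x₀∈ qx₀))))
          (λ 1≤ i≤ x∈ e → <⇒≢ 1≤ (sym (only-Q i≤ (_ , x∈ , e))))
          (joins (here refl) (W₂⊆ (touch₂ x₀∈ qx₀)) ((special (there (there (here refl))))) (q 0 ∷ W₁ ++ W₂) (≤-trans (s≤s W≤) (n≤1+n 7)) (here refl)
            (λ y∈ eq → there (Gr.cls₂ y∈ (trans eq (Gr.in₂ (touch₂ x₀∈ qx₀))))))
          (W₂⊆ (touch₂ x₀∈ qx₀)) (≤-trans (thin x₀∈ (clear₂ qx₀)) (m≤m+n 2 1)))
        where
        specials : List V
        specials = s ∷ σ ∷ q 0 ∷ q 1 ∷ q m ∷ []

        open Patch S c₁∈ c₁∉ c₂∈ c₂∉ specials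

        clear₂ : ∀ {x} → Adj (q 0) x → x ∉ Y
        clear₂ e x∈ = clean-¬adj (K⊆clean (q∈K 0)) x∈ e

        touch₁ : ∀ {x} → x ∈ˡ N → Adj σ x → x ∈ˡ W₁
        touch₁ = touched₁ (Ω⊆ σ∈) near₁

        touch₂ : ∀ {x} → x ∈ˡ N → Adj (q 0) x → x ∈ˡ W₂
        touch₂ = touched₂ (K⊆clean (q∈K 0)) near₂

        limbed : ∃ (Limbed S₀ q m x₀) → Outcome S
        limbed (S₁ , l₁) = connect {ys = ys} (≤-trans ys≤ (m≤m+n 11 21)) adv {σ} {a} {q m} connector (Ω⊆ σ∈) (clear σa) (clean∉ (K⊆clean (q∈K m))) (λ { refl → q∉N m a∈ })
          where
          module L₁ = Limbed l₁
          module S₁ = Skeleton S₁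
          module A₁ = _≼_ L₁.above

          S≼ : S ≼ S₁
          S≼ = ≼-trans S≼S₀ L₁.above

          -- If `s` is in the forest, it is a contact of `σ` and so enters `Y` within the window
          -- around `c₁`.
          windows : Windowed S ys
          windows = windowed ((λ s∈ → c₁ , c₁∉ , touch₁ s∈ (s-near s∈) , W₁⊆ys) ∷ (λ σ∈N → contradiction σ∈N σ∉N) ∷
            All.map (λ x∉ x∈ → contradiction x∈ x∉) (q∉N 0 ∷ q∉N 1 ∷ q∉N m ∷ []))

          inj : ∀ {i j} → i ≤ m → j ≤ m → q i ≡ q j → i ≡ j
          inj i≤ j≤ = Q.p-injective (≤-trans i≤ m≤) (≤-trans j≤ m≤)

          inside-q : ∀ {i} → 2 ≤ i → i < m → q i ∉ˡ ys
          inside-q {i} 2≤ i< = unmarked (q∉N i) ((λ eq → s∉K (subst (_∈ K) eq (q∈K i))) ∷ (λ eq → σ≢q (<⇒≤ i<) (sym eq)) ∷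
            (λ eq → <⇒≢ (<-trans z<s 2≤) (inj z≤n (<⇒≤ i<) (sym eq))) ∷ (λ eq → <⇒≢ 2≤ (inj (≤-trans (<⇒≤ 2≤) (<⇒≤ i<)) (<⇒≤ i<) (sym eq))) ∷
            (λ eq → <⇒≢ i< (inj (<⇒≤ i<) ≤-refl eq)) ∷ [])

          module Spot {v} (v∈core : v ∈ core (Y ⊕ ys)) (v∉ : v ∉ˡ S₁.N) where

            av : Avoids v (Y ⊕ ys)
            av y∈ = clean-¬adj (Ω⊆ v∈core) y∈

            v∈K : v ∈ K
            v∈K = core-minus ∈⊕⁺ˡ ((special (here refl))) v∈core

            v∉N : v ∉ˡ N
            v∉N v∈ = v∉ (_≼_.members S≼ v∈)

            low-q : ∀ {i} → i ≤ 1 → ¬ Adj v (q i)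
            low-q z≤n       = av ((special (there (there (here refl)))))
            low-q (s≤s z≤n) = av ((special (there (there (there (here refl))))))

            N-not-q : ∀ {i} → Touches N v → i ≤ m → ¬ Adj v (q i)
            N-not-q t i≤ e = low-q (near-Q v∈K v∉N (av ((special (here refl)))) t i≤ e) e

            located′ : Touches S₁.N v → Centred S₁ v
            located′ (x , x∈ , vx) with L₁.new⁻ x∈
            ... | inj₁ x∈N = transfer S≼ only (recentre-⊕ S av windows t (located (K⊆core v∈K) v∉N t))
              where
              t : Touches N v
              t = x , x∈N , vx
              only : ∀ {y} → y ∈ˡ S₁.N → Adj v y → y ∈ˡ N
              only y∈ e with L₁.new⁻ y∈
              ... | inj₁ y∈N = y∈N
              ... | inj₂ (i , i≤ , refl) = contradiction e (N-not-q t i≤)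
            ... | inj₂ (i , i≤ , refl) = centre-on Q S₁ m≤ (∈⟪⟫⁺ (away? K N) (v∈K , v∉N)) av
                  ((special (there (there (here refl))))) ((special (there (there (there (here refl))))))
                  (λ _ → L₁.new) (λ _ → L₁.links) marked only (x , x∈ , vx)
              where
              marked : ∀ {j} → 2 ≤ j → j < m → q j ∈ Y ⊕ ys → q (suc j) ∈ Y ⊕ ys
              marked 2≤ j< qj∈ with ∈⊕⁻ qj∈
              ... | inj₁ qj∈Y  = contradiction qj∈Y (clean∉ (K⊆clean (q∈K _)))
              ... | inj₂ qj∈ys = contradiction qj∈ys (inside-q 2≤ j<)
              only : ∀ {y} → y ∈ˡ S₁.N → Adj v y → ∃[ j ] (j ≤ m × y ≡ q j)
              only y∈ e with L₁.new⁻ y∈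
              ... | inj₁ y∈N  = contradiction vx (N-not-q (_ , y∈N , e) i≤)
              ... | inj₂ on-q = on-q

          adv : Advance S S₁
          adv = record
            { located = λ v∈ v∉ → Spot.located′ v∈ v∉ ; housed = λ x∈ → inj₂ (_≼_.members S≼ x∈)
            ; kept = connector-kept ∈⊕⁺ˡ S≼ λ x∈ → fresh (L₁.new⁻ x∈) }
            where
            fresh : ∀ {x} → x ∈ˡ N ⊎ (∃[ i ] (i ≤ m × x ≡ q i)) → x ∈ˡ N ⊎ x ∈ clean Y
            fresh (inj₁ x∈) = inj₁ x∈
            fresh (inj₂ (i , _ , refl)) = inj₂ (K⊆clean (q∈K i))

          connector : IsConnector S₁ σ a (q m)
          connector = record
            { σ∈ = (special (there (here refl))) ; σ∉ = λ σ∈N → absurd (L₁.new⁻ σ∈N)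
            ; a∈ = A₁.members a∈ ; a∈Y = ∈⊕⁺ʳ (W₁⊆ys (touch₁ a∈ σa))
            ; b∈ = L₁.new ≤-refl ; b∈Y = (special (there (there (there (there (here refl))))))
            ; σa = σa ; σb = top ; root = root ; only = λ y∈ e → only (L₁.new⁻ y∈) e }
            where
            absurd : σ ∈ˡ N ⊎ (∃[ i ] (i ≤ m × σ ≡ q i)) → ⊥
            absurd (inj₁ σ∈N) = σ∉N σ∈N
            absurd (inj₂ (i , i≤ , eq)) = σ≢q i≤ eq
            only : ∀ {y} → y ∈ˡ N ⊎ (∃[ i ] (i ≤ m × y ≡ q i)) → Adj σ y → S₁.gid y ≡ S₁.gid a ⊎ S₁.gid y ≡ S₁.gid (q m)
            only (inj₁ y∈) e = inj₁ (trans (L₁.label-old y∈) (trans (Gr.in₁ (touch₁ y∈ e))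
              (sym (trans (L₁.label-old a∈) (Gr.in₁ (touch₁ a∈ σa))))))
            only (inj₂ (i , i≤ , refl)) e = inj₂ (cong (λ k → S₁.gid (q k)) (end i≤ e))

-- Replacing a forest vertex by a detour.

module Detours (G : Graph) (B : Graph.VertexSet G) where

  open Graph G renaming (order to n; symmetric to adj-sym; loopless to adj-irrefl)
  open Forest n
  open Structure G
  open Skeletons G
  open Growth G
  open Limbs G
  open Location G
  open Walks G
  open Tangle G
  open States G B

  record Scene {Y c} (S : Skeleton Y c) (s : V) : Set where
    field
      located : Located (core Y) S
      s∈core  : s ∈ core Y
      s∈B     : s ∈ B
      {u u′}  : V
      u≢u′    : u ≢ u′
      su      : Adj s u
      su′     : Adj s u′
      u∈K     : u ∈ Ω (clean Y ∖ s)
      u′∈K    : u′ ∈ Ω (clean Y ∖ s)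

  -- s lies in the forest, between u and u′.  A path Q of the core restores the tree
  -- after the removal of s, so that s becomes a connector.
  module Detour {Y c} {S : Skeleton Y c} {s : V} (scene : Scene S s) (s∈N : s ∈ˡ Skeleton.N S)
                (in-N : ∀ {v} → v ∈ Ω (clean Y ∖ s) → Adj s v → v ∈ˡ Skeleton.N S) where

    open Skeleton S
    open Scene scene

    K : VertexSet
    K = Ω (clean Y ∖ s)

    K⊆core : K ⊆ core Y
    K⊆core = Ω-mono (λ v∈ → proj₁ (∈∖⁻ (Ω⊆ v∈)))

    K⊆clean : K ⊆ clean Y
    K⊆clean v∈ = Ω⊆ (K⊆core v∈)

    K≢s : ∀ {v} → v ∈ K → v ≢ s
    K≢s v∈ = proj₂ (∈∖⁻ (Ω⊆ v∈))

    s∉Y : s ∉ Y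
    s∉Y = clean∉ (Ω⊆ s∈core)

    spoke : ∀ {y} → y ∈ˡ N → Adj s y → TE E s y
    spoke y∈ e with adj s∈N y∈ e
    ... | inj₁ e′ = e′
    ... | inj₂ eq = contradiction (sym (alone s∈N s∉Y y∈ (sym eq))) (adj-≢ e)

    two-spokes : ∀ {y} → TE E s y → y ≡ u ⊎ y ≡ u′
    two-spokes {y} e with y ≟ᶠ u
    ... | yes eq = inj₁ eq
    ... | no y≢u = inj₂ (sym (two-at-most (thin s∈N s∉Y) (te⇒nbr {E} (spoke (in-N u∈K su) su)) (te⇒nbr {E} (spoke (in-N u′∈K su′) su′))
                          (te⇒nbr {E} e) u≢u′ (λ eq → y≢u (sym eq))))

    module Rm = Remove S s∈N s∉Y
    S⁻ : Skeleton Y (suc c)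
    S⁻ = Rm.removed
    module S⁻ = Skeleton S⁻

    u∈ : u ∈ˡ S⁻.N
    u∈ = Rm.∈N′⁺ (in-N u∈K su) (K≢s u∈K)

    u′∈ : u′ ∈ˡ S⁻.N
    u′∈ = Rm.∈N′⁺ (in-N u′∈K su′) (K≢s u′∈K)

    Far : V → Set
    Far = Conn S⁻.E u′

    far? : U.Decidable Far
    far? = conn? S⁻.E u′

    u-near : ¬ Far u
    u-near p = remove-separates acyclic (spoke (in-N u∈K su) su) (spoke (in-N u′∈K su′) su′) u≢u′ (conn-sym p)

    adj⇒conn : ∀ {x y} → x ∈ˡ S⁻.N → y ∈ˡ S⁻.N → Adj x y → Conn S⁻.E x y
    adj⇒conn x∈ y∈ e with S⁻.adj x∈ y∈ e
    ... | inj₁ e′ = e′ ◅ ε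
    ... | inj₂ eq = gmap id proj₁ (S⁻.joined x∈ y∈ eq)

    Near-contact Far-contact : V → Set
    Near-contact v = ∃[ x ] (x ∈ˡ S⁻.N × Adj v x × ¬ Far x)
    Far-contact v = ∃[ x ] (x ∈ˡ S⁻.N × Adj v x × Far x)

    near-contact? : U.Decidable Near-contact
    near-contact? v = any? (λ x → (x ∈ˡ? S⁻.N) ×-dec (adj? v x ×-dec ¬? (far? x)))

    far-contact? : U.Decidable Far-contact
    far-contact? v = any? (λ x → (x ∈ˡ? S⁻.N) ×-dec (adj? v x ×-dec far? x))

    R : VertexSet
    R = ⟪ away? K N ⟫

    Crossing : Set
    Crossing = ∃[ z ] ∃[ a ] (Far-contact z × Near-contact a × a ∈ R × Path R a z)

    -- The walk from the far to the near side is followed while remembering where it last left the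
    -- far side of the forest. The stretch outside the forest from there until it enters the near
    -- side is the crossing.
    cross : ∀ {x y} → x ∈ K → Path K x y → y ∈ˡ S⁻.N → ¬ Far y →
            (x ∈ˡ S⁻.N × Far x) ⊎ (x ∈ R × ∃[ z ] (Far-contact z × Path R x z)) → Crossing
    cross x∈ ε y∈ near (inj₁ (_ , far)) = contradiction far near
    cross x∈ ε y∈ near (inj₂ (x∈R , _)) = contradiction (proj₁ (Rm.∈N′⁻ y∈)) (proj₂ (∈⟪⟫⁻ (away? K N) x∈R))
    cross {x} x∈ (_◅_ {j = w} (_ , w∈ , xw) p) y∈ near st with w ∈ˡ? N
    cross {x} x∈ (_◅_ {j = w} (_ , w∈ , xw) p) y∈ near (inj₁ (x∈N , far)) | yes w∈N =
      cross w∈ p y∈ near (inj₁ (w∈S , far ◅◅ adj⇒conn x∈N w∈S xw))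
      where w∈S = Rm.∈N′⁺ w∈N (K≢s w∈)
    cross {x} x∈ (_◅_ {j = w} (_ , w∈ , xw) p) y∈ near (inj₂ (x∈R , z , fz , q)) | yes w∈N with far? w
    ... | yes far-w = cross w∈ p y∈ near (inj₁ (Rm.∈N′⁺ w∈N (K≢s w∈) , far-w))
    ... | no near-w = z , x , fz , (w , Rm.∈N′⁺ w∈N (K≢s w∈) , xw , near-w) , x∈R , q
    cross {x} x∈ (_◅_ {j = w} (_ , w∈ , xw) p) y∈ near (inj₁ (x∈N , far)) | no w∉N =
      cross w∈ p y∈ near (inj₂ (∈⟪⟫⁺ (away? K N) (w∈ , w∉N) , w , (x , x∈N , adj-sym xw , far) , ε))
    cross {x} x∈ (_◅_ {j = w} (_ , w∈ , xw) p) y∈ near (inj₂ (x∈R , z , fz , q)) | no w∉N =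
      cross w∈ p y∈ near (inj₂ (w∈R , z , fz , (w∈R , x∈R , adj-sym xw) ◅ q))
      where w∈R = ∈⟪⟫⁺ (away? K N) (w∈ , w∉N)

    crossing : Crossing
    crossing = cross u′∈K (Ω-connected u′∈K u∈K) u∈ u-near (inj₁ (u′∈ , ε))

    shortest-crossing : Shortest R ⟪ near-contact? ⟫ ⟪ far-contact? ⟫
    shortest-crossing = build crossing
      where
      build : Crossing → Shortest R ⟪ near-contact? ⟫ ⟪ far-contact? ⟫
      build (z , a , fz , na , a∈R , q) = let j , r = path⇒reaches q (∈⟪⟫⁺ far-contact? fz) in shortest j (∈⟪⟫⁺ near-contact? na) a∈R r

    module Along (Q : Shortest R ⟪ near-contact? ⟫ ⟪ far-contact? ⟫) where

      open Shortest Q using (ℓ) renaming (p to q)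
      module Q = Shortest Q

      q∈K : ∀ i → q i ∈ K
      q∈K i = proj₁ (∈⟪⟫⁻ (away? K N) (Q.inside i))

      q∉N : ∀ i → q i ∉ˡ N
      q∉N i = proj₂ (∈⟪⟫⁻ (away? K N) (Q.inside i))

      q∉S⁻ : ∀ i → q i ∉ˡ S⁻.N
      q∉S⁻ i q∈ = q∉N i (proj₁ (Rm.∈N′⁻ q∈))

      q-near : ∀ {i x} → i ≤ ℓ → x ∈ˡ S⁻.N → Adj (q i) x → ¬ Far x → i ≡ 0
      q-near i≤ x∈ e near = Q.only-start i≤ (∈⟪⟫⁺ near-contact? (_ , x∈ , e , near))

      q-far : ∀ {i x} → i ≤ ℓ → x ∈ˡ S⁻.N → Adj (q i) x → Far x → i ≡ ℓ
      q-far i≤ x∈ e far = Q.only-finish i≤ (∈⟪⟫⁺ far-contact? (_ , x∈ , e , far))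

      -- Only s can be the centre of a vertex touching both sides.
      side : ∀ {v} → v ∈ K → v ∉ˡ N → Touches S⁻.N v →
             (∀ {x} → x ∈ˡ S⁻.N → Adj v x → x ≡ u ⊎ x ≡ u′) ⊎ Centred S⁻ v
      side {v} v∈ v∉ (x , x∈ , vx) with located (K⊆core v∈) v∉ (x , proj₁ (Rm.∈N′⁻ x∈) , vx)
      ... | c₀ , c₀∈ , c₀∉ , near with c₀ ≟ᶠ s
      ... | no c₀≢s = inj₂ (c₀ , Rm.∈N′⁺ c₀∈ c₀≢s , c₀∉ , λ y∈ e →
              Data.Sum.Base.map₂ (λ e′ → te-remove⁺ e′ c₀≢s (proj₂ (Rm.∈N′⁻ y∈))) (near (proj₁ (Rm.∈N′⁻ y∈)) e))
      ... | yes refl = inj₁ λ y∈ e → at y∈ (near (proj₁ (Rm.∈N′⁻ y∈)) e)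
        where
        at : ∀ {y} → y ∈ˡ S⁻.N → y ≡ s ⊎ TE E s y → y ≡ u ⊎ y ≡ u′
        at y∈ (inj₁ eq) = contradiction eq (proj₂ (Rm.∈N′⁻ y∈))
        at y∈ (inj₂ e)  = two-spokes e

      -- If the centre of `v` is `s`, then `v` can touch only `u` and `u′`, which lie on different
      -- sides. With all contacts on one side there is a single one, and it becomes the centre.
      one-sided : ∀ {v} → v ∈ K → v ∉ˡ N → Touches S⁻.N v → (∀ {x y} → x ∈ˡ S⁻.N → Adj v x → Far x → y ∈ˡ S⁻.N → Adj v y → Far y) → Centred S⁻ v
      one-sided {v} v∈ v∉ (x , x∈ , vx) same with side v∈ v∉ (x , x∈ , vx)
      ... | inj₂ centre = centre
      ... | inj₁ only = x , x∈ , x∉Y , λ y∈ e → inj₁ (pick y∈ e (only y∈ e) (only x∈ vx))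
        where
        x∉Y : x ∉ Y
        x∉Y x∈Y = clean-¬adj (K⊆clean v∈) x∈Y vx
        pick : ∀ {y} → y ∈ˡ S⁻.N → Adj v y → y ≡ u ⊎ y ≡ u′ → x ≡ u ⊎ x ≡ u′ → y ≡ x
        pick y∈ e (inj₁ refl) (inj₁ refl) = refl
        pick y∈ e (inj₂ refl) (inj₂ refl) = refl
        pick y∈ e (inj₁ refl) (inj₂ refl) = contradiction (same x∈ vx ε y∈ e) u-near
        pick y∈ e (inj₂ refl) (inj₁ refl) = contradiction (same y∈ e ε x∈ vx) u-near

      -- Besides `s` and its neighbours these are the first two and the last two path vertices: a
      -- core vertex touching the near side could see only the former, one touching the far side
      -- only the latter.
      specials : List V
      specials = s ∷ u ∷ u′ ∷ q 0 ∷ q 1 ∷ q (ℓ ∸ 1) ∷ q ℓ ∷ []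

      module Finish (ws : List V) (ws≤ : length ws ≤ 6)
        (ws⊆N : ∀ {x} → x ∈ˡ ws → x ∈ˡ S⁻.N)
        (ws-windows : ∀ {x} → x ∈ˡ ws → InWindow S (specials ++ ws) x)
        (S′ : Skeleton (Y ⊕ (specials ++ ws)) c) (S≼ : S⁻ ≼ S′) (new : ∀ {i} → i ≤ ℓ → q i ∈ˡ Skeleton.N S′)
        (new⁻ : ∀ {x} → x ∈ˡ Skeleton.N S′ → x ∈ˡ S⁻.N ⊎ ∃[ i ] (i ≤ ℓ × x ≡ q i))
        (links : ∀ {i} → i < ℓ → TE (Skeleton.E S′) (q i) (q (suc i))) where

        private
          module S′ = Skeleton S′
          module A = _≼_ S≼

        ys : List V
        ys = specials ++ ws

        special : ∀ {x} → x ∈ˡ specials → x ∈ Y ⊕ ys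
        special x∈ = ∈⊕⁺ʳ (∈-++⁺ˡ x∈)

        hub : ∀ {z} → z ∈ˡ window Y E s → z ∈ˡ ys
        hub z∈ with window⁻ {E = E} s∉Y z∈
        ... | inj₁ refl , _ = here refl
        ... | inj₂ e , _ with two-spokes e
        ...   | inj₁ refl = there (here refl)
        ...   | inj₂ refl = there (there (here refl))

        around-s : ∀ {x} → x ∉ Y → x ≡ s ⊎ TE E s x → InWindow S ys x
        around-s x∉ near = s , s∉Y , window⁺ {E = E} s∉Y x∉ near , hub

        windows : Windowed S ys
        windows x∈ x∈ys with ∈-++⁻ specials x∈ys
        ... | inj₂ x∈ws = ws-windows x∈ws
        ... | inj₁ x∈s  = All.lookup near-s x∈s x∈
          where
          near-s : All (λ x → x ∈ˡ N → InWindow S ys x) specials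
          near-s = (λ _ → around-s s∉Y (inj₁ refl)) ∷ (λ _ → around-s (clean∉ (K⊆clean u∈K)) (inj₂ (spoke (in-N u∈K su) su))) ∷
            (λ _ → around-s (clean∉ (K⊆clean u′∈K)) (inj₂ (spoke (in-N u′∈K su′) su′))) ∷
            All.map (λ x∉ x∈ → contradiction x∈ x∉) (q∉N 0 ∷ q∉N 1 ∷ q∉N (ℓ ∸ 1) ∷ q∉N ℓ ∷ [])

        module Spot {v} (v∈core : v ∈ core (Y ⊕ ys)) (v∉ : v ∉ˡ S′.N) where

          av : Avoids v (Y ⊕ ys)
          av y∈ = clean-¬adj (Ω⊆ v∈core) y∈

          v∈K : v ∈ K
          v∈K = core-minus ∈⊕⁺ˡ (special (here refl)) v∈core

          v∉N : v ∉ˡ N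
          v∉N v∈ = v∉ (A.members (Rm.∈N′⁺ v∈ (K≢s v∈K)))

          v∈R : v ∈ R
          v∈R = ∈⟪⟫⁺ (away? K N) (v∈K , v∉N)

          low-q : ∀ {i} → i ≤ 1 → ¬ Adj v (q i)
          low-q z≤n       = av (special (there (there (there (here refl)))))
          low-q (s≤s z≤n) = av (special (there (there (there (there (here refl))))))

          high-q : ∀ {i} → i ≤ ℓ → ℓ ≤ i + 1 → ¬ Adj v (q i)
          high-q {i} i≤ ℓ≤ with m≤n⇒m<n∨m≡n i≤
          ... | inj₂ refl = av (special (there (there (there (there (there (there (here refl))))))))
          ... | inj₁ i<ℓ = subst (λ k → ¬ Adj v (q k)) (sym eq) (av (special (there (there (there (there (there (here refl))))))))
            where
            eq : i ≡ ℓ ∸ 1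
            eq = sym (trans (cong (_∸ 1) (≤-antisym ℓ≤ (subst (_≤ ℓ) (+-comm 1 i) i<ℓ))) (m+n∸n≡m i 1))

          not-q : ∀ {x i} → x ∈ˡ S⁻.N → Adj v x → i ≤ ℓ → ¬ Adj v (q i)
          not-q {x} x∈ vx i≤ e with far? x
          ... | yes far = high-q i≤ (Q.near-finish i≤ v∈R (∈⟪⟫⁺ far-contact? (x , x∈ , vx , far)) e) e
          ... | no near = low-q (Q.near-start i≤ v∈R (∈⟪⟫⁺ near-contact? (x , x∈ , vx , near)) e) e

          centred : Touches S′.N v → Centred S′ v
          centred (x , x∈ , vx) with new⁻ x∈
          ... | inj₁ x∈⁻ = restore (recentre-⊕ S av windows t (located (K⊆core v∈K) v∉N t))
            where
            t : Touches N v
            t = x , proj₁ (Rm.∈N′⁻ x∈⁻) , vx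
            only : ∀ {y} → y ∈ˡ S′.N → Adj v y → y ∈ˡ S⁻.N
            only y∈ e with new⁻ y∈
            ... | inj₁ y∈⁻ = y∈⁻
            ... | inj₂ (i , i≤ , refl) = contradiction e (not-q x∈⁻ vx i≤)
            restore : ∃[ c₁ ] (c₁ ∈ˡ N × c₁ ∉ Y ⊕ ys × (∀ {y} → y ∈ˡ N → Adj v y → y ≡ c₁ ⊎ TE E c₁ y)) → Centred S′ v
            restore (c₁ , c₁∈ , c₁∉ , near) = transfer S≼ only (c₁ , Rm.∈N′⁺ c₁∈ c₁≢s , c₁∉ , λ y∈ e →
                Data.Sum.Base.map₂ (λ e′ → te-remove⁺ e′ c₁≢s (proj₂ (Rm.∈N′⁻ y∈))) (near (proj₁ (Rm.∈N′⁻ y∈)) e))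
              where c₁≢s = λ { refl → c₁∉ (special (here refl)) }
          ... | inj₂ (i , i≤ , refl) = centre-on Q S′ ≤-refl v∈R av (special (there (there (there (here refl)))))
                (special (there (there (there (there (here refl)))))) (λ _ → new) (λ _ → links) marked only (x , x∈ , vx)
            where
            marked : ∀ {j} → 2 ≤ j → j < ℓ → q j ∈ Y ⊕ ys → q (suc j) ∈ Y ⊕ ys
            marked {j} 2≤ j< qj∈ with ∈⊕⁻ qj∈
            ... | inj₁ qj∈Y = contradiction qj∈Y (clean∉ (K⊆clean (q∈K j)))
            ... | inj₂ qj∈ys with ∈-++⁻ specials qj∈ys
            ...   | inj₂ qj∈ws = contradiction (ws⊆N qj∈ws) (q∉S⁻ j)
            ...   | inj₁ qj∈s  = All.lookup next qj∈s refl
              where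
              not : ∀ {x} → q j ≢ x → q j ≡ x → q (suc j) ∈ Y ⊕ ys
              not ≢ eq = contradiction eq ≢
              -- The last vertex but one is in `Y`, but so is its successor, as `marked` demands.
              last : q j ≡ q (ℓ ∸ 1) → suc j ≡ ℓ
              last eq = trans (cong suc (Q.p-injective (<⇒≤ j<) (m∸n≤m ℓ 1) eq)) (m+[n∸m]≡n {1} (≤-trans (s≤s z≤n) j<))
              next : All (λ x → q j ≡ x → q (suc j) ∈ Y ⊕ ys) specials
              next = not (K≢s (q∈K j)) ∷ not (λ eq → q∉S⁻ j (subst (_∈ˡ S⁻.N) (sym eq) u∈)) ∷ not (λ eq → q∉S⁻ j (subst (_∈ˡ S⁻.N) (sym eq) u′∈)) ∷
                not (λ eq → <⇒≢ (<-trans z<s 2≤) (Q.p-injective z≤n (<⇒≤ j<) (sym eq))) ∷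
                not (λ eq → <⇒≢ 2≤ (Q.p-injective (≤-trans (<⇒≤ 2≤) (<⇒≤ j<)) (<⇒≤ j<) (sym eq))) ∷
                (λ eq → subst (λ k → q k ∈ Y ⊕ ys) (sym (last eq)) (special (there (there (there (there (there (there (here refl))))))))) ∷
                not (λ eq → <⇒≢ j< (Q.p-injective (<⇒≤ j<) ≤-refl eq)) ∷ []
            only : ∀ {y} → y ∈ˡ S′.N → Adj v y → ∃[ j ] (j ≤ ℓ × y ≡ q j)
            only y∈ e with new⁻ y∈
            ... | inj₁ y∈⁻  = contradiction vx (not-q y∈⁻ e i≤)
            ... | inj₂ on-q = on-q

        adv : Advance S S′
        adv = record { located = λ v∈ v∉ → Spot.centred v∈ v∉ ; housed = housed ; kept = λ κ → connector-kept ∈⊕⁺ˡ S≼ (λ x∈ → fresh (new⁻ x∈)) (without κ) }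
          where
          fresh : ∀ {x} → x ∈ˡ S⁻.N ⊎ (∃[ i ] (i ≤ ℓ × x ≡ q i)) → x ∈ˡ S⁻.N ⊎ x ∈ clean Y
          fresh (inj₁ x∈) = inj₁ x∈
          fresh (inj₂ (i , _ , refl)) = inj₂ (K⊆clean (q∈K i))
          housed : ∀ {x} → x ∈ˡ N → x ∈ Y ⊕ ys ⊎ x ∈ˡ S′.N
          housed {x} x∈ with x ≟ᶠ s
          ... | yes refl = inj₁ (special (here refl))
          ... | no x≢s   = inj₂ (A.members (Rm.∈N′⁺ x∈ x≢s))
          without : ∀ {σ a b} → IsConnector S σ a b → IsConnector S⁻ σ a b
          without κ = record { σ∈ = σ∈ ; σ∉ = λ σ∈N → σ∉ (proj₁ (Rm.∈N′⁻ σ∈N)) ; a∈ = Rm.∈N′⁺ a∈ (λ { refl → s∉Y a∈Y }) ; a∈Y = a∈Y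
                             ; b∈ = Rm.∈N′⁺ b∈ (λ { refl → s∉Y b∈Y }) ; b∈Y = b∈Y ; σa = σa ; σb = σb ; root = root
                             ; only = λ y∈ → only (proj₁ (Rm.∈N′⁻ y∈)) }
            where open IsConnector κ

        connector : IsConnector S′ s u u′
        connector = record
          { σ∈ = special (here refl) ; σ∉ = λ s∈ → absurd (new⁻ s∈) ; a∈ = A.members u∈ ; a∈Y = special (there (here refl))
          ; b∈ = A.members u′∈ ; b∈Y = special (there (there (here refl))) ; σa = su ; σb = su′ ; root = inj₁ s∈B ; only = λ y∈ e → only (new⁻ y∈) e }
          where
          absurd : s ∈ˡ S⁻.N ⊎ (∃[ i ] (i ≤ ℓ × s ≡ q i)) → ⊥
          absurd (inj₁ s∈) = proj₂ (Rm.∈N′⁻ s∈) refl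
          absurd (inj₂ (i , _ , eq)) = K≢s (q∈K i) (sym eq)
          only : ∀ {y} → y ∈ˡ S⁻.N ⊎ (∃[ i ] (i ≤ ℓ × y ≡ q i)) → Adj s y → S′.gid y ≡ S′.gid u ⊎ S′.gid y ≡ S′.gid u′
          only (inj₁ y∈) e with two-spokes (spoke (proj₁ (Rm.∈N′⁻ y∈)) e)
          ... | inj₁ refl = inj₁ refl
          ... | inj₂ refl = inj₂ refl
          only (inj₂ (i , _ , refl)) e = contradiction (in-N (q∈K i) e) (q∉N i)

        outcome : Outcome S
        outcome = connect {ys = ys} (≤-trans (+-monoʳ-≤ 7 ws≤) (m≤m+n 13 19)) adv {s} {u} {u′} connector (Ω⊆ s∈core)
          (clean∉ (K⊆clean u∈K)) (clean∉ (K⊆clean u′∈K)) u≢u′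

      -- The vertex `q 0` touches both sides. With a centre other than `s` its contacts would be
      -- connected in the remaining forest, so it touches exactly `u` and `u′` and takes the place
      -- of `s` between them.
      at-once : ℓ ≡ 0 → Outcome S
      at-once ℓ≡0 = touching (∈⟪⟫⁻ near-contact? Q.start) (subst (λ i → Far-contact (q i)) ℓ≡0 (∈⟪⟫⁻ far-contact? Q.finish))
        where
        ys : List V
        ys = specials ++ []

        S₀ : Skeleton (Y ⊕ ys) (suc c)
        S₀ = record { N = S⁻.N ; E = S⁻.E ; gid = S⁻.gid ; forest = enlarge ∈⊕⁺ˡ S⁻.forest }

        room : ∀ {x} → x ∈ˡ ys → deg S⁻.E x ≤ 2 → deg S⁻.E x ≤ 1 ⊎ (x ∈ Y ⊕ ys × deg S⁻.E x ≤ 3)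
        room x∈ ≤2 = inj₂ (∈⊕⁺ʳ x∈ , ≤-trans ≤2 (m≤m+n 2 1))

        both : (∀ {x} → x ∈ˡ S⁻.N → Adj (q 0) x → x ≡ u ⊎ x ≡ u′) → Adj (q 0) u → Adj (q 0) u′ → Outcome S
        both only qu qu′ = finish (bridge S₀ (q∉S⁻ 0) u∈ u′∈ qu qu′ (λ x∈ e → Data.Sum.Base.map₂ inj₁ (only x∈ e)) own
            (room (there (here refl)) (S⁻.thin u∈ (clean∉ (K⊆clean u∈K))))
            (room (there (there (here refl))) (S⁻.thin u′∈ (clean∉ (K⊆clean u′∈K)))) (λ p → u-near (conn-sym p)))
          where
          finish : ∃[ S′ ] Placed {c′ = c} S₀ (q 0) (u ∷ u′ ∷ []) (q 0) S′ → Outcome S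
          finish (S′ , pl) = Finish.outcome [] z≤n (λ ()) (λ ()) S′ (≼-trans (record { members = id ; edges = id ; coarsens = λ _ _ → id }) P.above)
            (λ i≤ → at-0 (subst (_ ≤_) ℓ≡0 i≤)) (λ x∈ → sort (P.new⁻ x∈)) (λ i< → contradiction (subst (_ <_) ℓ≡0 i<) λ ())
            where
            module P = Placed pl
            at-0 : ∀ {i} → i ≤ 0 → q i ∈ˡ Skeleton.N S′
            at-0 z≤n = P.new
            sort : ∀ {x} → x ≡ q 0 ⊎ x ∈ˡ S⁻.N → x ∈ˡ S⁻.N ⊎ ∃[ i ] (i ≤ ℓ × x ≡ q i)
            sort (inj₁ eq) = inj₂ (0 , z≤n , eq)
            sort (inj₂ x∈) = inj₁ x∈

        touching : Near-contact (q 0) → Far-contact (q 0) → Outcome S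
        touching (x , x∈ , qx , near-x) (y , y∈ , qy , far-y) with side (q∈K 0) (q∉N 0) (x , x∈ , qx)
        ... | inj₂ (c₀ , _ , _ , near) = contradiction (far-y ◅◅ conn-sym (linked (near y∈ qy)) ◅◅ linked (near x∈ qx)) near-x
          where
          linked : ∀ {z} → z ≡ c₀ ⊎ TE S⁻.E c₀ z → Conn S⁻.E c₀ z
          linked (inj₁ refl) = ε
          linked (inj₂ e)    = e ◅ ε
        ... | inj₁ only = both only (at-u (only x∈ qx)) (at-u′ (only y∈ qy))
          where
          at-u : x ≡ u ⊎ x ≡ u′ → Adj (q 0) u
          at-u (inj₁ eq)   = subst (Adj (q 0)) eq qx
          at-u (inj₂ refl) = contradiction ε near-x
          at-u′ : y ≡ u ⊎ y ≡ u′ → Adj (q 0) u′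
          at-u′ (inj₂ eq)   = subst (Adj (q 0)) eq qy
          at-u′ (inj₁ refl) = contradiction far-y u-near

      -- The path up to `q k` becomes a limb of the near side. Then `q ℓ` bridges its top and the
      -- far side, which brings the component count back to `c`.
      along : ∀ {k} → ℓ ≡ suc k → Outcome S
      along {k} ℓ≡ = touching (∈⟪⟫⁻ near-contact? Q.start) (∈⟪⟫⁻ far-contact? Q.finish)
        where
        0≢ℓ : 0 ≢ ℓ
        0≢ℓ eq = contradiction (trans eq ℓ≡) λ ()

        k≤ : k ≤ ℓ
        k≤ = ≤-trans (n≤1+n k) (≤-reflexive (sym ℓ≡))

        module At {x₁ x₂ c₁ c₂} (x₁∈ : x₁ ∈ˡ S⁻.N) (qx₁ : Adj (q 0) x₁) (near-x₁ : ¬ Far x₁) (x₂∈ : x₂ ∈ˡ S⁻.N) (qx₂ : Adj (q ℓ) x₂) (far-x₂ : Far x₂)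
          (c₁∈ : c₁ ∈ˡ S⁻.N) (c₁∉ : c₁ ∉ Y) (near₁ : ∀ {y} → y ∈ˡ S⁻.N → Adj (q 0) y → y ≡ c₁ ⊎ TE S⁻.E c₁ y)
          (c₂∈ : c₂ ∈ˡ S⁻.N) (c₂∉ : c₂ ∉ Y) (near₂ : ∀ {y} → y ∈ˡ S⁻.N → Adj (q ℓ) y → y ≡ c₂ ⊎ TE S⁻.E c₂ y) where

          open Patch S⁻ c₁∈ c₁∉ c₂∈ c₂∉ specials

          C : List V
          C = q 0 ∷ q ℓ ∷ W₁ ++ W₂

          touch₁ : ∀ {x} → x ∈ˡ S⁻.N → Adj (q 0) x → x ∈ˡ W₁
          touch₁ = touched₁ (K⊆clean (q∈K 0)) near₁

          touch₂ : ∀ {x} → x ∈ˡ S⁻.N → Adj (q ℓ) x → x ∈ˡ W₂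
          touch₂ = touched₂ (K⊆clean (q∈K ℓ)) near₂

          clear : ∀ {v x} → v ∈ K → Adj v x → x ∉ Y
          clear v∈ e x∈ = clean-¬adj (K⊆clean v∈) x∈ e

          -- In the old forest the window may contain `s` in addition, and `s` is among the
          -- specials.
          widen : ∀ {w} → w ∈ˡ S⁻.N → w ∉ Y → (∀ {z} → z ∈ˡ window Y S⁻.E w → z ∈ˡ ys) → ∀ {x} → x ∈ˡ window Y S⁻.E w →
                  InWindow S ys x
          widen {w} w∈ w∉ ⊆ys {x} x∈ = w , w∉ , window⁺ {E = E} w∉ (proj₂ x-in) (Data.Sum.Base.map₂ (λ e → proj₁ (te-remove⁻ e)) (proj₁ x-in)) ,
              λ z∈ → let near , z∉ = window⁻ {E = E} w∉ z∈ in back z∉ near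
            where
            x-in : (x ≡ w ⊎ TE S⁻.E w x) × x ∉ Y
            x-in = window⁻ {E = S⁻.E} w∉ x∈
            back : ∀ {z} → z ∉ Y → z ≡ w ⊎ TE E w z → z ∈ˡ ys
            back z∉ (inj₁ refl) = ⊆ys (here refl)
            back {z} z∉ (inj₂ e) with z ≟ᶠ s
            ... | yes refl = here refl
            ... | no z≢s   = ⊆ys (window⁺ {E = S⁻.E} w∉ z∉ (inj₂ (te-remove⁺ e (proj₂ (Rm.∈N′⁻ w∈)) z≢s)))

          ws-windows : ∀ {x} → x ∈ˡ W₁ ++ W₂ → InWindow S ys x
          ws-windows = by-window {InWindow S ys} (widen c₁∈ c₁∉ W₁⊆ys) (widen c₂∈ c₂∉ W₂⊆ys)

          untouched : ∀ {i x} → 1 ≤ i → i ≤ k → x ∈ˡ S⁻.N → ¬ Adj (q i) x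
          untouched {i} {x} 1≤ i≤ x∈ e with far? x
          ... | yes far = <⇒≢ (≤-trans (s≤s i≤) (≤-reflexive (sym ℓ≡))) (q-far (≤-trans i≤ k≤) x∈ e far)
          ... | no near = <⇒≢ 1≤ (sym (q-near (≤-trans i≤ k≤) x∈ e near))

          limbed : ∃ (Limbed S₀ q k x₁) → Outcome S
          limbed (S₁ , l₁) = bridged (bridge S₁ (λ q∈ → q∉S₁ (L₁.new⁻ q∈)) (L₁.new ≤-refl) (A₁.members x₂∈) link qx₂
              (λ x∈ e → touch (L₁.new⁻ x∈) e)
              (joins (there (here refl)) (∈⊕⁺ʳ (W₂⊆ys (touch₂ x₂∈ qx₂))) (special (there (there (there (there (there (there (here refl))))))))
                C (s≤s (s≤s W≤)) (there (here refl)) (λ y∈ eq → group₂ (L₁.mates x₂∈ y∈ (trans eq (L₁.label-old x₂∈))) eq))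
              (inj₁ L₁.deg-top) (inj₂ (∈⊕⁺ʳ (W₂⊆ys (touch₂ x₂∈ qx₂)) , ≤-trans (L₁.deg-old x₂∈) (s≤s (S⁻.thin x₂∈ (clear (q∈K ℓ) qx₂)))))
              -- The limb hangs on the near side, so a connection from its top to `x₂` would join
              -- both sides.
              (λ p → near-x₁ (far-x₂ ◅◅ conn-sym (L₁.conn-top x₂∈ p))))
            where
            module L₁ = Limbed l₁
            module S₁ = Skeleton S₁
            module A₁ = _≼_ L₁.above

            q∉S₁ : q ℓ ∈ˡ S⁻.N ⊎ ∃[ j ] (j ≤ k × q ℓ ≡ q j) → ⊥
            q∉S₁ (inj₁ q∈) = q∉S⁻ ℓ q∈
            q∉S₁ (inj₂ (j , j≤ , eq)) = <⇒≢ (≤-trans (s≤s j≤) (≤-reflexive (sym ℓ≡))) (sym (Q.p-injective ≤-refl (≤-trans j≤ k≤) eq))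

            link : Adj (q ℓ) (q k)
            link = adj-sym (subst (λ i → Adj (q k) (q i)) (sym ℓ≡) (Q.step (≤-reflexive (sym ℓ≡))))

            touch : ∀ {x} → x ∈ˡ S⁻.N ⊎ ∃[ j ] (j ≤ k × x ≡ q j) → Adj (q ℓ) x → x ≡ q k ⊎ x ≡ x₂ ⊎ S₁.gid x ≡ S₁.gid x₂
            touch (inj₁ x∈) e = inj₂ (inj₂ (trans (L₁.label-old x∈) (trans (Gr.in₂ (touch₂ x∈ e))
              (trans (sym (Gr.in₂ (touch₂ x₂∈ qx₂))) (sym (L₁.label-old x₂∈))))))
            touch (inj₂ (j , j≤ , refl)) e with Q.induced ≤-refl (≤-trans j≤ k≤) e
            ... | inj₁ eq = inj₁ (cong q (suc-injective (trans (sym eq) ℓ≡)))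
            ... | inj₂ eq = contradiction (≤-trans (≤-reflexive (cong suc (sym ℓ≡))) (≤-trans (≤-reflexive (sym eq)) j≤)) (<⇒≱ (m≤n⇒m≤1+n ≤-refl))

            group₂ : ∀ {y} → y ∈ˡ S⁻.N ⊎ y ≡ q 0 → S₁.gid y ≡ S₁.gid x₂ → y ∈ˡ C
            group₂ (inj₂ eq) _ = here eq
            group₂ (inj₁ y∈) eq = there (there (Gr.cls₂ y∈ (trans (sym (L₁.label-old y∈))
              (trans eq (trans (L₁.label-old x₂∈) (Gr.in₂ (touch₂ x₂∈ qx₂)))))))

            bridged : ∃[ S′ ] Placed {c′ = c} S₁ (q ℓ) (q k ∷ x₂ ∷ []) (S₁.gid x₂) S′ → Outcome S
            bridged (S₂ , pl) = Finish.outcome (W₁ ++ W₂) W≤ windows⊆N ws-windows S₂ S≼ new (λ x∈ → sort (P.new⁻ x∈)) links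
              where
              module P = Placed pl
              module A₂ = _≼_ P.above
              S≼ : S⁻ ≼ S₂
              S≼ = ≼-trans S≼S₀ (≼-trans L₁.above P.above)
              new : ∀ {i} → i ≤ ℓ → q i ∈ˡ Skeleton.N S₂
              new i≤ with m≤n⇒m<n∨m≡n i≤
              ... | inj₁ i<  = A₂.members (L₁.new (≤-pred (subst (_ <_) ℓ≡ i<)))
              ... | inj₂ eq  = subst (λ i → q i ∈ˡ Skeleton.N S₂) (sym eq) P.new
              sort : ∀ {x} → x ≡ q ℓ ⊎ x ∈ˡ S₁.N → x ∈ˡ S⁻.N ⊎ ∃[ i ] (i ≤ ℓ × x ≡ q i)
              sort (inj₁ eq) = inj₂ (ℓ , ≤-refl , eq)
              sort (inj₂ x∈) with L₁.new⁻ x∈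
              ... | inj₁ x∈⁻ = inj₁ x∈⁻
              ... | inj₂ (i , i≤ , eq) = inj₂ (i , ≤-trans i≤ k≤ , eq)
              links : ∀ {i} → i < ℓ → TE (Skeleton.E S₂) (q i) (q (suc i))
              links {i} i< with m≤n⇒m<n∨m≡n (≤-pred (subst (i <_) ℓ≡ i<))
              ... | inj₁ i<k  = A₂.edges (L₁.links i<k)
              ... | inj₂ refl = subst (λ j → TE (Skeleton.E S₂) (q k) (q j)) ℓ≡ (te-sym (P.linked (here refl)))

          outcome : Outcome S
          outcome = limbed (limb S₀ (initial-path Q k≤) x₁∈ qx₁ (λ _ → q∉S⁻ _)
            (λ x∈ e → trans (Gr.in₁ (touch₁ x∈ e)) (sym (Gr.in₁ (touch₁ x₁∈ qx₁)))) untouched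
            (joins (here refl) (∈⊕⁺ʳ (W₁⊆ys (touch₁ x₁∈ qx₁))) (special (there (there (there (here refl)))))
              C (s≤s (s≤s W≤)) (here refl) (λ y∈ eq → there (there (Gr.cls₁ y∈ (trans eq (Gr.in₁ (touch₁ x₁∈ qx₁)))))))
            (∈⊕⁺ʳ (W₁⊆ys (touch₁ x₁∈ qx₁))) (≤-trans (S⁻.thin x₁∈ (clear (q∈K 0) qx₁)) (m≤m+n 2 1)))

        touching : Near-contact (q 0) → Far-contact (q ℓ) → Outcome S
        touching (x₁ , x₁∈ , qx₁ , near-x₁) (x₂ , x₂∈ , qx₂ , far-x₂) =
          centred (one-sided (q∈K 0) (q∉N 0) (x₁ , x₁∈ , qx₁) (λ x∈ e far _ _ → contradiction (q-far z≤n x∈ e far) 0≢ℓ))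
                  (one-sided (q∈K ℓ) (q∉N ℓ) (x₂ , x₂∈ , qx₂) (λ _ _ _ y∈ e → decidable-stable (far? _) λ near → 0≢ℓ (sym (q-near ≤-refl y∈ e near))))
          where
          centred : Centred S⁻ (q 0) → Centred S⁻ (q ℓ) → Outcome S
          centred (c₁ , c₁∈ , c₁∉ , near₁) (c₂ , c₂∈ , c₂∉ , near₂) =
            At.outcome x₁∈ qx₁ near-x₁ x₂∈ qx₂ far-x₂ c₁∈ c₁∉ near₁ c₂∈ c₂∉ near₂

      detoured : ∀ k → ℓ ≡ k → Outcome S
      detoured zero    = at-once
      detoured (suc k) = along

    detour : Outcome S
    detour = Along.detoured shortest-crossing (Shortest.ℓ shortest-crossing) refl

-- The case distinction of a single step.

module Events (G : Graph) (B : Graph.VertexSet G) where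

  open Graph G renaming (order to n; symmetric to adj-sym; loopless to adj-irrefl)
  open Forest n
  open Structure G
  open Skeletons G
  open Growth G
  open Location G
  open Walks G
  open Tangle G
  open States G B
  open Pairs G B
  open Lasso G B
  open Detours G B

  Attached : VertexSet → List V → Set
  Attached K N = ∃[ y ] (y ∈ K × (y ∈ˡ N ⊎ Touches N y))

  attached? : ∀ K N → Dec (Attached K N)
  attached? K N = any? (λ y → (y ∈? K) ×-dec ((y ∈ˡ? N) ⊎-dec touches? N y))

  shortest-from : ∀ {R A Z a z} → a ∈ A → a ∈ R → z ∈ Z → Path R z a → Shortest R A Z
  shortest-from a∈A a∈R z∈Z p = let j , r = path⇒reaches (path-sym p) z∈Z in shortest j a∈A a∈R r

  module Event {Y c} {S : Skeleton Y c} {s : V} (scene : Scene S s) where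

    open Scene scene renaming (s∈core to s∈)
    open Skeleton S

    K : VertexSet
    K = Ω (clean Y ∖ s)

    K⊆core : K ⊆ core Y
    K⊆core = Ω-mono (λ v∈ → proj₁ (∈∖⁻ (Ω⊆ v∈)))

    K≢s : ∀ {v} → v ∈ K → v ≢ s
    K≢s v∈ = proj₂ (∈∖⁻ (Ω⊆ v∈))

    away⁻ : ∀ {M v} → v ∈ ⟪ away? K M ⟫ → v ∈ K × v ∉ˡ M
    away⁻ {M} = ∈⟪⟫⁻ (away? K M)

    return : ∀ {A Z} (L : Shortest ⟪ away? K N ⟫ A Z) (let module L = Shortest L) {t} → t ∈ K → Adj s t → t ∉ˡ N → t ∉ˡ vertices-of L.p L.ℓ →
             Shortest ⟪ away? K (N ++ vertices-of L.p L.ℓ) ⟫ ⟪ touches? (N ++ vertices-of L.p L.ℓ) ⟫ ⟪ other-neighbours? s (L.p L.ℓ) ⟫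
    return L {t} t∈ st t∉N t∉L = build (approach t∈ (λ t∈′ → [ t∉N , t∉L ] (∈-++⁻ N t∈′)) (Ω-connected t∈ (proj₁ (away⁻ (L.inside L.ℓ))))
        (inj₁ (∈-++⁺ʳ N top)))
      where
      module L = Shortest L
      top : L.p L.ℓ ∈ˡ vertices-of L.p L.ℓ
      top = ∈-vertices⁺ {p = L.p} ≤-refl
      M : List V
      M = N ++ vertices-of L.p L.ℓ
      build : ∃[ a ] (a ∈ K × a ∉ˡ M × Touches M a × Path ⟪ away? K M ⟫ t a) → Shortest ⟪ away? K M ⟫ ⟪ touches? M ⟫ ⟪ other-neighbours? s (L.p L.ℓ) ⟫
      build (a , a∈ , a∉ , touch , p) = shortest-from (∈⟪⟫⁺ (touches? M) touch) (∈⟪⟫⁺ (away? K M) (a∈ , a∉))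
        (∈⟪⟫⁺ (other-neighbours? s (L.p L.ℓ)) (st , λ { refl → t∉L top })) p

    split-touch : ∀ {p m v} → Touches (N ++ vertices-of p m) v → Touches N v ⊎ ∃[ i ] (i ≤ m × Adj v (p i))
    split-touch {p} {m} (x , x∈ , e) with ∈-++⁻ N x∈
    ... | inj₁ x∈N = inj₁ (x , x∈N , e)
    ... | inj₂ x∈p with ∈-vertices⁻ {p = p} x∈p
    ... | i , i≤ , refl = inj₂ (i , i≤ , e)

    -- As `K` stays away from the forest, `L` can be the single vertex `u`, and the second path can
    -- only start next to it. So a cycle is enclosed.
    unattached : ¬ Attached K N → s ∉ˡ N → Outcome S
    unattached none s∉N = close (return L u′∈K su′ (λ u′∈ → none (u′ , u′∈K , inj₁ u′∈)) u′∉L)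
      where
      L : Shortest ⟪ away? K N ⟫ ⁅ u ⁆ ⁅ u ⁆
      L = shortest 0 (x∈⁅x⁆ u) (∈⟪⟫⁺ (away? K N) (u∈K , λ u∈ → none (u , u∈K , inj₁ u∈))) (x∈⁅x⁆ u)
      close : Shortest ⟪ away? K (N ++ vertices-of (Shortest.p L) (Shortest.ℓ L)) ⟫
                ⟪ touches? (N ++ vertices-of (Shortest.p L) (Shortest.ℓ L)) ⟫ ⟪ other-neighbours? s (Shortest.p L (Shortest.ℓ L)) ⟫ → Outcome S
      u′∉L : u′ ∉ˡ vertices-of (Shortest.p L) (Shortest.ℓ L)

      module L = Shortest L

      at-u : ∀ {i} → i ≤ L.ℓ → i ≡ L.ℓ
      at-u i≤ = ≤-antisym i≤ (≤-trans (L.minimal 0 (x∈⁅x⁆ u) (∈⟪⟫⁺ (away? K N) (u∈K , λ u∈ → none (u , u∈K , inj₁ u∈))) (x∈⁅x⁆ u)) z≤n)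

      end : L.p L.ℓ ≡ u
      end = x∈⁅y⁆⇒x≡y u L.finish

      u′∉L u′∈ with ∈-vertices⁻ {p = L.p} u′∈
      ... | i , i≤ , eq = u≢u′ (trans (sym end) (trans (cong L.p (sym (at-u i≤))) (sym eq)))

      free : ∀ {v} → v ∈ K → ¬ Touches N v
      free v∈ t = none (_ , v∈ , inj₂ t)

      close Q = enter (∈⟪⟫⁻ (touches? (N ++ vertices-of L.p L.ℓ)) Q.start)
        where
        module Q = Shortest Q
        untouched : ∀ {i} → i ≤ L.ℓ → Touches N (L.p i) → i ≡ 0
        untouched {i} _ t = contradiction t (free (proj₁ (away⁻ (L.inside i))))
        pairing : Pairing S s
        pairing = record
          { located = located ; s∈ = s∈ ; s∉N = s∉N ; s∈B = s∈B ; L = L ; near-L = λ v∈ _ t → contradiction t (free v∈)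
          ; only-L = untouched ; top-L = subst (Adj s) (sym end) su ; end-L = λ i≤ _ → at-u i≤ ; Q = Q }
        module P = Pair pairing
        enter : Touches (N ++ vertices-of L.p L.ℓ) (Q.p 0) → Outcome S
        enter t with split-touch {p = L.p} t
        ... | inj₁ t′           = contradiction t′ (free (proj₁ (away⁻ (Q.inside 0))))
        ... | inj₂ (i , i≤ , e) = P.enclosing i≤ e

    module _ (s∉N : s ∉ˡ N) where

      lasso-s : ∀ {x v} → x ∈ˡ N → Adj s x → v ∈ K → v ∉ˡ N → Adj s v → Attached K N → Outcome S
      lasso-s {x} {v} x∈ sx v∈ v∉ sv (y , y∈ , near) = throw (build (approach v∈ v∉ (Ω-connected v∈ y∈) near))
        where
        build : ∃[ a ] (a ∈ K × a ∉ˡ N × Touches N a × Path ⟪ away? K N ⟫ v a) → Shortest ⟪ away? K N ⟫ ⟪ touches? N ⟫ ⟪ adj? s ⟫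
        build (a , a∈ , a∉ , t , p) = shortest-from (∈⟪⟫⁺ (touches? N) t) (∈⟪⟫⁺ (away? K N) (a∈ , a∉)) (∈⟪⟫⁺ (adj? s) sv) p
        throw : Shortest ⟪ away? K N ⟫ ⟪ touches? N ⟫ ⟪ adj? s ⟫ → Outcome S
        throw Q = lassoing S located s∈ s∉N x∈ sx (inj₁ s∈B) Q ≤-refl
          (λ w∈ w∉ _ t i≤ e → Q.near-start i≤ (∈⟪⟫⁺ (away? K N) (w∈ , w∉)) (∈⟪⟫⁺ (touches? N) t) e)
          (λ i≤ t → Q.only-start i≤ (∈⟪⟫⁺ (touches? N) t)) (∈⟪⟫⁻ (touches? N) Q.start)
          (λ {i} _ eq → K≢s (proj₁ (away⁻ (Q.inside i))) (sym eq)) (∈⟪⟫⁻ (adj? s) Q.finish)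
          (λ i≤ e → Q.only-finish i≤ (∈⟪⟫⁺ (adj? s) e)) (λ s∈N → contradiction s∈N s∉N)
          where module Q = Shortest Q

      -- Two paths lead to different neighbours of `s`. If the second starts next to the first, a
      -- cycle is enclosed; otherwise both start next to the forest and `s` connects their tops.
      far-s : (∀ {x} → x ∈ˡ N → ¬ Adj s x) → Attached K N → Outcome S
      far-s s-free (y , y∈ , near) = first (build (approach u∈K (λ u∈ → s-free u∈ su) (Ω-connected u∈K y∈) near))
        where
        build : ∃[ a ] (a ∈ K × a ∉ˡ N × Touches N a × Path ⟪ away? K N ⟫ u a) → Shortest ⟪ away? K N ⟫ ⟪ touches? N ⟫ ⟪ adj? s ⟫
        build (a , a∈ , a∉ , t , p) = shortest-from (∈⟪⟫⁺ (touches? N) t) (∈⟪⟫⁺ (away? K N) (a∈ , a∉)) (∈⟪⟫⁺ (adj? s) su) p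
        first : Shortest ⟪ away? K N ⟫ ⟪ touches? N ⟫ ⟪ adj? s ⟫ → Outcome S
        first L = second (pick (u ≟ᶠ L.p L.ℓ))
          where
          module L = Shortest L
          pick : Dec (u ≡ L.p L.ℓ) → ∃[ t ] (t ∈ K × Adj s t × t ≢ L.p L.ℓ)
          pick (no u≢)  = u , u∈K , su , u≢
          pick (yes eq) = u′ , u′∈K , su′ , λ eq′ → u≢u′ (trans eq (sym eq′))
          second : ∃[ t ] (t ∈ K × Adj s t × t ≢ L.p L.ℓ) → Outcome S
          second (t , t∈ , st , t≢) = close (return L t∈ st (λ t∈N → s-free t∈N st) t∉L)
            where
            t∉L : t ∉ˡ vertices-of L.p L.ℓ
            t∉L t∈L with ∈-vertices⁻ {p = L.p} t∈L
            ... | i , i≤ , refl = t≢ (cong L.p (L.only-finish i≤ (∈⟪⟫⁺ (adj? s) st)))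
            close : Shortest ⟪ away? K (N ++ vertices-of L.p L.ℓ) ⟫ ⟪ touches? (N ++ vertices-of L.p L.ℓ) ⟫ ⟪ other-neighbours? s (L.p L.ℓ) ⟫ → Outcome S
            close Q = enter (touches? (vertices-of L.p L.ℓ) (Q.p 0)) (∈⟪⟫⁻ (touches? (N ++ vertices-of L.p L.ℓ)) Q.start)
              where
              module Q = Shortest Q
              pairing : Pairing S s
              pairing = record
                { located = located ; s∈ = s∈ ; s∉N = s∉N ; s∈B = s∈B ; L = L
                ; near-L = λ w∈ w∉ t i≤ e → L.near-start i≤ (∈⟪⟫⁺ (away? K N) (w∈ , w∉)) (∈⟪⟫⁺ (touches? N) t) e
                ; only-L = λ i≤ t → L.only-start i≤ (∈⟪⟫⁺ (touches? N) t) ; top-L = ∈⟪⟫⁻ (adj? s) L.finish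
                ; end-L = λ i≤ e → L.only-finish i≤ (∈⟪⟫⁺ (adj? s) e) ; Q = Q }
              module P = Pair pairing
              enter : Dec (Touches (vertices-of L.p L.ℓ) (Q.p 0)) → Touches (N ++ vertices-of L.p L.ℓ) (Q.p 0) → Outcome S
              enter (yes (x , x∈ , e)) _ with ∈-vertices⁻ {p = L.p} x∈
              ... | i , i≤ , refl = P.enclosing i≤ e
              enter (no ¬t) t with split-touch {p = L.p} t
              ... | inj₁ t′           = P.joining (∈⟪⟫⁻ (touches? N) L.start) t′ (λ i≤ e → ¬t (_ , ∈-vertices⁺ {p = L.p} i≤ , e)) s-free
              ... | inj₂ (i , i≤ , e) = contradiction (_ , ∈-vertices⁺ {p = L.p} i≤ , e) ¬t

      outside : Outcome S
      outside with attached? K N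
      ... | no none = unattached none s∉N
      ... | yes att with touches? N s
      ... | no ¬t = far-s (λ x∈ e → ¬t (_ , x∈ , e)) att
      ... | yes (x , x∈ , sx) with u ∈ˡ? N | u′ ∈ˡ? N
      ... | no u∉  | _        = lasso-s x∈ sx u∈K u∉ su att
      ... | yes _  | no u′∉   = lasso-s x∈ sx u′∈K u′∉ su′ att
      ... | yes u∈ | yes u′∈ = pinning S located s∈ s∉N u∈ su (inj₁ s∈B) u′∈ su′ u≢u′

    module _ (s∈N : s ∈ˡ N) where

      other? : U.Decidable (λ x → x ≢ s)
      other? x = ¬? (x ≟ᶠ s)

      N⁻ : List V
      N⁻ = filter other? N

      touch⁻ : ∀ {v} → Touches N⁻ v → Touches N v
      touch⁻ (x , x∈ , e) = x , proj₁ (∈-filter⁻ other? x∈) , e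

      touch⁺ : ∀ {v} → ¬ Adj v s → Touches N v → Touches N⁻ v
      touch⁺ ¬vs (x , x∈ , e) = x , ∈-filter⁺ other? x∈ (λ { refl → ¬vs e }) , e

      -- Here `s` is a forest vertex, so it cannot be the connector. The last path vertex is, with
      -- `s ∈ B` as its foot, and the path before it becomes the limb.
      lasso-through : ∀ {v} → v ∈ K → v ∉ˡ N → Adj s v → Attached K N⁻ → Outcome S
      lasso-through {v} v∈ v∉ sv (y , y∈ , near) = throw (build (approach v∈ (λ v∈⁻ → v∉ (proj₁ (∈-filter⁻ other? v∈⁻))) (Ω-connected v∈ y∈) near))
        where
        away-from-s : ⟪ away? K N⁻ ⟫ ⊆ ⟪ away? K N ⟫
        away-from-s w∈ = let w∈K , w∉ = ∈⟪⟫⁻ (away? K N⁻) w∈ in ∈⟪⟫⁺ (away? K N) (w∈K , λ w∈N → w∉ (∈-filter⁺ other? w∈N (K≢s w∈K)))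
        build : ∃[ a ] (a ∈ K × a ∉ˡ N⁻ × Touches N⁻ a × Path ⟪ away? K N⁻ ⟫ v a) → Shortest ⟪ away? K N ⟫ ⟪ touches? N⁻ ⟫ ⟪ adj? s ⟫
        build (a , a∈ , a∉ , t , p) = shortest-from (∈⟪⟫⁺ (touches? N⁻) t) (away-from-s (∈⟪⟫⁺ (away? K N⁻) (a∈ , a∉)))
          (∈⟪⟫⁺ (adj? s) sv) (path-mono away-from-s p)
        throw : Shortest ⟪ away? K N ⟫ ⟪ touches? N⁻ ⟫ ⟪ adj? s ⟫ → Outcome S
        throw Q = go Q.ℓ refl
          where
          module Q = Shortest Q
          q∈K : ∀ i → Q.p i ∈ K
          q∈K i = proj₁ (away⁻ (Q.inside i))
          q∉N : ∀ i → Q.p i ∉ˡ N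
          q∉N i = proj₂ (away⁻ (Q.inside i))
          top : Adj s (Q.p Q.ℓ)
          top = ∈⟪⟫⁻ (adj? s) Q.finish
          start : Touches N⁻ (Q.p 0)
          start = ∈⟪⟫⁻ (touches? N⁻) Q.start
          pin : Touches N⁻ (Q.p 0) → Adj s (Q.p 0) → Outcome S
          pin (x , x∈ , e) sq = let x∈N , x≢s = ∈-filter⁻ other? {xs = N} x∈ in
            pinning S located (K⊆core (q∈K 0)) (q∉N 0) s∈N (adj-sym sq) (inj₂ s∈B) x∈N e (λ eq → x≢s (sym eq))
          go : ∀ k → Q.ℓ ≡ k → Outcome S
          -- The path is a single vertex, which touches `s` and another forest vertex.
          go zero eq = pin start (subst (λ i → Adj s (Q.p i)) eq top)
          go (suc k) eq = lassoing S located (K⊆core (q∈K Q.ℓ)) (q∉N Q.ℓ) s∈N (adj-sym top) (inj₂ s∈B) Q k≤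
              (λ w∈ w∉ ¬ws t i≤ e → Q.near-start (≤-trans i≤ k≤) (∈⟪⟫⁺ (away? K N) (w∈ , w∉)) (∈⟪⟫⁺ (touches? N⁻) (touch⁺ ¬ws t)) e)
              (λ i≤ t → Q.only-start (≤-trans i≤ k≤) (∈⟪⟫⁺ (touches? N⁻) (touch⁺ (λ e → <⇒≢ (below i≤) (Q.only-finish (≤-trans i≤ k≤) (∈⟪⟫⁺ (adj? s) (adj-sym e)))) t)))
              (touch⁻ start) (λ i≤ eq′ → <⇒≢ (below i≤) (sym (Q.p-injective ≤-refl (≤-trans i≤ k≤) eq′))) link (λ i≤ e → last i≤ (Q.induced ≤-refl (≤-trans i≤ k≤) e))
              (λ _ → adj-sym top)
            where
            k≤ : k ≤ Q.ℓ
            k≤ = ≤-trans (n≤1+n k) (≤-reflexive (sym eq))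
            below : ∀ {i} → i ≤ k → i < Q.ℓ
            below i≤ = ≤-trans (s≤s i≤) (≤-reflexive (sym eq))
            link : Adj (Q.p Q.ℓ) (Q.p k)
            link = adj-sym (subst (λ i → Adj (Q.p k) (Q.p i)) (sym eq) (Q.step (≤-reflexive (sym eq))))
            last : ∀ {i} → i ≤ k → Q.ℓ ≡ suc i ⊎ i ≡ suc Q.ℓ → i ≡ k
            last i≤ (inj₁ eq′) = suc-injective (trans (sym eq′) eq)
            last i≤ (inj₂ eq′) = contradiction (below i≤) (<⇒≯ (≤-reflexive (sym eq′)))

      -- A neighbour of `s` in `K` outside the forest yields a lasso; without such a neighbour the
      -- assumption of `Detour` holds.
      inside : Outcome S ⊎ ¬ Attached K N⁻
      inside with attached? K N⁻
      ... | no none = inj₂ none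
      ... | yes att with any? (λ v → (v ∈? K) ×-dec (¬? (v ∈ˡ? N) ×-dec adj? s v))
      ... | yes (v , v∈ , v∉ , sv) = inj₁ (lasso-through v∈ v∉ sv att)
      ... | no none = inj₁ (Detour.detour scene s∈N (λ v∈ sv → decidable-stable (_ ∈ˡ? N) λ v∉ → none (_ , v∈ , v∉ , sv)))

-- Collecting cycles and connectors.

module Run (G : Graph) (B : Graph.VertexSet G) where

  open Graph G renaming (order to n; symmetric to adj-sym; loopless to adj-irrefl)
  open Forest n
  open Structure G
  open Skeletons G
  open Growth G
  open Location G
  open Walks G
  open Tangle G
  open Cycles G
  open Packing G
  open States G B
  open Events G B
  open Detours G B using (Scene)

  HasCycle : VertexSet → Set
  HasCycle Γ = ∃[ v ] (v ∈ B × CycleThrough v (_∈ Γ))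

  -- The sets `Γs` merely contain cycles, so the packing is formed by the carriers of these.
  cycles-bound : ∀ {𝓗 k} → ((m : ℕ) → Contains 𝓗 (cycle m)) → π[ 𝓗 , G , B ]≤ k →
                 ∀ Γs → All HasCycle Γs → AllPairs (Anticomplete G) Γs → length Γs ≤ k
  cycles-bound {𝓗} {k} cycles bound Γs rooted apart = subst (_≤ k) (length-carriers Γs rooted)
      (packing-bound 𝓗 B bound (carriers Γs rooted) (apart′ Γs rooted apart) (members Γs rooted))
    where
    carrier-of : ∀ {Γ} → HasCycle Γ → VertexSet
    carrier-of (_ , _ , C) = InducedCopy.carrier (CycleThrough.copy C)
    inside : ∀ {Γ} (h : HasCycle Γ) → carrier-of h ⊆ Γ
    inside (_ , _ , C) v∈ with InducedCopy.carrier⁻ (CycleThrough.copy C) v∈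
    ... | u , refl = CycleThrough.within C u
    carriers : ∀ Γs → All HasCycle Γs → List VertexSet
    carriers [] [] = []
    carriers (Γ ∷ Γs) (h ∷ hs) = carrier-of h ∷ carriers Γs hs
    length-carriers : ∀ Γs (hs : All HasCycle Γs) → length (carriers Γs hs) ≡ length Γs
    length-carriers [] [] = refl
    length-carriers (Γ ∷ Γs) (h ∷ hs) = cong suc (length-carriers Γs hs)
    apart-head : ∀ {S} Γs (hs : All HasCycle Γs) → All (λ Γ′ → Anticomplete G S Γ′) Γs → All (Anticomplete G S) (carriers Γs hs)
    apart-head [] [] [] = []
    apart-head {S} (Γ ∷ Γs) (h ∷ hs) (a ∷ as) = (λ {u} {v} u∈ v∈ → a u∈ (inside h v∈)) ∷ apart-head {S} Γs hs as
    apart′ : ∀ Γs (hs : All HasCycle Γs) → AllPairs (Anticomplete G) Γs → AllPairs (Anticomplete G) (carriers Γs hs)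
    apart′ [] [] [] = []
    apart′ (Γ ∷ Γs) (h ∷ hs) (as ∷ ps) = apart-head Γs hs (All.map (λ a {u} {v} u∈ v∈ → a (inside h u∈) v∈) as) ∷ apart′ Γs hs ps
    members : ∀ Γs (hs : All HasCycle Γs) i → Member 𝓗 B (lookupˡ (carriers Γs hs) i)
    members (Γ ∷ Γs) ((v , v∈ , C) ∷ hs) zero = (proj₁ (cycles m) , proj₁ (proj₂ (cycles m)) , InducedCopy.copy-≅ copy (proj₂ (proj₂ (cycles m)))) ,
        v , subst (_∈ InducedCopy.carrier copy) apex (InducedCopy.f∈carrier copy zero) , v∈
      where open CycleThrough C
    members (Γ ∷ Γs) (h ∷ hs) (suc i) = members Γs hs i

  Conflict : VertexSet → VertexSet → Set
  Conflict Γ Δ = ∃[ u ] ∃[ v ] (u ∈ Γ × v ∈ Δ × (u ≡ v ⊎ Adj u v))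

  conflict? : ∀ Γ → U.Decidable (Conflict Γ)
  conflict? Γ Δ = any? λ u → any? λ v → (u ∈? Γ) ×-dec ((v ∈? Δ) ×-dec ((u ≟ᶠ v) ⊎-dec adj? u v))

  -- The newest set comes first, so the bound counts its conflicts with earlier ones.
  data Sparse : List VertexSet → Set where
    []  : Sparse []
    _∷_ : ∀ {Γ Γs} → length (filter (conflict? Γ) Γs) ≤ 9 → Sparse Γs → Sparse (Γ ∷ Γs)

  sparse-filter : ∀ {P : Pred VertexSet 0ℓ} (P? : U.Decidable P) {Γs} → Sparse Γs → Sparse (filter P? Γs)
  sparse-filter P? [] = []
  sparse-filter P? {Γ ∷ Γs} (few ∷ sp) with P? Γ
  ... | no _  = sparse-filter P? sp
  ... | yes _ = ≤-trans (filter-filter (conflict? Γ) P? Γs) few ∷ sparse-filter P? sp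

  -- Greedy choice: each selected set excludes at most nine others, hence the factor ten.
  select : ∀ r Γs → Sparse Γs → All HasCycle Γs → r * 10 ≤ length Γs →
           ∃[ Δs ] (length Δs ≡ r × (∀ {Δ} → Δ ∈ˡ Δs → Δ ∈ˡ Γs) × AllPairs (Anticomplete G) Δs × All HasCycle Δs)
  select zero Γs _ _ _ = [] , refl , (λ ()) , [] , []
  select (suc r) (Γ ∷ Γs) (few ∷ sp) (h ∷ hs) (s≤s len) = extend
    (select r rest (sparse-filter free? sp) (Allₚ.filter⁺ free? hs) (+-cancelˡ-≤ 9 (r * 10) (length rest) (≤-trans len
      (≤-trans (≤-reflexive (filter-complement (conflict? Γ) Γs)) (+-monoˡ-≤ (length rest) few)))))
    where
    free? : U.Decidable (λ Δ → ¬ Conflict Γ Δ)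
    free? Δ = ¬? (conflict? Γ Δ)
    rest = filter free? Γs
    extend : ∃[ Δs ] (length Δs ≡ r × (∀ {Δ} → Δ ∈ˡ Δs → Δ ∈ˡ rest) × AllPairs (Anticomplete G) Δs × All HasCycle Δs) →
             ∃[ Δs ] (length Δs ≡ suc r × (∀ {Δ} → Δ ∈ˡ Δs → Δ ∈ˡ Γ ∷ Γs) × AllPairs (Anticomplete G) Δs × All HasCycle Δs)
    extend (Δs , count , ⊆rest , apart , hΔs) = Γ ∷ Δs , cong suc count ,
      (λ { (here eq) → here eq ; (there Δ∈) → there (proj₁ (∈-filter⁻ free? {xs = Γs} (⊆rest Δ∈))) }) ,
      All.tabulate (λ Δ∈ {u} {v} u∈ v∈ → (λ eq → clash Δ∈ u∈ v∈ (inj₁ eq)) , λ e → clash Δ∈ u∈ v∈ (inj₂ e)) ∷ apart , h ∷ hΔs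
      where
      clash : ∀ {Δ u v} → Δ ∈ˡ Δs → u ∈ Γ → v ∈ Δ → ¬ (u ≡ v ⊎ Adj u v)
      clash Δ∈ u∈ v∈ c = proj₂ (∈-filter⁻ free? {xs = Γs} (⊆rest Δ∈)) (_ , _ , u∈ , v∈ , c)

  Connector : Set
  Connector = V × V × V

  feet : List Connector → List V
  feet = concatMap λ (_ , a , b) → a ∷ b ∷ []

  Spread : Connector → Connector → Set
  Spread (σ , _) (τ , _) = σ ≢ τ × ¬ Adj σ τ

  Valid : ∀ {Y c} → Skeleton Y c → Connector → Set
  Valid S (σ , a , b) = IsConnector S σ a b

  feet⁻ : ∀ {κs x} → x ∈ˡ feet κs → ∃[ κ ] (κ ∈ˡ κs × (x ≡ proj₁ (proj₂ κ) ⊎ x ≡ proj₂ (proj₂ κ)))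
  feet⁻ {κ ∷ κs} (here eq)           = κ , here refl , inj₁ eq
  feet⁻ {κ ∷ κs} (there (here eq))   = κ , here refl , inj₂ eq
  feet⁻ {κ ∷ κs} (there (there x∈)) = let κ′ , κ∈ , eq = feet⁻ {κs} x∈ in κ′ , there κ∈ , eq

  record Stage {Y c} (S : Skeleton Y c) (κs : List Connector) (Γs : List VertexSet) : Set where
    open Skeleton S
    field
      located  : Located (core Y) S
      valid    : All (Valid S) κs
      distinct : Unique (feet κs)
      spread   : AllPairs Spread κs
      cyclic   : All HasCycle Γs
      housed   : All (λ Γ → ∀ {v} → v ∈ Γ → v ∈ Y ⊎ v ∈ˡ N) Γs
      disjoint : AllPairs (λ Γ Δ → ∀ {v} → v ∈ Γ → v ∉ Δ) Γs
      sparse   : Sparse Γs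
      few      : c ≤ 2 * length Γs

    foot∈Y : ∀ {x} → x ∈ˡ feet κs → x ∈ Y
    foot∈Y x∈ with feet⁻ x∈
    ... | κ , κ∈ , inj₁ refl = IsConnector.a∈Y (All.lookup valid κ∈)
    ... | κ , κ∈ , inj₂ refl = IsConnector.b∈Y (All.lookup valid κ∈)

  record State (m : ℕ) : Set where
    field
      {Y}      : VertexSet
      {c}      : ℕ
      {S}      : Skeleton Y c
      {κs}     : List Connector
      {Γs}     : List VertexSet
      stage    : Stage S κs Γs
      -- 32 vertices for the outcome of a step, and one for a step that has to be retried.
      size     : ∣ Y ∣ ≤ m * 33
      progress : length κs + length Γs ≡ m

  -- One point of `W` is picked from each set; by disjointness these points differ.
  hitting-bound : ∀ W Γs → AllPairs (λ Γ Δ → ∀ {v} → v ∈ Γ → v ∉ Δ) Γs → All (λ Γ → ∃[ x ] (x ∈ˡ W × x ∈ Γ)) Γs → length Γs ≤ length W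
  hitting-bound W Γs apart hits = ≤-trans (≤-reflexive (sym (length-points Γs hits))) (unique-length (points-unique Γs hits apart) (points⊆ Γs hits))
    where
    points : ∀ Γs → All (λ Γ → ∃[ x ] (x ∈ˡ W × x ∈ Γ)) Γs → List V
    points [] [] = []
    points (_ ∷ Γs) ((x , _) ∷ hs) = x ∷ points Γs hs
    length-points : ∀ Γs hs → length (points Γs hs) ≡ length Γs
    length-points [] [] = refl
    length-points (_ ∷ Γs) (_ ∷ hs) = cong suc (length-points Γs hs)
    points⊆ : ∀ Γs hs {x} → x ∈ˡ points Γs hs → x ∈ˡ W
    points⊆ (_ ∷ Γs) ((x , x∈ , _) ∷ hs) (here refl) = x∈
    points⊆ (_ ∷ Γs) (_ ∷ hs) (there y∈) = points⊆ Γs hs y∈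
    fresh : ∀ {x} Γs hs → All (λ Δ → x ∉ Δ) Γs → All (x ≢_) (points Γs hs)
    fresh [] [] [] = []
    fresh (_ ∷ Γs) ((y , _ , y∈) ∷ hs) (x∉ ∷ xs) = (λ { refl → x∉ y∈ }) ∷ fresh Γs hs xs
    points-unique : ∀ Γs hs → AllPairs (λ Γ Δ → ∀ {v} → v ∈ Γ → v ∉ Δ) Γs → Unique (points Γs hs)
    points-unique [] [] [] = []
    points-unique (_ ∷ Γs) ((x , _ , x∈) ∷ hs) (ds ∷ ps) = fresh Γs hs (All.map (λ d → d x∈) ds) ∷ points-unique Γs hs ps

  advance-stage : ∀ {Y Y′ c c′} {S : Skeleton Y c} {S′ : Skeleton Y′ c′} {κs Γs} → Y ⊆ Y′ → Advance S S′ → Stage S κs Γs →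
    All (Valid S′) κs × All (λ Γ → ∀ {v} → v ∈ Γ → v ∈ Y′ ⊎ v ∈ˡ Skeleton.N S′) Γs
  advance-stage {Y} {Y′} {S = S} {S′} Y⊆ adv stage = All.map (λ κ → kept κ) valid , All.map (λ h {v} v∈ → move (h v∈)) (Stage.housed stage)
    where
    open Advance adv using (kept; housed)
    move : ∀ {v} → v ∈ Y ⊎ v ∈ˡ Skeleton.N S → v ∈ Y′ ⊎ v ∈ˡ Skeleton.N S′
    move (inj₁ v∈Y) = inj₁ (Y⊆ v∈Y)
    move (inj₂ v∈N) = housed v∈N
    open Stage stage using (valid)

  absorb : ∀ {m Y c} {S : Skeleton Y c} {κs Γs} → Stage S κs Γs → ∣ Y ∣ ≤ suc (m * 33) → length κs + length Γs ≡ m → Outcome S → State (suc m)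
  absorb {m} {Y} {κs = κs} {Γs} stage size progress (connect {ys} ys≤ {S′} adv {σ} {a} {b} κ σ∈ a∉ b∉ a≢b) = record
    { S = S′ ; κs = (σ , a , b) ∷ κs ; Γs = Γs
    ; stage = record
      { located = Advance.located adv ; valid = κ ∷ proj₁ moved ; cyclic = cyclic
      ; distinct = (a≢b ∷ All.tabulate (λ x∈ eq → a∉ (subst (_∈ Y) (sym eq) (foot∈Y x∈)))) ∷ (All.tabulate (λ x∈ eq → b∉ (subst (_∈ Y) (sym eq) (foot∈Y x∈)))) ∷ distinct
      -- The new `σ` comes from `clean Y`, while the older ones are in `Y`.
      ; spread = All.map (λ κ′ → (λ { refl → clean∉ σ∈ (IsConnector.σ∈ κ′) }) , clean-¬adj σ∈ (IsConnector.σ∈ κ′)) valid ∷ spread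
      ; housed = proj₂ moved ; disjoint = disjoint ; sparse = sparse ; few = few }
    ; size = grown ys≤ ; progress = cong suc progress }
    where
    open Stage stage
    moved = advance-stage ∈⊕⁺ˡ adv stage
    grown : length ys ≤ 32 → ∣ Y ⊕ ys ∣ ≤ suc m * 33
    grown ≤32 = ≤-trans (∣⊕∣≤ Y ys) (≤-trans (+-mono-≤ size ≤32) (≤-reflexive (trans (cong suc (+-comm (m * 33) 32)) refl)))
  absorb {m} {Y} {c} {S} {κs} {Γs} stage size progress (enclose {ys} ys≤ {S′} adv {Γ} {apex} member apex∈ cyc {W} W≤ W-all) = record
    { S = S′ ; κs = κs ; Γs = Γ ∷ Γs
    ; stage = record
      { located = Advance.located adv ; valid = proj₁ moved ; distinct = distinct ; spread = spread
      ; cyclic = (apex , apex∈ , cyc) ∷ cyclic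
      ; housed = (λ {v} v∈ → proj₂ (proj₂ (member v∈))) ∷ proj₂ moved
      ; disjoint = All.map (λ h {v} v∈ v∈Δ → [ clean∉ (proj₁ (member v∈)) , proj₁ (proj₂ (member v∈)) ] (h v∈Δ)) housed ∷ disjoint
      ; sparse = conflicts ∷ sparse
      ; few = ≤-trans (+-monoʳ-≤ 2 few) (≤-reflexive (sym (*-suc 2 (length Γs)))) }
    ; size = ≤-trans (∣⊕∣≤ Y ys) (≤-trans (+-mono-≤ size ys≤) (≤-reflexive (trans (cong suc (+-comm (m * 33) 32)) refl)))
    ; progress = trans (+-suc (length κs) (length Γs)) (cong suc progress) }
    where
    open Stage stage
    moved = advance-stage ∈⊕⁺ˡ adv stage
    -- `Γ` lies in `clean Y` and off the forest, and older cycles are housed in `Y` and the forest.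
    -- So a conflict can only be an edge to a forest vertex.
    meets-W : ∀ {Δ} → (∀ {v} → v ∈ Δ → v ∈ Y ⊎ v ∈ˡ Skeleton.N S) → Conflict Γ Δ → ∃[ x ] (x ∈ˡ W × x ∈ Δ)
    meets-W h (u , v , u∈ , v∈ , c) with h v∈ | c
    ... | inj₁ v∈Y | inj₁ refl = contradiction v∈Y (clean∉ (proj₁ (member u∈)))
    ... | inj₁ v∈Y | inj₂ e    = contradiction e (clean-¬adj (proj₁ (member u∈)) v∈Y)
    ... | inj₂ v∈N | inj₁ refl = contradiction v∈N (proj₁ (proj₂ (member u∈)))
    ... | inj₂ v∈N | inj₂ e    = v , W-all u∈ v∈N e , v∈
    conflicts : length (filter (conflict? Γ) Γs) ≤ 9
    conflicts = ≤-trans (hitting-bound W (filter (conflict? Γ) Γs) (AllPairsₚ.filter⁺ (conflict? Γ) disjoint)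
        (All.tabulate λ Δ∈ → let Δ∈Γs , c = ∈-filter⁻ (conflict? Γ) {xs = Γs} Δ∈ in meets-W (All.lookup housed Δ∈Γs) c)) W≤

  module Steps (s : ℕ) (persistent : ∀ X → ∣ X ∣ ≤ suc (s + s) → ∃[ v ] (v ∈ core X))
               (rooted : ∀ X → ∣ X ∣ ≤ s → ∃[ w ] (w ∈ central X × w ∈ B)) where

    open Persistent s persistent using (central-neighbours)

    module Stepping {m Y c} {S : Skeleton Y c} {κs Γs} (stage : Stage S κs Γs) (size : ∣ Y ∣ ≤ m * 33)
      (progress : length κs + length Γs ≡ m) (room : m * 33 < s) {w} (w∈ : w ∈ central Y) (w∈B : w ∈ B)
      {u u′} (u≢u′ : u ≢ u′) (wu : Adj w u) (wu′ : Adj w u′) (u∈ : u ∈ Ω (clean Y ∖ w)) (u′∈ : u′ ∈ Ω (clean Y ∖ w)) where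

      open Skeleton S
      open Stage stage using (located)

      w∈core : w ∈ core Y
      w∈core = proj₁ (central⁻ w∈)

      scene : Scene S w
      scene = record { located = located ; s∈core = w∈core ; s∈B = w∈B ; u≢u′ = u≢u′ ; su = wu ; su′ = wu′ ; u∈K = u∈ ; u′∈K = u′∈ }

      module Ev = Event scene

      -- If the giant component left by w misses the rest of the forest, w is dominated first.
      module Retry (w∈N : w ∈ˡ N) (none : ¬ Attached (Ω (clean Y ∖ w)) (Ev.N⁻ w∈N)) where

        Y₁ : VertexSet
        Y₁ = Y ⊕ (w ∷ [])

        size₁ : ∣ Y₁ ∣ ≤ suc (m * 33)
        size₁ = ≤-trans (∣⊕∣≤ Y (w ∷ [])) (≤-trans (+-monoˡ-≤ 1 size) (≤-reflexive (+-comm (m * 33) 1)))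

        S₁ : Skeleton Y₁ c
        S₁ = record { N = N ; E = E ; gid = gid ; forest = enlarge ∈⊕⁺ˡ forest }

        into-K : core Y₁ ⊆ Ω (clean Y ∖ w)
        into-K = core-minus ∈⊕⁺ˡ (∈⊕⁺ʳ (here refl))

        -- The only possible contact was `w`, which the vertices of the new core neither equal nor
        -- see.
        apart : ∀ {v} → v ∈ core Y₁ → ¬ (v ∈ˡ N ⊎ Touches N v)
        apart v∈ (inj₁ v∈N) = none (_ , into-K v∈ , inj₁ (∈-filter⁺ (Ev.other? w∈N) v∈N (proj₂ (∈∖⁻ (Ω⊆ (into-K v∈))))))
        apart v∈ (inj₂ (x , x∈ , e)) = none (_ , into-K v∈ , inj₂ (x ,
          ∈-filter⁺ (Ev.other? w∈N) x∈ (λ { refl → clean-¬adj (Ω⊆ v∈) (∈⊕⁺ʳ (here refl)) e }) , e))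

        located₁ : Located (core Y₁) S₁
        located₁ v∈ _ t = contradiction (inj₂ t) (apart v∈)

        stage₁ : Stage S₁ κs Γs
        stage₁ = record
          { located = located₁ ; valid = proj₁ moved ; distinct = distinct ; spread = spread ; cyclic = cyclic ; housed = proj₂ moved
          ; disjoint = disjoint ; sparse = sparse ; few = few }
          where
          open Stage stage
          advance₁ : Advance S S₁
          advance₁ = record { located = located₁ ; housed = inj₂
            ; kept = connector-kept ∈⊕⁺ˡ (record { members = id ; edges = id ; coarsens = λ _ _ → id }) inj₁ }
          moved = advance-stage ∈⊕⁺ˡ advance₁ stage

        again : ∀ {w′} → w′ ∈ central Y₁ → w′ ∈ B →
                ∃[ v ] ∃[ v′ ] (v ≢ v′ × Adj w′ v × Adj w′ v′ × v ∈ Ω (clean Y₁ ∖ w′) × v′ ∈ Ω (clean Y₁ ∖ w′)) → State (suc m)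
        again {w′} w′∈ w′∈B (v , v′ , v≢v′ , wv , wv′ , v∈ , v′∈) = absorb stage₁ size₁ progress
          (Event.unattached scene₁
            (λ (y , y∈ , near) → apart (Ω-mono (λ x∈ → proj₁ (∈∖⁻ (Ω⊆ x∈))) y∈) near) (λ w′∈N → apart w′∈core (inj₁ w′∈N)))
          where
          w′∈core : w′ ∈ core Y₁
          w′∈core = proj₁ (central⁻ w′∈)
          scene₁ : Scene S₁ w′
          scene₁ = record { located = located₁ ; s∈core = w′∈core ; s∈B = w′∈B ; u≢u′ = v≢v′ ; su = wv ; su′ = wv′ ; u∈K = v∈ ; u′∈K = v′∈ }

        retry : ∃[ w′ ] (w′ ∈ central Y₁ × w′ ∈ B) → State (suc m)
        retry (w′ , w′∈ , w′∈B) = again w′∈ w′∈B (central-neighbours (≤-trans size₁ (≤-trans room (m≤m+n s s))) w′∈)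

      settle : (w∈N : w ∈ˡ N) → Outcome S ⊎ ¬ Attached (Ω (clean Y ∖ w)) (Ev.N⁻ w∈N) → State (suc m)
      settle w∈N (inj₁ out)  = absorb stage (m≤n⇒m≤1+n size) progress out
      settle w∈N (inj₂ none) = Retry.retry w∈N none (rooted _ (≤-trans (Retry.size₁ w∈N none) room))

      step′ : Dec (w ∈ˡ N) → State (suc m)
      step′ (no w∉)   = absorb stage (m≤n⇒m≤1+n size) progress (Ev.outside w∉)
      step′ (yes w∈N) = settle w∈N (Ev.inside w∈N)

    step : ∀ {m} → m * 33 < s → State m → State (suc m)
    step room st = at (rooted Y (≤-trans size (<⇒≤ room)))
      where
      open State st
      next : ∀ {w} → w ∈ central Y → w ∈ B → ∃[ u ] ∃[ u′ ] (u ≢ u′ × Adj w u × Adj w u′ × u ∈ Ω (clean Y ∖ w) × u′ ∈ Ω (clean Y ∖ w)) → State _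
      next {w} w∈ w∈B (u , u′ , u≢u′ , wu , wu′ , u∈ , u′∈) = Stepping.step′ stage size progress room w∈ w∈B u≢u′ wu wu′ u∈ u′∈ (w ∈ˡ? Skeleton.N S)
      at : ∃[ w ] (w ∈ central Y × w ∈ B) → State _
      at (w , w∈ , w∈B) = next w∈ w∈B (central-neighbours (≤-trans size (≤-trans (<⇒≤ room) (m≤m+n s s))) w∈)

    start : State 0
    start = record
      { Y = ∅ ; c = 0 ; S = record { N = [] ; E = [] ; gid = id ; forest = record
        { uniq = [] ; ends = λ { (inj₁ ()) ; (inj₂ ()) } ; acyclic = _ ; count = z≤n ; label = λ () ; idem = λ () ; adj = λ ()
        ; edge = λ { (inj₁ ()) ; (inj₂ ()) } ; joined = λ () ; class = λ () ; alone = λ () ; thin = λ () ; bounded = λ _ → z≤n } }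
      ; κs = [] ; Γs = []
      ; stage = record { located = λ { _ _ (_ , () , _) } ; valid = [] ; distinct = [] ; spread = [] ; cyclic = [] ; housed = [] ; disjoint = []
                       ; sparse = [] ; few = z≤n }
      ; size = ≤-reflexive (∣⊥∣≡0 n) ; progress = refl }

    run : ∀ m → m * 33 ≤ s → State m
    run zero    _    = start
    run (suc m) ≤s = step (≤-trans (s≤s (m≤n+m (m * 33) 32)) ≤s) (run m (≤-trans (m≤n+m (m * 33) 33) ≤s))

-- Pigeonhole for pairs of parts.

module Twins {n : ℕ} {A : Set} (f g : A → Fin n) {R : Rel A 0ℓ} where

  key : A → Fin n × Fin n
  key x = f x , g x

  On : Fin n → Pred A 0ℓ
  On z x = f x ≡ z ⊎ g x ≡ z

  on? : ∀ z → U.Decidable (On z)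
  on? z x = (f x ≟ᶠ z) ⊎-dec (g x ≟ᶠ z)

  module KeyMembership = DecMembership (≡-dec (_≟ᶠ_ {n}) (_≟ᶠ_ {n}))

  twin-or-unique : ∀ xs → AllPairs R xs → (∃[ x ] ∃[ y ] (x ∈ˡ xs × y ∈ˡ xs × R x y × key x ≡ key y)) ⊎ Unique (map key xs)
  twin-or-unique [] [] = inj₂ []
  twin-or-unique (x ∷ xs) (rs ∷ ps) with KeyMembership._∈?_ (key x) (map key xs)
  ... | yes k∈ = let y , y∈ , eq = ∈-map⁻ key k∈ in inj₁ (x , y , here refl , there y∈ , All.lookup rs y∈ , eq)
  ... | no k∉ with twin-or-unique xs ps
  ... | inj₁ (y , z , y∈ , z∈ , r , eq) = inj₁ (y , z , there y∈ , there z∈ , r , eq)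
  ... | inj₂ uniq = inj₂ (All.tabulate (λ k∈ eq → k∉ (subst (_∈ˡ map key xs) (sym eq) k∈)) ∷ uniq)

  Twin : List A → A × A → Set
  Twin xs (x , y) = x ∈ˡ xs × y ∈ˡ xs × R x y × key x ≡ key y

  Apart : A × A → A × A → Set
  Apart (x , _) (y , _) = ∀ {z} → On z x → ¬ On z y

  -- There are at most `length Rs * length Rs` keys, so two elements share one. Everything on either
  -- of their two parts is then dropped, at most `θ` elements each. This leaves enough for the
  -- remaining pairs, which use other parts.
  twins : ∀ r {θ} Rs xs → 1 ≤ θ → AllPairs R xs → (∀ {x} → x ∈ˡ xs → f x ∈ˡ Rs × g x ∈ˡ Rs) →
          (∀ z → length (filter (on? z) xs) ≤ θ) → length Rs * length Rs + r * (θ + θ) ≤ length xs →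
          ∃[ ps ] (length ps ≡ r × All (Twin xs) ps × AllPairs Apart ps)
  twins zero Rs xs _ _ _ _ _ = [] , refl , [] , []
  twins (suc r) {θ} Rs xs 1≤θ rel in-Rs sparse many = go (twin-or-unique xs rel)
    where
    go : (∃[ x ] ∃[ y ] (x ∈ˡ xs × y ∈ˡ xs × R x y × key x ≡ key y)) ⊎ Unique (map key xs) →
         ∃[ ps ] (length ps ≡ suc r × All (Twin xs) ps × AllPairs Apart ps)
    go (inj₂ uniq) = contradiction many (<⇒≱ (begin-strict
        length xs                                           ≡⟨ length-map key xs ⟨
        length (map key xs)                                 ≤⟨ unique-length uniq (λ k∈ → let x , x∈ , eq = ∈-map⁻ key k∈ in
                                                                subst (_∈ˡ cartesianProduct Rs Rs) (sym eq) (∈-cartesianProduct⁺ (proj₁ (in-Rs x∈)) (proj₂ (in-Rs x∈)))) ⟩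
        length (cartesianProduct Rs Rs)                     ≡⟨ length-product Rs Rs ⟩
        length Rs * length Rs                               <⟨ m<m+n (length Rs * length Rs) (≤-trans 1≤θ (≤-trans (m≤m+n θ θ) (m≤m+n (θ + θ) (r * (θ + θ))))) ⟩
        length Rs * length Rs + suc r * (θ + θ)             ∎))
      where open ≤-Reasoning
    go (inj₁ (x , y , x∈ , y∈ , rxy , eq)) = extend (twins r Rs xs₂ 1≤θ (AllPairsₚ.filter⁺ off₂? (AllPairsₚ.filter⁺ off₁? rel))
        (λ z∈ → in-Rs (back z∈)) (λ z → ≤-trans (filter-filter (on? z) off₂? xs₁) (≤-trans (filter-filter (on? z) off₁? xs) (sparse z))) enough)
      where
      off₁? : U.Decidable (λ z → ¬ On (f x) z)
      off₁? z = ¬? (on? (f x) z)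
      off₂? : U.Decidable (λ z → ¬ On (g x) z)
      off₂? z = ¬? (on? (g x) z)
      xs₁ xs₂ : List A
      xs₁ = filter off₁? xs
      xs₂ = filter off₂? xs₁
      back : ∀ {z} → z ∈ˡ xs₂ → z ∈ˡ xs
      back z∈ = proj₁ (∈-filter⁻ off₁? (proj₁ (∈-filter⁻ off₂? {xs = xs₁} z∈)))
      enough : length Rs * length Rs + r * (θ + θ) ≤ length xs₂
      enough = +-cancelˡ-≤ (θ + θ) _ _ (begin
        θ + θ + (length Rs * length Rs + r * (θ + θ))       ≡⟨ +-assoc (θ + θ) (length Rs * length Rs) _ ⟨
        θ + θ + length Rs * length Rs + r * (θ + θ)         ≡⟨ cong (_+ r * (θ + θ)) (+-comm (θ + θ) _) ⟩
        length Rs * length Rs + (θ + θ) + r * (θ + θ)       ≡⟨ +-assoc (length Rs * length Rs) (θ + θ) _ ⟩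
        length Rs * length Rs + suc r * (θ + θ)             ≤⟨ many ⟩
        length xs                                           ≡⟨ filter-complement (on? (f x)) xs ⟩
        length (filter (on? (f x)) xs) + length xs₁         ≤⟨ +-monoˡ-≤ (length xs₁) (sparse (f x)) ⟩
        θ + length xs₁                                      ≡⟨ cong (θ +_) (filter-complement (on? (g x)) xs₁) ⟩
        θ + (length (filter (on? (g x)) xs₁) + length xs₂)  ≤⟨ +-monoʳ-≤ θ (+-monoˡ-≤ (length xs₂) (≤-trans (filter-filter (on? (g x)) off₁? xs) (sparse (g x)))) ⟩
        θ + (θ + length xs₂)                                ≡⟨ +-assoc θ θ (length xs₂) ⟨
        θ + θ + length xs₂                                  ∎)
        where open ≤-Reasoning
      extend : ∃[ ps ] (length ps ≡ r × All (Twin xs₂) ps × AllPairs Apart ps) → ∃[ ps ] (length ps ≡ suc r × All (Twin xs) ps × AllPairs Apart ps)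
      extend (ps , count , tw , ap) = (x , y) ∷ ps , cong suc count ,
          (x∈ , y∈ , rxy , eq) ∷ All.map (λ (u∈ , v∈ , ruv , eq′) → back u∈ , back v∈ , ruv , eq′) tw ,
          All.map (λ (u∈ , _) {z} on-x on-u → off u∈ on-x on-u) tw ∷ ap
        where
        off : ∀ {u z} → u ∈ˡ xs₂ → On z x → ¬ On z u
        off u∈ (inj₁ refl) on-u = proj₂ (∈-filter⁻ off₁? {xs = xs} (proj₁ (∈-filter⁻ off₂? {xs = xs₁} u∈))) on-u
        off u∈ (inj₂ refl) on-u = proj₂ (∈-filter⁻ off₂? {xs = xs₁} u∈) on-u

-- Cycles from pairs of connectors.

module Extraction (G : Graph) (B : Graph.VertexSet G) where

  open Graph G renaming (order to n; symmetric to adj-sym; loopless to adj-irrefl)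
  open Forest n
  open Elimination n
  open Structure G
  open Skeletons G
  open Quotient G
  open Walks G
  open Cycles G
  open States G B
  open Run G B

  widen-cycle : ∀ {v K K′} → (∀ {x} → K x → K′ x) → CycleThrough v K → CycleThrough v K′
  widen-cycle f C = record { m = m ; copy = copy ; apex = apex ; within = λ i → f (within i) }
    where open CycleThrough C

  -- If only a is in B, the walk is stopped before its first visit to a and closed up through σ and a.
  cycle-at : ∀ {Γ σ a b} → σ ∈ Γ → a ∈ Γ → b ∈ Γ → a ≢ b → Adj σ a → Adj σ b → σ ∈ B ⊎ a ∈ B → Path (Γ ∖ σ) b a → HasCycle Γ
  cycle-at {Γ} {σ} {a} {b} σ∈ a∈ b∈ a≢b σa σb (inj₁ σ∈B) walk = σ , σ∈B ,
    widen-cycle (λ { (inj₁ refl) → σ∈ ; (inj₂ v∈) → proj₁ (∈∖⁻ v∈) })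
      (cycle-through (λ σ∈D → proj₂ (∈∖⁻ σ∈D) refl) (∈∖⁺ b∈ (λ { refl → adj-≢ σb refl })) (∈∖⁺ a∈ (λ { refl → adj-≢ σa refl }))
        (λ eq → a≢b (sym eq)) σb σa walk)
  cycle-at {Γ} {σ} {a} {b} σ∈ a∈ b∈ a≢b σa σb (inj₂ a∈B) walk = close (hit walk (λ eq → a≢b (sym eq)))
    where
    close : ∃[ u ] (u ∈ Γ ∖ σ × Adj u a × u ≢ a × a ∈ Γ ∖ σ × Path (Γ ∖ σ ∖ a) b u) → HasCycle Γ
    close (u , u∈ , ua , u≢a , _ , p) = a , a∈B , widen-cycle (λ { (inj₁ refl) → a∈ ; (inj₂ v∈) → proj₁ (∈∖⁻ v∈) })
      (cycle-through (λ a∈D → proj₂ (∈∖⁻ a∈D) refl) σ∈D (∈∖⁺ (proj₁ (∈∖⁻ u∈)) u≢a) (λ eq → proj₂ (∈∖⁻ u∈) (sym eq)) (adj-sym σa) (adj-sym ua)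
        ((σ∈D , ∈∖⁺ b∈ (λ eq → a≢b (sym eq)) , σb) ◅ path-mono (λ v∈ → ∈∖⁺ (proj₁ (∈∖⁻ (proj₁ (∈∖⁻ v∈)))) (proj₂ (∈∖⁻ v∈))) p))
      where
      σ∈D : σ ∈ Γ ∖ a
      σ∈D = ∈∖⁺ σ∈ (λ { refl → adj-≢ σa refl })

  module Extract {Y c} (S : Skeleton Y c) {κs Γs} (stage : Stage S κs Γs) (θ : ℕ) (1≤θ : 1 ≤ θ) where
    open Skeleton S
    open Stage stage using (valid; distinct; spread)
    open Contract S

    -- The weight of a group is the number of listed vertices in it, later the feet of connectors.
    marks : List V → V → ℕ
    marks []       = λ _ → 0
    marks (x ∷ xs) = bump (gid x) 1 (marks xs)

    partition : Parts Nq Eq (marks (feet κs)) θ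
    partition = eliminate (length Nq) ≤-refl 1≤θ unique-q ends-q acyclic-q loopfree-q

    module Pieces (parts : Parts Nq Eq (marks (feet κs)) θ) where
      open Parts parts

      module _ {Sel : Pred V 0ℓ} (sel? : U.Decidable Sel) where

        load-marks : ∀ xs → (∀ {x} → x ∈ˡ xs → x ∈ˡ N) → length (filter (λ x → sel? (gid x)) xs) ≡ load sel? (marks xs) Nq
        load-marks []       _  = sym (empty Nq)
          where
          empty : ∀ ls → load sel? (λ _ → 0) ls ≡ 0
          empty []       = refl
          empty (l ∷ ls) = cong₂ _+_ (zero-gate (sel? l)) (empty ls)
            where
            zero-gate : Dec (Sel l) → gate sel? l 0 ≡ 0
            zero-gate (yes s) = gate-yes sel? 0 s
            zero-gate (no ¬s) = gate-no sel? 0 ¬s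
        load-marks (x ∷ xs) ⊆N = split (sel? (gid x))
          where
          ih = load-marks xs (λ x∈ → ⊆N (there x∈))
          split : Dec (Sel (gid x)) → length (filter (λ x → sel? (gid x)) (x ∷ xs)) ≡ load sel? (marks (x ∷ xs)) Nq
          split (yes s) = trans (cong length (Data.List.Properties.filter-accept (λ x → sel? (gid x)) {x} {xs} s))
            (trans (cong suc ih) (sym (load-bump sel? 1 (marks xs) unique-q (label∈Nq (⊆N (here refl))) s)))
          split (no ¬s) = trans (cong length (Data.List.Properties.filter-reject (λ x → sel? (gid x)) {x} {xs} ¬s))
            (trans ih (sym (load-bump-out sel? 1 (marks xs) Nq ¬s)))

      foot∈N : ∀ {x} → x ∈ˡ feet κs → x ∈ˡ N
      foot∈N x∈ with feet⁻ {κs} x∈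
      ... | κ , κ∈ , inj₁ refl = IsConnector.a∈ (All.lookup valid κ∈)
      ... | κ , κ∈ , inj₂ refl = IsConnector.b∈ (All.lookup valid κ∈)

      length-feet : ∀ κs → length (feet κs) ≡ 2 * length κs
      length-feet []       = refl
      length-feet (κ ∷ κs) = trans (cong (2 +_) (length-feet κs)) (sym (*-suc 2 (length κs)))

      cuts : θ * length P ≤ 2 * length κs
      cuts = begin
        θ * length P                       ≤⟨ charged ⟩
        total (marks (feet κs)) Nq         ≡⟨ load-marks (λ _ → yes tt) (feet κs) foot∈N ⟨
        length (filter (λ _ → yes tt) (feet κs)) ≤⟨ length-filter (λ _ → yes tt) (feet κs) ⟩
        length (feet κs)                   ≡⟨ length-feet κs ⟩
        2 * length κs                      ∎
        where open ≤-Reasoning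

      -- The contracted forest has at most `c` components, and its cut vertices have degree at most
      -- 32.
      pieces : length Rs ≤ c + length P * 32
      pieces = +-cancelʳ-≤ (length Eq) (length Rs) (c + length P * 32) (begin
        length Rs + length Eq                  ≤⟨ few ⟩
        length Nq + sum (map (deg Eq) P)       ≤⟨ +-mono-≤ count-q (sum-≤ (deg Eq) 32 P (λ p∈ → deg-q (P⊆N p∈))) ⟩
        c + length Eq + length P * 32          ≡⟨ +-assoc c (length Eq) _ ⟩
        c + (length Eq + length P * 32)        ≡⟨ cong (c +_) (+-comm (length Eq) _) ⟩
        c + (length P * 32 + length Eq)        ≡⟨ +-assoc c _ (length Eq) ⟨
        c + length P * 32 + length Eq          ∎)
        where open ≤-Reasoning

      piece : V → V
      piece x = rep (gid x)

      fᵃ fᵇ : Connector → V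
      fᵃ (_ , a , _) = piece a
      fᵇ (_ , _ , b) = piece b

      open Twins fᵃ fᵇ {Spread} using (Twin; Apart; twins; On; on?)

      Uncut : Connector → Set
      Uncut (_ , a , b) = gid a ∉ˡ P × gid b ∉ˡ P

      uncut? : U.Decidable Uncut
      uncut? (_ , a , b) = ¬? (gid a ∈ˡ? P) ×-dec ¬? (gid b ∈ˡ? P)

      good : List Connector
      good = filter uncut? κs

      by-feet : ∀ {Q : Pred Connector 0ℓ} {F : Pred V 0ℓ} (q? : U.Decidable Q) (f? : U.Decidable F) →
                (∀ {σ a b} → Q (σ , a , b) → F a ⊎ F b) → ∀ κs → length (filter q? κs) ≤ length (filter f? (feet κs))
      by-feet q? f? foot [] = z≤n
      by-feet q? f? foot ((σ , a , b) ∷ κs) with q? (σ , a , b) | by-feet q? f? foot κs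
      ... | no _  | ih with f? a
      ...   | no _ with f? b
      ...     | no _  = ih
      ...     | yes _ = m≤n⇒m≤1+n ih
      by-feet q? f? foot ((σ , a , b) ∷ κs) | no _ | ih | yes _ with f? b
      ...     | no _  = m≤n⇒m≤1+n ih
      ...     | yes _ = m≤n⇒m≤1+n (m≤n⇒m≤1+n ih)
      by-feet q? f? foot ((σ , a , b) ∷ κs) | yes q | ih with f? a
      ...   | yes _ with f? b
      ...     | no _  = s≤s ih
      ...     | yes _ = s≤s (m≤n⇒m≤1+n ih)
      by-feet q? f? foot ((σ , a , b) ∷ κs) | yes q | ih | no ¬a with f? b
      ...     | yes _ = s≤s ih
      ...     | no ¬b = contradiction (foot q) [ ¬a , ¬b ]

      cover : ∀ P → (∀ {p} → p ∈ˡ P → p ∈ˡ Nq) → ∃[ C ] (length C ≤ length P * 8 × (∀ {x} → x ∈ˡ N → gid x ∈ˡ P → x ∈ˡ C))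
      cover [] _ = [] , z≤n , λ _ ()
      cover (p ∷ P) ⊆Nq with class (proj₁ (Nq⁻ (⊆Nq (here refl)))) | cover P (λ p∈ → ⊆Nq (there p∈))
      ... | C , len , all | D , len′ , all′ = C ++ D , ≤-trans (≤-reflexive (length-++ C)) (+-mono-≤ len len′) , λ x∈ → place x∈
        where
        place : ∀ {x} → x ∈ˡ N → gid x ∈ˡ p ∷ P → x ∈ˡ C ++ D
        place x∈ (here eq)  = ∈-++⁺ˡ (all x∈ (trans eq (sym (proj₂ (Nq⁻ (⊆Nq (here refl)))))))
        place x∈ (there p∈) = ∈-++⁺ʳ C (all′ x∈ p∈)

      -- Feet are distinct and a group has at most eight vertices, so each cut spoils at most eight
      -- connectors.
      mostly-good : length κs ≤ length P * 8 + length good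
      mostly-good = ≤-trans (≤-reflexive (filter-complement (λ κ → ¬? (uncut? κ)) κs)) (+-mono-≤ bad (≤-reflexive stable))
        where
        cut-foot? : U.Decidable (λ x → gid x ∈ˡ P)
        cut-foot? x = gid x ∈ˡ? P
        cut-foot : ∀ {σ a b} → ¬ Uncut (σ , a , b) → gid a ∈ˡ P ⊎ gid b ∈ˡ P
        cut-foot {σ} {a} {b} ¬u with gid a ∈ˡ? P | gid b ∈ˡ? P
        ... | yes a∈ | _      = inj₁ a∈
        ... | no _   | yes b∈ = inj₂ b∈
        ... | no a∉  | no b∉  = contradiction (a∉ , b∉) ¬u
        bad : length (filter (λ κ → ¬? (uncut? κ)) κs) ≤ length P * 8
        bad = covered (cover P P⊆N)
          where
          covered : ∃[ C ] (length C ≤ length P * 8 × (∀ {x} → x ∈ˡ N → gid x ∈ˡ P → x ∈ˡ C)) → length (filter (λ κ → ¬? (uncut? κ)) κs) ≤ length P * 8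
          covered (C , len , all) = ≤-trans (by-feet (λ κ → ¬? (uncut? κ)) cut-foot? (λ {σ} → cut-foot {σ}) κs)
            (≤-trans (unique-length (Uniqueₚ.filter⁺ cut-foot? distinct) (λ x∈ → let x∈f , cut = ∈-filter⁻ cut-foot? {xs = feet κs} x∈ in all (foot∈N x∈f) cut)) len)
        stable : length (filter (λ κ → ¬? (¬? (uncut? κ))) κs) ≡ length good
        stable = cong length (Data.List.Properties.filter-≐ (λ κ → ¬? (¬? (uncut? κ))) uncut? ((λ {κ} → decidable-stable (uncut? κ)) , λ u ¬u → ¬u u) κs)

      good⁻ : ∀ {κ} → κ ∈ˡ good → κ ∈ˡ κs × Uncut κ
      good⁻ = ∈-filter⁻ uncut?

      -- Each of these connectors has a foot in the piece `z`, and the weight of the piece, which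
      -- counts feet, is below `θ`.
      sparse-keys : ∀ z → length (filter (on? z) good) ≤ θ
      sparse-keys z = begin
        length (filter (on? z) good)                            ≤⟨ filter-both (on? z) uncut? κs ⟩
        length (filter both? κs)                            ≤⟨ by-feet both? (λ x → in-part? P rep z (gid x)) (λ { (inj₁ eq , a∉ , _) → inj₁ (a∉ , eq) ; (inj₂ eq , _ , b∉) → inj₂ (b∉ , eq) }) κs ⟩
        length (filter (λ x → in-part? P rep z (gid x)) (feet κs)) ≡⟨ load-marks (in-part? P rep z) (feet κs) foot∈N ⟩
        load (in-part? P rep z) (marks (feet κs)) Nq        ≤⟨ <⇒≤ (light z) ⟩
        θ                                                   ∎
        where
        open ≤-Reasoning
        both? : U.Decidable (λ κ → On z κ × Uncut κ)
        both? κ = on? z κ ×-dec uncut? κ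

      feet-distinct : ∀ {σ a b} κs → (σ , a , b) ∈ˡ κs → Unique (feet κs) → a ≢ b
      feet-distinct (_ ∷ _)  (here refl) ((a≢b ∷ _) ∷ _) = a≢b
      feet-distinct (_ ∷ κs) (there κ∈) (_ ∷ _ ∷ uniq)   = feet-distinct κs κ∈ uniq

      Within-piece : V → V → Set
      Within-piece z v = v ∈ˡ N × gid v ∉ˡ P × piece v ≡ z

      -- The first vertices of both connectors together with both pieces. Whole pieces are taken
      -- because the cycle may run anywhere in them.
      hull? : ∀ (p : Connector × Connector) → U.Decidable (λ v → (v ≡ proj₁ (proj₁ p) ⊎ v ≡ proj₁ (proj₂ p)) ⊎
                (v ∈ˡ N × gid v ∉ˡ P × (piece v ≡ fᵃ (proj₁ p) ⊎ piece v ≡ fᵇ (proj₁ p))))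
      hull? ((σ , a , b) , (τ , _)) v = ((v ≟ᶠ σ) ⊎-dec (v ≟ᶠ τ)) ⊎-dec
        ((v ∈ˡ? N) ×-dec (¬? (gid v ∈ˡ? P) ×-dec ((piece v ≟ᶠ piece a) ⊎-dec (piece v ≟ᶠ piece b))))

      hull : Connector × Connector → VertexSet
      hull p = ⟪ hull? p ⟫

      -- A walk between uncut groups is lifted to `G`: within a group by `joined`, between groups
      -- along the forest edge behind the contracted one.
      across : ∀ {D z l l′} → (∀ {v} → Within-piece z v → v ∈ D) → Star (Kept Eq P) l l′ → l ∉ˡ P → rep l ≡ z →
               ∀ {x y} → x ∈ˡ N → gid x ≡ l → y ∈ˡ N → gid y ≡ l′ → Path D x y
      across {D} {z} inD ε l∉ l≡ {x} {y} x∈ refl y∈ y≡ = within x∈ (joined x∈ y∈ (sym y≡)) l∉ l≡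
        where
        within : ∀ {x y} → x ∈ˡ N → Star (Within E gid) x y → gid x ∉ˡ P → rep (gid x) ≡ z → Path D x y
        within x∈ ε _ _ = ε
        within x∈ ((e , eq) ◅ p) x∉ x≡ = (inD (x∈ , x∉ , x≡) , inD (ends′ e , w∉ , w≡) , edge e) ◅ within (ends′ e) p w∉ w≡
          where
          w∉ = λ w∈ → x∉ (subst (_∈ˡ P) (sym eq) w∈)
          w≡ = trans (cong rep (sym eq)) x≡
      across {D} {z} inD ((e , l∉ , m∉) ◅ p) _ l≡ {x} {y} x∈ refl y∈ y≡ with contract-te⁻ {E} e
      ... | u , v , uv , gu , refl , _ = across inD ε l∉ l≡ x∈ refl (ends uv) (sym gu) ◅◅
            (inD (ends uv , subst (_∉ˡ P) gu l∉ , trans (cong rep (sym gu)) l≡) , inD (ends′ uv , m∉ , m≡) , edge uv) ◅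
            across inD p m∉ m≡ (ends′ uv) refl y∈ y≡
        where
        m≡ : rep (gid v) ≡ z
        m≡ = trans (sym (same e l∉ m∉)) l≡

      joined-piece : ∀ {D z x y} → (∀ {v} → Within-piece z v → v ∈ D) → Within-piece z x → Within-piece z y → Path D x y
      joined-piece inD (x∈ , x∉ , x≡) (y∈ , y∉ , y≡) = across inD
        (subst (Star (Kept Eq P) (gid _)) x≡ (to-rep (label∈Nq x∈) x∉) ◅◅
          reverse (λ (e , p , q) → te-sym e , q , p) (subst (Star (Kept Eq P) (gid _)) y≡ (to-rep (label∈Nq y∈) y∉)))
        x∉ x≡ x∈ refl y∈ refl

      twin-cycle : ∀ {p} → Twin good p → HasCycle (hull p)
      twin-cycle {(σ , a , b) , (τ , a′ , b′)} (κ∈ , κ′∈ , (σ≢τ , _) , eq) = cycle-at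
          (into (inj₁ (inj₁ refl))) (a-in D⊆) (b-in D⊆) (feet-distinct κs (proj₁ κ⁻) distinct) K.σa K.σb K.root walk
        where
        κ⁻ = good⁻ κ∈
        κ′⁻ = good⁻ κ′∈
        module K = IsConnector (All.lookup valid (proj₁ κ⁻))
        module K′ = IsConnector (All.lookup valid (proj₁ κ′⁻))
        Γ : VertexSet
        Γ = hull ((σ , a , b) , (τ , a′ , b′))
        into : ∀ {v} → (v ≡ σ ⊎ v ≡ τ) ⊎ (v ∈ˡ N × gid v ∉ˡ P × (piece v ≡ piece a ⊎ piece v ≡ piece b)) → v ∈ Γ
        into = ∈⟪⟫⁺ (hull? ((σ , a , b) , (τ , a′ , b′)))
        D : VertexSet
        D = Γ ∖ σ
        D⊆ : ∀ {v} → v ∈ D → v ∈ Γ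
        D⊆ v∈ = proj₁ (∈∖⁻ v∈)
        in-a : ∀ {v} → Within-piece (piece a) v → v ∈ D
        in-a (v∈ , v∉ , v≡) = ∈∖⁺ (into (inj₂ (v∈ , v∉ , inj₁ v≡))) λ { refl → K.σ∉ v∈ }
        in-b : ∀ {v} → Within-piece (piece b) v → v ∈ D
        in-b (v∈ , v∉ , v≡) = ∈∖⁺ (into (inj₂ (v∈ , v∉ , inj₂ v≡))) λ { refl → K.σ∉ v∈ }
        wa : Within-piece (piece a) a
        wa = K.a∈ , proj₁ (proj₂ κ⁻) , refl
        wb : Within-piece (piece b) b
        wb = K.b∈ , proj₂ (proj₂ κ⁻) , refl
        wa′ : Within-piece (piece a) a′
        wa′ = K′.a∈ , proj₁ (proj₂ κ′⁻) , sym (cong proj₁ eq)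
        wb′ : Within-piece (piece b) b′
        wb′ = K′.b∈ , proj₂ (proj₂ κ′⁻) , sym (cong proj₂ eq)
        a-in : ∀ {X : VertexSet} → (∀ {v} → v ∈ D → v ∈ X) → a ∈ X
        a-in f = f (in-a wa)
        b-in : ∀ {X : VertexSet} → (∀ {v} → v ∈ D → v ∈ X) → b ∈ X
        b-in f = f (in-b wb)
        τ∈D : τ ∈ D
        τ∈D = ∈∖⁺ (into (inj₁ (inj₂ refl))) (λ eq′ → σ≢τ (sym eq′))
        -- The second connector `τ` leads from one piece to the other while `σ` is avoided.
        walk : Path D b a
        walk = joined-piece in-b wb wb′ ◅◅ (in-b wb′ , τ∈D , adj-sym K′.σb) ◅ (τ∈D , in-a wa′ , K′.σa) ◅ joined-piece in-a wa′ wa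

      data Place (p : Connector × Connector) (v : V) : Set where
        centre : ∀ {κ} → κ ∈ˡ good → v ≡ proj₁ κ → (∀ {z} → On z κ → On z (proj₁ p)) → Place p v
        limb   : v ∈ˡ N → gid v ∉ˡ P → On (piece v) (proj₁ p) → Place p v

      place : ∀ {p v} → Twin good p → v ∈ hull p → Place p v
      place {p} (κ∈ , κ′∈ , _ , eq) v∈ with ∈⟪⟫⁻ (hull? p) v∈
      ... | inj₁ (inj₁ v≡)                 = centre κ∈ v≡ id
      ... | inj₁ (inj₂ v≡)                 = centre κ′∈ v≡ (λ { (inj₁ e) → inj₁ (trans (cong proj₁ eq) e) ; (inj₂ e) → inj₂ (trans (cong proj₂ eq) e) })
      ... | inj₂ (v∈N , v∉ , inj₁ e)       = limb v∈N v∉ (inj₁ (sym e))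
      ... | inj₂ (v∈N , v∉ , inj₂ e)       = limb v∈N v∉ (inj₂ (sym e))

      -- A connector sees forest vertices only in the groups of its two feet, hence only in the
      -- pieces of its own pair.
      centre-apart : ∀ {p q u v} → Apart p q → Place p u → Place q v → ∀ {κ} → κ ∈ˡ good → u ≡ proj₁ κ → (∀ {z} → On z κ → On z (proj₁ p)) →
                     v ∈ˡ N → On (piece v) (proj₁ q) → u ≢ v × ¬ Adj u v
      centre-apart ap _ _ {κ} κ∈ refl sub v∈ on-v = (λ { refl → K.σ∉ v∈ }) , λ e → touch (K.only v∈ e)
        where
        module K = IsConnector (All.lookup valid (proj₁ (good⁻ κ∈)))
        touch : gid _ ≡ gid (proj₁ (proj₂ κ)) ⊎ gid _ ≡ gid (proj₂ (proj₂ κ)) → ⊥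
        touch (inj₁ eq) = ap (sub (inj₁ (cong rep (sym eq)))) on-v
        touch (inj₂ eq) = ap (sub (inj₂ (cong rep (sym eq)))) on-v

      -- Adjacent uncut forest vertices share a piece, connectors see only their own pieces, and
      -- different connectors are neither equal nor adjacent. Pairs without a common piece are
      -- therefore apart.
      hulls-apart : ∀ {p q} → Twin good p → Twin good q → Apart p q → Anticomplete G (hull p) (hull q)
      hulls-apart {p} {q} tp tq ap {u} {v} u∈ v∈ = go (place tp u∈) (place tq v∈)
        where
        ap′ : Apart q p
        ap′ on-q on-p = ap on-p on-q
        go : Place p u → Place q v → u ≢ v × ¬ Adj u v
        go (limb u∈N u∉ on-u) (limb v∈N v∉ on-v) = (λ { refl → ap on-u on-v }) , λ e → linked (adj u∈N v∈N e)
          where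
          same-piece : piece u ≡ piece v → ⊥
          same-piece eq = ap on-u (subst (λ z → On z (proj₁ q)) (sym eq) on-v)
          linked : TE E u v ⊎ gid u ≡ gid v → ⊥
          linked (inj₂ eq) = same-piece (cong rep eq)
          linked (inj₁ e) with gid u ≟ᶠ gid v
          ... | yes eq = same-piece (cong rep eq)
          ... | no u≢v = same-piece (same (contract-te⁺ e u≢v) u∉ v∉)
        go pu@(centre κ∈ u≡ sub) pv@(limb v∈N _ on-v) = centre-apart {p} {q} ap pu pv κ∈ u≡ sub v∈N on-v
        go pu@(limb u∈N _ on-u) pv@(centre κ∈ v≡ sub) = (λ eq → proj₁ flipped (sym eq)) , λ e → proj₂ flipped (adj-sym e)
          where flipped = centre-apart {q} {p} ap′ pv pu κ∈ v≡ sub u∈N on-u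
        go (centre {κ} κ∈ refl sub) (centre {τ} τ∈ refl sub′) with pairwise-members spread (proj₁ (good⁻ κ∈)) (proj₁ (good⁻ τ∈))
        ... | inj₁ refl             = contradiction (sub′ (inj₁ refl)) (ap (sub (inj₁ refl)))
        ... | inj₂ (inj₁ (≢ , ¬e)) = ≢ , ¬e
        ... | inj₂ (inj₂ (≢ , ¬e)) = (λ eq → ≢ (sym eq)) , λ e → ¬e (adj-sym e)

      extract : ∀ r → length Rs * length Rs + r * (θ + θ) ≤ length good →
                ∃[ Δs ] (length Δs ≡ r × All HasCycle Δs × AllPairs (Anticomplete G) Δs)
      extract r many = collect (twins r Rs good 1≤θ (AllPairsₚ.filter⁺ uncut? spread) in-Rs sparse-keys many)
        where
        in-Rs : ∀ {κ} → κ ∈ˡ good → fᵃ κ ∈ˡ Rs × fᵇ κ ∈ˡ Rs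
        in-Rs κ∈ = let κ∈κs , a∉ , b∉ = good⁻ κ∈ in
          listed (label∈Nq (IsConnector.a∈ (All.lookup valid κ∈κs))) a∉ , listed (label∈Nq (IsConnector.b∈ (All.lookup valid κ∈κs))) b∉
        apart : ∀ {ps} → All (Twin good) ps → AllPairs Apart ps → AllPairs (Anticomplete G) (map hull ps)
        apart [] [] = []
        apart {p ∷ ps} (t ∷ ts) (as ∷ aps) = Allₚ.map⁺ (both ts as) ∷ apart ts aps
          where
          both : ∀ {ps} → All (Twin good) ps → All (Apart p) ps → All (λ q → Anticomplete G (hull p) (hull q)) ps
          both [] [] = []
          both (t′ ∷ ts) (a ∷ as) = (λ {u} {v} → hulls-apart t t′ a {u} {v}) ∷ both ts as
        collect : ∃[ ps ] (length ps ≡ r × All (Twin good) ps × AllPairs Apart ps) → ∃[ Δs ] (length Δs ≡ r × All HasCycle Δs × AllPairs (Anticomplete G) Δs)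
        collect (ps , count , tw , ap) = map hull ps , trans (length-map hull ps) count , Allₚ.map⁺ (All.map twin-cycle tw) , apart tw ap

-- The final counts.

open ≤-Reasoning

2k≤ : ∀ {k} → 1 ≤ k → suc k ≤ 2 * k
2k≤ {k} 1≤k = ≤-trans (+-monoˡ-≤ k 1≤k) (≤-reflexive (cong (k +_) (sym (+-identityʳ k))))

vertex : ∀ {n} → 2 ≤ n → Fin n
vertex (s≤s _) = zero

module _ {𝓗 : Family} {G : Graph} {k : ℕ} (1≤k : 1 ≤ k) (2≤n : 2 ≤ Graph.order G) (bounded : tree-π[ 𝓗 , G ]≤ k) where

  open Graph G using (order; VertexSet)
  open Tangle G
  open Packing G
  open TreeDecomposition (proj₁ bounded) using (bag)

  -- Reduces both bounds to one task: to refute that a fixed bag meets the central sets of all sets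
  -- of size at most `s`.
  halving-or-rooted : ∀ s → (∀ (persistent : ∀ X → ∣ X ∣ ≤ suc (s + s) → ∃[ v ] (v ∈ core X)) B → π[ 𝓗 , G , B ]≤ k →
                       ¬ (∀ X → ∣ X ∣ ≤ s → ∃[ w ] (w ∈ central X × w ∈ B))) → ∃[ X ] (HalvingNeighbourhood G X × ∣ X ∣ ≤ suc (s + s))
  halving-or-rooted s absurd = split (halving-or-persistent (suc (s + s)))
    where
    split : (∃[ X ] (HalvingNeighbourhood G X × ∣ X ∣ ≤ suc (s + s))) ⊎ (∀ X → ∣ X ∣ ≤ suc (s + s) → ∃[ v ] (v ∈ core X)) →
            ∃[ X ] (HalvingNeighbourhood G X × ∣ X ∣ ≤ suc (s + s))
    split (inj₁ found)      = found
    split (inj₂ persistent) = let t , meets = Persistent.central-bag s persistent (proj₁ bounded) (vertex 2≤n) in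
      contradiction meets (absurd persistent (bag t) (proj₂ bounded t))

  path-bound : ∀ {t} → 1 ≤ t → Contains 𝓗 (path t) → ∃[ X ] (HalvingNeighbourhood G X × ∣ X ∣ ≤ 5 * (k * t))
  path-bound {suc i} 1≤t has-path = let X , halves , ≤M = halving-or-rooted s many in X , halves , ≤-trans ≤M size
    where
    t = suc i
    s = suc k * t
    many : ∀ (persistent : ∀ X → ∣ X ∣ ≤ suc (s + s) → ∃[ v ] (v ∈ core X)) B → π[ 𝓗 , G , B ]≤ k →
           ¬ (∀ X → ∣ X ∣ ≤ s → ∃[ w ] (w ∈ central X × w ∈ B))
    many persistent B bound meets = <-irrefl refl (subst (_≤ k) R.count (packing-bound 𝓗 B bound R.Ss R.anti R.member))
      where
      rooted : ∀ X → ∣ X ∣ ≤ s → ∃[ v ] (v ∈ core X × v ∈ B)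
      rooted X ≤s = let w , w∈ , w∈B = meets X ≤s in w , proj₁ (central⁻ w∈) , w∈B
      open Gyarfas s (λ X ≤s → persistent X (≤-trans ≤s (m≤n⇒m≤1+n (m≤m+n s s)))) B rooted
      module R = Rounds (rounds 𝓗 has-path (suc k) ≤-refl)
    -- By `suc k ≤ 2 * k` the two copies of `s` cost `4 * (k * t)`, and the summand one costs
    -- another `k * t`.
    size : suc (s + s) ≤ 5 * (k * t)
    size = begin
      suc (s + s)                                ≤⟨ +-mono-≤ (*-mono-≤ 1≤k 1≤t) (+-mono-≤ (*-monoˡ-≤ t (2k≤ 1≤k)) (*-monoˡ-≤ t (2k≤ 1≤k))) ⟩
      k * t + (2 * k * t + 2 * k * t)            ≡⟨ arith k t ⟩
      5 * (k * t)                                ∎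
      where
      arith : ∀ k t → k * t + (2 * k * t + 2 * k * t) ≡ 5 * (k * t)
      arith = solve-∀

  module Cyclic (cycles : (m : ℕ) → Contains 𝓗 (cycle m)) (α : ℕ) (large : 212 * 212 + 58 ≤ α) where

    -- All feet together weigh at most `2 * m`, which is `6 * K` times `θ`, so there are at most
    -- `6 * K` cuts. Two thirds of the `m` steps pay for the `2 * θ` connectors dropped with each of
    -- `K` twin pairs; the last third pays for the squared number of parts and for the steps without
    -- a usable connector.
    K θ m s : ℕ
    K = suc k
    θ = α * K
    m = 3 * (α * (K * K))
    s = m * 33

    1≤α : 1 ≤ α
    1≤α = ≤-trans (m≤n+m 1 (212 * 212 + 57)) (≤-trans (≤-reflexive (+-assoc (212 * 212) 57 1)) large)

    1≤θ : 1 ≤ θ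
    1≤θ = *-mono-≤ 1≤α (s≤s z≤n)

    -- At most 6K cuts and 20K components give at most 20K + 32 · 6K = 212K parts, and all but
    -- 10K + 8 · 6K = 58K of the m steps yield a connector without a foot in a cut group.
    enough : ∀ {κ γ P R c good} → κ + γ ≡ m → γ ≤ K * 10 → c ≤ 2 * γ → θ * P ≤ 2 * κ → R ≤ c + P * 32 → κ ≤ P * 8 + good →
             R * R + K * (θ + θ) ≤ good
    enough {κ} {γ} {P} {R} {c} {good} total few-γ few-c cuts pieces mostly = +-cancelʳ-≤ (58 * K) _ _ (begin
      R * R + K * (θ + θ) + 58 * K                          ≤⟨ +-mono-≤ (+-monoˡ-≤ (K * (θ + θ)) (*-mono-≤ R≤ R≤)) (*-monoʳ-≤ 58 (m≤m*n K K)) ⟩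
      212 * K * (212 * K) + K * (θ + θ) + 58 * (K * K)      ≡⟨ arith₁ 212 58 α K ⟩
      (212 * 212 + 58) * (K * K) + 2 * (α * (K * K))        ≤⟨ +-monoˡ-≤ (2 * (α * (K * K))) (*-monoˡ-≤ (K * K) large) ⟩
      m                                                     ≡⟨ total ⟨
      κ + γ                                                 ≤⟨ +-mono-≤ (≤-trans mostly (+-monoˡ-≤ good (*-monoˡ-≤ 8 P≤))) few-γ ⟩
      6 * K * 8 + good + K * 10                             ≡⟨ arith₂ K good ⟩
      good + 58 * K                                         ∎)
      where
      arith₁ : ∀ ρ δ α K → ρ * K * (ρ * K) + K * (α * K + α * K) + δ * (K * K) ≡ (ρ * ρ + δ) * (K * K) + 2 * (α * (K * K))
      arith₁ = solve-∀
      arith₂ : ∀ K good → 6 * K * 8 + good + K * 10 ≡ good + 58 * K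
      arith₂ = solve-∀
      arith₃ : ∀ α K → 2 * (3 * (α * (K * K))) ≡ α * K * (6 * K)
      arith₃ = solve-∀
      arith₄ : ∀ K → 2 * (K * 10) + 6 * K * 32 ≡ 212 * K
      arith₄ = solve-∀
      P≤ : P ≤ 6 * K
      P≤ = *-cancelˡ-≤ θ {{>-nonZero 1≤θ}} (begin
        θ * P          ≤⟨ cuts ⟩
        2 * κ          ≤⟨ *-monoʳ-≤ 2 (≤-trans (m≤m+n κ γ) (≤-reflexive total)) ⟩
        2 * m          ≡⟨ arith₃ α K ⟩
        θ * (6 * K)    ∎)
      R≤ : R ≤ 212 * K
      R≤ = ≤-trans pieces (≤-trans (+-mono-≤ (≤-trans few-c (*-monoʳ-≤ 2 few-γ)) (*-monoˡ-≤ 32 P≤)) (≤-reflexive (arith₄ K)))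

    module _ (persistent : ∀ X → ∣ X ∣ ≤ suc (s + s) → ∃[ v ] (v ∈ core X)) (B : VertexSet) (bound : π[ 𝓗 , G , B ]≤ k)
             (meets : ∀ X → ∣ X ∣ ≤ s → ∃[ w ] (w ∈ central X × w ∈ B)) where

      open Run G B
      open Extraction G B

      too-many : State m → ⊥
      too-many st = split (K * 10 ≤? length Γs)
        where
        open State st
        open Stage stage using (sparse; cyclic; few)
        split : Dec (K * 10 ≤ length Γs) → ⊥
        split (yes many) = let Δs , count , _ , apart , hs = select K Γs sparse cyclic many in
          <-irrefl refl (subst (_≤ k) count (cycles-bound cycles bound Δs hs apart))
        split (no ¬many) = let Δs , count , hs , apart = E.extract K (enough progress (<⇒≤ (≰⇒> ¬many)) few E.cuts E.pieces E.mostly-good) in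
          <-irrefl refl (subst (_≤ k) count (cycles-bound cycles bound Δs hs apart))
          where
          module Ex = Extract S stage θ 1≤θ
          module E = Ex.Pieces Ex.partition

      contradictory : ⊥
      contradictory = too-many (Steps.run s persistent meets m ≤-refl)

    cycle-bound : ∃[ X ] (HalvingNeighbourhood G X × ∣ X ∣ ≤ (792 * α + 1) * (k ^ 3 * ⌊log₂ order ⌋))
    cycle-bound = let X , halves , ≤M = halving-or-rooted s contradictory in X , halves , ≤-trans ≤M size
      where
      1≤log : 1 ≤ ⌊log₂ order ⌋
      1≤log = ⌊log₂⌋-mono-≤ 2≤n
      -- Here `792 = 2 * 33 * 3 * 4`, the 4 stemming from `K ≤ 2 * k` squared; the extra 1 comes
      -- from the summand one in `suc (s + s)`.
      arith : ∀ α k → 1 * (k * k) + (3 * (α * (2 * k * (2 * k))) * 33 + 3 * (α * (2 * k * (2 * k))) * 33) ≡ (792 * α + 1) * (k * k)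
      arith = solve-∀
      s≤ : s ≤ 3 * (α * (2 * k * (2 * k))) * 33
      s≤ = *-monoˡ-≤ 33 (*-monoʳ-≤ 3 (*-monoʳ-≤ α (*-mono-≤ (2k≤ 1≤k) (2k≤ 1≤k))))
      -- The construction costs a multiple of `k * k`; the factors `k` and `⌊log₂ order ⌋`, both at
      -- least one, bring this into the stated form.
      cube : k * k ≤ k ^ 3 * ⌊log₂ order ⌋
      cube = begin
        k * k                     ≡⟨ *-identityʳ (k * k) ⟨
        k * k * 1                 ≤⟨ *-mono-≤ (m≤n*m (k * k) k {{>-nonZero 1≤k}}) 1≤log ⟩
        k * (k * k) * ⌊log₂ order ⌋ ≡⟨ cong (λ j → k * (k * j) * ⌊log₂ order ⌋) (*-identityʳ k) ⟨
        k ^ 3 * ⌊log₂ order ⌋     ∎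
      size : suc (s + s) ≤ (792 * α + 1) * (k ^ 3 * ⌊log₂ order ⌋)
      size = begin
        suc (s + s)                                       ≤⟨ +-mono-≤ (*-mono-≤ (≤-refl {1}) (*-mono-≤ 1≤k 1≤k)) (+-mono-≤ s≤ s≤) ⟩
        1 * (k * k) + (3 * (α * (2 * k * (2 * k))) * 33 + 3 * (α * (2 * k * (2 * k))) * 33)  ≡⟨ arith α k ⟩
        (792 * α + 1) * (k * k)                           ≤⟨ *-monoʳ-≤ (792 * α + 1) cube ⟩
        (792 * α + 1) * (k ^ 3 * ⌊log₂ order ⌋)           ∎

opaque

  -- The value of `212 * 212 + 58`, opaque so that type checking does not compute with it.
  scale : ℕ
  scale = 45002

  scale-large : 212 * 212 + 58 ≤ scale
  scale-large = ≤-refl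

theorem1p7 :
    ∃[ c₁ ] ∃[ c₂ ]
      ((𝓗 : Family) (G : Graph) (k : ℕ) → let n = Graph.order G in
       1 ≤ k → 2 ≤ n → tree-π[ 𝓗 , G ]≤ k →
         ((t : ℕ) → 1 ≤ t → Contains 𝓗 (path t) →
            ∃[ X ] (HalvingNeighbourhood G X × ∣ X ∣ ≤ c₁ * (k * t)))
         ×
         (((m : ℕ) → Contains 𝓗 (cycle m)) →
            ∃[ X ] (HalvingNeighbourhood G X × ∣ X ∣ ≤ c₂ * (k ^ 3 * ⌊log₂ n ⌋))))
theorem1p7 = 5 , 792 * scale + 1 , λ 𝓗 G k 1≤k 2≤n bounded →
  (λ t 1≤t has-path → path-bound 1≤k 2≤n bounded 1≤t has-path) ,
  λ cycles → Cyclic.cycle-bound 1≤k 2≤n bounded cycles scale scale-large
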